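{- Let $n\ge1$, $c\ge0$ with $m:=n-c+1\ge2$, and let $\mathrm{Quad}^c_{\mathbb{A}}(n)$ be the set of connected non-negative unit forms in $n$ variables of corank $c$ and Dynkin type $\mathbb{A}_{n-c}$. The cycle type $\mathrm{ct}:\mathrm{Quad}^c_{\mathbb{A}}(n)\to\mathrm{Part}(m)$ is constant on strong Gram congruence classes and induces a bijection $$\mathrm{Quad}^c_{\mathbb{A}}(n)/\!\approx\;\longrightarrow\;\mathrm{Part}^c_1(m):=\{\pi\vdash m \mid 0\le c-(\ell(\pi)-1)\equiv 0 \bmod 2\},$$ where $\approx$ denotes strong Gram congruence. Moreover, if $\mathrm{ct}(q)=(\pi_1,\dots,\pi_\ell)$ for $q\in\mathrm{Quad}^c_{\mathbb{A}}(n)$, then: (i) $\varphi_q(\lambda)=(\lambda-1)^{c-1}\prod_{t=1}^{\ell}(\lambda^{\pi_t}-1)$; (ii) the Coxeter number of $q$ is $\pi_1$ if $\ell=1$ and $\infty$ otherwise; (iii) the reduced Coxeter number of $q$ is $\mathrm{lcm}(\pi_1,\dots,\pi_\ell)$; (iv) the geometric multiplicity of $1$ as an eigenvalue of $\Phi_q$ equals the corank $c$; (v) the reduced corank of $q$ is $\ell-1$, and the algebraic multiplicity of $1$ as an eigenvalue of $\Phi_q$ is $c+(\ell-1)$.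
   Context: An integral quadratic form $q:\mathbb{Z}^n\to\mathbb{Z}$ is a unit form if $q(\mathbf{e}_i)=1$ for all $i$; non-negative, connected (connected graph of nonzero off-diagonal coefficients) in the usual sense. $G_q$ is the symmetric Gram matrix of $\mathbb{b}_q(x,y)=q(x+y)-q(x)-q(y)$; $\check G_q$ is the upper triangular integer matrix with $q(x)=x^{\mathrm{tr}}\check G_qx$, and $\check{\mathbb{b}}_q(x,y)=x^{\mathrm{tr}}\check G_q y$. Strong Gram congruence: $\check G_{q'}=B^{\mathrm{tr}}\check G_qB$ with $B$ $\mathbb{Z}$-invertible. The radical is $\mathrm{rad}(q)=\ker G_q\subseteq\mathbb{Z}^n$, the corank is its rank. The reduced radical is $\mathrm{rad}_{re}(q)=\{x\in\mathrm{rad}(q)\mid y^{\mathrm{tr}}\check G_qx=0\ \forall y\in\mathrm{rad}(q)\}$ and its rank is the reduced corank. The Coxeter matrix is $\Phi_q=-\check G_q^{\mathrm{tr}}\check G_q^{ -1}$, the Coxeter polynomial $\varphi_q$ its characteristic polynomial; the Coxeter number is the least $t>0$ with $\Phi_q^t=\mathrm{Id}$ ($\infty$ if none), and the reduced Coxeter number is the least $t>0$ with $\Phi_q^t-\mathrm{Id}$ nilpotent. Dynkin type: the unique simply-laced Dynkin diagram $\Delta$ such that the form induced by $q$ on $\mathbb{Z}^n/\mathrm{rad}(q)$ is equivalent to $q_\Delta$ ($G_{q_\Delta}=2\mathrm{Id}-\mathrm{Adj}(\Delta)$). A partition $\pi\vdash m$ is a nonincreasing sequence of positive integers summing to $m$;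 $\ell(\pi)$ is its length and $\mathrm{Part}(m)$ the set of partitions of $m$. Cycle type: for a quiver $Q$ with vertices $\{1,\dots,m\}$, arrows $\{1,\dots,n\}$, source/target maps $s,t$, its incidence matrix $I(Q)$ is the $m\times n$ matrix with $i$-th column $\mathbf{e}_{s(i)}-\mathbf{e}_{t(i)}$; $q_Q(x)=\frac12\|I(Q)x\|^2$; $\check G_Q:=\check G_{q_Q}$. Its Coxeter–Laplacian $\Lambda_Q=\mathrm{Id}_m-I(Q)\check G_Q^{ -1}I(Q)^{\mathrm{tr}}$ is (a known fact) for connected loop-less $Q$ a permutation matrix $P(\xi)$ ($P(\xi)\mathbf{e}_v=\mathbf{e}_{\xi(v)}$); $\mathrm{ct}(Q)$ is the partition of $m$ given by the orbit sizes of $\xi$. Every $q\in\mathrm{Quad}^c_{\mathbb{A}}(n)$ equals $q_Q$ for some connected loop-less quiver $Q$ with $n$ arrows and $m$ vertices, and $\mathrm{ct}(q):=\mathrm{ct}(Q)$ does not depend on the choice of $Q$. -}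

module Defs where

open import Data.Nat as ℕ using (ℕ; zero; suc; _∸_)
import Data.Nat.Properties as ℕP
open import Data.Nat.LCM using (lcm)
open import Data.Integer as ℤ using (ℤ; +_; -_; ∣_∣)
import Data.Integer.Properties as ℤP
open import Data.Fin as Fin using (Fin; toℕ; punchIn)
import Data.Fin.Properties as FinP
open import Data.Fin.Permutation using (Permutation′; _⟨$⟩ʳ_)
open import Data.List as List using (List; []; _∷_; length; filter; foldr; allFin)
open import Data.Nat.ListAction using (sum)
open import Data.List.Relation.Unary.All using (All)
open import Data.List.Relation.Unary.Linked using (Linked)
open import Data.Maybe using (Maybe; just; nothing)
open import Data.Product using (Σ; ∃; ∃-syntax; _×_; _,_)
open import Data.Sum using (_⊎_)
open import Data.Bool using (Bool; true; false; if_then_else_)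
open import Relation.Nullary using (¬_; yes; no; Dec)
open import Relation.Nullary.Decidable using (⌊_⌋)
open import Relation.Binary.PropositionalEquality using (_≡_; _≢_)

Vecℤ : ℕ → Set
Vecℤ n = Fin n → ℤ

Mat : ℕ → ℕ → Set
Mat m n = Fin m → Fin n → ℤ

∑ : ∀ {n} → (Fin n → ℤ) → ℤ
∑ {zero}  f = + 0
∑ {suc n} f = f Fin.zero ℤ.+ ∑ (λ i → f (Fin.suc i))

_≈V_ : ∀ {n} → Vecℤ n → Vecℤ n → Set
u ≈V v = ∀ i → u i ≡ v i

0V : ∀ {n} → Vecℤ n
0V _ = + 0

_≈M_ : ∀ {m n} → Mat m n → Mat m n → Set
A ≈M B = ∀ i j → A i j ≡ B i j

δ : ∀ {n} → Fin n → Fin n → ℤ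
δ i j = if ⌊ i Fin.≟ j ⌋ then + 1 else + 0

Id : ∀ {n} → Mat n n
Id = δ

0M : ∀ {m n} → Mat m n
0M _ _ = + 0

_ᵀ : ∀ {m n} → Mat m n → Mat n m
(A ᵀ) i j = A j i

_⊗_ : ∀ {m k n} → Mat m k → Mat k n → Mat m n
(A ⊗ B) i j = ∑ (λ l → A i l ℤ.* B l j)

_⊕_ : ∀ {m n} → Mat m n → Mat m n → Mat m n
(A ⊕ B) i j = A i j ℤ.+ B i j

_⊖_ : ∀ {m n} → Mat m n → Mat m n → Mat m n
(A ⊖ B) i j = A i j ℤ.- B i j

negM : ∀ {m n} → Mat m n → Mat m n
negM A i j = - A i j

_·_ : ∀ {m n} → Mat m n → Vecℤ n → Vecℤ m
(A · x) i = ∑ (λ j → A i j ℤ.* x j)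

bil : ∀ {n} → Mat n n → Vecℤ n → Vecℤ n → ℤ
bil A x y = ∑ (λ i → x i ℤ.* (A · y) i)

_^M_ : ∀ {n} → Mat n n → ℕ → Mat n n
A ^M zero  = Id
A ^M suc k = A ⊗ (A ^M k)

∑M : ∀ {n} → ℕ → (ℕ → Mat n n) → Mat n n
∑M zero    f = 0M
∑M (suc k) f = ∑M k f ⊕ f k

-- Inverse of a unipotent (unit upper triangular) matrix U = Id - N, with
-- N nilpotent, N^n = 0:  U^{-1} = Id + N + ... + N^{n-1}.
invUni : ∀ {n} → Mat n n → Mat n n
invUni {n} U = ∑M n (λ k → (Id ⊖ U) ^M k)

Invertible : ∀ {n} → Mat n n → Set
Invertible {n} B = ∃[ B' ] ((B ⊗ B') ≈M Id × (B' ⊗ B) ≈M Id)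

Nilpotent : ∀ {n} → Mat n n → Set
Nilpotent A = ∃[ k ] (A ^M k) ≈M 0M

LinIndep : ∀ {n r} → (Fin r → Vecℤ n) → Set
LinIndep {n} {r} v =
  ∀ (a : Fin r → ℤ) → (λ (i : Fin n) → ∑ (λ k → a k ℤ.* v k i)) ≈V 0V → ∀ k → a k ≡ + 0

LinDep : ∀ {n r} → (Fin r → Vecℤ n) → Set
LinDep {n} {r} v =
  Σ (Fin r → ℤ) λ a → (∃[ k ] (a k ≢ + 0)) × ((λ (i : Fin n) → ∑ (λ k → a k ℤ.* v k i)) ≈V 0V)

HasRank : ∀ {n} → (Vecℤ n → Set) → ℕ → Set
HasRank {n} S r =
  (∃[ v ] ((∀ k → S (v k)) × LinIndep {n} {r} v))
  × (∀ (w : Fin (suc r) → Vecℤ n) → (∀ k → S (w k)) → LinDep w)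

-- Unit forms, represented by their upper triangular matrix Ǧ_q

record UnitForm (n : ℕ) : Set where
  field
    Ǧ     : Mat n n
    diag  : ∀ i → Ǧ i i ≡ + 1
    lower : ∀ i j → j Fin.< i → Ǧ i j ≡ + 0
open UnitForm public

qval : ∀ {n} → UnitForm n → Vecℤ n → ℤ
qval q x = bil (Ǧ q) x x

G : ∀ {n} → UnitForm n → Mat n n
G q = Ǧ q ⊕ (Ǧ q ᵀ)

NonNegative : ∀ {n} → UnitForm n → Set
NonNegative q = ∀ x → + 0 ℤ.≤ qval q x

data Reach {V : Set} (E : V → V → Set) : V → V → Set where
  here  : ∀ {v} → Reach E v v
  there : ∀ {u v w} → E u v → Reach E v w → Reach E u w

Connected : ∀ {n} → UnitForm n → Set
Connected {n} q =
  ∀ (i j : Fin n) → Reach (λ a b → a ≢ b × G q a b ≢ + 0) i j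

rad : ∀ {n} → UnitForm n → Vecℤ n → Set
rad q x = (G q · x) ≈V 0V

radRe : ∀ {n} → UnitForm n → Vecℤ n → Set
radRe q x = rad q x × (∀ y → rad q y → bil (Ǧ q) y x ≡ + 0)

Corank : ∀ {n} → UnitForm n → ℕ → Set
Corank q c = HasRank (rad q) c

ReducedCorank : ∀ {n} → UnitForm n → ℕ → Set
ReducedCorank q c = HasRank (radRe q) c

_≈Gram_ : ∀ {n} → UnitForm n → UnitForm n → Set
q ≈Gram q' = ∃[ B ] (Invertible B × Ǧ q' ≈M ((B ᵀ) ⊗ (Ǧ q ⊗ B)))

GA : (k : ℕ) → Mat k k
GA k i j with toℕ i ℕ.≟ toℕ j | suc (toℕ i) ℕ.≟ toℕ j | suc (toℕ j) ℕ.≟ toℕ i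
... | yes _ | _     | _     = + 2
... | no _  | yes _ | _     = - (+ 1)
... | no _  | no _  | yes _ = - (+ 1)
... | no _  | no _  | no _  = + 0

-- q has Dynkin type A_k: the form induced on Z^n / rad(q) is equivalent
-- to q_{A_k}.  The quotient is represented by a surjective Z-linear map
-- P : Z^n → Z^k with kernel rad(q); q(x) = q_{A_k}(P x) for all x means
-- G_q = P^tr G_{A_k} P.
DynkinTypeA : ∀ {n} → UnitForm n → ℕ → Set
DynkinTypeA {n} q k =
  ∃[ P ] ((∀ (y : Vecℤ k) → ∃[ x ] (P · x) ≈V y)
         × (∀ x → (P · x) ≈V 0V → rad q x)
         × (∀ x → rad q x → (P · x) ≈V 0V)
         × G q ≈M ((P ᵀ) ⊗ (GA k ⊗ P)))

InQuadA : (n c : ℕ) → UnitForm n → Set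
InQuadA n c q = Connected q × NonNegative q × Corank q c × DynkinTypeA q (n ∸ c)

Φ : ∀ {n} → UnitForm n → Mat n n
Φ q = negM ((Ǧ q ᵀ) ⊗ invUni (Ǧ q))

-- Integer polynomials as coefficient lists (lowest degree first)

Poly : Set
Poly = List ℤ

coeff : Poly → ℕ → ℤ
coeff []      _       = + 0
coeff (a ∷ p) zero    = a
coeff (a ∷ p) (suc k) = coeff p k

_≈P_ : Poly → Poly → Set
p ≈P q = ∀ k → coeff p k ≡ coeff q k

_+P_ : Poly → Poly → Poly
[]      +P q       = q
(a ∷ p) +P []      = a ∷ p
(a ∷ p) +P (b ∷ q) = (a ℤ.+ b) ∷ (p +P q)

scaleP : ℤ → Poly → Poly
scaleP a = List.map (a ℤ.*_)

_*P_ : Poly → Poly → Poly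
[]      *P q = []
(a ∷ p) *P q = scaleP a q +P (+ 0 ∷ (p *P q))

negP : Poly → Poly
negP = List.map -_

constP : ℤ → Poly
constP a = a ∷ []

Xp : Poly
Xp = + 0 ∷ + 1 ∷ []

_^P_ : Poly → ℕ → Poly
p ^P zero  = constP (+ 1)
p ^P suc k = p *P (p ^P k)

evalP : Poly → ℤ → ℤ
evalP []      x = + 0
evalP (a ∷ p) x = a ℤ.+ x ℤ.* evalP p x

∑P : ∀ {n} → (Fin n → Poly) → Poly
∑P {zero}  f = []
∑P {suc n} f = f Fin.zero +P ∑P (λ i → f (Fin.suc i))

negIter : ℕ → Poly → Poly
negIter zero    p = p
negIter (suc k) p = negP (negIter k p)

detP : ∀ n → (Fin n → Fin n → Poly) → Poly
detP zero    M = constP (+ 1)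
detP (suc n) M =
  ∑P (λ j → negIter (toℕ j)
      (M Fin.zero j *P detP n (λ a b → M (Fin.suc a) (punchIn j b))))

charPoly : ∀ {n} → Mat n n → Poly
charPoly {n} A =
  detP n (λ i j → if ⌊ i Fin.≟ j ⌋ then (- A i j) ∷ + 1 ∷ []
                                   else constP (- A i j))

φ : ∀ {n} → UnitForm n → Poly
φ q = charPoly (Φ q)

XkMinus1 : ℕ → Poly
XkMinus1 k = (Xp ^P k) +P constP (- (+ 1))

RootMult1 : Poly → ℕ → Set
RootMult1 p k = ∃[ g ] (p ≈P ((XkMinus1 1 ^P k) *P g) × evalP g (+ 1) ≢ + 0)

AlgMult1 : ∀ {n} → Mat n n → ℕ → Set
AlgMult1 A k = RootMult1 (charPoly A) k

GeomMult1 : ∀ {n} → Mat n n → ℕ → Set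
GeomMult1 A k = HasRank (λ x → ((A ⊖ Id) · x) ≈V 0V) k

IsLeast : (ℕ → Set) → ℕ → Set
IsLeast P t = P t × (∀ s → P s → t ℕ.≤ s)

CoxeterNumber : ∀ {n} → Mat n n → Maybe ℕ → Set
CoxeterNumber A (just t) = IsLeast (λ s → 0 ℕ.< s × (A ^M s) ≈M Id) t
CoxeterNumber A nothing  = ∀ s → 0 ℕ.< s → ¬ ((A ^M s) ≈M Id)

ReducedCoxeterNumber : ∀ {n} → Mat n n → ℕ → Set
ReducedCoxeterNumber A t =
  IsLeast (λ s → 0 ℕ.< s × Nilpotent ((A ^M s) ⊖ Id)) t

IsPartition : ℕ → List ℕ → Set
IsPartition m π = Linked ℕ._≥_ π × All (0 ℕ.<_) π × sum π ≡ m

InPartc1 : ℕ → ℕ → List ℕ → Set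
InPartc1 c m π = IsPartition m π × ∃[ k ] (c ℕ.+ 1 ≡ length π ℕ.+ 2 ℕ.* k)

lcmList : List ℕ → ℕ
lcmList = foldr lcm 1

prodP : List Poly → Poly
prodP = foldr _*P_ (constP (+ 1))

record Quiver (m n : ℕ) : Set where
  field
    s t : Fin n → Fin m
open Quiver public

LoopLess : ∀ {m n} → Quiver m n → Set
LoopLess Q = ∀ i → s Q i ≢ t Q i

QConnected : ∀ {m n} → Quiver m n → Set
QConnected {m} {n} Q =
  ∀ (u v : Fin m) → Reach (λ a b → ∃[ i ] ((s Q i ≡ a × t Q i ≡ b) ⊎ (s Q i ≡ b × t Q i ≡ a))) u v

Inc : ∀ {m n} → Quiver m n → Mat m n
Inc Q v i = δ v (s Q i) ℤ.- δ v (t Q i)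

-- Ǧ_Q : upper triangular matrix of q_Q(x) = 1/2 ||I(Q) x||^2
ǦQ : ∀ {m n} → Quiver m n → Mat n n
ǦQ Q i j with Fin.compare i j
... | Fin.less _ _    = ((Inc Q ᵀ) ⊗ Inc Q) i j
... | Fin.equal _   = + (∣ ((Inc Q ᵀ) ⊗ Inc Q) i i ∣ ℕ./ 2)
... | Fin.greater _ _ = + 0

ΛQ : ∀ {m n} → Quiver m n → Mat m m
ΛQ Q = Id ⊖ (Inc Q ⊗ (invUni (ǦQ Q) ⊗ (Inc Q ᵀ)))

PermMat : ∀ {m} → Permutation′ m → Mat m m
PermMat ξ u v = δ u (ξ ⟨$⟩ʳ v)

iter : ∀ {m} → Permutation′ m → ℕ → Fin m → Fin m
iter ξ zero    v = v
iter ξ (suc k) v = ξ ⟨$⟩ʳ iter ξ k v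

returnSearch : ∀ {m} → Permutation′ m → Fin m → ℕ → ℕ → ℕ
returnSearch ξ v zero       k = k
returnSearch ξ v (suc fuel) k =
  if ⌊ iter ξ k v Fin.≟ v ⌋ then k else returnSearch ξ v fuel (suc k)

-- size of the ξ-orbit of v (least k > 0 with ξ^k v = v; it is ≤ m)
orbitSize : ∀ {m} → Permutation′ m → Fin m → ℕ
orbitSize {m} ξ v = returnSearch ξ v m 1

-- π is the partition of m given by the orbit sizes of ξ:
-- for every k, k · (number of parts of π equal to k)
--            = number of v whose orbit has size k
CycleTypeOf : ∀ {m} → Permutation′ m → List ℕ → Set
CycleTypeOf {m} ξ π =
  IsPartition m π ×
  (∀ k → k ℕ.* length (filter (k ℕ.≟_) π)
         ≡ length (filter (λ v → orbitSize ξ v ℕ.≟ k) (allFin m)))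

QCycleType : ∀ {m n} → Quiver m n → List ℕ → Set
QCycleType Q π = ∃[ ξ ] (ΛQ Q ≈M PermMat ξ × CycleTypeOf ξ π)

CT : ∀ {n} → (m : ℕ) → UnitForm n → List ℕ → Set
CT {n} m q π =
  ∃[ Q ] (LoopLess {m} {n} Q × QConnected Q × Ǧ q ≈M ǦQ Q × QCycleType Q π)

coxNumberOf : List ℕ → Maybe ℕ
coxNumberOf (p ∷ []) = just p
coxNumberOf _        = nothing

{-# OPTIONS --safe #-}
-- Let I be the incidence matrix of a quiver with arrows a₁, …, aₙ.  Then Λ is the product of the
-- reflections in the columns of I, hence the permutation matrix of a product of transpositions ξ.
-- Every form of Dynkin type A comes from a quiver, since roots of A are differences eₛ - eₜ.
--
-- As Φ = 1 - Iᵀ (I Ǧ⁻¹) and Λ = 1 - (I Ǧ⁻¹) Iᵀ, the matrices Φ and Λ have the same spectral data up to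
-- the eigenvalue 1: Sylvester's identity gives the Coxeter polynomial, Φˢ - 1 = - Iᵀ (∑_{k<s} Λᵏ) I Ǧ⁻¹
-- gives the Coxeter numbers, and tr Φˢ counts the fixed points of ξˢ, so ct is a congruence invariant.
--
-- Injectivity: write b for the bilinear form of Ǧ, R = ker I and J = Ǧ⁻¹ Iᵀ, so b(x, J w) = ⟨I x, w⟩
-- and I J = 1 - Λ.  The form b is alternating on R, with radical the image under J of the functions that
-- are constant on the cycles of ξ, and it is unimodular modulo that radical.  A symplectic basis u, v of
-- R modulo its radical, the vectors J w, and lifts xⱼ of e_{rep j} - e_{rep 0} (one for each cycle, made
-- orthogonal to u, v and with b(xᵢ, xⱼ) = 0 for i < j) span ℤⁿ, and their Gram matrix depends on ξ only.
-- Counting this basis gives the parity condition.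
module Submission where

open import Defs
open import Data.Nat as ℕ using (ℕ; zero; suc; z≤n; s≤s)
import Data.Nat.Properties as ℕP
open import Relation.Binary.Definitions using (tri<; tri≈; tri>)
open import Data.Nat.ListAction using (sum)
open import Data.Integer as ℤ using (ℤ; +_; -[1+_]; -_; ∣_∣; +≤+)
import Data.Integer.Properties as ℤP
open import Data.Integer.Tactic.RingSolver using (solve-∀)
open import Data.Fin as Fin using (Fin; zero; suc; toℕ; punchIn; inject₁; _↑ˡ_; _↑ʳ_; splitAt)
import Data.Fin.Properties as FinP
open import Data.Fin.Permutation using (Permutation′; _⟨$⟩ʳ_; _⟨$⟩ˡ_; inverseˡ)
import Data.Fin.Permutation as Perm
open import Data.List using (List; []; _∷_; length; map; filter; allFin)
open import Data.List.Relation.Unary.All as All using (All; []; _∷_)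
open import Data.List.Relation.Unary.Linked as Linked using (Linked; []; [-]; _∷_)
open import Data.Product using (Σ; ∃; ∃-syntax; _×_; _,_; proj₁; proj₂)
open import Data.Sum using (_⊎_; inj₁; inj₂; [_,_]′)
open import Data.Bool using (if_then_else_)
open import Function using (_∘_; id)
open import Relation.Nullary using (¬_; Dec; yes; no; contradiction)
open import Relation.Nullary.Decidable using (⌊_⌋; ¬?; _×-dec_)
open import Relation.Binary.PropositionalEquality using (_≡_; _≢_; refl; sym; trans; cong; cong₂; subst; module ≡-Reasoning)

-- Two forms of equal cycle type become comparable because both are transported to the one
-- permutation `std π`: their frames share index sets and coordinates, and only the rank k of the
-- symplectic part and the numbers `b (x i) (x j)`, i < j, could still differ. Counting the basis
-- fixes k; adding radical vectors `r l` to the lifts makes the numbers vanish. The delicate point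
-- is unimodularity over ℤ: if b(·, u) is divisible by d on R, then u is d times an element of R
-- modulo the radical. A first quotient h has d h - u = J w; since I J w = w - Λ w is divisible by
-- d, w is constant modulo d on each cycle and can be split accordingly. For surjectivity, a new
-- vertex attached by one arrow lengthens a cycle; attached by two antiparallel arrows it is a new
-- cycle of length 1; two antiparallel arrows between old vertices leave ξ unchanged and raise the
-- corank by 2, which is the parity again. All linear algebra stays over ℤ: elimination is
-- fraction-free, and polynomial identities are checked at the integers x ≥ 2, where powers of x - 1
-- can be cancelled.

-- Finite sums of integers and the Kronecker delta.

module Sums where

  open import Data.Integer using (_+_; _*_; _-_)

  ∑-cong : ∀ {n} {f g : Fin n → ℤ} → (∀ i → f i ≡ g i) → ∑ f ≡ ∑ g
  ∑-cong {zero}  f≡g = refl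
  ∑-cong {suc n} f≡g = cong₂ _+_ (f≡g zero) (∑-cong (f≡g ∘ suc))

  ∑-zero : ∀ {n} {f : Fin n → ℤ} → (∀ i → f i ≡ + 0) → ∑ f ≡ + 0
  ∑-zero {zero}  f≡0 = refl
  ∑-zero {suc n} f≡0 = cong₂ _+_ (f≡0 zero) (∑-zero (f≡0 ∘ suc))

  interchange : ∀ a b c d → (a + b) + (c + d) ≡ (a + c) + (b + d)
  interchange = solve-∀

  ∑-+ : ∀ {n} (f g : Fin n → ℤ) → ∑ (λ i → f i + g i) ≡ ∑ f + ∑ g
  ∑-+ {zero}  f g = refl
  ∑-+ {suc n} f g = trans (cong (_+_ (f zero + g zero)) (∑-+ (f ∘ suc) (g ∘ suc)))
                          (interchange (f zero) (g zero) _ _)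

  ∑-*ˡ : ∀ {n} (a : ℤ) (f : Fin n → ℤ) → ∑ (λ i → a * f i) ≡ a * ∑ f
  ∑-*ˡ {zero}  a f = sym (ℤP.*-zeroʳ a)
  ∑-*ˡ {suc n} a f = trans (cong (_+_ (a * f zero)) (∑-*ˡ a (f ∘ suc)))
                           (sym (ℤP.*-distribˡ-+ a (f zero) _))

  ∑-*ʳ : ∀ {n} (a : ℤ) (f : Fin n → ℤ) → ∑ (λ i → f i * a) ≡ ∑ f * a
  ∑-*ʳ a f = trans (∑-cong λ i → ℤP.*-comm (f i) a) (trans (∑-*ˡ a f) (ℤP.*-comm a (∑ f)))

  ∑-neg : ∀ {n} (f : Fin n → ℤ) → ∑ (λ i → - f i) ≡ - ∑ f
  ∑-neg {zero}  f = refl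
  ∑-neg {suc n} f = trans (cong (_+_ (- f zero)) (∑-neg (f ∘ suc)))
                          (sym (ℤP.neg-distrib-+ (f zero) _))

  ∑-- : ∀ {n} (f g : Fin n → ℤ) → ∑ (λ i → f i - g i) ≡ ∑ f - ∑ g
  ∑-- f g = trans (∑-+ f (λ i → - g i)) (cong (λ z → ∑ f + z) (∑-neg g))

  ∑-swap : ∀ {m n} (f : Fin m → Fin n → ℤ) →
           ∑ (λ i → ∑ (λ j → f i j)) ≡ ∑ (λ j → ∑ (λ i → f i j))
  ∑-swap {zero} {n} f = sym (∑-zero {n} λ _ → refl)
  ∑-swap {suc m} f = trans (cong (_+_ (∑ (f zero))) (∑-swap (f ∘ suc)))
                           (sym (∑-+ (f zero) (λ j → ∑ (λ i → f (suc i) j))))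

  ∑-++ : ∀ a {b} (f : Fin (a ℕ.+ b) → ℤ) →
         ∑ f ≡ ∑ (λ i → f (i ↑ˡ b)) + ∑ (λ j → f (a ↑ʳ j))
  ∑-++ zero    f = sym (ℤP.+-identityˡ _)
  ∑-++ (suc a) f = trans (cong (_+_ (f zero)) (∑-++ a (f ∘ suc))) (sym (ℤP.+-assoc (f zero) _ _))

  left-comm : ∀ a b c → a + (b + c) ≡ b + (a + c)
  left-comm = solve-∀

  ∑-punchIn : ∀ {n} (p : Fin (suc n)) (f : Fin (suc n) → ℤ) →
              ∑ f ≡ f p + ∑ (λ i → f (punchIn p i))
  ∑-punchIn zero f = refl
  ∑-punchIn {suc n} (suc p) f =
    trans (cong (_+_ (f zero)) (∑-punchIn p (f ∘ suc))) (left-comm (f zero) (f (suc p)) _)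

  δ-refl : ∀ {n} (i : Fin n) → δ i i ≡ + 1
  δ-refl i with i Fin.≟ i
  ... | yes _  = refl
  ... | no i≢i = contradiction refl i≢i

  δ-≢ : ∀ {n} {i j : Fin n} → i ≢ j → δ i j ≡ + 0
  δ-≢ {i = i} {j} i≢j with i Fin.≟ j
  ... | yes i≡j = contradiction i≡j i≢j
  ... | no _    = refl

  δ-sym : ∀ {n} (i j : Fin n) → δ i j ≡ δ j i
  δ-sym i j with i Fin.≟ j
  ... | yes refl = sym (δ-refl i)
  ... | no i≢j   = sym (δ-≢ (i≢j ∘ sym))

  δ-inj : ∀ {m n} (f : Fin m → Fin n) → (∀ {i j} → f i ≡ f j → i ≡ j) → ∀ i j → δ (f i) (f j) ≡ δ i j
  δ-inj f f-inj i j with i Fin.≟ j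
  ... | yes refl = δ-refl (f i)
  ... | no i≢j   = δ-≢ (i≢j ∘ f-inj)

  δ-suc : ∀ {n} (i j : Fin n) → δ (suc i) (suc j) ≡ δ i j
  δ-suc = δ-inj suc FinP.suc-injective

  δ-≢0 : ∀ {n} {i j : Fin n} → δ i j ≢ + 0 → i ≡ j
  δ-≢0 {i = i} {j} δ≢0 with i Fin.≟ j
  ... | yes i≡j = i≡j
  ... | no _    = contradiction refl δ≢0

  ∑-δˡ : ∀ {n} (j : Fin n) (f : Fin n → ℤ) → ∑ (λ i → δ j i * f i) ≡ f j
  ∑-δˡ {suc n} zero f = begin
      + 1 * f zero + ∑ (λ i → δ zero (suc i) * f (suc i))
        ≡⟨ cong₂ _+_ (ℤP.*-identityˡ (f zero)) (∑-zero {n} λ i → refl) ⟩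
      f zero + + 0 ≡⟨ ℤP.+-identityʳ _ ⟩
      f zero ∎
    where open ≡-Reasoning
  ∑-δˡ {suc n} (suc j) f = trans (ℤP.+-identityˡ _)
    (trans (∑-cong λ i → cong (_* f (suc i)) (δ-suc j i)) (∑-δˡ j (f ∘ suc)))

  ∑-δˡ′ : ∀ {n} (j : Fin n) (f : Fin n → ℤ) → ∑ (λ i → δ i j * f i) ≡ f j
  ∑-δˡ′ j f = trans (∑-cong λ i → cong (_* f i) (δ-sym i j)) (∑-δˡ j f)

  ∑-δʳ : ∀ {n} (j : Fin n) (f : Fin n → ℤ) → ∑ (λ i → f i * δ i j) ≡ f j
  ∑-δʳ j f = trans (∑-cong λ i → ℤP.*-comm (f i) _) (∑-δˡ′ j f)

  ∑-δʳ′ : ∀ {n} (j : Fin n) (f : Fin n → ℤ) → ∑ (λ i → f i * δ j i) ≡ f j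
  ∑-δʳ′ j f = trans (∑-cong λ i → ℤP.*-comm (f i) _) (∑-δˡ j f)

  ∑-δ : ∀ {n} (j : Fin n) → ∑ (λ i → δ i j) ≡ + 1
  ∑-δ j = trans (∑-cong λ i → sym (ℤP.*-identityʳ (δ i j))) (∑-δˡ′ j (λ _ → + 1))

  ∑-const : ∀ {n} (a : ℤ) → ∑ {n} (λ _ → a) ≡ + n * a
  ∑-const {zero}  a = refl
  ∑-const {suc n} a = trans (cong (_+_ a) (∑-const {n} a)) (sym (ℤP.suc-* (+ n) a))

  -- Insert the factor ∑ᵢ δ (f i) v = 1.
  ∑-reindex : ∀ {m n} (f : Fin m → Fin n) (f⁻¹ : Fin n → Fin m) → (∀ v → f (f⁻¹ v) ≡ v) →
              (∀ {i j} → f i ≡ f j → i ≡ j) → (g : Fin n → ℤ) → ∑ g ≡ ∑ (g ∘ f)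
  ∑-reindex f f⁻¹ ff⁻¹ f-inj g = begin
      ∑ g
        ≡⟨ ∑-cong (λ v → trans (sym (ℤP.*-identityˡ (g v))) (cong (_* g v) (sym (one v)))) ⟩
      ∑ (λ v → ∑ (λ i → δ (f i) v) * g v)
        ≡⟨ ∑-cong (λ v → sym (∑-*ʳ (g v) (λ i → δ (f i) v))) ⟩
      ∑ (λ v → ∑ (λ i → δ (f i) v * g v))
        ≡⟨ ∑-swap (λ v i → δ (f i) v * g v) ⟩
      ∑ (λ i → ∑ (λ v → δ (f i) v * g v))
        ≡⟨ ∑-cong (λ i → ∑-δˡ (f i) g) ⟩
      ∑ (g ∘ f) ∎
    where
    open ≡-Reasoning
    one : ∀ v → ∑ (λ i → δ (f i) v) ≡ + 1
    one v = trans (∑-cong λ i → trans (cong (δ (f i)) (sym (ff⁻¹ v))) (δ-inj f f-inj i (f⁻¹ v)))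
                  (∑-δ (f⁻¹ v))

  ∑-mono : ∀ {n} {f g : Fin n → ℤ} → (∀ i → f i ℤ.≤ g i) → ∑ f ℤ.≤ ∑ g
  ∑-mono {zero}  f≤g = ℤP.≤-refl
  ∑-mono {suc n} f≤g = ℤP.+-mono-≤ (f≤g zero) (∑-mono (f≤g ∘ suc))

  ∑-≥0 : ∀ {n} {f : Fin n → ℤ} → (∀ i → + 0 ℤ.≤ f i) → + 0 ℤ.≤ ∑ f
  ∑-≥0 {n} {f} f≥0 = subst (ℤ._≤ ∑ f) (∑-zero {n} {λ _ → + 0} λ _ → refl) (∑-mono f≥0)

  ∑-≥0-≡0 : ∀ {n} {f : Fin n → ℤ} → (∀ i → + 0 ℤ.≤ f i) → ∑ f ≡ + 0 → ∀ i → f i ≡ + 0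
  ∑-≥0-≡0 {suc n} {f} f≥0 s zero = ℤP.≤-antisym
    (ℤP.≤-trans (ℤP.≤-reflexive (sym (ℤP.+-identityʳ _)))
      (ℤP.≤-trans (ℤP.+-monoʳ-≤ (f zero) (∑-≥0 (f≥0 ∘ suc))) (ℤP.≤-reflexive s)))
    (f≥0 zero)
  ∑-≥0-≡0 {suc n} {f} f≥0 s (suc i) = ∑-≥0-≡0 (f≥0 ∘ suc)
    (trans (sym (ℤP.+-identityˡ _))
      (trans (cong (_+ ∑ (f ∘ suc)) (sym (∑-≥0-≡0 f≥0 s zero))) s)) i

  square-≥0 : ∀ a → + 0 ℤ.≤ a * a
  square-≥0 (+ zero)    = +≤+ z≤n
  square-≥0 (+ suc n)   = +≤+ z≤n
  square-≥0 (-[1+ n ])  = +≤+ z≤n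

  square-≡0 : ∀ a → a * a ≡ + 0 → a ≡ + 0
  square-≡0 a a²≡0 = [ id , id ]′ (ℤP.i*j≡0⇒i≡0∨j≡0 a a²≡0)

  *-nonzero-cancelˡ : ∀ a b → a ≢ + 0 → a * b ≡ + 0 → b ≡ + 0
  *-nonzero-cancelˡ a b a≢0 ab≡0 = [ (λ a≡0 → contradiction a≡0 a≢0) , id ]′ (ℤP.i*j≡0⇒i≡0∨j≡0 a ab≡0)

  +-cancelˡ : ∀ a {b c} → a + b ≡ a + c → b ≡ c
  +-cancelˡ a {b} {c} eq = trans (lemma a b) (trans (cong (_+_ (- a)) eq) (sym (lemma a c)))
    where
    lemma : ∀ a b → b ≡ - a + (a + b)
    lemma = solve-∀

open Sums

-- Matrix algebra and inverses of unitriangular matrices.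

module Matrices where

  open import Data.Integer using (_+_; _*_; _-_)

  ≈M-sym : ∀ {m n} {A B : Mat m n} → A ≈M B → B ≈M A
  ≈M-sym A≈B i j = sym (A≈B i j)

  ≈M-trans : ∀ {m n} {A B C : Mat m n} → A ≈M B → B ≈M C → A ≈M C
  ≈M-trans A≈B B≈C i j = trans (A≈B i j) (B≈C i j)

  ⊗-cong : ∀ {m k n} {A A' : Mat m k} {B B' : Mat k n} → A ≈M A' → B ≈M B' → (A ⊗ B) ≈M (A' ⊗ B')
  ⊗-cong A≈A' B≈B' i j = ∑-cong λ l → cong₂ _*_ (A≈A' i l) (B≈B' l j)

  ⊗-congˡ : ∀ {m k n} (A : Mat m k) {B B' : Mat k n} → B ≈M B' → (A ⊗ B) ≈M (A ⊗ B')
  ⊗-congˡ A B≈B' i j = ∑-cong λ l → cong (A i l *_) (B≈B' l j)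

  ⊗-congʳ : ∀ {m k n} {A A' : Mat m k} (B : Mat k n) → A ≈M A' → (A ⊗ B) ≈M (A' ⊗ B)
  ⊗-congʳ B A≈A' i j = ∑-cong λ l → cong (_* B l j) (A≈A' i l)

  ⊗-assoc : ∀ {m k l n} (A : Mat m k) (B : Mat k l) (C : Mat l n) → ((A ⊗ B) ⊗ C) ≈M (A ⊗ (B ⊗ C))
  ⊗-assoc A B C i j = begin
      ∑ (λ b → ∑ (λ a → A i a * B a b) * C b j)
        ≡⟨ ∑-cong (λ b → sym (∑-*ʳ (C b j) (λ a → A i a * B a b))) ⟩
      ∑ (λ b → ∑ (λ a → A i a * B a b * C b j))
        ≡⟨ ∑-swap (λ b a → A i a * B a b * C b j) ⟩
      ∑ (λ a → ∑ (λ b → A i a * B a b * C b j))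
        ≡⟨ ∑-cong (λ a → trans (∑-cong λ b → ℤP.*-assoc (A i a) (B a b) (C b j))
                                (∑-*ˡ (A i a) (λ b → B a b * C b j))) ⟩
      ∑ (λ a → A i a * ∑ (λ b → B a b * C b j)) ∎
    where open ≡-Reasoning

  ⊗-identityˡ : ∀ {m n} (A : Mat m n) → (Id ⊗ A) ≈M A
  ⊗-identityˡ A i j = ∑-δˡ i (λ l → A l j)

  ⊗-identityʳ : ∀ {m n} (A : Mat m n) → (A ⊗ Id) ≈M A
  ⊗-identityʳ A i j = ∑-δʳ j (A i)

  ⊗-distribˡ-⊕ : ∀ {m k n} (A : Mat m k) (B C : Mat k n) → (A ⊗ (B ⊕ C)) ≈M ((A ⊗ B) ⊕ (A ⊗ C))
  ⊗-distribˡ-⊕ A B C i j = trans (∑-cong λ l → ℤP.*-distribˡ-+ (A i l) (B l j) (C l j))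
    (∑-+ (λ l → A i l * B l j) (λ l → A i l * C l j))

  ⊗-distribʳ-⊕ : ∀ {m k n} (A B : Mat m k) (C : Mat k n) → ((A ⊕ B) ⊗ C) ≈M ((A ⊗ C) ⊕ (B ⊗ C))
  ⊗-distribʳ-⊕ A B C i j = trans (∑-cong λ l → ℤP.*-distribʳ-+ (C l j) (A i l) (B i l))
    (∑-+ (λ l → A i l * C l j) (λ l → B i l * C l j))

  *-distribˡ-- : ∀ a b c → a * (b - c) ≡ a * b - a * c
  *-distribˡ-- = solve-∀

  *-distribʳ-- : ∀ a b c → (b - c) * a ≡ b * a - c * a
  *-distribʳ-- = solve-∀

  ⊗-distribˡ-⊖ : ∀ {m k n} (A : Mat m k) (B C : Mat k n) → (A ⊗ (B ⊖ C)) ≈M ((A ⊗ B) ⊖ (A ⊗ C))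
  ⊗-distribˡ-⊖ A B C i j = trans (∑-cong λ l → *-distribˡ-- (A i l) (B l j) (C l j))
    (∑-- (λ l → A i l * B l j) (λ l → A i l * C l j))

  ⊗-distribʳ-⊖ : ∀ {m k n} (A B : Mat m k) (C : Mat k n) → ((A ⊖ B) ⊗ C) ≈M ((A ⊗ C) ⊖ (B ⊗ C))
  ⊗-distribʳ-⊖ A B C i j = trans (∑-cong λ l → *-distribʳ-- (C l j) (A i l) (B i l))
    (∑-- (λ l → A i l * C l j) (λ l → B i l * C l j))

  ⊗-negˡ : ∀ {m k n} (A : Mat m k) (B : Mat k n) → (negM A ⊗ B) ≈M negM (A ⊗ B)
  ⊗-negˡ A B i j = trans (∑-cong λ l → sym (ℤP.neg-distribˡ-* (A i l) (B l j))) (∑-neg (λ l → A i l * B l j))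

  ⊗-zeroˡ : ∀ {m k n} (B : Mat k n) → (0M {m} ⊗ B) ≈M 0M
  ⊗-zeroˡ {k = k} B i j = ∑-zero {k} λ _ → refl

  ⊗-zeroʳ : ∀ {m k n} (A : Mat m k) → (A ⊗ 0M {k} {n}) ≈M 0M
  ⊗-zeroʳ A i j = ∑-zero λ l → ℤP.*-zeroʳ (A i l)

  ᵀ-⊗ : ∀ {m k n} (A : Mat m k) (B : Mat k n) → ((A ⊗ B) ᵀ) ≈M ((B ᵀ) ⊗ (A ᵀ))
  ᵀ-⊗ A B i j = ∑-cong λ l → ℤP.*-comm (A j l) (B l i)

  ^M-cong : ∀ {n} {A B : Mat n n} → A ≈M B → ∀ k → (A ^M k) ≈M (B ^M k)
  ^M-cong A≈B zero    i j = refl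
  ^M-cong A≈B (suc k) = ⊗-cong A≈B (^M-cong A≈B k)

  ^M-sucʳ : ∀ {n} (A : Mat n n) k → (A ^M suc k) ≈M ((A ^M k) ⊗ A)
  ^M-sucʳ A zero    i j = trans (⊗-identityʳ A i j) (sym (⊗-identityˡ A i j))
  ^M-sucʳ A (suc k) i j = trans (⊗-congˡ A (^M-sucʳ A k) i j) (sym (⊗-assoc A (A ^M k) A i j))

  -- With N = Id - U, the product (Id - N)(Id + N + ... + N^(k-1)) telescopes.
  geometricˡ : ∀ {n} (U : Mat n n) k → (U ⊗ ∑M k (λ l → (Id ⊖ U) ^M l)) ≈M (Id ⊖ ((Id ⊖ U) ^M k))
  geometricˡ U zero    i j = trans (⊗-zeroʳ U i j) (sym (ℤP.+-inverseʳ (Id i j)))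
  geometricˡ U (suc k) i j = begin
      (U ⊗ (∑M k (N ^M_) ⊕ (N ^M k))) i j
        ≡⟨ ⊗-distribˡ-⊕ U (∑M k (N ^M_)) (N ^M k) i j ⟩
      (U ⊗ ∑M k (N ^M_)) i j + (U ⊗ (N ^M k)) i j
        ≡⟨ cong₂ _+_ (geometricˡ U k i j) refl ⟩
      (Id i j - (N ^M k) i j) + (U ⊗ (N ^M k)) i j
        ≡⟨ lemma (Id i j) ((N ^M k) i j) ((U ⊗ (N ^M k)) i j) ⟩
      Id i j - ((N ^M k) i j - (U ⊗ (N ^M k)) i j)
        ≡⟨ cong (λ z → Id i j - (z - (U ⊗ (N ^M k)) i j)) (sym (⊗-identityˡ (N ^M k) i j)) ⟩
      Id i j - ((Id ⊗ (N ^M k)) i j - (U ⊗ (N ^M k)) i j)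
        ≡⟨ cong (λ z → Id i j - z) (sym (⊗-distribʳ-⊖ Id U (N ^M k) i j)) ⟩
      Id i j - (N ⊗ (N ^M k)) i j ∎
    where
    open ≡-Reasoning
    N = Id ⊖ U
    lemma : ∀ a b c → (a - b) + c ≡ a - (b - c)
    lemma = solve-∀

  geometricʳ : ∀ {n} (U : Mat n n) k → (∑M k (λ l → (Id ⊖ U) ^M l) ⊗ U) ≈M (Id ⊖ ((Id ⊖ U) ^M k))
  geometricʳ U zero    i j = trans (⊗-zeroˡ U i j) (sym (ℤP.+-inverseʳ (Id i j)))
  geometricʳ U (suc k) i j = begin
      ((∑M k (N ^M_) ⊕ (N ^M k)) ⊗ U) i j
        ≡⟨ ⊗-distribʳ-⊕ (∑M k (N ^M_)) (N ^M k) U i j ⟩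
      (∑M k (N ^M_) ⊗ U) i j + ((N ^M k) ⊗ U) i j
        ≡⟨ cong₂ _+_ (geometricʳ U k i j) refl ⟩
      (Id i j - (N ^M k) i j) + ((N ^M k) ⊗ U) i j
        ≡⟨ lemma (Id i j) ((N ^M k) i j) (((N ^M k) ⊗ U) i j) ⟩
      Id i j - ((N ^M k) i j - ((N ^M k) ⊗ U) i j)
        ≡⟨ cong (λ z → Id i j - (z - ((N ^M k) ⊗ U) i j)) (sym (⊗-identityʳ (N ^M k) i j)) ⟩
      Id i j - (((N ^M k) ⊗ Id) i j - ((N ^M k) ⊗ U) i j)
        ≡⟨ cong (λ z → Id i j - z) (sym (⊗-distribˡ-⊖ (N ^M k) Id U i j)) ⟩
      Id i j - ((N ^M k) ⊗ N) i j
        ≡⟨ cong (λ z → Id i j - z) (sym (^M-sucʳ N k i j)) ⟩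
      Id i j - (N ⊗ (N ^M k)) i j ∎
    where
    open ≡-Reasoning
    N = Id ⊖ U
    lemma : ∀ a b c → (a - b) + c ≡ a - (b - c)
    lemma = solve-∀

  UpperUnitriangular : ∀ {n} → Mat n n → Set
  UpperUnitriangular U = (∀ i → U i i ≡ + 1) × (∀ i j → j Fin.< i → U i j ≡ + 0)

  -- Each factor of the strictly upper triangular matrix Id - U moves the support one diagonal
  -- further up, so the k-th power lives on j ≥ i + k; at k = n nothing is left.
  unipotent-power : ∀ {n} (U : Mat n n) → UpperUnitriangular U →
    ∀ k i j → toℕ j ℕ.< toℕ i ℕ.+ k → ((Id ⊖ U) ^M k) i j ≡ + 0
  unipotent-power U _ zero i j j<i = δ-≢ λ i≡j →
    ℕP.<-irrefl (cong toℕ (sym i≡j)) (subst (toℕ j ℕ.<_) (ℕP.+-identityʳ (toℕ i)) j<i)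
  unipotent-power U tri@(dg , lo) (suc k) i j j<i+1+k = ∑-zero term
    where
    term : ∀ l → (Id ⊖ U) i l * ((Id ⊖ U) ^M k) l j ≡ + 0
    term l with ℕP.<-cmp (toℕ l) (toℕ i)
    ... | tri< l<i _ _ = cong (_* ((Id ⊖ U) ^M k) l j)
            (cong₂ _-_ (δ-≢ λ i≡l → ℕP.<-irrefl (cong toℕ (sym i≡l)) l<i) (lo i l l<i))
    ... | tri≈ _ l≡i _ with FinP.toℕ-injective l≡i
    ...   | refl = cong (_* ((Id ⊖ U) ^M k) l j) (cong₂ _-_ (δ-refl l) (dg l))
    term l | tri> _ _ i<l = trans
            (cong ((Id ⊖ U) i l *_) (unipotent-power U tri k l j
              (ℕP.<-≤-trans j<i+1+k (ℕP.≤-trans (ℕP.≤-reflexive (ℕP.+-suc (toℕ i) k)) (ℕP.+-monoˡ-≤ k i<l)))))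
            (ℤP.*-zeroʳ ((Id ⊖ U) i l))

  unipotent-nilpotent : ∀ {n} (U : Mat n n) → UpperUnitriangular U → ((Id ⊖ U) ^M n) ≈M 0M
  unipotent-nilpotent {n} U tri i j =
    unipotent-power U tri n i j (ℕP.<-≤-trans (FinP.toℕ<n j) (ℕP.m≤n+m n (toℕ i)))

  invUni-inverseʳ : ∀ {n} (U : Mat n n) → UpperUnitriangular U → (U ⊗ invUni U) ≈M Id
  invUni-inverseʳ {n} U tri i j = trans (geometricˡ U n i j)
    (trans (cong (λ z → Id i j - z) (unipotent-nilpotent U tri i j)) (ℤP.+-identityʳ _))

  invUni-inverseˡ : ∀ {n} (U : Mat n n) → UpperUnitriangular U → (invUni U ⊗ U) ≈M Id
  invUni-inverseˡ {n} U tri i j = trans (geometricʳ U n i j)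
    (trans (cong (λ z → Id i j - z) (unipotent-nilpotent U tri i j)) (ℤP.+-identityʳ _))

  ∑M-cong : ∀ {n} k {f g : ℕ → Mat n n} → (∀ l → f l ≈M g l) → ∑M k f ≈M ∑M k g
  ∑M-cong zero    f≈g i j = refl
  ∑M-cong (suc k) f≈g i j = cong₂ _+_ (∑M-cong k f≈g i j) (f≈g k i j)

  invUni-cong : ∀ {n} {U W : Mat n n} → U ≈M W → invUni U ≈M invUni W
  invUni-cong {n} U≈W = ∑M-cong n (^M-cong λ i j → cong (λ z → Id i j - z) (U≈W i j))

open Matrices

-- Vectors, kernels and linear dependence over ℤ.

module Vectors where

  open import Data.Integer using (_+_; _*_; _-_)
  open import Data.Vec.Functional using (insertAt)
  open import Data.Vec.Functional.Properties using (insertAt-lookup; insertAt-punchIn)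

  infixl 6 _+V_ _-V_
  infixl 7 _*V_

  _+V_ _-V_ : ∀ {n} → Vecℤ n → Vecℤ n → Vecℤ n
  (x +V y) i = x i + y i
  (x -V y) i = x i - y i

  _*V_ : ∀ {n} → ℤ → Vecℤ n → Vecℤ n
  (a *V x) i = a * x i

  𝐞 : ∀ {n} → Fin n → Vecℤ n
  𝐞 v u = δ u v

  lc : ∀ {n k} → (Fin k → ℤ) → (Fin k → Vecℤ n) → Vecℤ n
  lc a v i = ∑ (λ k → a k * v k i)

  dot : ∀ {n} → Vecℤ n → Vecℤ n → ℤ
  dot x y = ∑ (λ i → x i * y i)

  module _ {n : ℕ} where

    dot-cong : {x x' y y' : Vecℤ n} → x ≈V x' → y ≈V y' → dot x y ≡ dot x' y'
    dot-cong x≈x' y≈y' = ∑-cong λ i → cong₂ _*_ (x≈x' i) (y≈y' i)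

    dot-congʳ : (x : Vecℤ n) {y y' : Vecℤ n} → y ≈V y' → dot x y ≡ dot x y'
    dot-congʳ x y≈y' = ∑-cong λ i → cong (x i *_) (y≈y' i)

    dot-congˡ : {x x' : Vecℤ n} (y : Vecℤ n) → x ≈V x' → dot x y ≡ dot x' y
    dot-congˡ y x≈x' = ∑-cong λ i → cong (_* y i) (x≈x' i)

    dot-comm : (x y : Vecℤ n) → dot x y ≡ dot y x
    dot-comm x y = ∑-cong λ i → ℤP.*-comm (x i) (y i)

    dot-+ʳ : (x y z : Vecℤ n) → dot x (y +V z) ≡ dot x y + dot x z
    dot-+ʳ x y z = trans (∑-cong λ i → ℤP.*-distribˡ-+ (x i) (y i) (z i))
                         (∑-+ (λ i → x i * y i) (λ i → x i * z i))

    dot--ʳ : (x y z : Vecℤ n) → dot x (y -V z) ≡ dot x y - dot x z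
    dot--ʳ x y z = trans (∑-cong λ i → *-distribˡ-- (x i) (y i) (z i))
                         (∑-- (λ i → x i * y i) (λ i → x i * z i))

    dot-*ʳ : (a : ℤ) (x y : Vecℤ n) → dot x (a *V y) ≡ a * dot x y
    dot-*ʳ a x y = trans (∑-cong λ i → left-comm-* (x i) a (y i)) (∑-*ˡ a (λ i → x i * y i))
      where
      left-comm-* : ∀ p q r → p * (q * r) ≡ q * (p * r)
      left-comm-* = solve-∀

    dot-0ʳ : (x : Vecℤ n) {y : Vecℤ n} → y ≈V 0V → dot x y ≡ + 0
    dot-0ʳ x y≈0 = ∑-zero λ i → trans (cong (x i *_) (y≈0 i)) (ℤP.*-zeroʳ (x i))

    dot-lcʳ : ∀ {k} (x : Vecℤ n) (a : Fin k → ℤ) (v : Fin k → Vecℤ n) →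
              dot x (lc a v) ≡ ∑ (λ j → a j * dot x (v j))
    dot-lcʳ x a v = begin
        ∑ (λ i → x i * ∑ (λ j → a j * v j i))
          ≡⟨ ∑-cong (λ i → sym (∑-*ˡ (x i) (λ j → a j * v j i))) ⟩
        ∑ (λ i → ∑ (λ j → x i * (a j * v j i)))
          ≡⟨ ∑-swap (λ i j → x i * (a j * v j i)) ⟩
        ∑ (λ j → ∑ (λ i → x i * (a j * v j i)))
          ≡⟨ ∑-cong (λ j → dot-*ʳ (a j) x (v j)) ⟩
        ∑ (λ j → a j * dot x (v j)) ∎
      where open ≡-Reasoning

    dot-+ˡ : (x y z : Vecℤ n) → dot (x +V y) z ≡ dot x z + dot y z
    dot-+ˡ x y z = trans (dot-comm (x +V y) z) (trans (dot-+ʳ z x y) (cong₂ _+_ (dot-comm z x) (dot-comm z y)))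

    dot--ˡ : (x y z : Vecℤ n) → dot (x -V y) z ≡ dot x z - dot y z
    dot--ˡ x y z = trans (dot-comm (x -V y) z) (trans (dot--ʳ z x y) (cong₂ _-_ (dot-comm z x) (dot-comm z y)))

    dot-*ˡ : (a : ℤ) (x y : Vecℤ n) → dot (a *V x) y ≡ a * dot x y
    dot-*ˡ a x y = trans (dot-comm (a *V x) y) (trans (dot-*ʳ a y x) (cong (a *_) (dot-comm y x)))

    dot-0ˡ : {x : Vecℤ n} (y : Vecℤ n) → x ≈V 0V → dot x y ≡ + 0
    dot-0ˡ {x} y x≈0 = trans (dot-comm x y) (dot-0ʳ y x≈0)

    dot-lcˡ : ∀ {k} (a : Fin k → ℤ) (v : Fin k → Vecℤ n) (y : Vecℤ n) →
              dot (lc a v) y ≡ ∑ (λ j → a j * dot (v j) y)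
    dot-lcˡ a v y = trans (dot-comm (lc a v) y)
      (trans (dot-lcʳ y a v) (∑-cong λ j → cong (a j *_) (dot-comm y (v j))))

    dot-𝐞ˡ : (v : Fin n) (x : Vecℤ n) → dot (𝐞 v) x ≡ x v
    dot-𝐞ˡ v x = ∑-δˡ′ v x

    dot-𝐞ʳ : (x : Vecℤ n) (v : Fin n) → dot x (𝐞 v) ≡ x v
    dot-𝐞ʳ x v = ∑-δʳ v x

    dot-self-≡0 : (x : Vecℤ n) → dot x x ≡ + 0 → x ≈V 0V
    dot-self-≡0 x xx≡0 i = square-≡0 (x i) (∑-≥0-≡0 (λ j → square-≥0 (x j)) xx≡0 i)

    lc-𝐞 : (x : Vecℤ n) → lc x 𝐞 ≈V x
    lc-𝐞 x i = ∑-δʳ′ i x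

  module _ {m n : ℕ} (A : Mat m n) where

    ·-cong : {x y : Vecℤ n} → x ≈V y → (A · x) ≈V (A · y)
    ·-cong x≈y i = dot-congʳ (A i) x≈y

    ·-+ : (x y : Vecℤ n) → (A · (x +V y)) ≈V ((A · x) +V (A · y))
    ·-+ x y i = dot-+ʳ (A i) x y

    ·-- : (x y : Vecℤ n) → (A · (x -V y)) ≈V ((A · x) -V (A · y))
    ·-- x y i = dot--ʳ (A i) x y

    ·-* : (a : ℤ) (x : Vecℤ n) → (A · (a *V x)) ≈V (a *V (A · x))
    ·-* a x i = dot-*ʳ a (A i) x

    ·-0 : {x : Vecℤ n} → x ≈V 0V → (A · x) ≈V 0V
    ·-0 x≈0 i = dot-0ʳ (A i) x≈0

    ·-lc : ∀ {k} (a : Fin k → ℤ) (v : Fin k → Vecℤ n) → (A · lc a v) ≈V lc a (λ j → A · v j)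
    ·-lc a v i = dot-lcʳ (A i) a v

    ·-𝐞 : (j : Fin n) → (A · 𝐞 j) ≈V (λ i → A i j)
    ·-𝐞 j i = dot-𝐞ʳ (A i) j

    dot-· : (x : Vecℤ m) (y : Vecℤ n) → dot x (A · y) ≡ dot ((A ᵀ) · x) y
    dot-· x y = begin
        ∑ (λ i → x i * ∑ (λ j → A i j * y j))
          ≡⟨ ∑-cong (λ i → sym (∑-*ˡ (x i) (λ j → A i j * y j))) ⟩
        ∑ (λ i → ∑ (λ j → x i * (A i j * y j)))
          ≡⟨ ∑-swap (λ i j → x i * (A i j * y j)) ⟩
        ∑ (λ j → ∑ (λ i → x i * (A i j * y j)))
          ≡⟨ ∑-cong (λ j → trans (∑-cong λ i → rearrange (x i) (A i j) (y j))
                                  (∑-*ʳ (y j) (λ i → A i j * x i))) ⟩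
        ∑ (λ j → ∑ (λ i → A i j * x i) * y j) ∎
      where
      open ≡-Reasoning
      rearrange : ∀ a b c → a * (b * c) ≡ b * a * c
      rearrange = solve-∀

  ·-⊗ : ∀ {m k n} (A : Mat m k) (B : Mat k n) (x : Vecℤ n) → ((A ⊗ B) · x) ≈V (A · (B · x))
  ·-⊗ A B x i = sym (trans (dot-· B (A i) x) (dot-congˡ x λ j → dot-comm (λ l → B l j) (A i)))

  Id-· : ∀ {n} (x : Vecℤ n) → (Id · x) ≈V x
  Id-· x i = ∑-δˡ i x

  ·-congˡ : ∀ {m n} {A B : Mat m n} (x : Vecℤ n) → A ≈M B → (A · x) ≈V (B · x)
  ·-congˡ x A≈B i = dot-congˡ x (A≈B i)

  module _ {m n : ℕ} (A : Mat n n) (I : Mat m n) (A≈IᵀI : A ≈M ((I ᵀ) ⊗ I)) where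

    gram-kernel⇐ : ∀ x → (I · x) ≈V 0V → (A · x) ≈V 0V
    gram-kernel⇐ x Ix≈0 i = trans (·-congˡ x A≈IᵀI i) (trans (·-⊗ (I ᵀ) I x i) (·-0 (I ᵀ) Ix≈0 i))

    -- From A x = 0 follows 0 = xᵀ A x = ‖I x‖², and a sum of squares vanishes only termwise. Hence
    -- the radical of a form with Gram matrix Iᵀ I is the kernel of I.
    gram-kernel⇒ : ∀ x → (A · x) ≈V 0V → (I · x) ≈V 0V
    gram-kernel⇒ x Ax≈0 = dot-self-≡0 (I · x) (trans (dot-· I (I · x) x) (dot-0ˡ x λ i →
      trans (sym (·-⊗ (I ᵀ) I x i)) (trans (·-congˡ x (≈M-sym A≈IᵀI) i) (Ax≈0 i))))

  -- Fraction-free elimination, one row at a time. If the new row vanishes on all vectors found for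
  -- the other rows, one of them is dropped; otherwise a pivot `v p` clears the rest through α p · v
  -- i - α i · v p. The vectors are independent but need not generate the kernel.
  kernel-vectors : ∀ k {n c} → n ≡ k ℕ.+ c → (A : Mat k n) →
    ∃[ v ] ((∀ j → (A · v j) ≈V 0V) × LinIndep {n} {c} v)
  kernel-vectors zero refl A = 𝐞 , (λ j ()) , λ a a≈0 k → trans (sym (lc-𝐞 a k)) (a≈0 k)
  kernel-vectors (suc k) {n} {c} n≡ A
    with kernel-vectors k {n} {suc c} (trans n≡ (sym (ℕP.+-suc k c))) (A ∘ suc)
  ... | v , Av , ind with FinP.any? (λ p → ¬? (dot (A zero) (v p) ℤ.≟ + 0))
  ...   | no none = v ∘ suc , Av' , ind'
    where
    Av' : ∀ j → (A · v (suc j)) ≈V 0V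
    Av' j zero with dot (A zero) (v (suc j)) ℤ.≟ + 0
    ... | yes z≡0 = z≡0
    ... | no z≢0  = contradiction (suc j , z≢0) none
    Av' j (suc i) = Av (suc j) i
    ind' : LinIndep (v ∘ suc)
    ind' a a≈0 j = ind (insertAt a zero (+ 0)) (λ i → trans (ℤP.+-identityˡ _) (a≈0 i)) (suc j)
  ...   | yes (p , αp≢0) = w , Aw , ind'
    where
    open ≡-Reasoning
    α : Fin (suc c) → ℤ
    α j = dot (A zero) (v j)
    w : Fin c → Vecℤ n
    w i = α p *V v (punchIn p i) -V α (punchIn p i) *V v p
    Aw : ∀ j → (A · w j) ≈V 0V
    Aw j i = trans (dot--ʳ (A i) _ _) (trans
        (cong₂ _-_ (dot-*ʳ (α p) (A i) (v (punchIn p j))) (dot-*ʳ (α (punchIn p j)) (A i) (v p))) (zeros i))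
      where
      zeros : ∀ i → α p * dot (A i) (v (punchIn p j)) - α (punchIn p j) * dot (A i) (v p) ≡ + 0
      zeros zero    = trans (cong (λ z → α p * α (punchIn p j) - z) (ℤP.*-comm (α (punchIn p j)) (α p)))
                            (ℤP.+-inverseʳ (α p * α (punchIn p j)))
      zeros (suc i) = cong₂ _-_ (trans (cong (α p *_) (Av (punchIn p j) i)) (ℤP.*-zeroʳ (α p)))
                                (trans (cong (α (punchIn p j) *_) (Av p i)) (ℤP.*-zeroʳ (α (punchIn p j))))
    ind' : LinIndep w
    ind' a a≈0 j = *-nonzero-cancelˡ (α p) (a j) αp≢0
        (trans (ℤP.*-comm (α p) (a j)) (trans (sym (insertAt-punchIn b' p bp j)) (ind b b≈0 (punchIn p j))))
      where
      b' : Fin c → ℤ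
      b' i = a i * α p
      -- A relation a among the `w i` is a relation among the `v i`, with coefficients a i · α p
      -- away from the pivot and this one at it.
      bp = - ∑ (λ i → a i * α (punchIn p i))
      b = insertAt b' p bp
      rearrange : ∀ x y z t u → x * (y * z - t * u) ≡ x * y * z + - (x * t) * u
      rearrange = solve-∀
      b≈0 : (λ i → ∑ (λ k → b k * v k i)) ≈V 0V
      b≈0 i = begin
        ∑ (λ k → b k * v k i)
          ≡⟨ ∑-punchIn p (λ k → b k * v k i) ⟩
        b p * v p i + ∑ (λ k → b (punchIn p k) * v (punchIn p k) i)
          ≡⟨ cong₂ _+_ (cong (_* v p i) (insertAt-lookup b' p bp))
                       (∑-cong λ k → cong (_* v (punchIn p k) i) (insertAt-punchIn b' p bp k)) ⟩
        bp * v p i + ∑ (λ k → a k * α p * v (punchIn p k) i)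
          ≡⟨ ℤP.+-comm (bp * v p i) _ ⟩
        ∑ (λ k → a k * α p * v (punchIn p k) i) + bp * v p i
          ≡⟨ cong (_+_ (∑ (λ k → a k * α p * v (punchIn p k) i))) (trans (cong (_* v p i) (sym (∑-neg (λ k → a k * α (punchIn p k)))))
                                 (sym (∑-*ʳ (v p i) (λ k → - (a k * α (punchIn p k)))))) ⟩
        ∑ (λ k → a k * α p * v (punchIn p k) i) + ∑ (λ k → - (a k * α (punchIn p k)) * v p i)
          ≡⟨ sym (∑-+ (λ k → a k * α p * v (punchIn p k) i) (λ k → - (a k * α (punchIn p k)) * v p i)) ⟩
        ∑ (λ k → a k * α p * v (punchIn p k) i + - (a k * α (punchIn p k)) * v p i)
          ≡⟨ ∑-cong (λ k → sym (rearrange (a k) (α p) (v (punchIn p k) i) (α (punchIn p k)) (v p i))) ⟩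
        ∑ (λ k → a k * w k i)
          ≡⟨ a≈0 i ⟩
        + 0 ∎

  independent-≢0 : ∀ {n r} (v : Fin r → Vecℤ n) → LinIndep v → ∀ k → ¬ (v k ≈V 0V)
  independent-≢0 v ind k vk≈0 = contradiction (trans (sym (δ-refl k)) (ind (δ k) lc≈0 k)) λ ()
    where
    lc≈0 : lc (δ k) v ≈V 0V
    lc≈0 i = trans (∑-δˡ k (λ j → v j i)) (vk≈0 i)

  nonzero-entry : ∀ {n} (a : Fin n → ℤ) → ¬ (a ≈V 0V) → ∃[ k ] (a k ≢ + 0)
  nonzero-entry a a≉0 = FinP.¬∀⟶∃¬ _ (λ i → a i ≡ + 0) (λ i → a i ℤ.≟ + 0) a≉0

  -- The r × (r + 1) matrix of the values `dot (F i) (w k)` has a nonzero kernel vector. With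
  -- functionals F that are injective on a submodule, this bounds the rank of the submodule by r.
  nontrivial-relation : ∀ {n r} (F : Mat r n) (w : Fin (suc r) → Vecℤ n) →
    ∃[ a ] ((∃[ k ] (a k ≢ + 0)) × (F · lc a w) ≈V 0V)
  nontrivial-relation {n} {r} F w
    with kernel-vectors r {suc r} {1} (ℕP.+-comm 1 r) (λ i k → dot (F i) (w k))
  ... | v , Fv , ind = v zero , nonzero-entry (v zero) (independent-≢0 v ind zero) ,
    λ i → trans (dot-lcʳ (F i) (v zero) w)
      (trans (∑-cong λ k → ℤP.*-comm (v zero k) (dot (F i) (w k))) (Fv zero i))

  injective⇒≤ : ∀ {a b} (F : Mat b a) → (∀ x → (F · x) ≈V 0V → x ≈V 0V) → a ℕ.≤ b
  injective⇒≤ {a} {b} F F-inj with a ℕ.≤? b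
  ... | yes a≤b = a≤b
  ... | no a≰b with ℕP.m≤n⇒∃[o]m+o≡n (ℕP.≰⇒> a≰b)
  ...   | o , eq with kernel-vectors b {a} {suc o} (trans (sym eq) (sym (ℕP.+-suc b o))) F
  ...     | v , Fv , ind = contradiction (F-inj (v zero) (Fv zero)) (independent-≢0 v ind zero)

  -- The n + 1 vectors e_j and the columns of C in ℤⁿ satisfy a relation a₀ e_j + C a' = 0. Applying
  -- D gives a' = - a₀ D e_j, so a₀ ≠ 0, and substituting back yields a₀ (e_j - C D e_j) = 0.
  leftInverse⇒rightInverse : ∀ {n} (D C : Mat n n) → (D ⊗ C) ≈M Id → (C ⊗ D) ≈M Id
  leftInverse⇒rightInverse {n} D C DC≈1 i j with nontrivial-relation {n} {n} Id w
    where
    w : Fin (suc n) → Vecℤ n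
    w zero    = 𝐞 j
    w (suc k) = λ l → C l k
  ... | a , (k , ak≢0) , rel = ℤP.i-j≡0⇒i≡j _ _ (*-nonzero-cancelˡ a₀ _ a₀≢0 (begin
        a₀ * ((C ⊗ D) i j - δ i j)
          ≡⟨ *-distribˡ-- a₀ _ _ ⟩
        a₀ * (C ⊗ D) i j - a₀ * δ i j
          ≡⟨ cong₂ _-_ (sym (dot-*ʳ a₀ (C i) (λ l → D l j))) (neg-swap _ _ (a₀e+Ca≡0 i)) ⟩
        dot (C i) (λ l → a₀ * D l j) - - (C · a') i
          ≡⟨ cong (λ z → z - - (C · a') i) (dot-congʳ (C i) (λ l → neg-swap _ _ (a₀De+a≡0 l))) ⟩
        dot (C i) (λ l → - a' l) - - (C · a') i
          ≡⟨ cong (λ z → z - - (C · a') i) (trans (∑-cong λ l → sym (ℤP.neg-distribʳ-* (C i l) (a' l)))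
               (∑-neg (λ l → C i l * a' l))) ⟩
        - (C · a') i - - (C · a') i
          ≡⟨ ℤP.+-inverseʳ (- (C · a') i) ⟩
        + 0 ∎))
    where
    open ≡-Reasoning
    a₀ = a zero
    a' : Vecℤ n
    a' l = a (suc l)
    neg-swap : ∀ x y → x + y ≡ + 0 → x ≡ - y
    neg-swap x y x+y≡0 = trans (lemma x y) (trans (cong (_- y) x+y≡0) (ℤP.+-identityˡ (- y)))
      where
      lemma : ∀ x y → x ≡ x + y - y
      lemma = solve-∀
    a₀e+Ca≡0 : ∀ l → a₀ * δ l j + (C · a') l ≡ + 0
    a₀e+Ca≡0 l = trans (cong (_+_ (a₀ * δ l j)) (∑-cong λ k → ℤP.*-comm (C l k) (a' k)))
                       (trans (sym (Id-· _ l)) (rel l))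
    a₀De+a≡0 : ∀ l → a₀ * D l j + a' l ≡ + 0
    a₀De+a≡0 l = begin
      a₀ * D l j + a' l
        ≡⟨ cong₂ _+_ (cong (a₀ *_) (sym (·-𝐞 D j l))) (sym (trans (·-congˡ a' DC≈1 l) (Id-· a' l))) ⟩
      a₀ * (D · 𝐞 j) l + ((D ⊗ C) · a') l
        ≡⟨ cong₂ _+_ (sym (·-* D a₀ (𝐞 j) l)) (·-⊗ D C a' l) ⟩
      (D · (a₀ *V 𝐞 j)) l + (D · (C · a')) l
        ≡⟨ sym (·-+ D (a₀ *V 𝐞 j) (C · a') l) ⟩
      (D · (a₀ *V 𝐞 j +V C · a')) l
        ≡⟨ ·-0 D a₀e+Ca≡0 l ⟩
      + 0 ∎
    a₀≢0 : a₀ ≢ + 0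
    a₀≢0 a₀≡0 = ak≢0 (all-zero k)
      where
      all-zero : ∀ k → a k ≡ + 0
      all-zero zero    = a₀≡0
      all-zero (suc l) = trans (sym (ℤP.+-identityˡ _))
        (trans (cong (λ z → z * D l j + a' l) (sym a₀≡0)) (a₀De+a≡0 l))

open Vectors

-- Determinants: alternating maps, multiplicativity, block triangular matrices.

module Determinants where

  open import Data.Integer using (_+_; _*_; _-_)
  open import Data.Vec.Functional using (insertAt)
  open import Data.Vec.Functional.Properties using (insertAt-lookup; insertAt-punchIn)

  sgn : ℕ → ℤ
  sgn zero    = + 1
  sgn (suc k) = - sgn k

  minor : ∀ {n k} → Fin (suc k) → Mat n (suc k) → Mat n k
  minor j M a b = M a (punchIn j b)

  det : ∀ {n} → Mat n n → ℤ
  det {zero}  M = + 1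
  det {suc n} M = ∑ (λ j → sgn (toℕ j) * (M zero j * det (minor j (M ∘ suc))))

  cons : ∀ {n m} → Vecℤ m → Mat n m → Mat (suc n) m
  cons x M zero    = x
  cons x M (suc i) = M i

  record IsLinear {m k} (L : Vecℤ m → Vecℤ k) : Set where
    field
      L-cong : ∀ {x y} → x ≈V y → L x ≈V L y
      L-lin  : ∀ a b x y → L (a *V x +V b *V y) ≈V (a *V L x +V b *V L y)
  open IsLinear

  -- Vanishing is only required on two equal adjacent rows; Alt-repeated gives the general case.
  Alternating : ∀ n {m} → (Mat n m → ℤ) → Set
  Alternating zero    F = ∀ A B → F A ≡ F B
  Alternating (suc n) {m} F =
      (∀ {A B} → A ≈M B → F A ≡ F B)
    × (∀ a b x y M → F (cons (a *V x +V b *V y) M) ≡ a * F (cons x M) + b * F (cons y M))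
    × (∀ x → Alternating n (λ M → F (cons x M)))
    × (∀ k (eq : n ≡ suc k) x (M : Mat k m) → F (cons x (subst (λ l → Mat l m) (sym eq) (cons x M))) ≡ + 0)

  module _ {m : ℕ} where

    cons-cong : ∀ {n} {x y : Vecℤ m} {M N : Mat n m} → x ≈V y → M ≈M N → cons x M ≈M cons y N
    cons-cong x≈y M≈N zero    = x≈y
    cons-cong x≈y M≈N (suc i) = M≈N i

    cons-η : ∀ {n} (A : Mat (suc n) m) → A ≈M cons (A zero) (A ∘ suc)
    cons-η A zero    j = refl
    cons-η A (suc i) j = refl

    Alt-≗ : ∀ n {F G : Mat n m → ℤ} → (∀ A → F A ≡ G A) → Alternating n F → Alternating n G
    Alt-≗ zero    F≗G alt A B = trans (sym (F≗G A)) (trans (alt A B) (F≗G B))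
    Alt-≗ (suc n) F≗G (cg , ln , tl , ad) =
      (λ A≈B → trans (sym (F≗G _)) (trans (cg A≈B) (F≗G _))) ,
      (λ a b x y M → trans (sym (F≗G _)) (trans (ln a b x y M)
         (cong₂ _+_ (cong (a *_) (F≗G _)) (cong (b *_) (F≗G _))))) ,
      (λ x → Alt-≗ n (λ M → F≗G (cons x M)) (tl x)) ,
      (λ k eq x M → trans (sym (F≗G _)) (ad k eq x M))

    Alt-0 : ∀ n → Alternating n {m} (λ _ → + 0)
    Alt-0 zero    A B = refl
    Alt-0 (suc n) = (λ _ → refl) , (λ a b x y M → sym (cong₂ _+_ (ℤP.*-zeroʳ a) (ℤP.*-zeroʳ b))) ,
      (λ x → Alt-0 n) , (λ k eq x M → refl)

    Alt-+ : ∀ n {F G : Mat n m → ℤ} → Alternating n F → Alternating n G → Alternating n (λ A → F A + G A)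
    Alt-+ zero    f g A B = cong₂ _+_ (f A B) (g A B)
    Alt-+ (suc n) {F} {G} (cg , ln , tl , ad) (cg' , ln' , tl' , ad') =
      (λ A≈B → cong₂ _+_ (cg A≈B) (cg' A≈B)) ,
      (λ a b x y M → trans (cong₂ _+_ (ln a b x y M) (ln' a b x y M))
         (lemma a b (F (cons x M)) (F (cons y M)) (G (cons x M)) (G (cons y M)))) ,
      (λ x → Alt-+ n (tl x) (tl' x)) ,
      (λ k eq x M → cong₂ _+_ (ad k eq x M) (ad' k eq x M))
      where
      lemma : ∀ a b p q r s → (a * p + b * q) + (a * r + b * s) ≡ a * (p + r) + b * (q + s)
      lemma = solve-∀

    Alt-* : ∀ n c {F : Mat n m → ℤ} → Alternating n F → Alternating n (λ A → c * F A)
    Alt-* zero    c f A B = cong (c *_) (f A B)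
    Alt-* (suc n) c {F} (cg , ln , tl , ad) =
      (λ A≈B → cong (c *_) (cg A≈B)) ,
      (λ a b x y M → trans (cong (c *_) (ln a b x y M)) (lemma a b c (F (cons x M)) (F (cons y M)))) ,
      (λ x → Alt-* n c (tl x)) ,
      (λ k eq x M → trans (cong (c *_) (ad k eq x M)) (ℤP.*-zeroʳ c))
      where
      lemma : ∀ a b c p q → c * (a * p + b * q) ≡ a * (c * p) + b * (c * q)
      lemma = solve-∀

    Alt-∑ : ∀ n {k} (F : Fin k → Mat n m → ℤ) → (∀ j → Alternating n (F j)) →
            Alternating n (λ A → ∑ (λ j → F j A))
    Alt-∑ n {zero}  F alt = Alt-0 n
    Alt-∑ n {suc k} F alt = Alt-+ n (alt zero) (Alt-∑ n (F ∘ suc) (alt ∘ suc))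

  module _ {m k : ℕ} (L : Vecℤ m → Vecℤ k) (lin : IsLinear L) where

    cons-map : ∀ {n} x (M : Mat n m) → (L ∘ cons x M) ≈M cons (L x) (L ∘ M)
    cons-map x M zero    j = refl
    cons-map x M (suc i) j = refl

    map-cong : ∀ {n} {A B : Mat n m} → A ≈M B → (L ∘ A) ≈M (L ∘ B)
    map-cong A≈B i = L-cong lin (A≈B i)

    Alt-map : ∀ n (F : Mat n k → ℤ) → Alternating n F → Alternating n (λ A → F (L ∘ A))
    Alt-map zero    F f A B = f _ _
    Alt-map (suc n) F alt@(cg , ln , tl , ad) =
      (λ A≈B → cg (map-cong A≈B)) ,
      (λ a b x y M → trans (cg (≈M-trans (cons-map _ M) (cons-cong (L-lin lin a b x y) (λ _ _ → refl))))
         (trans (ln a b (L x) (L y) (L ∘ M))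
           (cong₂ _+_ (cong (a *_) (cg (≈M-sym (cons-map x M)))) (cong (b *_) (cg (≈M-sym (cons-map y M))))))) ,
      (λ x → Alt-≗ n (λ M → cg (≈M-sym (cons-map x M))) (Alt-map n (λ M → F (cons (L x) M)) (tl (L x)))) ,
      adjacent
      where
      adjacent : ∀ j (eq : n ≡ suc j) x (M : Mat j m) →
        F (L ∘ cons x (subst (λ l → Mat l m) (sym eq) (cons x M))) ≡ + 0
      adjacent j refl x M = trans
        (cg (≈M-trans (cons-map x (cons x M)) (cons-cong (λ _ → refl) (cons-map x M))))
        (ad j refl (L x) (L ∘ M))

  module _ {n m : ℕ} (F : Mat (suc n) m → ℤ) (alt : Alternating (suc n) F) where

    private
      cg = proj₁ alt
      ln = proj₁ (proj₂ alt)

    Alt-linear : ∀ a b x y z M → z ≈V (a *V x +V b *V y) →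
                 F (cons z M) ≡ a * F (cons x M) + b * F (cons y M)
    Alt-linear a b x y z M z≈ = trans (cg (cons-cong z≈ (λ _ _ → refl))) (ln a b x y M)

    Alt-zero-row : ∀ M → F (cons 0V M) ≡ + 0
    Alt-zero-row M = Alt-linear (+ 0) (+ 0) 0V 0V 0V M (λ _ → refl)

    Alt-lc : ∀ {k} (a : Fin k → ℤ) (v : Fin k → Vecℤ m) M →
             F (cons (lc a v) M) ≡ ∑ (λ j → a j * F (cons (v j) M))
    Alt-lc {zero}  a v M = Alt-zero-row M
    Alt-lc {suc k} a v M = trans
      (Alt-linear (a zero) (+ 1) (v zero) (lc (a ∘ suc) (v ∘ suc)) (lc a v) M
        (λ i → cong (_+_ (a zero * v zero i)) (sym (ℤP.*-identityˡ _))))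
      (cong (_+_ (a zero * F (cons (v zero) M)))
        (trans (ℤP.*-identityˡ _) (Alt-lc (a ∘ suc) (v ∘ suc) M)))

  -- Polarisation: expand the vanishing value at the repeated row x + y.
  Alt-swap : ∀ {n m} (F : Mat (suc (suc n)) m → ℤ) → Alternating (suc (suc n)) F →
             ∀ x y M → F (cons x (cons y M)) ≡ - F (cons y (cons x M))
  Alt-swap F alt@(cg , ln , tl , ad) x y M = ℤP.i-j≡0⇒i≡j _ _ (begin
      f x y - - f y x
        ≡⟨ lemma (f x y) (f y x) ⟩
      (+ 1 * (+ 1 * + 0 + + 1 * f x y) + + 1 * (+ 1 * f y x + + 1 * + 0))
        ≡⟨ cong₂ (λ p q → + 1 * (+ 1 * p + + 1 * f x y) + + 1 * (+ 1 * f y x + + 1 * q))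
                 (sym (ad _ refl x M)) (sym (ad _ refl y M)) ⟩
      (+ 1 * (+ 1 * f x x + + 1 * f x y) + + 1 * (+ 1 * f y x + + 1 * f y y))
        ≡⟨ sym (cong₂ (λ p q → + 1 * p + + 1 * q) (second x) (second y)) ⟩
      + 1 * f x x+y + + 1 * f y x+y
        ≡⟨ sym (ln (+ 1) (+ 1) x y (cons x+y M)) ⟩
      f x+y x+y
        ≡⟨ ad _ refl x+y M ⟩
      + 0 ∎)
    where
    open ≡-Reasoning
    f : _ → _ → ℤ
    f u v = F (cons u (cons v M))
    x+y = + 1 *V x +V + 1 *V y
    second : ∀ u → f u x+y ≡ + 1 * f u x + + 1 * f u y
    second u = proj₁ (proj₂ (tl u)) (+ 1) (+ 1) x y M
    lemma : ∀ p q → p - - q ≡ (+ 1 * (+ 1 * + 0 + + 1 * p) + + 1 * (+ 1 * q + + 1 * + 0))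
    lemma = solve-∀

  Alt-repeated : ∀ {n m} (F : Mat (suc n) m → ℤ) → Alternating (suc n) F →
                 ∀ x M i → M i ≈V x → F (cons x M) ≡ + 0
  Alt-repeated {suc n} F alt@(cg , ln , tl , ad) x M zero Mi≈x =
    trans (cg (cons-cong (λ _ → refl) (≈M-trans (cons-η M) (cons-cong Mi≈x (λ _ _ → refl)))))
          (ad n refl x (M ∘ suc))
  Alt-repeated {suc n} F alt@(cg , ln , tl , ad) x M (suc i) Mi≈x =
    trans (cg (cons-cong (λ _ → refl) (cons-η M)))
      (trans (Alt-swap F alt x (M zero) (M ∘ suc))
        (cong -_ (Alt-repeated (λ N → F (cons (M zero) N)) (tl (M zero)) x (M ∘ suc) i Mi≈x)))

  -- By linearity in each row the correction terms have a row equal to e, and H kills them. It is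
  -- applied to H = F with first row e in front, where it clears the column of e in all other rows.
  Alt-shear : ∀ n {m} (H : Mat n m → ℤ) → Alternating n H → (e : Vecℤ m) →
    (∀ M i → M i ≈V e → H M ≡ + 0) → ∀ (c : Fin n → ℤ) M → H (λ i → M i +V c i *V e) ≡ H M
  Alt-shear zero    H alt e van c M = alt _ _
  Alt-shear (suc n) H alt@(cg , ln , tl , ad) e van c M = begin
      H (λ i → M i +V c i *V e)
        ≡⟨ cg (cons-η _) ⟩
      H (cons (M zero +V c zero *V e) M')
        ≡⟨ Alt-linear H alt (+ 1) (c zero) (M zero) e _ M'
             (λ j → cong (λ z → z + c zero * e j) (sym (ℤP.*-identityˡ (M zero j)))) ⟩
      + 1 * H (cons (M zero) M') + c zero * H (cons e M')
        ≡⟨ cong₂ _+_ (ℤP.*-identityˡ (H (cons (M zero) M'))) (trans (cong (c zero *_) (van (cons e M') zero (λ _ → refl)))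
                                               (ℤP.*-zeroʳ (c zero))) ⟩
      H (cons (M zero) M') + + 0
        ≡⟨ ℤP.+-identityʳ _ ⟩
      H (cons (M zero) M')
        ≡⟨ Alt-shear n (λ N → H (cons (M zero) N)) (tl (M zero)) e
             (λ N i Ni≈e → van (cons (M zero) N) (suc i) Ni≈e) (c ∘ suc) (M ∘ suc) ⟩
      H (cons (M zero) (M ∘ suc))
        ≡⟨ cg (≈M-sym (cons-η M)) ⟩
      H M ∎
    where
    open ≡-Reasoning
    M' = λ i → M (suc i) +V c (suc i) *V e

  -- Row j reaches the front by j adjacent transpositions.
  Alt-cycle : ∀ {n m} (F : Mat (suc n) m → ℤ) → Alternating (suc n) F → (v : Mat (suc n) m) →
    ∀ j → F (cons (v j) (v ∘ punchIn j)) ≡ sgn (toℕ j) * F v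
  Alt-cycle F (cg , _) v zero = trans (cg (≈M-sym (cons-η v))) (sym (ℤP.*-identityˡ (F v)))
  Alt-cycle {suc n} F alt@(cg , ln , tl , ad) v (suc j) = begin
      F (cons (v (suc j)) (v ∘ punchIn (suc j)))
        ≡⟨ cg (cons-cong (λ _ → refl) (cons-η _)) ⟩
      F (cons (v (suc j)) (cons (v zero) (v ∘ suc ∘ punchIn j)))
        ≡⟨ Alt-swap F alt (v (suc j)) (v zero) (v ∘ suc ∘ punchIn j) ⟩
      - F (cons (v zero) (cons (v (suc j)) (v ∘ suc ∘ punchIn j)))
        ≡⟨ cong -_ (Alt-cycle (λ N → F (cons (v zero) N)) (tl (v zero)) (v ∘ suc) j) ⟩
      - (sgn (toℕ j) * F (cons (v zero) (v ∘ suc)))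
        ≡⟨ ℤP.neg-distribˡ-* (sgn (toℕ j)) _ ⟩
      - sgn (toℕ j) * F (cons (v zero) (v ∘ suc))
        ≡⟨ cong (- sgn (toℕ j) *_) (cg (≈M-sym (cons-η v))) ⟩
      - sgn (toℕ j) * F v ∎
    where open ≡-Reasoning

  insert0 : ∀ {n} → Fin (suc n) → Vecℤ n → Vecℤ (suc n)
  insert0 j x = insertAt x j (+ 0)

  punch-cases : ∀ {n} {P : Fin (suc n) → Set} (j : Fin (suc n)) → P j → (∀ i → P (punchIn j i)) → ∀ i → P i
  punch-cases {P = P} j Pj Pi i with j Fin.≟ i
  ... | yes refl = Pj
  ... | no j≢i   = subst P (FinP.punchIn-punchOut j≢i) (Pi (Fin.punchOut j≢i))

  insert0-linear : ∀ {n} (j : Fin (suc n)) → IsLinear (insert0 j)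
  insert0-linear j .L-cong {x} {y} x≈y = punch-cases j
    (trans (insertAt-lookup x j _) (sym (insertAt-lookup y j _)))
    (λ i → trans (insertAt-punchIn x j _ i) (trans (x≈y i) (sym (insertAt-punchIn y j _ i))))
  insert0-linear j .L-lin a b x y = punch-cases j
    (trans (insertAt-lookup (a *V x +V b *V y) j _) (sym (trans
      (cong₂ (λ p q → a * p + b * q) (insertAt-lookup x j _) (insertAt-lookup y j _))
      (cong₂ _+_ (ℤP.*-zeroʳ a) (ℤP.*-zeroʳ b)))))
    (λ i → trans (insertAt-punchIn (a *V x +V b *V y) j _ i)
      (sym (cong₂ (λ p q → a * p + b * q) (insertAt-punchIn x j _ i) (insertAt-punchIn y j _ i))))

  -- Expand the first row in the standard basis. Behind a first row e_j the j-th column can be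
  -- sheared to zero, and what remains is an alternating function of the minor, to which induction
  -- applies. Multiplicativity of `det` is the case A ↦ det (A B).
  Alt-unique : ∀ n (F : Mat n n → ℤ) → Alternating n F → ∀ A → F A ≡ det A * F Id
  Alt-unique zero    F alt A = trans (alt A Id) (sym (ℤP.*-identityˡ (F Id)))
  Alt-unique (suc n) F alt@(cg , ln , tl , ad) A = begin
      F A
        ≡⟨ cg (≈M-trans (cons-η A) (cons-cong (λ i → sym (lc-𝐞 (A zero) i)) (λ _ _ → refl))) ⟩
      F (cons (lc (A zero) 𝐞) A')
        ≡⟨ Alt-lc F alt (A zero) 𝐞 A' ⟩
      ∑ (λ j → A zero j * F (cons (𝐞 j) A'))
        ≡⟨ ∑-cong (λ j → cong (A zero j *_) (expand j)) ⟩
      ∑ (λ j → A zero j * (det (minor j A') * (sgn (toℕ j) * F Id)))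
        ≡⟨ ∑-cong (λ j → lemma (A zero j) (det (minor j A')) (sgn (toℕ j)) (F Id)) ⟩
      ∑ (λ j → sgn (toℕ j) * (A zero j * det (minor j A')) * F Id)
        ≡⟨ ∑-*ʳ (F Id) (λ j → sgn (toℕ j) * (A zero j * det (minor j A'))) ⟩
      det A * F Id ∎
    where
    open ≡-Reasoning
    A' = A ∘ suc
    lemma : ∀ a b c d → a * (b * (c * d)) ≡ c * (a * b) * d
    lemma = solve-∀
    module _ (j : Fin (suc n)) where
      H = λ (N : Mat n (suc n)) → F (cons (𝐞 j) N)
      sheared : A' ≈M (λ i → insert0 j (minor j A' i) +V A' i j *V 𝐞 j)
      sheared i = punch-cases j
        (sym (trans (cong₂ (λ p q → p + A' i j * q) (insertAt-lookup (minor j A' i) j _) (δ-refl j))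
                    (trans (ℤP.+-identityˡ _) (ℤP.*-identityʳ _))))
        (λ l → sym (trans (cong₂ (λ p q → p + A' i j * q) (insertAt-punchIn (minor j A' i) j _ l)
                                                          (δ-≢ (FinP.punchInᵢ≢i j l)))
                          (trans (cong (_+_ (A' i (punchIn j l))) (ℤP.*-zeroʳ (A' i j))) (ℤP.+-identityʳ _))))
      embedded-Id : (insert0 j ∘ Id) ≈M (λ i → 𝐞 (punchIn j i))
      embedded-Id i = punch-cases j
        (trans (insertAt-lookup (Id i) j _) (sym (δ-≢ (FinP.punchInᵢ≢i j i ∘ sym))))
        (λ l → trans (insertAt-punchIn (Id i) j _ l)
          (trans (δ-sym i l) (sym (δ-inj (punchIn j) (λ {a} {b} → FinP.punchIn-injective j a b) l i))))
      expand : F (cons (𝐞 j) A') ≡ det (minor j A') * (sgn (toℕ j) * F Id)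
      expand = begin
        F (cons (𝐞 j) A')
          ≡⟨ cg (cons-cong (λ _ → refl) sheared) ⟩
        H (λ i → insert0 j (minor j A' i) +V A' i j *V 𝐞 j)
          ≡⟨ Alt-shear n H (tl (𝐞 j)) (𝐞 j) (λ M i Mi≈e → Alt-repeated F alt (𝐞 j) M i Mi≈e)
               (λ i → A' i j) (insert0 j ∘ minor j A') ⟩
        H (insert0 j ∘ minor j A')
          ≡⟨ Alt-unique n (λ N → H (insert0 j ∘ N))
               (Alt-map (insert0 j) (insert0-linear j) n H (tl (𝐞 j))) (minor j A') ⟩
        det (minor j A') * H (insert0 j ∘ Id)
          ≡⟨ cong (det (minor j A') *_) (cg (cons-cong (λ _ → refl) embedded-Id)) ⟩
        det (minor j A') * F (cons (𝐞 j) (𝐞 ∘ punchIn j))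
          ≡⟨ cong (det (minor j A') *_) (Alt-cycle F alt 𝐞 j) ⟩
        det (minor j A') * (sgn (toℕ j) * F 𝐞)
          ≡⟨ cong (λ z → det (minor j A') * (sgn (toℕ j) * z)) (cg (λ a b → δ-sym b a)) ⟩
        det (minor j A') * (sgn (toℕ j) * F Id) ∎

  -- In a double Laplace expansion the terms removing the same two columns in either order are paired.
  ∑∑-cancel : ∀ n (F : Fin (suc n) → Fin n → ℤ) →
    (∀ a b → toℕ a ℕ.≤ toℕ b → F (inject₁ a) b + F (suc b) a ≡ + 0) →
    ∑ (λ j → ∑ (λ k → F j k)) ≡ + 0
  ∑∑-cancel zero    F pair = refl
  ∑∑-cancel (suc n) F pair = begin
      ∑ (F zero) + ∑ (λ j → F (suc j) zero + ∑ (λ k → F (suc j) (suc k)))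
        ≡⟨ cong (_+_ (∑ (F zero))) (∑-+ (λ j → F (suc j) zero) (λ j → ∑ (λ k → F (suc j) (suc k)))) ⟩
      ∑ (F zero) + (∑ (λ j → F (suc j) zero) + ∑ (λ j → ∑ (λ k → F (suc j) (suc k))))
        ≡⟨ sym (ℤP.+-assoc (∑ (F zero)) _ _) ⟩
      ∑ (F zero) + ∑ (λ j → F (suc j) zero) + ∑ (λ j → ∑ (λ k → F (suc j) (suc k)))
        ≡⟨ cong₂ _+_ (trans (sym (∑-+ (F zero) (λ j → F (suc j) zero))) (∑-zero λ j → pair zero j z≤n))
                     (∑∑-cancel n (λ j k → F (suc j) (suc k)) λ a b a≤b → pair (suc a) (suc b) (s≤s a≤b)) ⟩
      + 0 ∎
    where open ≡-Reasoning

  punchIn-comm : ∀ {n} (a b : Fin (suc n)) (x : Fin n) → toℕ a ℕ.≤ toℕ b →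
                 punchIn (inject₁ a) (punchIn b x) ≡ punchIn (suc b) (punchIn a x)
  punchIn-comm zero    b       x       _         = refl
  punchIn-comm (suc a) (suc b) zero    _         = refl
  punchIn-comm (suc a) (suc b) (suc x) (s≤s a≤b) = cong suc (punchIn-comm a b x a≤b)

  punchIn-inject₁ : ∀ {n} (a b : Fin (suc n)) → toℕ a ℕ.≤ toℕ b → punchIn (inject₁ a) b ≡ suc b
  punchIn-inject₁ zero    b _ = refl
  punchIn-inject₁ {suc n} (suc a) (suc b) (s≤s a≤b) = cong suc (punchIn-inject₁ a b a≤b)

  punchIn-suc : ∀ {n} (a b : Fin (suc n)) → toℕ a ℕ.≤ toℕ b → punchIn (suc b) a ≡ inject₁ a
  punchIn-suc zero    b _ = refl
  punchIn-suc {suc n} (suc a) (suc b) (s≤s a≤b) = cong suc (punchIn-suc a b a≤b)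

  det-cong : ∀ {n} {A B : Mat n n} → A ≈M B → det A ≡ det B
  det-cong {zero}  A≈B = refl
  det-cong {suc n} A≈B = ∑-cong λ j → cong (sgn (toℕ j) *_)
    (cong₂ _*_ (A≈B zero j) (det-cong λ a b → A≈B (suc a) (punchIn j b)))

  drop-linear : ∀ {n} (j : Fin (suc n)) → IsLinear {suc n} {n} (λ x → x ∘ punchIn j)
  drop-linear j .L-cong x≈y i      = x≈y (punchIn j i)
  drop-linear j .L-lin  a b x y i = refl

  -- Only the condition on adjacent rows is not immediate: two Laplace steps along equal rows remove
  -- two columns, and the two orders of removal carry opposite signs.
  det-Alternating : ∀ n → Alternating n (det {n})
  det-Alternating zero    A B = refl
  det-Alternating (suc n) = det-cong , linear , tails , adjacent
    where
    linear : ∀ a b x y M → det (cons (a *V x +V b *V y) M) ≡ a * det (cons x M) + b * det (cons y M)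
    linear a b x y M = trans
        (∑-cong λ j → lemma a b (x j) (y j) (sgn (toℕ j)) (det (minor j M)))
        (trans (∑-+ (λ j → a * (sgn (toℕ j) * (x j * det (minor j M))))
                    (λ j → b * (sgn (toℕ j) * (y j * det (minor j M)))))
               (cong₂ _+_ (∑-*ˡ a (λ j → sgn (toℕ j) * (x j * det (minor j M))))
                          (∑-*ˡ b (λ j → sgn (toℕ j) * (y j * det (minor j M))))))
      where
      lemma : ∀ a b x y s d → s * ((a * x + b * y) * d) ≡ a * (s * (x * d)) + b * (s * (y * d))
      lemma = solve-∀
    tails : ∀ x → Alternating n (λ M → det (cons x M))
    tails x = Alt-∑ n (λ j M → sgn (toℕ j) * (x j * det (minor j M))) λ j →
      Alt-* n (sgn (toℕ j)) (Alt-* n (x j)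
        (Alt-map (λ y → y ∘ punchIn j) (drop-linear j) n det (det-Alternating n)))
    adjacent : ∀ k (eq : n ≡ suc k) x (M : Mat k (suc n)) →
      det (cons x (subst (λ l → Mat l (suc n)) (sym eq) (cons x M))) ≡ + 0
    adjacent k refl x M = trans
        (∑-cong λ j → trans (cong (sgn (toℕ j) *_) (sym (∑-*ˡ (x j) (λ l → sgn (toℕ l) * (x (punchIn j l) * D j l)))))
                            (sym (∑-*ˡ (sgn (toℕ j)) (λ l → x j * (sgn (toℕ l) * (x (punchIn j l) * D j l))))))
        (∑∑-cancel (suc k) (λ j l → sgn (toℕ j) * (x j * (sgn (toℕ l) * (x (punchIn j l) * D j l)))) pair)
      where
      D : Fin (suc (suc k)) → Fin (suc k) → ℤ
      D j l = det (minor l (minor j M))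
      lemma : ∀ p q s t d → s * (p * (t * (q * d))) + - t * (q * (s * (p * d))) ≡ + 0
      lemma = solve-∀
      pair : ∀ a b → toℕ a ℕ.≤ toℕ b →
        sgn (toℕ (inject₁ a)) * (x (inject₁ a) * (sgn (toℕ b) * (x (punchIn (inject₁ a) b) * D (inject₁ a) b)))
        + sgn (toℕ (suc b)) * (x (suc b) * (sgn (toℕ a) * (x (punchIn (suc b) a) * D (suc b) a))) ≡ + 0
      pair a b a≤b rewrite FinP.toℕ-inject₁ a | punchIn-inject₁ a b a≤b | punchIn-suc a b a≤b
        | det-cong {k} {minor b (minor (inject₁ a) M)} {minor a (minor (suc b) M)}
            (λ i l → cong (M i) (punchIn-comm a b l a≤b))
        = lemma (x (inject₁ a)) (x (suc b)) (sgn (toℕ a)) (sgn (toℕ b)) (D (suc b) a)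

  det-⊗ : ∀ {n} (A B : Mat n n) → det (A ⊗ B) ≡ det A * det B
  det-⊗ {n} A B = trans (Alt-unique n (λ M → det (M ⊗ B)) alt A)
                        (cong (det A *_) (det-cong (⊗-identityˡ B)))
    where
    lin : IsLinear (λ x j → dot x (λ l → B l j))
    lin .L-cong x≈y j      = dot-congˡ (λ l → B l j) x≈y
    lin .L-lin  a b x y j = trans (dot-+ˡ (a *V x) (b *V y) (λ l → B l j))
      (cong₂ _+_ (dot-*ˡ a x (λ l → B l j)) (dot-*ˡ b y (λ l → B l j)))
    alt : Alternating n (λ M → det (M ⊗ B))
    alt = Alt-map _ lin n det (det-Alternating n)

  ∏ : ∀ {n} → (Fin n → ℤ) → ℤ
  ∏ {zero}  f = + 1
  ∏ {suc n} f = f zero * ∏ (f ∘ suc)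

  ∏-cong : ∀ {n} {f g : Fin n → ℤ} → (∀ i → f i ≡ g i) → ∏ f ≡ ∏ g
  ∏-cong {zero}  f≡g = refl
  ∏-cong {suc n} f≡g = cong₂ _*_ (f≡g zero) (∏-cong (f≡g ∘ suc))

  ∏-const : ∀ n (a : ℤ) → ∏ {n} (λ _ → a) ≡ a ℤ.^ n
  ∏-const zero    a = refl
  ∏-const (suc n) a = cong (a *_) (∏-const n a)

  ∏-++ : ∀ a {b} (f : Fin (a ℕ.+ b) → ℤ) → ∏ f ≡ ∏ (λ i → f (i ↑ˡ b)) * ∏ (λ j → f (a ↑ʳ j))
  ∏-++ zero    f = sym (ℤP.*-identityˡ _)
  ∏-++ (suc a) f = trans (cong (f zero *_) (∏-++ a (f ∘ suc))) (sym (ℤP.*-assoc (f zero) _ _))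

  det-zero-column : ∀ {n} (M : Mat n n) c → (∀ i → M i c ≡ + 0) → det M ≡ + 0
  det-zero-column {suc n} M c Mc≡0 = ∑-zero λ j → term j
    where
    term : ∀ j → sgn (toℕ j) * (M zero j * det (minor j (M ∘ suc))) ≡ + 0
    term j with j Fin.≟ c
    ... | yes refl = trans (cong (λ z → sgn (toℕ j) * (z * det (minor j (M ∘ suc)))) (Mc≡0 zero))
                           (ℤP.*-zeroʳ (sgn (toℕ j)))
    ... | no j≢c   = trans (cong (λ z → sgn (toℕ j) * (M zero j * z))
        (det-zero-column (minor j (M ∘ suc)) (Fin.punchOut j≢c) λ i →
           trans (cong (M (suc i)) (FinP.punchIn-punchOut j≢c)) (Mc≡0 (suc i))))
      (trans (cong (sgn (toℕ j) *_) (ℤP.*-zeroʳ (M zero j))) (ℤP.*-zeroʳ (sgn (toℕ j))))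

  det-upper : ∀ {n} (M : Mat n n) → (∀ i j → toℕ j ℕ.< toℕ i → M i j ≡ + 0) → det M ≡ ∏ (λ i → M i i)
  det-upper {zero}  M up = refl
  det-upper {suc n} M up = trans
    (cong₂ _+_ (trans (ℤP.*-identityˡ _) (cong (M zero zero *_)
                  (det-upper (minor zero (M ∘ suc)) λ i j j<i → up (suc i) (suc j) (s≤s j<i))))
               (∑-zero λ j → rest n M up j))
    (ℤP.+-identityʳ _)
    where
    rest : ∀ n (M : Mat (suc n) (suc n)) → (∀ i j → toℕ j ℕ.< toℕ i → M i j ≡ + 0) → ∀ (j : Fin n) →
           sgn (suc (toℕ j)) * (M zero (suc j) * det (minor (suc j) (M ∘ suc))) ≡ + 0
    rest (suc n) M up j = trans (cong (λ z → sgn (suc (toℕ j)) * (M zero (suc j) * z))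
        (det-zero-column (minor (suc j) (M ∘ suc)) zero λ i → up (suc i) zero (s≤s z≤n)))
      (trans (cong (sgn (suc (toℕ j)) *_) (ℤP.*-zeroʳ (M zero (suc j)))) (ℤP.*-zeroʳ (sgn (suc (toℕ j)))))

  det-lower : ∀ {n} (M : Mat n n) → (∀ i j → toℕ i ℕ.< toℕ j → M i j ≡ + 0) → det M ≡ ∏ (λ i → M i i)
  det-lower {zero}  M lo = refl
  det-lower {suc n} M lo = trans
    (cong₂ _+_ (trans (ℤP.*-identityˡ _) (cong (M zero zero *_)
                  (det-lower (minor zero (M ∘ suc)) λ i j i<j → lo (suc i) (suc j) (s≤s i<j))))
               (∑-zero λ j → trans (cong (λ z → sgn (suc (toℕ j)) * (z * det (minor (suc j) (M ∘ suc))))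
                                         (lo zero (suc j) (s≤s z≤n)))
                                   (ℤP.*-zeroʳ (sgn (suc (toℕ j))))))
    (ℤP.+-identityʳ _)

  punchIn-↑ˡ-↑ˡ : ∀ {p} s (j : Fin (suc p)) (b : Fin p) → punchIn (j ↑ˡ s) (b ↑ˡ s) ≡ punchIn j b ↑ˡ s
  punchIn-↑ˡ-↑ˡ s zero    b       = refl
  punchIn-↑ˡ-↑ˡ s (suc j) zero    = refl
  punchIn-↑ˡ-↑ˡ s (suc j) (suc b) = cong suc (punchIn-↑ˡ-↑ˡ s j b)

  punchIn-↑ˡ-↑ʳ : ∀ {p} s (j : Fin (suc p)) (b : Fin s) → punchIn (j ↑ˡ s) (p ↑ʳ b) ≡ suc p ↑ʳ b
  punchIn-↑ˡ-↑ʳ         s zero    b = refl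
  punchIn-↑ˡ-↑ʳ {suc p} s (suc j) b = cong suc (punchIn-↑ˡ-↑ʳ s j b)

  -- Along the first row only the columns of the first block contribute, and each minor is again
  -- block triangular with the same lower block.
  det-block : ∀ p {s} (M : Mat (p ℕ.+ s) (p ℕ.+ s)) → (∀ i j → M (i ↑ˡ s) (p ↑ʳ j) ≡ + 0) →
    det M ≡ det (λ i j → M (i ↑ˡ s) (j ↑ˡ s)) * det (λ i j → M (p ↑ʳ i) (p ↑ʳ j))
  det-block zero        M up = sym (ℤP.*-identityˡ _)
  det-block (suc p) {s} M up = begin
      det M
        ≡⟨ ∑-++ (suc p) (λ j → sgn (toℕ j) * (M zero j * det (minor j (M ∘ suc)))) ⟩
      ∑ (λ j → sgn (toℕ (j ↑ˡ s)) * (M zero (j ↑ˡ s) * det (minor (j ↑ˡ s) (M ∘ suc))))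
        + ∑ (λ j → sgn (toℕ (suc p ↑ʳ j)) * (M zero (suc p ↑ʳ j) * det (minor (suc p ↑ʳ j) (M ∘ suc))))
        ≡⟨ cong₂ _+_ (∑-cong term) (∑-zero λ j →
             trans (cong (λ z → sgn (toℕ (suc p ↑ʳ j)) * (z * det (minor (suc p ↑ʳ j) (M ∘ suc)))) (up zero j))
                   (ℤP.*-zeroʳ (sgn (toℕ (suc p ↑ʳ j))))) ⟩
      ∑ (λ j → sgn (toℕ j) * (A zero j * det (minor j (A ∘ suc))) * det D) + + 0
        ≡⟨ ℤP.+-identityʳ _ ⟩
      ∑ (λ j → sgn (toℕ j) * (A zero j * det (minor j (A ∘ suc))) * det D)
        ≡⟨ ∑-*ʳ (det D) (λ j → sgn (toℕ j) * (A zero j * det (minor j (A ∘ suc)))) ⟩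
      det A * det D ∎
    where
    open ≡-Reasoning
    A : Mat (suc p) (suc p)
    A i j = M (i ↑ˡ s) (j ↑ˡ s)
    D : Mat s s
    D i j = M (suc p ↑ʳ i) (suc p ↑ʳ j)
    term : ∀ j → sgn (toℕ (j ↑ˡ s)) * (M zero (j ↑ˡ s) * det (minor (j ↑ˡ s) (M ∘ suc)))
               ≡ sgn (toℕ j) * (A zero j * det (minor j (A ∘ suc))) * det D
    term j = trans (cong₂ (λ a b → sgn a * (A zero j * b)) (FinP.toℕ-↑ˡ j s)
        (trans (det-block p (minor (j ↑ˡ s) (M ∘ suc))
                  (λ a b → trans (cong (M (suc a ↑ˡ s)) (punchIn-↑ˡ-↑ʳ s j b)) (up (suc a) b)))
          (cong₂ _*_ (det-cong λ a b → cong (M (suc a ↑ˡ s)) (punchIn-↑ˡ-↑ˡ s j b))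
                     (det-cong λ a b → cong (M (suc p ↑ʳ a)) (punchIn-↑ˡ-↑ʳ s j b)))))
      (lemma (sgn (toℕ j)) (A zero j) (det (minor j (A ∘ suc))) (det D))
      where
      lemma : ∀ s a b d → s * (a * (b * d)) ≡ s * (a * b) * d
      lemma = solve-∀

open Determinants

-- Block matrices and Sylvester's identity.

module Sylvester where

  open import Data.Integer using (_+_; _*_; _-_)

  scal : ∀ {n} → ℤ → Mat n n
  scal z i j = z * δ i j

  ↑-cases : ∀ a {b} (P : Fin (a ℕ.+ b) → Set) → (∀ i → P (i ↑ˡ b)) → (∀ j → P (a ↑ʳ j)) → ∀ i → P i
  ↑-cases a {b} P Pˡ Pʳ i = subst P (FinP.join-splitAt a b i) (cases (splitAt a i))
    where
    cases : ∀ s → P (Fin.join a b s)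
    cases (inj₁ l) = Pˡ l
    cases (inj₂ r) = Pʳ r

  δ-↑ˡ↑ʳ : ∀ {a b} (i : Fin a) (j : Fin b) → δ (i ↑ˡ b) (a ↑ʳ j) ≡ + 0
  δ-↑ˡ↑ʳ {a} {b} i j = δ-≢ λ eq → contradiction
    (trans (sym (FinP.splitAt-↑ˡ a i b)) (trans (cong (splitAt a) eq) (FinP.splitAt-↑ʳ a b j))) λ ()

  module _ {n m : ℕ} where

    block : Mat n n → Mat n m → Mat m n → Mat m m → Mat (n ℕ.+ m) (n ℕ.+ m)
    block A B C D i j = [ (λ a → [ A a , B a ]′ (splitAt n j)) , (λ c → [ C c , D c ]′ (splitAt n j)) ]′ (splitAt n i)

    module _ (A : Mat n n) (B : Mat n m) (C : Mat m n) (D : Mat m m) where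

      block-ˡˡ : ∀ i j → block A B C D (i ↑ˡ m) (j ↑ˡ m) ≡ A i j
      block-ˡˡ i j rewrite FinP.splitAt-↑ˡ n i m | FinP.splitAt-↑ˡ n j m = refl

      block-ˡʳ : ∀ i j → block A B C D (i ↑ˡ m) (n ↑ʳ j) ≡ B i j
      block-ˡʳ i j rewrite FinP.splitAt-↑ˡ n i m | FinP.splitAt-↑ʳ n m j = refl

      block-ʳˡ : ∀ i j → block A B C D (n ↑ʳ i) (j ↑ˡ m) ≡ C i j
      block-ʳˡ i j rewrite FinP.splitAt-↑ʳ n m i | FinP.splitAt-↑ˡ n j m = refl

      block-ʳʳ : ∀ i j → block A B C D (n ↑ʳ i) (n ↑ʳ j) ≡ D i j
      block-ʳʳ i j rewrite FinP.splitAt-↑ʳ n m i | FinP.splitAt-↑ʳ n m j = refl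

    module _ (A : Mat n n) (B : Mat n m) (C : Mat m n) (D : Mat m m)
             (A' : Mat n n) (B' : Mat n m) (C' : Mat m n) (D' : Mat m m) where

      private
        X = block A B C D
        X' = block A' B' C' D'

      block-⊗-ˡˡ : ∀ i j → (X ⊗ X') (i ↑ˡ m) (j ↑ˡ m) ≡ ((A ⊗ A') ⊕ (B ⊗ C')) i j
      block-⊗-ˡˡ i j = trans (∑-++ n (λ l → X (i ↑ˡ m) l * X' l (j ↑ˡ m))) (cong₂ _+_
        (∑-cong λ l → cong₂ _*_ (block-ˡˡ A B C D i l) (block-ˡˡ A' B' C' D' l j))
        (∑-cong λ l → cong₂ _*_ (block-ˡʳ A B C D i l) (block-ʳˡ A' B' C' D' l j)))

      block-⊗-ˡʳ : ∀ i j → (X ⊗ X') (i ↑ˡ m) (n ↑ʳ j) ≡ ((A ⊗ B') ⊕ (B ⊗ D')) i j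
      block-⊗-ˡʳ i j = trans (∑-++ n (λ l → X (i ↑ˡ m) l * X' l (n ↑ʳ j))) (cong₂ _+_
        (∑-cong λ l → cong₂ _*_ (block-ˡˡ A B C D i l) (block-ˡʳ A' B' C' D' l j))
        (∑-cong λ l → cong₂ _*_ (block-ˡʳ A B C D i l) (block-ʳʳ A' B' C' D' l j)))

      block-⊗-ʳʳ : ∀ i j → (X ⊗ X') (n ↑ʳ i) (n ↑ʳ j) ≡ ((C ⊗ B') ⊕ (D ⊗ D')) i j
      block-⊗-ʳʳ i j = trans (∑-++ n (λ l → X (n ↑ʳ i) l * X' l (n ↑ʳ j))) (cong₂ _+_
        (∑-cong λ l → cong₂ _*_ (block-ʳˡ A B C D i l) (block-ˡʳ A' B' C' D' l j))
        (∑-cong λ l → cong₂ _*_ (block-ʳʳ A B C D i l) (block-ʳʳ A' B' C' D' l j)))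

    det-block-upper : ∀ (B : Mat n m) z → det (block Id B 0M (scal z)) ≡ z ℤ.^ m
    det-block-upper B z = begin
        det X
          ≡⟨ det-upper X (λ i j → upper i j) ⟩
        ∏ (λ i → X i i)
          ≡⟨ ∏-++ n (λ i → X i i) ⟩
        ∏ (λ i → X (i ↑ˡ m) (i ↑ˡ m)) * ∏ (λ i → X (n ↑ʳ i) (n ↑ʳ i))
          ≡⟨ cong₂ _*_ (∏-cong λ i → trans (block-ˡˡ Id B 0M (scal z) i i) (δ-refl i))
                       (∏-cong λ i → trans (block-ʳʳ Id B 0M (scal z) i i)
                          (trans (cong (z *_) (δ-refl i)) (ℤP.*-identityʳ z))) ⟩
        ∏ {n} (λ _ → + 1) * ∏ {m} (λ _ → z)
          ≡⟨ cong₂ _*_ (trans (∏-const n (+ 1)) (ℤP.^-zeroˡ n)) (∏-const m z) ⟩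
        + 1 * z ℤ.^ m
          ≡⟨ ℤP.*-identityˡ (z ℤ.^ m) ⟩
        z ℤ.^ m ∎
      where
      open ≡-Reasoning
      X = block Id B 0M (scal z)
      upper : ∀ i j → toℕ j ℕ.< toℕ i → X i j ≡ + 0
      upper = ↑-cases n (λ i → ∀ j → toℕ j ℕ.< toℕ i → X i j ≡ + 0)
        (λ i → ↑-cases n (λ j → toℕ j ℕ.< toℕ (i ↑ˡ m) → X (i ↑ˡ m) j ≡ + 0)
          (λ j j<i → trans (block-ˡˡ Id B 0M (scal z) i j)
             (δ-≢ λ i≡j → ℕP.<-irrefl (cong (λ k → toℕ (k ↑ˡ m)) (sym i≡j)) j<i))
          (λ j j<i → contradiction
             (ℕP.<-≤-trans (subst (ℕ._< _) (FinP.toℕ-↑ʳ n j) j<i)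
               (ℕP.≤-trans (ℕP.≤-reflexive (FinP.toℕ-↑ˡ i m))
                 (ℕP.≤-trans (ℕP.<⇒≤ (FinP.toℕ<n i)) (ℕP.m≤m+n n (toℕ j)))))
             (ℕP.<-irrefl refl)))
        (λ i → ↑-cases n (λ j → toℕ j ℕ.< toℕ (n ↑ʳ i) → X (n ↑ʳ i) j ≡ + 0)
          (λ j _ → block-ʳˡ Id B 0M (scal z) i j)
          (λ j j<i → trans (block-ʳʳ Id B 0M (scal z) i j)
             (trans (cong (z *_) (δ-≢ λ i≡j → ℕP.<-irrefl (cong (λ k → toℕ (n ↑ʳ k)) (sym i≡j)) j<i))
                    (ℤP.*-zeroʳ z))))

  scal-⊗ : ∀ {k m} z (A : Mat k m) → (scal z ⊗ A) ≈M (λ i j → z * A i j)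
  scal-⊗ z A i j = trans (∑-cong λ l → ℤP.*-assoc z (δ i l) (A l j))
    (trans (∑-*ˡ z (λ l → δ i l * A l j)) (cong (z *_) (⊗-identityˡ A i j)))

  ⊗-scal : ∀ {k m} z (A : Mat k m) → (A ⊗ scal z) ≈M (λ i j → z * A i j)
  ⊗-scal z A i j = trans (∑-cong λ l → rearrange (A i l) z (δ l j))
    (trans (∑-*ˡ z (λ l → A i l * δ l j)) (cong (z *_) (⊗-identityʳ A i j)))
    where
    rearrange : ∀ a b c → a * (b * c) ≡ b * (a * c)
    rearrange = solve-∀

  det-scal : ∀ n z → det {n} (scal z) ≡ z ℤ.^ n
  det-scal n z = trans (det-lower (scal {n} z) (λ i j i<j → trans (cong (z *_)
      (δ-≢ λ i≡j → ℕP.<-irrefl (cong toℕ i≡j) i<j)) (ℤP.*-zeroʳ z)))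
    (trans (∏-cong {n} λ i → trans (cong (z *_) (δ-refl i)) (ℤP.*-identityʳ z)) (∏-const n z))

  -- Sylvester's identity: both sides are computed from det [[z, -X], [Y, 1]].
  det-sylvester : ∀ {n m} (X : Mat n m) (Y : Mat m n) z →
    z ℤ.^ m * det (scal z ⊕ (X ⊗ Y)) ≡ z ℤ.^ n * det (scal z ⊕ (Y ⊗ X))
  det-sylvester {n} {m} X Y z = begin
      z ℤ.^ m * det (scal z ⊕ (X ⊗ Y))
        ≡⟨ cong (z ℤ.^ m *_) (sym det-M) ⟩
      z ℤ.^ m * det M
        ≡⟨ ℤP.*-comm (z ℤ.^ m) (det M) ⟩
      det M * z ℤ.^ m
        ≡⟨ cong (det M *_) (sym (det-block-upper X z)) ⟩
      det M * det E₂
        ≡⟨ sym (det-⊗ M E₂) ⟩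
      det (M ⊗ E₂)
        ≡⟨ det-block n (M ⊗ E₂) (λ i j → trans (block-⊗-ˡʳ (scal z) (negM X) Y Id Id X 0M (scal z) i j)
             (trans (cong₂ _+_ (scal-⊗ z X i j)
                      (trans (⊗-negˡ X (scal z) i j) (cong -_ (⊗-scal z X i j))))
               (ℤP.+-inverseʳ (z * X i j)))) ⟩
      det (λ i j → (M ⊗ E₂) (i ↑ˡ m) (j ↑ˡ m)) * det (λ i j → (M ⊗ E₂) (n ↑ʳ i) (n ↑ʳ j))
        ≡⟨ cong₂ _*_ (trans (det-cong λ i j → trans (block-⊗-ˡˡ (scal z) (negM X) Y Id Id X 0M (scal z) i j)
               (trans (cong₂ _+_ (⊗-identityʳ (scal z) i j) (⊗-zeroʳ (negM X) i j)) (ℤP.+-identityʳ _)))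
               (det-scal n z))
             (det-cong λ i j → trans (block-⊗-ʳʳ (scal z) (negM X) Y Id Id X 0M (scal z) i j)
               (trans (cong (_+_ ((Y ⊗ X) i j)) (⊗-identityˡ (scal z) i j))
                 (ℤP.+-comm ((Y ⊗ X) i j) (scal z i j)))) ⟩
      z ℤ.^ n * det (scal z ⊕ (Y ⊗ X)) ∎
    where
    open ≡-Reasoning
    M  = block (scal z) (negM X) Y Id
    -- `E₁ ⊗ M` and `M ⊗ E₂` both have a zero upper right block; their diagonal blocks are z + X Y,
    -- 1 and z, z + Y X. The entry z of `E₂`, in place of 1, avoids dividing by z.
    E₁ = block Id X 0M (scal (+ 1))
    E₂ = block Id X 0M (scal z)
    det-M : det M ≡ det (scal z ⊕ (X ⊗ Y))
    det-M = begin
      det M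
        ≡⟨ sym (ℤP.*-identityˡ (det M)) ⟩
      + 1 * det M
        ≡⟨ cong (_* det M) (sym (trans (det-block-upper X (+ 1)) (ℤP.^-zeroˡ m))) ⟩
      det E₁ * det M
        ≡⟨ sym (det-⊗ E₁ M) ⟩
      det (E₁ ⊗ M)
        ≡⟨ det-block n (E₁ ⊗ M) (λ i j → trans (block-⊗-ˡʳ Id X 0M (scal (+ 1)) (scal z) (negM X) Y Id i j)
             (trans (cong₂ _+_ (⊗-identityˡ (negM X) i j) (⊗-identityʳ X i j)) (ℤP.+-inverseˡ (X i j)))) ⟩
      det (λ i j → (E₁ ⊗ M) (i ↑ˡ m) (j ↑ˡ m)) * det (λ i j → (E₁ ⊗ M) (n ↑ʳ i) (n ↑ʳ j))
        ≡⟨ cong₂ _*_ (det-cong λ i j → trans (block-⊗-ˡˡ Id X 0M (scal (+ 1)) (scal z) (negM X) Y Id i j)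
                        (cong (λ t → t + (X ⊗ Y) i j) (⊗-identityˡ (scal z) i j)))
             (trans (det-cong λ i j → trans (block-⊗-ʳʳ Id X 0M (scal (+ 1)) (scal z) (negM X) Y Id i j)
                (trans (cong₂ _+_ (⊗-zeroˡ (negM X) i j) (⊗-identityʳ (scal (+ 1)) i j)) (ℤP.+-identityˡ _)))
               (trans (det-scal m (+ 1)) (ℤP.^-zeroˡ m))) ⟩
      det (scal z ⊕ (X ⊗ Y)) * + 1
        ≡⟨ ℤP.*-identityʳ _ ⟩
      det (scal z ⊕ (X ⊗ Y)) ∎

open Sylvester

-- Integer polynomials and their values.

module Polynomials where

  open import Data.Integer using (_+_; _*_; _-_)

  module _ (x : ℤ) where

    evalP-+P : ∀ p q → evalP (p +P q) x ≡ evalP p x + evalP q x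
    evalP-+P []      q       = sym (ℤP.+-identityˡ _)
    evalP-+P (a ∷ p) []      = sym (ℤP.+-identityʳ _)
    evalP-+P (a ∷ p) (b ∷ q) = trans (cong (λ z → a + b + x * z) (evalP-+P p q))
        (lemma a b x (evalP p x) (evalP q x))
      where
      lemma : ∀ a b x p q → a + b + x * (p + q) ≡ (a + x * p) + (b + x * q)
      lemma = solve-∀

    evalP-scaleP : ∀ a p → evalP (scaleP a p) x ≡ a * evalP p x
    evalP-scaleP a []      = sym (ℤP.*-zeroʳ a)
    evalP-scaleP a (b ∷ p) = trans (cong (λ z → a * b + x * z) (evalP-scaleP a p)) (lemma a b x (evalP p x))
      where
      lemma : ∀ a b x p → a * b + x * (a * p) ≡ a * (b + x * p)
      lemma = solve-∀

    evalP-*P : ∀ p q → evalP (p *P q) x ≡ evalP p x * evalP q x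
    evalP-*P []      q = refl
    evalP-*P (a ∷ p) q = trans (evalP-+P (scaleP a q) (+ 0 ∷ (p *P q)))
        (trans (cong₂ (λ u v → u + (+ 0 + x * v)) (evalP-scaleP a q) (evalP-*P p q))
               (lemma a x (evalP p x) (evalP q x)))
      where
      lemma : ∀ a x p q → a * q + (+ 0 + x * (p * q)) ≡ (a + x * p) * q
      lemma = solve-∀

    evalP-negP : ∀ p → evalP (negP p) x ≡ - evalP p x
    evalP-negP []      = refl
    evalP-negP (a ∷ p) = trans (cong (λ z → - a + x * z) (evalP-negP p)) (lemma a x (evalP p x))
      where
      lemma : ∀ a x p → - a + x * - p ≡ - (a + x * p)
      lemma = solve-∀

    evalP-constP : ∀ a → evalP (constP a) x ≡ a
    evalP-constP a = trans (cong (_+_ a) (ℤP.*-zeroʳ x)) (ℤP.+-identityʳ a)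

    evalP-Xp : evalP Xp x ≡ x
    evalP-Xp = trans (ℤP.+-identityˡ _) (trans (cong (x *_) (evalP-constP (+ 1))) (ℤP.*-identityʳ x))

    evalP-^P : ∀ p k → evalP (p ^P k) x ≡ evalP p x ℤ.^ k
    evalP-^P p zero    = evalP-constP (+ 1)
    evalP-^P p (suc k) = trans (evalP-*P p (p ^P k)) (cong (evalP p x *_) (evalP-^P p k))

    evalP-XkMinus1 : ∀ k → evalP (XkMinus1 k) x ≡ x ℤ.^ k - + 1
    evalP-XkMinus1 k = trans (evalP-+P (Xp ^P k) (constP (- (+ 1))))
      (cong₂ _+_ (trans (evalP-^P Xp k) (cong (ℤ._^ k) evalP-Xp)) (evalP-constP (- (+ 1))))

    evalP-∑P : ∀ {n} (f : Fin n → Poly) → evalP (∑P f) x ≡ ∑ (λ i → evalP (f i) x)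
    evalP-∑P {zero}  f = refl
    evalP-∑P {suc n} f = trans (evalP-+P (f zero) (∑P (f ∘ suc))) (cong (_+_ (evalP (f zero) x)) (evalP-∑P (f ∘ suc)))

    evalP-negIter : ∀ k p → evalP (negIter k p) x ≡ sgn k * evalP p x
    evalP-negIter zero    p = sym (ℤP.*-identityˡ _)
    evalP-negIter (suc k) p = trans (evalP-negP (negIter k p))
      (trans (cong -_ (evalP-negIter k p)) (ℤP.neg-distribˡ-* (sgn k) (evalP p x)))

    evalP-detP : ∀ n (M : Fin n → Fin n → Poly) → evalP (detP n M) x ≡ det (λ i j → evalP (M i j) x)
    evalP-detP zero    M = evalP-constP (+ 1)
    evalP-detP (suc n) M = trans
      (evalP-∑P (λ j → negIter (toℕ j) (M zero j *P detP n (λ a b → M (suc a) (punchIn j b)))))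
      (∑-cong λ j → trans (evalP-negIter (toℕ j) (M zero j *P detP n (λ a b → M (suc a) (punchIn j b))))
        (cong (sgn (toℕ j) *_) (trans (evalP-*P (M zero j) (detP n (λ a b → M (suc a) (punchIn j b))))
          (cong (evalP (M zero j) x *_) (evalP-detP n (λ a b → M (suc a) (punchIn j b)))))))

    evalP-charPoly : ∀ {n} (A : Mat n n) → evalP (charPoly A) x ≡ det (λ i j → x * δ i j - A i j)
    evalP-charPoly {n} A = trans (evalP-detP n _) (det-cong entry)
      where
      lemma : ∀ a x → - a + x * + 1 ≡ x * + 1 - a
      lemma = solve-∀
      lemma' : ∀ a x → - a ≡ x * + 0 - a
      lemma' = solve-∀
      entry : ∀ i j → evalP (if ⌊ i Fin.≟ j ⌋ then (- A i j) ∷ + 1 ∷ [] else constP (- A i j)) x ≡ x * δ i j - A i j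
      entry i j with i Fin.≟ j
      ... | yes _ = trans (cong (λ z → - A i j + x * z) (evalP-constP (+ 1))) (lemma (A i j) x)
      ... | no _  = trans (evalP-constP (- A i j)) (lemma' (A i j) x)

  coeff-negP : ∀ p k → coeff (negP p) k ≡ - coeff p k
  coeff-negP []      k       = refl
  coeff-negP (a ∷ p) zero    = refl
  coeff-negP (a ∷ p) (suc k) = coeff-negP p k

  coeff-+P : ∀ p q k → coeff (p +P q) k ≡ coeff p k + coeff q k
  coeff-+P []      q       k       = sym (ℤP.+-identityˡ _)
  coeff-+P (a ∷ p) []      k       = sym (ℤP.+-identityʳ _)
  coeff-+P (a ∷ p) (b ∷ q) zero    = refl
  coeff-+P (a ∷ p) (b ∷ q) (suc k) = coeff-+P p q k

  -- The constant coefficient is divisible by every x ≥ 2 at which p vanishes.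
  vanishing⇒0 : ∀ p → (∀ k → evalP p (+ (2 ℕ.+ k)) ≡ + 0) → ∀ k → coeff p k ≡ + 0
  vanishing⇒0 []      van k = refl
  vanishing⇒0 (a ∷ p) van = λ { zero → a≡0 ; (suc k) → vanishing⇒0 p van' k }
    where
    -- `X` exceeds the absolute value of `a`, so divisibility by `X` leaves only `a` = 0.
    X = + (2 ℕ.+ ∣ a ∣)
    rearrange : ∀ a b → a ≡ (a + b) - b
    rearrange = solve-∀
    a≡ : a ≡ - (X * evalP p X)
    a≡ = trans (rearrange a (X * evalP p X)) (trans (cong (_- X * evalP p X) (van ∣ a ∣)) (ℤP.+-identityˡ _))
    ∣a∣≡ : ∣ a ∣ ≡ (2 ℕ.+ ∣ a ∣) ℕ.* ∣ evalP p X ∣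
    ∣a∣≡ = trans (cong ∣_∣ a≡) (trans (ℤP.∣-i∣≡∣i∣ (X * evalP p X)) (ℤP.abs-* X (evalP p X)))
    small : ∀ e → ∣ a ∣ ≡ (2 ℕ.+ ∣ a ∣) ℕ.* e → ∣ a ∣ ≡ 0
    small zero    eq = trans eq (ℕP.*-zeroʳ (2 ℕ.+ ∣ a ∣))
    small (suc e) eq = contradiction
      (ℕP.≤-trans (ℕP.m≤m*n (2 ℕ.+ ∣ a ∣) (suc e)) (ℕP.≤-reflexive (sym eq)))
      (ℕP.<⇒≱ (ℕP.m≤n⇒m≤1+n (ℕP.n<1+n ∣ a ∣)))
    a≡0 : a ≡ + 0
    a≡0 = ℤP.∣i∣≡0⇒i≡0 (small ∣ evalP p X ∣ ∣a∣≡)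
    van' : ∀ k → evalP p (+ (2 ℕ.+ k)) ≡ + 0
    van' k = *-nonzero-cancelˡ (+ (2 ℕ.+ k)) _ (λ ()) (trans (sym (ℤP.+-identityˡ _))
      (trans (cong (λ z → z + + (2 ℕ.+ k) * evalP p (+ (2 ℕ.+ k))) (sym a≡0)) (van k)))

  -- Only arguments ≥ 2 are tested, so identities obtained by cancelling powers of x - 1 still
  -- determine the coefficients.
  evalP-injective : ∀ p q → (∀ k → evalP p (+ (2 ℕ.+ k)) ≡ evalP q (+ (2 ℕ.+ k))) → p ≈P q
  evalP-injective p q p≗q k = ℤP.i-j≡0⇒i≡j (coeff p k) (coeff q k) (begin
      coeff p k - coeff q k
        ≡⟨ cong (_+_ (coeff p k)) (sym (coeff-negP q k)) ⟩
      coeff p k + coeff (negP q) k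
        ≡⟨ sym (coeff-+P p (negP q) k) ⟩
      coeff (p +P negP q) k
        ≡⟨ vanishing⇒0 (p +P negP q) (λ l → trans (evalP-+P _ p (negP q))
             (trans (cong₂ _+_ (p≗q l) (evalP-negP _ q)) (ℤP.+-inverseʳ (evalP q (+ (2 ℕ.+ l)))))) k ⟩
      + 0 ∎)
    where open ≡-Reasoning

open Polynomials

-- Orbits of permutations and a standard permutation for each cycle type.

module Orbits where

  open import Data.Fin.Relation.Unary.Top using (view; ‵fromℕ; ‵inject₁)

  pow : ∀ {A : Set} → (A → A) → ℕ → A → A
  pow g zero    v = v
  pow g (suc k) v = g (pow g k v)

  iter≡pow : ∀ {m} (ξ : Permutation′ m) k v → iter ξ k v ≡ pow (ξ ⟨$⟩ʳ_) k v
  iter≡pow ξ zero    v = refl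
  iter≡pow ξ (suc k) v = cong (ξ ⟨$⟩ʳ_) (iter≡pow ξ k v)

  pow-+ : ∀ {A : Set} (g : A → A) a b v → pow g (a ℕ.+ b) v ≡ pow g a (pow g b v)
  pow-+ g zero    b v = refl
  pow-+ g (suc a) b v = cong g (pow-+ g a b v)

  Inj : ∀ {A B : Set} → (A → B) → Set
  Inj f = ∀ {x y} → f x ≡ f y → x ≡ y

  ⟨$⟩ʳ-injective : ∀ {m} (ξ : Permutation′ m) → Inj (ξ ⟨$⟩ʳ_)
  ⟨$⟩ʳ-injective ξ eq = trans (sym (inverseˡ ξ)) (trans (cong (ξ ⟨$⟩ˡ_) eq) (inverseˡ ξ))

  pow-injective : ∀ {A : Set} (g : A → A) → Inj g → ∀ k → Inj (pow g k)
  pow-injective g g-inj zero    eq = eq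
  pow-injective g g-inj (suc k) eq = pow-injective g g-inj k (g-inj eq)

  pow-intertwine : ∀ {A B : Set} {g : A → A} {h : B → B} (f : A → B) → (∀ v → f (g v) ≡ h (f v)) →
                   ∀ k v → f (pow g k v) ≡ pow h k (f v)
  pow-intertwine f comm zero    v = refl
  pow-intertwine {h = h} f comm (suc k) v = trans (comm _) (cong h (pow-intertwine f comm k v))

  Period : ∀ {A : Set} → (A → A) → A → ℕ → Set
  Period g v p = 0 ℕ.< p × pow g p v ≡ v × (∀ k → 0 ℕ.< k → k ℕ.< p → pow g k v ≢ v)

  Period-unique : ∀ {A : Set} {g : A → A} {v p q} → Period g v p → Period g v q → p ≡ q
  Period-unique {p = p} {q} (0<p , gp , least) (0<q , gq , least') with ℕP.<-cmp p q
  ... | tri< p<q _ _ = contradiction gp (least' p 0<p p<q)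
  ... | tri≈ _ p≡q _ = p≡q
  ... | tri> _ _ q<p = contradiction gq (least q 0<q q<p)

  Period-intertwine : ∀ {A B : Set} {g : A → A} {h : B → B} (f : A → B) → Inj f → (∀ v → f (g v) ≡ h (f v)) →
                      ∀ {v p} → Period g v p → Period h (f v) p
  Period-intertwine f f-inj comm {v} {p} (0<p , gp , least) =
    0<p , trans (sym (pow-intertwine f comm p v)) (cong f gp) ,
    λ k 0<k k<p eq → least k 0<k k<p (f-inj (trans (pow-intertwine f comm k v) eq))

  pow-cancel : ∀ {A : Set} (g : A → A) → Inj g → ∀ {a b} v → a ℕ.≤ b → pow g a v ≡ pow g b v → pow g (b ℕ.∸ a) v ≡ v
  pow-cancel g g-inj {a} {b} v a≤b eq = sym (pow-injective g g-inj a (trans eq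
    (trans (cong (λ k → pow g k v) (sym (ℕP.m+[n∸m]≡n a≤b))) (pow-+ g a (b ℕ.∸ a) v))))

  module _ {m : ℕ} (ξ : Permutation′ m) (v : Fin m) where

    returnSearch-spec : ∀ fuel k → let r = returnSearch ξ v fuel k in
      k ℕ.≤ r × (∀ j → k ℕ.≤ j → j ℕ.< r → iter ξ j v ≢ v) × (iter ξ r v ≡ v ⊎ r ≡ k ℕ.+ fuel)
    returnSearch-spec zero k = ℕP.≤-refl , (λ j k≤j j<k → contradiction k≤j (ℕP.<⇒≱ j<k)) , inj₂ (sym (ℕP.+-identityʳ k))
    returnSearch-spec (suc fuel) k with iter ξ k v Fin.≟ v
    ... | yes eq = ℕP.≤-refl , (λ j k≤j j<k → contradiction k≤j (ℕP.<⇒≱ j<k)) , inj₁ eq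
    ... | no neq with returnSearch-spec fuel (suc k)
    ...   | k<r , least , end = ℕP.<⇒≤ k<r , least' , [ inj₁ , (λ eq → inj₂ (trans eq (sym (ℕP.+-suc k fuel)))) ]′ end
      where
      least' : ∀ j → k ℕ.≤ j → j ℕ.< returnSearch ξ v fuel (suc k) → iter ξ j v ≢ v
      least' j k≤j j<r with ℕP.m≤n⇒m<n∨m≡n k≤j
      ... | inj₁ k<j  = least j k<j j<r
      ... | inj₂ refl = neq

    -- Among m + 1 iterates two coincide, so v returns after at most m steps, and the search with
    -- fuel m ends at a true return.
    orbitSize-period : Period (ξ ⟨$⟩ʳ_) v (orbitSize ξ v) × orbitSize ξ v ℕ.≤ m
    orbitSize-period with returnSearch-spec m 1 | FinP.pigeonhole (ℕP.n<1+n m) (λ (i : Fin (suc m)) → pow (ξ ⟨$⟩ʳ_) (toℕ i) v)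
    ... | 0<r , least , end | i , j , i<j , eq = (0<r , returns , least') , ℕP.≤-trans r≤j∸i (ℕP.≤-trans (ℕP.m∸n≤m _ (toℕ i)) (ℕP.≤-pred (FinP.toℕ<n j)))
      where
      r = orbitSize ξ v
      least' : ∀ k → 0 ℕ.< k → k ℕ.< r → pow (ξ ⟨$⟩ʳ_) k v ≢ v
      least' k 0<k k<r eq' = least k 0<k k<r (trans (iter≡pow ξ k v) eq')
      back : pow (ξ ⟨$⟩ʳ_) (toℕ j ℕ.∸ toℕ i) v ≡ v
      back = pow-cancel (ξ ⟨$⟩ʳ_) (⟨$⟩ʳ-injective ξ) v (ℕP.<⇒≤ i<j) eq
      r≤j∸i : r ℕ.≤ toℕ j ℕ.∸ toℕ i
      r≤j∸i = ℕP.≮⇒≥ λ lt → least' _ (ℕP.m<n⇒0<n∸m i<j) lt back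
      returns : pow (ξ ⟨$⟩ʳ_) r v ≡ v
      returns = [ (λ eq' → trans (sym (iter≡pow ξ r v)) eq')
                , (λ eq' → contradiction
                    (ℕP.≤-trans (ℕP.≤-reflexive (sym eq')) (ℕP.≤-trans r≤j∸i
                      (ℕP.≤-trans (ℕP.m∸n≤m _ (toℕ i)) (ℕP.≤-pred (FinP.toℕ<n j)))))
                    (ℕP.<-irrefl refl)) ]′ end

  orbitSize-unique : ∀ {m} (ξ : Permutation′ m) v {p} → Period (ξ ⟨$⟩ʳ_) v p → orbitSize ξ v ≡ p
  orbitSize-unique ξ v per = Period-unique (proj₁ (orbitSize-period ξ v)) per

  -- A cycle on the first p + 1 points beside σ on the rest. For `suc p` it is the transposition (0
  -- 1) after the shorter cycle moved up by one place: `punchIn (suc zero)` is that transposition on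
  -- successors. Attaching a vertex by one arrow produces a permutation in exactly this form.
  cycleF : ∀ p {s} → (Fin s → Fin s) → Fin (suc p ℕ.+ s) → Fin (suc p ℕ.+ s)
  cycleF zero    σ zero    = zero
  cycleF zero    σ (suc i) = suc (σ i)
  cycleF (suc p) σ zero    = suc zero
  cycleF (suc p) σ (suc i) = punchIn (suc zero) (cycleF p σ i)

  -- The standard permutation of cycle type π: the parts of π are consecutive intervals
  -- of Fin (sum π), each of them permuted by i ↦ i + 1 cyclically.
  std : (π : List ℕ) → Fin (sum π) → Fin (sum π)
  std []          = id
  std (zero ∷ π)  = std π
  std (suc p ∷ π) = cycleF p (std π)

  module _ {s : ℕ} (σ : Fin s → Fin s) where

    cycleF-last : ∀ p → cycleF p σ (Fin.fromℕ p ↑ˡ s) ≡ zero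
    cycleF-last zero    = refl
    cycleF-last (suc p) = cong (punchIn (suc zero)) (cycleF-last p)

    cycleF-step : ∀ p (b : Fin p) → cycleF p σ (inject₁ b ↑ˡ s) ≡ suc b ↑ˡ s
    cycleF-step (suc p) zero    = refl
    cycleF-step (suc p) (suc b) = cong (punchIn (suc zero)) (cycleF-step p b)

    cycleF-rest : ∀ p (j : Fin s) → cycleF p σ (suc p ↑ʳ j) ≡ suc p ↑ʳ σ j
    cycleF-rest zero    j = refl
    cycleF-rest (suc p) j = cong (punchIn (suc zero)) (cycleF-rest p j)

    cycleF-injective : Inj σ → ∀ p → Inj (cycleF p σ)
    cycleF-injective σ-inj zero    {zero}  {zero}  eq = refl
    cycleF-injective σ-inj zero    {suc x} {suc y} eq = cong suc (σ-inj (FinP.suc-injective eq))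
    cycleF-injective σ-inj (suc p) {zero}  {zero}  eq = refl
    cycleF-injective σ-inj (suc p) {zero}  {suc y} eq = contradiction (sym eq) (FinP.punchInᵢ≢i (suc zero) _)
    cycleF-injective σ-inj (suc p) {suc x} {zero}  eq = contradiction eq (FinP.punchInᵢ≢i (suc zero) _)
    cycleF-injective σ-inj (suc p) {suc x} {suc y} eq =
      cong suc (cycleF-injective σ-inj p (FinP.punchIn-injective (suc zero) _ _ eq))

    cycleF-pow : ∀ p k (i : Fin (suc p)) → toℕ i ≡ k → pow (cycleF p σ) k zero ≡ i ↑ˡ s
    cycleF-pow p zero    zero    eq = refl
    cycleF-pow p (suc k) (suc i) eq = trans
      (cong (cycleF p σ) (cycleF-pow p k (inject₁ i) (trans (FinP.toℕ-inject₁ i) (ℕP.suc-injective eq))))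
      (cycleF-step p i)

    cycleF-period : ∀ p → Period (cycleF p σ) zero (suc p)
    cycleF-period p = s≤s z≤n ,
      trans (cong (cycleF p σ) (cycleF-pow p p (Fin.fromℕ p) (FinP.toℕ-fromℕ p))) (cycleF-last p) ,
      λ { (suc k) _ (s≤s k<p) eq → contradiction
            (trans (sym (cycleF-pow p (suc k) (suc (Fin.fromℕ< k<p)) (cong suc (FinP.toℕ-fromℕ< k<p)))) eq) λ () }

    -- A power of `cycleF` moves zero to the given point and commutes with `cycleF`, so it carries
    -- the period along.
    cycleF-periodˡ : Inj σ → ∀ p (i : Fin (suc p)) → Period (cycleF p σ) (i ↑ˡ s) (suc p)
    cycleF-periodˡ σ-inj p i = subst (λ v → Period (cycleF p σ) v (suc p)) (cycleF-pow p (toℕ i) i refl)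
      (Period-intertwine (pow (cycleF p σ) (toℕ i)) (pow-injective _ (cycleF-injective σ-inj p) (toℕ i))
        (λ v → trans (sym (pow-+ (cycleF p σ) (toℕ i) 1 v)) (cong (λ k → pow (cycleF p σ) k v) (ℕP.+-comm (toℕ i) 1)))
        (cycleF-period p))

  std-injective : ∀ π → Inj (std π)
  std-injective []          {()}
  std-injective (zero ∷ π)  = std-injective π
  std-injective (suc p ∷ π) = cycleF-injective (std π) (std-injective π) p

  cyc : ∀ π → Fin (sum π) → Fin (length π)
  cyc []      ()
  cyc (p ∷ π) v = [ (λ _ → zero) , suc ∘ cyc π ]′ (splitAt p v)

  part : ∀ π → Fin (sum π) → ℕ
  part []      ()
  part (p ∷ π) v = [ (λ _ → p) , part π ]′ (splitAt p v)

  std-period : ∀ π v → Period (std π) v (part π v)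
  std-period []          ()
  std-period (zero ∷ π)  = std-period π
  std-period (suc p ∷ π) = ↑-cases (suc p) (λ v → Period (cycleF p (std π)) v (part (suc p ∷ π) v))
    (λ i → subst (Period _ (i ↑ˡ sum π)) (sym (cong [ (λ _ → suc p) , part π ]′ (FinP.splitAt-↑ˡ (suc p) i (sum π))))
             (cycleF-periodˡ (std π) (std-injective π) p i))
    (λ j → subst (Period _ (suc p ↑ʳ j)) (sym (cong [ (λ _ → suc p) , part π ]′ (FinP.splitAt-↑ʳ (suc p) (sum π) j)))
             (Period-intertwine (suc p ↑ʳ_) (FinP.↑ʳ-injective (suc p) _ _) (λ v → sym (cycleF-rest (std π) p v))
                (std-period π j)))

  record Conj {m} (ξ : Permutation′ m) (π : List ℕ) : Set where
    field
      f     : Fin (sum π) → Fin m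
      f⁻¹   : Fin m → Fin (sum π)
      ff⁻¹  : ∀ v → f (f⁻¹ v) ≡ v
      f-inj : Inj f
      comm  : ∀ i → f (std π i) ≡ ξ ⟨$⟩ʳ f i

  module _ {m : ℕ} (ξ : Permutation′ m) where

    private
      g = ξ ⟨$⟩ʳ_
      g-inj = ⟨$⟩ʳ-injective ξ

    -- An invariant part of Fin m on which ξ has cycle type π, containing all orbits of size < k.
    record Partial (k : ℕ) : Set where
      field
        π      : List ℕ
        f      : Fin (sum π) → Fin m
        f-inj  : Inj f
        comm   : ∀ i → f (std π i) ≡ g (f i)
        sorted : Linked ℕ._≥_ (k ∷ π)
        pos    : All (0 ℕ.<_) π
        large  : ∀ v → ¬ (∃[ i ] (f i ≡ v)) → k ℕ.≤ orbitSize ξ v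
    open Partial

    -- The new orbit goes to the front: orbits are collected by increasing size, which makes the
    -- list of parts nonincreasing.
    extend : ∀ {k} (S : Partial k) v → ¬ (∃[ i ] (f S i ≡ v)) → orbitSize ξ v ≡ k →
             Σ (Partial k) λ S' → π S' ≡ k ∷ π S
    extend {zero} S v v∉ eq = contradiction (proj₁ (proj₁ (orbitSize-period ξ v))) (subst (λ z → ¬ (0 ℕ.< z)) (sym eq) λ ())
    extend {suc p} S v v∉ eq = record
        { π = suc p ∷ π S ; f = f' ; f-inj = f'-inj _ _ ; comm = comm'
        ; sorted = ℕP.≤-refl ∷ sorted S ; pos = s≤s z≤n ∷ pos S
        ; large = λ w w∉ → large S w λ { (i , fi≡w) → w∉ (suc p ↑ʳ i , trans (f'ʳ i) fi≡w) } } , refl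
      where
      ∣S∣ = sum (π S)
      per : Period g v (suc p)
      per = subst (Period g v) eq (proj₁ (orbitSize-period ξ v))
      f' : Fin (suc p ℕ.+ ∣S∣) → Fin m
      f' i = [ (λ a → pow g (toℕ a) v) , f S ]′ (splitAt (suc p) i)
      f'ˡ : ∀ a → f' (a ↑ˡ ∣S∣) ≡ pow g (toℕ a) v
      f'ˡ a = cong [ (λ a → pow g (toℕ a) v) , f S ]′ (FinP.splitAt-↑ˡ (suc p) a ∣S∣)
      f'ʳ : ∀ j → f' (suc p ↑ʳ j) ≡ f S j
      f'ʳ j = cong [ (λ a → pow g (toℕ a) v) , f S ]′ (FinP.splitAt-↑ʳ (suc p) ∣S∣ j)
      comm' : ∀ i → f' (cycleF p (std (π S)) i) ≡ g (f' i)
      comm' = ↑-cases (suc p) (λ i → f' (cycleF p (std (π S)) i) ≡ g (f' i)) commˡ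
        (λ j → trans (cong f' (cycleF-rest (std (π S)) p j)) (trans (f'ʳ _) (trans (comm S j) (cong g (sym (f'ʳ j))))))
        where
        commˡ : ∀ a → f' (cycleF p (std (π S)) (a ↑ˡ ∣S∣)) ≡ g (f' (a ↑ˡ ∣S∣))
        commˡ a with view a
        ... | ‵fromℕ = trans (cong f' (cycleF-last (std (π S)) p)) (trans (sym (proj₁ (proj₂ per)))
                (cong g (trans (cong (λ k → pow g k v) (sym (FinP.toℕ-fromℕ p))) (sym (f'ˡ (Fin.fromℕ p))))))
        ... | ‵inject₁ b = trans (cong f' (cycleF-step (std (π S)) p b)) (trans (f'ˡ (suc b))
                (cong g (trans (cong (λ k → pow g k v) (sym (FinP.toℕ-inject₁ b))) (sym (f'ˡ (inject₁ b))))))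
      distinct : ∀ {a b : Fin (suc p)} → toℕ a ℕ.< toℕ b → pow g (toℕ a) v ≢ pow g (toℕ b) v
      distinct {a} {b} a<b eq' = proj₂ (proj₂ per) (toℕ b ℕ.∸ toℕ a) (ℕP.m<n⇒0<n∸m a<b)
        (ℕP.≤-<-trans (ℕP.m∸n≤m (toℕ b) (toℕ a)) (FinP.toℕ<n b)) (pow-cancel g g-inj v (ℕP.<⇒≤ a<b) eq')
      -- If a point of the orbit of v were already covered, the remaining `r` steps around the orbit
      -- would show v covered too, the covered part being invariant.
      disjoint : ∀ (a : Fin (suc p)) j → pow g (toℕ a) v ≢ f S j
      disjoint a j eq' = v∉ (pow (std (π S)) r j , (begin
          f S (pow (std (π S)) r j)   ≡⟨ pow-intertwine (f S) (comm S) r j ⟩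
          pow g r (f S j)             ≡⟨ cong (pow g r) (sym eq') ⟩
          pow g r (pow g (toℕ a) v)   ≡⟨ sym (pow-+ g r (toℕ a) v) ⟩
          pow g (r ℕ.+ toℕ a) v       ≡⟨ cong (λ k → pow g k v) (ℕP.m∸n+n≡m (ℕP.<⇒≤ (FinP.toℕ<n a))) ⟩
          pow g (suc p) v             ≡⟨ proj₁ (proj₂ per) ⟩
          v                           ∎))
        where
        open ≡-Reasoning
        r = suc p ℕ.∸ toℕ a
      f'-inj : ∀ x y → f' x ≡ f' y → x ≡ y
      f'-inj = ↑-cases (suc p) (λ x → ∀ y → f' x ≡ f' y → x ≡ y)
        (λ a → ↑-cases (suc p) (λ y → f' (a ↑ˡ ∣S∣) ≡ f' y → a ↑ˡ ∣S∣ ≡ y)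
          (λ b eq' → ll a b (trans (sym (f'ˡ a)) (trans eq' (f'ˡ b))))
          (λ j eq' → contradiction (trans (sym (f'ˡ a)) (trans eq' (f'ʳ j))) (disjoint a j)))
        (λ i → ↑-cases (suc p) (λ y → f' (suc p ↑ʳ i) ≡ f' y → suc p ↑ʳ i ≡ y)
          (λ b eq' → contradiction (trans (sym (f'ˡ b)) (trans (sym eq') (f'ʳ i))) (disjoint b i))
          (λ j eq' → cong (suc p ↑ʳ_) (f-inj S (trans (sym (f'ʳ i)) (trans eq' (f'ʳ j))))))
        where
        ll : ∀ (a b : Fin (suc p)) → pow g (toℕ a) v ≡ pow g (toℕ b) v → a ↑ˡ ∣S∣ ≡ b ↑ˡ ∣S∣
        ll a b eq' with ℕP.<-cmp (toℕ a) (toℕ b)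
        ... | tri< a<b _ _ = contradiction eq' (distinct a<b)
        ... | tri≈ _ a≡b _ = cong (_↑ˡ ∣S∣) (FinP.toℕ-injective a≡b)
        ... | tri> _ _ b<a = contradiction (sym eq') (distinct b<a)

    image? : ∀ {k} (S : Partial k) v → Dec (∃[ i ] (f S i ≡ v))
    image? S v = FinP.any? (λ i → f S i Fin.≟ v)

    -- Either an uncovered orbit of size k is absorbed, which uses up b, or there is none and k is
    -- raised, which uses up a. The fuel b bounds the number of uncovered points, a the sizes still
    -- to be tried; once a = 0, k exceeds m and nothing is uncovered.
    grow : ∀ a b {k} (S : Partial k) → suc m ℕ.≤ k ℕ.+ a → m ℕ.≤ sum (π S) ℕ.+ b →
           Σ (List ℕ) λ ρ → Conj ξ ρ × IsPartition m ρ
    grow a b {k} S m<k+a m≤s+b with FinP.any? (λ v → ¬? (image? S v) ×-dec (orbitSize ξ v ℕ.≟ k))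
    grow a zero {k} S m<k+a m≤s+0 | yes (v , v∉ , eq) with extend S v v∉ eq
    ... | S' , eq' = contradiction (FinP.injective⇒≤ (f-inj S')) (ℕP.<⇒≱ (ℕP.≤-<-trans
            (subst (m ℕ.≤_) (ℕP.+-identityʳ _) m≤s+0)
            (subst (λ ρ → sum (π S) ℕ.< sum ρ) (sym eq')
              (ℕP.+-monoˡ-≤ (sum (π S)) (subst (0 ℕ.<_) eq (proj₁ (proj₁ (orbitSize-period ξ v))))))))
    grow a (suc b) {k} S m<k+a m≤s+b | yes (v , v∉ , eq) with extend S v v∉ eq
    ... | S' , eq' = grow a b S' m<k+a (ℕP.≤-trans m≤s+b (ℕP.≤-trans (ℕP.≤-reflexive (ℕP.+-suc (sum (π S)) b))
            (ℕP.+-monoˡ-≤ b (subst (λ ρ → sum (π S) ℕ.< sum ρ) (sym eq')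
              (ℕP.+-monoˡ-≤ (sum (π S)) (subst (0 ℕ.<_) eq (proj₁ (proj₁ (orbitSize-period ξ v)))))))))
    grow (suc a) b {k} S m<k+a m≤s+b | no none = grow a b S⁺ (subst (suc m ℕ.≤_) (ℕP.+-suc k a) m<k+a) m≤s+b
      where
      weaken : ∀ {ρ} → Linked ℕ._≥_ (k ∷ ρ) → Linked ℕ._≥_ (suc k ∷ ρ)
      weaken [-]       = [-]
      weaken (k≥x ∷ l) = ℕP.m≤n⇒m≤1+n k≥x ∷ l
      S⁺ : Partial (suc k)
      S⁺ = record { π = π S ; f = f S ; f-inj = f-inj S ; comm = comm S ; sorted = weaken (sorted S) ; pos = pos S
                  ; large = λ v v∉ → ℕP.≤∧≢⇒< (large S v v∉) λ eq → none (v , v∉ , sym eq) }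
    grow zero b {k} S m<k+a m≤s+b | no none =
        π S , record { f = f S ; f⁻¹ = proj₁ ∘ onto ; ff⁻¹ = proj₂ ∘ onto ; f-inj = f-inj S ; comm = comm S } ,
        Linked.tail (sorted S) , pos S ,
        ℕP.≤-antisym (FinP.injective⇒≤ (f-inj S))
          (FinP.injective⇒≤ {f = proj₁ ∘ onto} λ {x} {y} eq → trans (sym (proj₂ (onto x))) (trans (cong (f S) eq) (proj₂ (onto y))))
      where
      onto : ∀ v → ∃[ i ] (f S i ≡ v)
      onto v with image? S v
      ... | yes v∈ = v∈
      ... | no v∉  = contradiction (ℕP.≤-trans (subst (suc m ℕ.≤_) (ℕP.+-identityʳ k) m<k+a)
                       (ℕP.≤-trans (large S v v∉) (proj₂ (orbitSize-period ξ v)))) (ℕP.<-irrefl refl)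

    conj-exists : Σ (List ℕ) λ ρ → Conj ξ ρ × IsPartition m ρ
    conj-exists = grow (suc m) m start ℕP.≤-refl ℕP.≤-refl
      where
      start : Partial 0
      start = record { π = [] ; f = λ () ; f-inj = λ { {()} } ; comm = λ () ; sorted = [-] ; pos = [] ; large = λ _ _ → z≤n }

open Orbits

-- Partitions are determined by the fixed point counts of powers.

module Partitions where

  open import Data.Integer using (_+_; _*_; _-_)
  open import Data.List using (tabulate)
  open import Data.List.Properties using (filter-accept; filter-reject)
  open import Data.Nat.Divisibility using (_∣_; _∣?_; ∣⇒≤; ∣-refl)
  open import Data.Nat.Induction using (<-rec)

  ind : ∀ {P : Set} → Dec P → ℤ
  ind P? = if ⌊ P? ⌋ then + 1 else + 0

  ind-yes : ∀ {P : Set} (P? : Dec P) → P → ind P? ≡ + 1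
  ind-yes (yes _) _ = refl
  ind-yes (no ¬p) p = contradiction p ¬p

  ind-no : ∀ {P : Set} (P? : Dec P) → ¬ P → ind P? ≡ + 0
  ind-no (yes p) ¬p = contradiction p ¬p
  ind-no (no _)  _  = refl

  ind-cong : ∀ {P Q : Set} (P? : Dec P) (Q? : Dec Q) → (P → Q) → (Q → P) → ind P? ≡ ind Q?
  ind-cong (yes p) Q? P→Q Q→P = sym (ind-yes Q? (P→Q p))
  ind-cong (no ¬p) Q? P→Q Q→P = sym (ind-no Q? (¬p ∘ Q→P))

  lsum : (ℕ → ℤ) → List ℕ → ℤ
  lsum h []      = + 0
  lsum h (p ∷ π) = h p + lsum h π

  ∑-part : ∀ π (h : ℕ → ℤ) → ∑ (λ i → h (part π i)) ≡ lsum (λ p → + p * h p) π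
  ∑-part []      h = refl
  ∑-part (p ∷ π) h = trans (∑-++ p (λ i → h (part (p ∷ π) i))) (cong₂ _+_
    (trans (∑-cong λ i → cong (h ∘ [ (λ _ → p) , part π ]′) (FinP.splitAt-↑ˡ p i (sum π))) (∑-const {p} (h p)))
    (trans (∑-cong λ j → cong (h ∘ [ (λ _ → p) , part π ]′) (FinP.splitAt-↑ʳ p (sum π) j)) (∑-part π h)))

  length-filter-tabulate : ∀ {A : Set} {P : A → Set} (P? : ∀ x → Dec (P x)) {n} (g : Fin n → A) →
    + length (filter P? (tabulate g)) ≡ ∑ (λ i → ind (P? (g i)))
  length-filter-tabulate P? {zero}  g = refl
  length-filter-tabulate P? {suc n} g with P? (g zero)
  ... | yes _ = cong (_+_ (+ 1)) (length-filter-tabulate P? (g ∘ suc))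
  ... | no _  = trans (length-filter-tabulate P? (g ∘ suc)) (sym (ℤP.+-identityˡ _))

  count : ℕ → List ℕ → ℕ
  count k π = length (filter (k ℕ.≟_) π)

  count-≡ : ∀ k π → count k (k ∷ π) ≡ suc (count k π)
  count-≡ k π = cong length (filter-accept (k ℕ.≟_) {x = k} {xs = π} refl)

  count-≢ : ∀ {k p} π → k ≢ p → count k (p ∷ π) ≡ count k π
  count-≢ {k} {p} π k≢p = cong length (filter-reject (k ℕ.≟_) {x = p} {xs = π} k≢p)

  count-∷ : ∀ k p π → + count k (p ∷ π) ≡ ind (k ℕ.≟ p) + + count k π
  count-∷ k p π with k ℕ.≟ p
  ... | yes refl = cong +_ (count-≡ k π)
  ... | no k≢p   = trans (cong +_ (count-≢ π k≢p)) (sym (ℤP.+-identityˡ _))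

  count-lsum : ∀ k π → + (k ℕ.* count k π) ≡ lsum (λ p → + p * ind (p ℕ.≟ k)) π
  count-lsum k []      = cong +_ (ℕP.*-zeroʳ k)
  count-lsum k (p ∷ π) = begin
      + (k ℕ.* count k (p ∷ π))
        ≡⟨ ℤP.pos-* k (count k (p ∷ π)) ⟩
      + k * + count k (p ∷ π)
        ≡⟨ cong (+ k *_) (count-∷ k p π) ⟩
      + k * (ind (k ℕ.≟ p) + + count k π)
        ≡⟨ ℤP.*-distribˡ-+ (+ k) (ind (k ℕ.≟ p)) (+ count k π) ⟩
      + k * ind (k ℕ.≟ p) + + k * + count k π
        ≡⟨ cong₂ _+_ (head k p) (trans (sym (ℤP.pos-* k (count k π))) (count-lsum k π)) ⟩
      + p * ind (p ℕ.≟ k) + lsum (λ p → + p * ind (p ℕ.≟ k)) π ∎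
    where
    open ≡-Reasoning
    head : ∀ k p → + k * ind (k ℕ.≟ p) ≡ + p * ind (p ℕ.≟ k)
    head k p with k ℕ.≟ p
    ... | yes refl = cong (+ k *_) (sym (ind-yes (k ℕ.≟ k) refl))
    ... | no k≢p   = trans (ℤP.*-zeroʳ (+ k))
      (sym (trans (cong (+ p *_) (ind-no (p ℕ.≟ k) (k≢p ∘ sym))) (ℤP.*-zeroʳ (+ p))))

  conj⇒cycleType : ∀ {m} (ξ : Permutation′ m) π → Conj ξ π → IsPartition m π → CycleTypeOf ξ π
  conj⇒cycleType {m} ξ π C part-π = part-π , λ k → ℤP.+-injective (begin
      + (k ℕ.* count k π)
        ≡⟨ count-lsum k π ⟩
      lsum (λ p → + p * ind (p ℕ.≟ k)) π
        ≡⟨ sym (∑-part π (λ p → ind (p ℕ.≟ k))) ⟩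
      ∑ (λ i → ind (part π i ℕ.≟ k))
        ≡⟨ ∑-cong (λ i → cong (λ p → ind (p ℕ.≟ k)) (sym (orbitSize-unique ξ (f i)
             (Period-intertwine f f-inj comm (std-period π i))))) ⟩
      ∑ (λ i → ind (orbitSize ξ (f i) ℕ.≟ k))
        ≡⟨ sym (∑-reindex f f⁻¹ ff⁻¹ f-inj (λ v → ind (orbitSize ξ v ℕ.≟ k))) ⟩
      ∑ (λ v → ind (orbitSize ξ v ℕ.≟ k))
        ≡⟨ sym (length-filter-tabulate (λ v → orbitSize ξ v ℕ.≟ k) id) ⟩
      + length (filter (λ v → orbitSize ξ v ℕ.≟ k) (allFin m)) ∎)
    where
    open ≡-Reasoning
    open Conj C

  count-above : ∀ {k q} π → Linked ℕ._≥_ (q ∷ π) → q ℕ.< k → count k (q ∷ π) ≡ 0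
  count-above []      _            q<k = count-≢ [] (ℕP.<⇒≢ q<k ∘ sym)
  count-above (x ∷ π) (q≥x ∷ sort) q<k =
    trans (count-≢ (x ∷ π) (ℕP.<⇒≢ q<k ∘ sym)) (count-above π sort (ℕP.≤-<-trans q≥x q<k))

  -- Of two distinct heads, the larger occurs in its own list and exceeds all entries of the other,
  -- so the counts differ.
  sorted-unique : ∀ π ρ → Linked ℕ._≥_ π → Linked ℕ._≥_ ρ → All (0 ℕ.<_) π → All (0 ℕ.<_) ρ →
                  (∀ k → 0 ℕ.< k → count k π ≡ count k ρ) → π ≡ ρ
  sorted-unique []      []      _ _ _ _ _ = refl
  sorted-unique []      (q ∷ ρ) _ _ _ (0<q ∷ _) eq = contradiction (trans (eq q 0<q) (count-≡ q ρ)) λ ()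
  sorted-unique (p ∷ π) []      _ _ (0<p ∷ _) _ eq = contradiction (trans (sym (eq p 0<p)) (count-≡ p π)) λ ()
  sorted-unique (p ∷ π) (q ∷ ρ) sπ sρ (0<p ∷ pos) (0<q ∷ pos') eq with ℕP.<-cmp p q
  ... | tri< p<q _ _ = contradiction (trans (sym (count-≡ q ρ)) (trans (sym (eq q 0<q)) (count-above π sπ p<q))) λ ()
  ... | tri> _ _ q<p = contradiction (trans (sym (count-≡ p π)) (trans (eq p 0<p) (count-above ρ sρ q<p))) λ ()
  ... | tri≈ _ refl _ = cong (p ∷_) (sorted-unique π ρ (Linked.tail sπ) (Linked.tail sρ) pos pos' tails)
    where
    tails : ∀ k → 0 ℕ.< k → count k π ≡ count k ρ
    tails k 0<k with k ℕ.≟ p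
    ... | yes refl = ℕP.suc-injective (trans (sym (count-≡ k π)) (trans (eq k 0<k) (count-≡ k ρ)))
    ... | no k≢p   = trans (sym (count-≢ π k≢p)) (trans (eq k 0<k) (count-≢ ρ k≢p))

  cycleType-unique : ∀ {m} (ξ : Permutation′ m) {π ρ} → CycleTypeOf ξ π → CycleTypeOf ξ ρ → π ≡ ρ
  cycleType-unique ξ {π} {ρ} ((sπ , posπ , _) , ctπ) ((sρ , posρ , _) , ctρ) = sorted-unique π ρ sπ sρ posπ posρ
    λ { (suc k) _ → ℕP.*-cancelˡ-≡ (count (suc k) π) (count (suc k) ρ) (suc k) (trans (ctπ (suc k)) (sym (ctρ (suc k)))) }

  cycleType⇒conj : ∀ {m} (ξ : Permutation′ m) {π} → CycleTypeOf ξ π → Conj ξ π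
  cycleType⇒conj ξ {π} ct with conj-exists ξ
  ... | ρ , C , isPart = subst (Conj ξ) (cycleType-unique ξ (conj⇒cycleType ξ ρ C isPart) ct) C

  ∑-last : ∀ n (f : Fin (suc n) → ℤ) → ∑ f ≡ ∑ (f ∘ inject₁) + f (Fin.fromℕ n)
  ∑-last zero    f = ℤP.+-comm (f zero) (+ 0)
  ∑-last (suc n) f = trans (cong (_+_ (f zero)) (∑-last n (f ∘ suc))) (sym (ℤP.+-assoc (f zero) _ _))

  -- The number of fixed points of the k-th power of a permutation of cycle type π: a cycle of
  -- length p consists of fixed points exactly if p divides k.
  divSum : ℕ → List ℕ → ℤ
  divSum k = lsum (λ p → + p * ind (p ∣? k))

  ∑-single : ∀ k (h : ℕ → ℤ) p → (p ℕ.> k → h p ≡ + 0) → ∑ {suc k} (λ d → h (toℕ d) * ind (toℕ d ℕ.≟ p)) ≡ h p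
  ∑-single k h p big with p ℕ.<? suc k
  ... | yes p<1+k = trans (∑-cong (λ d → cong (h (toℕ d) *_) (ind-cong (toℕ d ℕ.≟ p) (d Fin.≟ Fin.fromℕ< p<1+k)
          (λ eq → FinP.toℕ-injective (trans eq (sym (FinP.toℕ-fromℕ< p<1+k))))
          (λ eq → trans (cong toℕ eq) (FinP.toℕ-fromℕ< p<1+k)))))
        (trans (∑-δʳ (Fin.fromℕ< p<1+k) (λ d → h (toℕ d))) (cong h (FinP.toℕ-fromℕ< p<1+k)))
  ... | no p≮1+k = trans (∑-zero (λ d → trans (cong (h (toℕ d) *_) (ind-no (toℕ d ℕ.≟ p)
          (λ eq → p≮1+k (subst (ℕ._< suc k) eq (FinP.toℕ<n d))))) (ℤP.*-zeroʳ (h (toℕ d)))))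
        (sym (big (ℕP.≮⇒≥ p≮1+k)))

  -- Parts larger than k do not divide k, so d = 0, ..., k suffices; this is where k > 0 enters.
  divSum-count : ∀ k π → 0 ℕ.< k →
    divSum k π ≡ ∑ {suc k} (λ d → + toℕ d * ind (toℕ d ∣? k) * + count (toℕ d) π)
  divSum-count k []      0<k = sym (∑-zero {suc k} λ d → ℤP.*-zeroʳ (+ toℕ d * ind (toℕ d ∣? k)))
  divSum-count k (p ∷ π) 0<k = begin
      h p + divSum k π
        ≡⟨ cong₂ _+_ (sym (∑-single k h p big)) (divSum-count k π 0<k) ⟩
      ∑ {suc k} (λ d → h (toℕ d) * ind (toℕ d ℕ.≟ p)) + ∑ {suc k} (λ d → h (toℕ d) * + count (toℕ d) π)
        ≡⟨ sym (∑-+ {suc k} (λ d → h (toℕ d) * ind (toℕ d ℕ.≟ p)) (λ d → h (toℕ d) * + count (toℕ d) π)) ⟩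
      ∑ {suc k} (λ d → h (toℕ d) * ind (toℕ d ℕ.≟ p) + h (toℕ d) * + count (toℕ d) π)
        ≡⟨ ∑-cong {suc k} (λ d → trans (sym (ℤP.*-distribˡ-+ (h (toℕ d)) (ind (toℕ d ℕ.≟ p)) (+ count (toℕ d) π)))
             (cong (h (toℕ d) *_) (sym (count-∷ (toℕ d) p π)))) ⟩
      ∑ {suc k} (λ d → h (toℕ d) * + count (toℕ d) (p ∷ π)) ∎
    where
    open ≡-Reasoning
    h : ℕ → ℤ
    h p = + p * ind (p ∣? k)
    big : p ℕ.> k → h p ≡ + 0
    big p>k = trans (cong (+ p *_) (ind-no (p ∣? k) λ p∣k → ℕP.<⇒≱ p>k (∣⇒≤ {{ℕ.>-nonZero 0<k}} p∣k))) (ℤP.*-zeroʳ (+ p))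

  -- Strong induction on k: in the sum over the divisors d of k the terms with d < k agree already,
  -- which leaves k · `count k`.
  divSum-injective : ∀ π ρ → (∀ k → 0 ℕ.< k → divSum k π ≡ divSum k ρ) → ∀ k → 0 ℕ.< k → count k π ≡ count k ρ
  divSum-injective π ρ eq = <-rec _ step
    where
    open ≡-Reasoning
    term : List ℕ → ℕ → ℕ → ℤ
    term σ k d = + d * ind (d ∣? k) * + count d σ
    step : ∀ k → (∀ {j} → j ℕ.< k → 0 ℕ.< j → count j π ≡ count j ρ) → 0 ℕ.< k → count k π ≡ count k ρ
    step (suc k) IH _ = ℤP.+-injective (ℤP.*-cancelˡ-≡ (+ suc k) (+ count (suc k) π) (+ count (suc k) ρ)
        (trans (sym (top π)) (trans (+-cancelˡ (low π) total) (top ρ))))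
      where
      K = suc k
      low : List ℕ → ℤ
      low σ = ∑ {K} (λ d → term σ K (toℕ (inject₁ d)))
      top : ∀ σ → term σ K (toℕ (Fin.fromℕ K)) ≡ + K * + count K σ
      top σ rewrite FinP.toℕ-fromℕ k = cong (_* + count K σ)
        (trans (cong (+ K *_) (ind-yes (K ∣? K) ∣-refl)) (ℤP.*-identityʳ (+ K)))
      split : ∀ σ → divSum K σ ≡ low σ + term σ K (toℕ (Fin.fromℕ K))
      split σ = trans (divSum-count K σ (s≤s z≤n)) (∑-last K (λ d → term σ K (toℕ d)))
      low-eq : low ρ ≡ low π
      low-eq = ∑-cong λ d → same (toℕ (inject₁ d)) (subst (ℕ._< K) (sym (FinP.toℕ-inject₁ d)) (FinP.toℕ<n d))
        where
        same : ∀ j → j ℕ.< K → term ρ K j ≡ term π K j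
        same zero    _   = refl
        same (suc j) j<K = cong (λ c → + suc j * ind (suc j ∣? K) * + c) (sym (IH j<K (s≤s z≤n)))
      total : low π + term π K (toℕ (Fin.fromℕ K)) ≡ low π + term ρ K (toℕ (Fin.fromℕ K))
      total = trans (sym (split π)) (trans (eq K (s≤s z≤n)) (trans (split ρ) (cong (λ z → z + term ρ K (toℕ (Fin.fromℕ K))) low-eq)))

open Partitions

-- Quivers and the Coxeter-Laplacian as a product of transpositions.

module Quivers where

  open import Data.Integer using (_+_; _*_; _-_)
  import Data.Fin.Permutation.Components as PC

  Edge : ∀ {m n} → Quiver m n → Fin m → Fin m → Set
  Edge Q a b = ∃[ i ] ((s Q i ≡ a × t Q i ≡ b) ⊎ (s Q i ≡ b × t Q i ≡ a))

  module _ {m n : ℕ} (Q : Quiver m n) where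

    inc-dot : ∀ i (w : Vecℤ m) → dot (λ v → Inc Q v i) w ≡ w (s Q i) - w (t Q i)
    inc-dot i w = trans (dot--ˡ (𝐞 (s Q i)) (𝐞 (t Q i)) w) (cong₂ _-_ (dot-𝐞ˡ (s Q i) w) (dot-𝐞ˡ (t Q i) w))

    inc-colsum : ∀ i → ∑ (λ v → Inc Q v i) ≡ + 0
    inc-colsum i = trans (∑-- (λ v → δ v (s Q i)) (λ v → δ v (t Q i))) (cong₂ _-_ (∑-δ (s Q i)) (∑-δ (t Q i)))

    inc-norm : LoopLess Q → ∀ i → ((Inc Q ᵀ) ⊗ Inc Q) i i ≡ + 2
    inc-norm ll i = trans (inc-dot i (λ v → Inc Q v i)) (cong₂ _-_
      (cong₂ _-_ (δ-refl (s Q i)) (δ-≢ (ll i))) (cong₂ _-_ (δ-≢ (ll i ∘ sym)) (δ-refl (t Q i))))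

    ǦQ-upper : ∀ i j → toℕ i ℕ.< toℕ j → ǦQ Q i j ≡ ((Inc Q ᵀ) ⊗ Inc Q) i j
    ǦQ-upper i j i<j with Fin.compare i j
    ... | Fin.less _ _      = refl
    ... | Fin.equal _       = contradiction i<j (ℕP.<-irrefl refl)
    ... | Fin.greater .i l  = contradiction (subst (toℕ i ℕ.<_) (FinP.toℕ-inject l) i<j) (ℕP.<⇒≯ (FinP.toℕ<n l))

    ǦQ-lower : ∀ i j → toℕ j ℕ.< toℕ i → ǦQ Q i j ≡ + 0
    ǦQ-lower i j j<i with Fin.compare i j
    ... | Fin.less .j l     = contradiction (subst (toℕ j ℕ.<_) (FinP.toℕ-inject l) j<i) (ℕP.<⇒≯ (FinP.toℕ<n l))
    ... | Fin.equal _       = contradiction j<i (ℕP.<-irrefl refl)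
    ... | Fin.greater _ _   = refl

    ǦQ-diag : LoopLess Q → ∀ i j → i ≡ j → ǦQ Q i j ≡ + 1
    ǦQ-diag ll i j i≡j with Fin.compare i j
    ... | Fin.less .j l    = contradiction (trans (sym (FinP.toℕ-inject l)) (cong toℕ i≡j)) (ℕP.<⇒≢ (FinP.toℕ<n l))
    ... | Fin.equal _      = cong (λ z → + (∣ z ∣ ℕ./ 2)) (inc-norm ll i)
    ... | Fin.greater .i l = contradiction (trans (sym (FinP.toℕ-inject l)) (cong toℕ (sym i≡j))) (ℕP.<⇒≢ (FinP.toℕ<n l))

    ǦQ-triangular : LoopLess Q → UpperUnitriangular (ǦQ Q)
    ǦQ-triangular ll = (λ i → ǦQ-diag ll i i refl) , ǦQ-lower

    ǦQ-sym : LoopLess Q → (ǦQ Q ⊕ (ǦQ Q ᵀ)) ≈M ((Inc Q ᵀ) ⊗ Inc Q)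
    ǦQ-sym ll i j with ℕP.<-cmp (toℕ i) (toℕ j)
    ... | tri< i<j _ _ = trans (cong₂ _+_ (ǦQ-upper i j i<j) (ǦQ-lower j i i<j)) (ℤP.+-identityʳ _)
    ... | tri> _ _ j<i = trans (cong₂ _+_ (ǦQ-lower i j j<i) (ǦQ-upper j i j<i))
                               (trans (ℤP.+-identityˡ _) (dot-comm (λ v → Inc Q v j) (λ v → Inc Q v i)))
    ... | tri≈ _ i≡j _ with FinP.toℕ-injective i≡j
    ...   | refl = trans (cong₂ _+_ (ǦQ-diag ll i i refl) (ǦQ-diag ll i i refl)) (sym (inc-norm ll i))

    -- Sum of the signed arrows of a walk. An arrow followed forwards counts with sign -1, since its
    -- column is e_s - e_t.
    reach-vector : ∀ {u v} → Reach (Edge Q) u v → ∃[ x ] ((Inc Q · x) ≈V (𝐞 v -V 𝐞 u))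
    reach-vector {u} here = 0V , λ w → trans (·-0 (Inc Q) (λ _ → refl) w) (sym (ℤP.+-inverseʳ (𝐞 u w)))
    reach-vector {u} {w} (there {v = v} (i , inj₁ (refl , refl)) r) with reach-vector r
    ... | x , Ix = x -V 𝐞 i , λ a → trans (·-- (Inc Q) x (𝐞 i) a)
        (trans (cong₂ _-_ (Ix a) (·-𝐞 (Inc Q) i a)) (lemma (𝐞 w a) (𝐞 v a) (𝐞 u a)))
      where
      lemma : ∀ a b c → (a - b) - (c - b) ≡ a - c
      lemma = solve-∀
    reach-vector {u} {w} (there {v = v} (i , inj₂ (refl , refl)) r) with reach-vector r
    ... | x , Ix = x +V 𝐞 i , λ a → trans (·-+ (Inc Q) x (𝐞 i) a)
        (trans (cong₂ _+_ (Ix a) (·-𝐞 (Inc Q) i a)) (lemma (𝐞 w a) (𝐞 v a) (𝐞 u a)))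
      where
      lemma : ∀ a b c → (a - b) + (b - c) ≡ a - c
      lemma = solve-∀

  tailQ : ∀ {m n} → Quiver m (suc n) → Quiver m n
  s (tailQ Q) i = s Q (suc i)
  t (tailQ Q) i = t Q (suc i)

  ξQ : ∀ {m n} → Quiver m n → Permutation′ m
  ξQ {n = zero}  Q = Perm.id
  ξQ {n = suc n} Q = ξQ (tailQ Q) Perm.∘ₚ Perm.transpose (s Q zero) (t Q zero)

  -- Closed form of Ǧ⁻¹ Iᵀ. As Ǧ is upper triangular, the rows of the later arrows do not change
  -- when an arrow is put in front.
  JQ : ∀ {m n} → Quiver m n → Mat n m
  JQ {n = suc n} Q zero    v = Inc Q (ξQ (tailQ Q) ⟨$⟩ʳ v) zero
  JQ {n = suc n} Q (suc i) v = JQ (tailQ Q) i v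

  reflection-transposition : ∀ {m} {a b : Fin m} → a ≢ b → ∀ u w →
    δ u w - (δ u a - δ u b) * (δ w a - δ w b) ≡ δ u (PC.transpose a b w)
  reflection-transposition {a = a} {b} a≢b u w with w Fin.≟ a
  ... | yes refl = trans (cong (λ z → δ u a - (δ u a - δ u b) * (+ 1 - z)) (δ-≢ a≢b)) (lemma (δ u a) (δ u b))
    where
    lemma : ∀ x y → x - (x - y) * (+ 1 - + 0) ≡ y
    lemma = solve-∀
  ... | no w≢a with w Fin.≟ b
  ...   | yes refl = lemma (δ u a) (δ u b)
    where
    lemma : ∀ x y → y - (x - y) * (+ 0 - + 1) ≡ x
    lemma = solve-∀
  ...   | no w≢b = lemma (δ u a) (δ u b) (δ u w)
    where
    lemma : ∀ x y z → z - (x - y) * (+ 0 - + 0) ≡ z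
    lemma = solve-∀

  -- An arrow put in front, with column a₀ = e_s - e_t, multiplies the permutation matrix of the
  -- remaining quiver from the left by the reflection 1 - a₀ a₀ᵀ, which swaps e_s and e_t.
  Inc-JQ : ∀ {m n} (Q : Quiver m n) → LoopLess Q → (Id ⊖ (Inc Q ⊗ JQ Q)) ≈M PermMat (ξQ Q)
  Inc-JQ {n = zero}  Q ll u v = ℤP.+-identityʳ (δ u v)
  Inc-JQ {n = suc n} Q ll u v = begin
      δ u v - (Inc Q u zero * Inc Q v' zero + (Inc (tailQ Q) ⊗ JQ (tailQ Q)) u v)
        ≡⟨ lemma (δ u v) (Inc Q u zero * Inc Q v' zero) ((Inc (tailQ Q) ⊗ JQ (tailQ Q)) u v) ⟩
      (δ u v - (Inc (tailQ Q) ⊗ JQ (tailQ Q)) u v) - Inc Q u zero * Inc Q v' zero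
        ≡⟨ cong (_- Inc Q u zero * Inc Q v' zero) (Inc-JQ (tailQ Q) (ll ∘ suc) u v) ⟩
      δ u v' - Inc Q u zero * Inc Q v' zero
        ≡⟨ reflection-transposition (ll zero) u v' ⟩
      δ u (PC.transpose (s Q zero) (t Q zero) v') ∎
    where
    open ≡-Reasoning
    v' = ξQ (tailQ Q) ⟨$⟩ʳ v
    lemma : ∀ a b c → a - (b + c) ≡ (a - c) - b
    lemma = solve-∀

  ǦQ-tail : ∀ {m n} (Q : Quiver m (suc n)) → LoopLess Q → ∀ i j → ǦQ Q (suc i) (suc j) ≡ ǦQ (tailQ Q) i j
  ǦQ-tail Q ll i j with ℕP.<-cmp (toℕ i) (toℕ j)
  ... | tri< i<j _ _ = trans (ǦQ-upper Q (suc i) (suc j) (s≤s i<j)) (sym (ǦQ-upper (tailQ Q) i j i<j))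
  ... | tri> _ _ j<i = trans (ǦQ-lower Q (suc i) (suc j) (s≤s j<i)) (sym (ǦQ-lower (tailQ Q) i j j<i))
  ... | tri≈ _ i≡j _ = trans (ǦQ-diag Q ll (suc i) (suc j) (cong suc (FinP.toℕ-injective i≡j)))
                             (sym (ǦQ-diag (tailQ Q) (ll ∘ suc) i j (FinP.toℕ-injective i≡j)))

  -- With Λ' the Coxeter–Laplacian of the quiver without its first arrow a₀, the first row of Ǧ⁻¹ Iᵀ is a₀ᵀ Λ'.
  ǦQ-JQ : ∀ {m n} (Q : Quiver m n) → LoopLess Q → (ǦQ Q ⊗ JQ Q) ≈M (Inc Q ᵀ)
  ǦQ-JQ {n = suc n} Q ll (suc i) v = trans (cong₂ _+_
      (cong (_* JQ Q zero v) (ǦQ-lower Q (suc i) zero (s≤s z≤n)))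
      (∑-cong λ j → cong (_* JQ (tailQ Q) j v) (ǦQ-tail Q ll i j)))
    (trans (ℤP.+-identityˡ _) (ǦQ-JQ (tailQ Q) (ll ∘ suc) i v))
  ǦQ-JQ {m} {suc n} Q ll zero v = begin
      ǦQ Q zero zero * a v' + ∑ (λ j → ǦQ Q zero (suc j) * J' j v)
        ≡⟨ cong₂ _+_ (trans (cong (_* a v') (ǦQ-diag Q ll zero zero refl)) (ℤP.*-identityˡ (a v')))
             (∑-cong λ j → cong (_* J' j v) (ǦQ-upper Q zero (suc j) (s≤s z≤n))) ⟩
      a v' + ∑ (λ j → dot a (λ w → I' w j) * J' j v)
        ≡⟨ cong (_+_ (a v')) (trans (∑-cong λ j → ℤP.*-comm (dot a (λ w → I' w j)) (J' j v))
             (sym (dot-lcʳ a (λ j → J' j v) (λ j w → I' w j)))) ⟩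
      a v' + dot a (λ w → ∑ (λ j → J' j v * I' w j))
        ≡⟨ cong (_+_ (a v')) (dot-congʳ a λ w → trans (∑-cong λ j → ℤP.*-comm (J' j v) (I' w j))
             (trans (lemma (δ w v) ((I' ⊗ J') w v)) (cong (λ z → δ w v - z) (Inc-JQ (tailQ Q) (ll ∘ suc) w v)))) ⟩
      a v' + dot a (𝐞 v -V 𝐞 v')
        ≡⟨ cong (_+_ (a v')) (trans (dot--ʳ a (𝐞 v) (𝐞 v')) (cong₂ _-_ (dot-𝐞ʳ a v) (dot-𝐞ʳ a v'))) ⟩
      a v' + (a v - a v')
        ≡⟨ lemma' (a v') (a v) ⟩
      a v ∎
    where
    open ≡-Reasoning
    a : Vecℤ m
    a w = Inc Q w zero
    I' = Inc (tailQ Q)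
    J' = JQ (tailQ Q)
    v' = ξQ (tailQ Q) ⟨$⟩ʳ v
    lemma : ∀ a b → b ≡ a - (a - b)
    lemma = solve-∀
    lemma' : ∀ a b → a + (b - a) ≡ b
    lemma' = solve-∀

  ΛQ-permutation : ∀ {m n} (Q : Quiver m n) → LoopLess Q → ΛQ Q ≈M PermMat (ξQ Q)
  ΛQ-permutation Q ll u v = trans (cong (λ z → δ u v - z) (⊗-congˡ (Inc Q) V-J u v)) (Inc-JQ Q ll u v)
    where
    open ≡-Reasoning
    V = invUni (ǦQ Q)
    V-J : (V ⊗ (Inc Q ᵀ)) ≈M JQ Q
    V-J i v = begin
      (V ⊗ (Inc Q ᵀ)) i v         ≡⟨ ⊗-congˡ V (≈M-sym (ǦQ-JQ Q ll)) i v ⟩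
      (V ⊗ (ǦQ Q ⊗ JQ Q)) i v     ≡⟨ sym (⊗-assoc V (ǦQ Q) (JQ Q) i v) ⟩
      ((V ⊗ ǦQ Q) ⊗ JQ Q) i v     ≡⟨ ⊗-congʳ (JQ Q) (invUni-inverseˡ (ǦQ Q) (ǦQ-triangular Q ll)) i v ⟩
      (Id ⊗ JQ Q) i v             ≡⟨ ⊗-identityˡ (JQ Q) i v ⟩
      JQ Q i v                    ∎

  -- The bilinear lattice (ℤⁿ, Ǧ) of a connected quiver whose vertices are labelled so that its
  -- Coxeter–Laplacian is the permutation matrix of σ.
  record Lat (n M : ℕ) (σ : Fin M → Fin M) : Set where
    field
      U V     : Mat n n
      UV      : (U ⊗ V) ≈M Id
      VU      : (V ⊗ U) ≈M Id
      I       : Mat M n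
      U+Uᵀ    : (U ⊕ (U ᵀ)) ≈M ((I ᵀ) ⊗ I)
      laplace : ∀ i j → (I ⊗ (V ⊗ (I ᵀ))) i j ≡ δ i j - δ i (σ j)
      colsum  : ∀ a → ∑ (λ i → I i a) ≡ + 0
      T       : Fin M → Fin M → Vecℤ n
      IT      : ∀ u v → (I · T u v) ≈V (𝐞 v -V 𝐞 u)

  -- Vertices are renamed along the conjugation, so forms of the same cycle type give lattices over
  -- literally the same σ. The matrix A is passed separately so that `U` can be Ǧ of a given form by
  -- definition and not only up to `≈M`.
  lattice : ∀ {m n} (Q : Quiver m n) → LoopLess Q → QConnected Q → (ξ : Permutation′ m) → ΛQ Q ≈M PermMat ξ →
            ∀ {π} → Conj ξ π → (A : Mat n n) → A ≈M ǦQ Q → Lat n (sum π) (std π)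
  lattice {m} {n} Q ll con ξ Λ≈P {π} C A A≈Ǧ = record
      { U = A ; V = invUni A ; UV = invUni-inverseʳ A tri ; VU = invUni-inverseˡ A tri
      ; I = I ; U+Uᵀ = symm ; laplace = lap
      ; colsum = λ a → trans (sym (∑-reindex f f⁻¹ ff⁻¹ f-inj (λ v → Inc Q v a))) (inc-colsum Q a)
      ; T = λ u v → proj₁ (reach-vector Q (con (f u) (f v)))
      ; IT = λ u v w → trans (proj₂ (reach-vector Q (con (f u) (f v))) (f w))
                             (cong₂ _-_ (δ-inj f f-inj w v) (δ-inj f f-inj w u)) }
    where
    open Conj C
    open ≡-Reasoning
    tri : UpperUnitriangular A
    tri = (λ i → trans (A≈Ǧ i i) (ǦQ-diag Q ll i i refl)) , λ i j j<i → trans (A≈Ǧ i j) (ǦQ-lower Q i j j<i)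
    I : Mat (sum π) n
    I i a = Inc Q (f i) a
    symm : (A ⊕ (A ᵀ)) ≈M ((I ᵀ) ⊗ I)
    symm a b = trans (cong₂ _+_ (A≈Ǧ a b) (A≈Ǧ b a)) (trans (ǦQ-sym Q ll a b)
      (∑-reindex f f⁻¹ ff⁻¹ f-inj (λ v → Inc Q v a * Inc Q v b)))
    lemma : ∀ a b → b ≡ a - (a - b)
    lemma = solve-∀
    lap : ∀ i j → (I ⊗ (invUni A ⊗ (I ᵀ))) i j ≡ δ i j - δ i (std π j)
    lap i j = begin
      (I ⊗ (invUni A ⊗ (I ᵀ))) i j
        ≡⟨ ⊗-congˡ I (⊗-congʳ (I ᵀ) (invUni-cong A≈Ǧ)) i j ⟩
      (Inc Q ⊗ (invUni (ǦQ Q) ⊗ (Inc Q ᵀ))) (f i) (f j)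
        ≡⟨ lemma (δ (f i) (f j)) _ ⟩
      δ (f i) (f j) - ΛQ Q (f i) (f j)
        ≡⟨ cong₂ _-_ (δ-inj f f-inj i j) (Λ≈P (f i) (f j)) ⟩
      δ i j - δ (f i) (ξ ⟨$⟩ʳ f j)
        ≡⟨ cong (λ z → δ i j - δ (f i) z) (sym (comm j)) ⟩
      δ i j - δ (f i) (f (std π j))
        ≡⟨ cong (λ z → δ i j - z) (δ-inj f f-inj i (std π j)) ⟩
      δ i j - δ i (std π j) ∎

open Quivers

-- The cycles of the standard permutation.

module CycleStructure where

  record Cycles (M ℓ : ℕ) (σ : Fin M → Fin M) : Set where
    field
      σ-inj   : Inj σ
      σ-surj  : ∀ v → ∃[ u ] (σ u ≡ v)
      κ       : Fin M → Fin ℓ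
      κ-σ     : ∀ v → κ (σ v) ≡ κ v
      rep     : Fin ℓ → Fin M
      κ-rep   : ∀ j → κ (rep j) ≡ j
      path    : ∀ v → ∃[ k ] (pow σ k (rep (κ v)) ≡ v)

  std-surjective : ∀ π v → ∃[ u ] (std π u ≡ v)
  std-surjective π v with part π v | std-period π v
  ... | suc p | _ , eq , _ = pow (std π) p v , eq

  std-cycles : ∀ π → All (0 ℕ.<_) π → Cycles (sum π) (length π) (std π)
  std-cycles π pos = record
      { σ-inj = std-injective π ; σ-surj = std-surjective π ; κ = cyc π ; κ-σ = cyc-std π
      ; rep = rep π pos ; κ-rep = cyc-rep π pos ; path = path π pos }
    where
    cycˡ : ∀ p π (i : Fin p) → cyc (p ∷ π) (i ↑ˡ sum π) ≡ zero
    cycˡ p π i = cong [ (λ _ → zero) , suc ∘ cyc π ]′ (FinP.splitAt-↑ˡ p i (sum π))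
    cycʳ : ∀ p π j → cyc (p ∷ π) (p ↑ʳ j) ≡ suc (cyc π j)
    cycʳ p π j = cong [ (λ _ → zero) , suc ∘ cyc π ]′ (FinP.splitAt-↑ʳ p (sum π) j)
    rep : ∀ π → All (0 ℕ.<_) π → Fin (length π) → Fin (sum π)
    rep (suc p ∷ π) (_ ∷ pos) zero    = zero
    rep (suc p ∷ π) (_ ∷ pos) (suc j) = suc p ↑ʳ rep π pos j
    cyc-rep : ∀ π pos j → cyc π (rep π pos j) ≡ j
    cyc-rep (suc p ∷ π) (_ ∷ pos) zero    = refl
    cyc-rep (suc p ∷ π) (_ ∷ pos) (suc j) = trans (cycʳ (suc p) π (rep π pos j)) (cong suc (cyc-rep π pos j))
    path : ∀ π pos v → ∃[ k ] (pow (std π) k (rep π pos (cyc π v)) ≡ v)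
    path (suc p ∷ π) (p>0 ∷ pos) = ↑-cases (suc p)
      (λ v → ∃[ k ] (pow (std (suc p ∷ π)) k (rep (suc p ∷ π) (p>0 ∷ pos) (cyc (suc p ∷ π) v)) ≡ v))
      (λ i → toℕ i , trans (cong (pow _ (toℕ i) ∘ rep (suc p ∷ π) (p>0 ∷ pos)) (cycˡ (suc p) π i))
                           (cycleF-pow (std π) p (toℕ i) i refl))
      (λ j → proj₁ (path π pos j) , trans
         (cong (pow _ (proj₁ (path π pos j)) ∘ rep (suc p ∷ π) (p>0 ∷ pos)) (cycʳ (suc p) π j))
         (trans (sym (pow-intertwine (suc p ↑ʳ_) (λ v → sym (cycleF-rest (std π) p v)) (proj₁ (path π pos j)) _))
                (cong (suc p ↑ʳ_) (proj₂ (path π pos j)))))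
    cyc-std : ∀ π v → cyc π (std π v) ≡ cyc π v
    cyc-std (zero ∷ π)  v = cong suc (cyc-std π v)
    cyc-std (suc p ∷ π) = ↑-cases (suc p) (λ v → cyc (suc p ∷ π) (cycleF p (std π) v) ≡ cyc (suc p ∷ π) v)
      (λ i → trans (cyc-cycleF i) (sym (cycˡ (suc p) π i)))
      (λ j → trans (cong (cyc (suc p ∷ π)) (cycleF-rest (std π) p j))
        (trans (cycʳ (suc p) π (std π j)) (trans (cong suc (cyc-std π j)) (sym (cycʳ (suc p) π j)))))
      where
      open import Data.Fin.Relation.Unary.Top using (view; ‵fromℕ; ‵inject₁)
      cyc-cycleF : ∀ i → cyc (suc p ∷ π) (cycleF p (std π) (i ↑ˡ sum π)) ≡ zero
      cyc-cycleF i with view i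
      ... | ‵fromℕ     = cong (cyc (suc p ∷ π)) (cycleF-last (std π) p)
      ... | ‵inject₁ b = trans (cong (cyc (suc p ∷ π)) (cycleF-step (std π) p b)) (cycˡ (suc p) π (suc b))

open CycleStructure

-- The form b, its restriction to R = ker I, and the map J.

module Lattices where

  open import Data.Integer using (_+_; _*_; _-_)

  module LatticeTheory {n M ℓ : ℕ} {σ : Fin M → Fin M} (L : Lat n M σ) (cs : Cycles M ℓ σ) (o : Fin M) where

    open Lat L
    open Cycles cs

    b : Vecℤ n → Vecℤ n → ℤ
    b x y = dot x (U · y)

    b-cong : ∀ {x x' y y'} → x ≈V x' → y ≈V y' → b x y ≡ b x' y'
    b-cong x≈ y≈ = dot-cong x≈ (·-cong U y≈)

    b-congˡ : ∀ {x x'} y → x ≈V x' → b x y ≡ b x' y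
    b-congˡ y = dot-congˡ (U · y)

    b-congʳ : ∀ x {y y'} → y ≈V y' → b x y ≡ b x y'
    b-congʳ x y≈ = dot-congʳ x (·-cong U y≈)

    b-+ˡ : ∀ x y z → b (x +V y) z ≡ b x z + b y z
    b-+ˡ x y z = dot-+ˡ x y (U · z)

    b--ˡ : ∀ x y z → b (x -V y) z ≡ b x z - b y z
    b--ˡ x y z = dot--ˡ x y (U · z)

    b-*ˡ : ∀ a x z → b (a *V x) z ≡ a * b x z
    b-*ˡ a x z = dot-*ˡ a x (U · z)

    b-lcˡ : ∀ {k} (a : Fin k → ℤ) v z → b (lc a v) z ≡ ∑ (λ j → a j * b (v j) z)
    b-lcˡ a v z = dot-lcˡ a v (U · z)

    b-+ʳ : ∀ x y z → b x (y +V z) ≡ b x y + b x z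
    b-+ʳ x y z = trans (dot-congʳ x (·-+ U y z)) (dot-+ʳ x (U · y) (U · z))

    b-lcʳ : ∀ {k} x (a : Fin k → ℤ) v → b x (lc a v) ≡ ∑ (λ j → a j * b x (v j))
    b-lcʳ x a v = trans (dot-congʳ x (·-lc U a v)) (dot-lcʳ x a (λ j → U · v j))

    b-0ˡ : ∀ {x} y → x ≈V 0V → b x y ≡ + 0
    b-0ˡ y = dot-0ˡ (U · y)

    b-𝐞ˡ : ∀ i y → b (𝐞 i) y ≡ (U · y) i
    b-𝐞ˡ i y = dot-𝐞ˡ i (U · y)

    J : Vecℤ M → Vecℤ n
    J w = V · ((I ᵀ) · w)

    UVx : ∀ x → (U · (V · x)) ≈V x
    UVx x i = trans (sym (·-⊗ U V x i)) (trans (·-congˡ x UV i) (Id-· x i))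

    VUx : ∀ x → (V · (U · x)) ≈V x
    VUx x i = trans (sym (·-⊗ V U x i)) (trans (·-congˡ x VU i) (Id-· x i))

    U-injective : ∀ {x y} → (U · x) ≈V (U · y) → x ≈V y
    U-injective {x} {y} eq i = trans (sym (VUx x i)) (trans (·-cong V eq i) (VUx y i))

    U-J : ∀ w → (U · J w) ≈V ((I ᵀ) · w)
    U-J w = UVx ((I ᵀ) · w)

    b-Jʳ : ∀ x w → b x (J w) ≡ dot (I · x) w
    b-Jʳ x w = trans (dot-congʳ x (U-J w)) (dot-· (I ᵀ) x w)

    b-sym : ∀ x y → b x y + b y x ≡ dot (I · x) (I · y)
    b-sym x y = begin
        dot x (U · y) + dot y (U · x)
          ≡⟨ cong (_+_ (b x y)) (trans (dot-· U y x) (dot-comm ((U ᵀ) · y) x)) ⟩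
        dot x (U · y) + dot x ((U ᵀ) · y)
          ≡⟨ sym (dot-+ʳ x (U · y) ((U ᵀ) · y)) ⟩
        dot x ((U · y) +V ((U ᵀ) · y))
          ≡⟨ dot-congʳ x (λ i → trans (sym (dot-+ˡ (U i) ((U ᵀ) i) y)) (dot-congˡ y (U+Uᵀ i))) ⟩
        dot x (((I ᵀ) ⊗ I) · y)
          ≡⟨ dot-congʳ x (·-⊗ (I ᵀ) I y) ⟩
        dot x ((I ᵀ) · (I · y))
          ≡⟨ dot-· (I ᵀ) x (I · y) ⟩
        dot (I · x) (I · y) ∎
      where open ≡-Reasoning

    b-flip : ∀ x y → b x y ≡ dot (I · x) (I · y) - b y x
    b-flip x y = trans (lemma (b x y) (b y x)) (cong (_- b y x) (b-sym x y))
      where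
      lemma : ∀ p q → p ≡ (p + q) - q
      lemma = solve-∀

    R : Vecℤ n → Set
    R x = (I · x) ≈V 0V

    b-antisymˡ : ∀ {x} y → R x → b x y ≡ - b y x
    b-antisymˡ {x} y Rx = trans (b-flip x y) (trans (cong (_- b y x) (dot-0ˡ (I · y) Rx)) (ℤP.+-identityˡ _))

    b-antisymʳ : ∀ x {y} → R y → b x y ≡ - b y x
    b-antisymʳ x {y} Ry = trans (b-flip x y) (trans (cong (_- b y x) (dot-0ʳ (I · x) Ry)) (ℤP.+-identityˡ _))

    IJ : ∀ w i → (I · J w) i ≡ w i - ∑ (λ j → δ i (σ j) * w j)
    IJ w i = begin
        (I · (V · ((I ᵀ) · w))) i
          ≡⟨ ·-cong I (λ a → sym (·-⊗ V (I ᵀ) w a)) i ⟩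
        (I · ((V ⊗ (I ᵀ)) · w)) i
          ≡⟨ sym (·-⊗ I (V ⊗ (I ᵀ)) w i) ⟩
        ((I ⊗ (V ⊗ (I ᵀ))) · w) i
          ≡⟨ dot-congˡ w (laplace i) ⟩
        dot (λ j → δ i j - δ i (σ j)) w
          ≡⟨ dot--ˡ (δ i) (λ j → δ i (σ j)) w ⟩
        dot (δ i) w - ∑ (λ j → δ i (σ j) * w j)
          ≡⟨ cong (_- ∑ (λ j → δ i (σ j) * w j)) (∑-δˡ i w) ⟩
        w i - ∑ (λ j → δ i (σ j) * w j) ∎
      where open ≡-Reasoning

    IJ-σ : ∀ w k → (I · J w) (σ k) ≡ w (σ k) - w k
    IJ-σ w k = trans (IJ w (σ k)) (cong (λ z → w (σ k) - z)
      (trans (∑-cong λ j → cong (_* w j) (δ-inj σ σ-inj k j)) (∑-δˡ k w)))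

    IJ-𝐞 : ∀ v → (I · J (𝐞 v)) ≈V (𝐞 v -V 𝐞 (σ v))
    IJ-𝐞 v i = trans (IJ (𝐞 v) i) (cong (λ z → 𝐞 v i - z) (∑-δʳ v (λ j → δ i (σ j))))

    J-lin : ∀ {k} (a : Fin k → ℤ) (w : Fin k → Vecℤ M) → J (lc a w) ≈V lc a (λ j → J (w j))
    J-lin a w i = trans (·-cong V (·-lc (I ᵀ) a w) i) (·-lc V a (λ j → (I ᵀ) · w j) i)

    J-- : ∀ w w' → J (w -V w') ≈V (J w -V J w')
    J-- w w' i = trans (·-cong V (·-- (I ᵀ) w w') i) (·-- V ((I ᵀ) · w) ((I ᵀ) · w') i)

    J-+ : ∀ w w' → J (w +V w') ≈V (J w +V J w')
    J-+ w w' i = trans (·-cong V (·-+ (I ᵀ) w w') i) (·-+ V ((I ᵀ) · w) ((I ᵀ) · w') i)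

    J-* : ∀ a w → J (a *V w) ≈V (a *V J w)
    J-* a w i = trans (·-cong V (·-* (I ᵀ) a w) i) (·-* V a ((I ᵀ) · w) i)

    J-cong : ∀ {w w'} → w ≈V w' → J w ≈V J w'
    J-cong w≈w' = ·-cong V (·-cong (I ᵀ) w≈w')

    invariant⇒R : ∀ w → (∀ k → w (σ k) ≡ w k) → R (J w)
    invariant⇒R w inv i with σ-surj i
    ... | k , refl = trans (IJ-σ w k) (trans (cong (_- w k) (inv k)) (ℤP.+-inverseʳ (w k)))

    R⇒invariant : ∀ w → R (J w) → ∀ k → w (σ k) ≡ w k
    R⇒invariant w RJw k = ℤP.i-j≡0⇒i≡j (w (σ k)) (w k) (trans (sym (IJ-σ w k)) (RJw (σ k)))

    invariant-rep : ∀ (w : Vecℤ M) → (∀ k → w (σ k) ≡ w k) → ∀ v → w v ≡ w (rep (κ v))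
    invariant-rep w inv v = trans (cong w (sym (proj₂ (path v)))) (along (proj₁ (path v)))
      where
      along : ∀ k → w (pow σ k (rep (κ v))) ≡ w (rep (κ v))
      along zero    = refl
      along (suc k) = trans (inv _) (along k)

    I-sum : ∀ y → ∑ (I · y) ≡ + 0
    I-sum y = trans (∑-swap (λ i a → I i a * y a)) (∑-zero λ a →
      trans (∑-*ʳ (y a) (λ i → I i a)) (cong (_* y a) (colsum a)))

    sum-zero-lc : ∀ (z : Vecℤ M) → ∑ z ≡ + 0 → ∀ (c : Vecℤ M) (f : Fin M → Vecℤ M) →
                  lc z (λ v → f v -V c) ≈V lc z f
    sum-zero-lc z z≡0 c f i = trans (∑-cong λ v → *-distribˡ-- (z v) (f v i) (c i))
      (trans (∑-- (λ v → z v * f v i) (λ v → z v * c i))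
        (trans (cong (λ t → lc z f i - t) (trans (∑-*ʳ (c i) z) (cong (_* c i) z≡0))) (ℤP.+-identityʳ _)))

    -- A section of I over the vectors of sum zero, assembled from paths starting at o. It makes `ρ`
    -- a projection of ℤⁿ onto R.
    τ : Vecℤ M → Vecℤ n
    τ z = lc z (T o)

    Iτ : ∀ z → ∑ z ≡ + 0 → (I · τ z) ≈V z
    Iτ z z≡0 i = trans (·-lc I z (T o) i) (trans (∑-cong λ v → cong (z v *_) (IT o v i))
      (trans (sum-zero-lc z z≡0 (𝐞 o) 𝐞 i) (lc-𝐞 z i)))

    ρ : Vecℤ n → Vecℤ n
    ρ y = y -V τ (I · y)

    Rρ : ∀ y → R (ρ y)
    Rρ y i = trans (·-- I y (τ (I · y)) i)
      (trans (cong (λ z → (I · y) i - z) (Iτ (I · y) (I-sum y) i)) (ℤP.+-inverseʳ ((I · y) i)))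

    b-τ : ∀ z y → b (τ z) y ≡ dot z (λ v → b (T o v) y)
    b-τ z y = b-lcˡ z (T o) y

    I-𝐞 : ∀ a → (I · 𝐞 a) ≈V (λ v → I v a)
    I-𝐞 = ·-𝐞 I

    b-ρ𝐞 : ∀ a y → b (ρ (𝐞 a)) y ≡ (U · y) a - ((I ᵀ) · (λ v → b (T o v) y)) a
    b-ρ𝐞 a y = trans (b--ˡ (𝐞 a) (τ (I · 𝐞 a)) y) (cong₂ _-_ (b-𝐞ˡ a y)
      (trans (b-τ (I · 𝐞 a) y) (dot-congˡ (λ v → b (T o v) y) (I-𝐞 a))))

    -- Since I y = 0, the corrections made by `ρ` cancel in the sum of the y a · ρ e_a. So the ρ e_a
    -- generate R, and b on R can be tested on finitely many vectors.
    b-generators : ∀ y → R y → ∀ z → b y z ≡ ∑ (λ a → y a * b (ρ (𝐞 a)) z)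
    b-generators y Ry z = begin
        b y z
          ≡⟨ sym (trans (cong (λ t → b y z - t) (trans (dot-· (I ᵀ) y B) (dot-0ˡ B Ry))) (ℤP.+-identityʳ _)) ⟩
        b y z - dot y ((I ᵀ) · B)
          ≡⟨ sym (dot--ʳ y (U · z) ((I ᵀ) · B)) ⟩
        dot y ((U · z) -V ((I ᵀ) · B))
          ≡⟨ dot-congʳ y (λ a → sym (b-ρ𝐞 a z)) ⟩
        ∑ (λ a → y a * b (ρ (𝐞 a)) z) ∎
      where
      open ≡-Reasoning
      B = λ v → b (T o v) z

    -- Put w v = b(T o v, y). Orthogonality to ρ e_a says that b(e_a, y) equals b(τ (I e_a), y),
    -- which is the pairing of I e_a with w, that is b(e_a, J w).
    orthogonal-R⇒J : ∀ y → (∀ z → R z → b z y ≡ + 0) → y ≈V J (λ v → b (T o v) y)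
    orthogonal-R⇒J y orth = U-injective λ a → trans
      (ℤP.i-j≡0⇒i≡j _ _ (trans (sym (b-ρ𝐞 a y)) (orth (ρ (𝐞 a)) (Rρ (𝐞 a)))))
      (sym (U-J (λ v → b (T o v) y) a))

    -- The alternating form induced on R modulo its radical is unimodular.
    divide : ∀ u → R u → ∀ d → d ≢ + 0 → (q : Vecℤ n) → (∀ a → b (ρ (𝐞 a)) u ≡ d * q a) →
             ∃[ h ] (R h × (∀ v → R v → b u v ≡ d * b h v))
    divide u Ru d d≢0 q div = h , Rh , b-uv
      where
      open ≡-Reasoning
      -- Solves b(e_a, h̃) = q a. Then d · h̃ and u differ by some J w, but h̃ need not lie in R.
      h̃ = V · q
      w : Vecℤ M
      w v = - b (T o v) u
      neg-dot : ∀ {k} (x y : Vecℤ k) → dot x (λ v → - y v) ≡ - dot x y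
      neg-dot x y = trans (∑-cong λ i → sym (ℤP.neg-distribʳ-* (x i) (y i))) (∑-neg (λ i → x i * y i))
      dh̃-u : (d *V h̃ -V u) ≈V J w
      dh̃-u = U-injective λ a → begin
        (U · (d *V h̃ -V u)) a
          ≡⟨ ·-- U (d *V h̃) u a ⟩
        (U · (d *V h̃)) a - (U · u) a
          ≡⟨ cong (_- (U · u) a) (trans (·-* U d h̃ a) (cong (d *_) (UVx q a))) ⟩
        d * q a - (U · u) a
          ≡⟨ cong (_- (U · u) a) (trans (sym (div a)) (b-ρ𝐞 a u)) ⟩
        (U · u) a - ((I ᵀ) · (λ v → b (T o v) u)) a - (U · u) a
          ≡⟨ lemma ((U · u) a) (((I ᵀ) · (λ v → b (T o v) u)) a) ⟩
        - ((I ᵀ) · (λ v → b (T o v) u)) a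
          ≡⟨ sym (neg-dot (λ v → I v a) (λ v → b (T o v) u)) ⟩
        ((I ᵀ) · w) a
          ≡⟨ sym (U-J w a) ⟩
        (U · J w) a ∎
        where
        lemma : ∀ p q → p - q - p ≡ - q
        lemma = solve-∀
      IJw : ∀ i → (I · J w) i ≡ d * (I · h̃) i
      IJw i = begin
        (I · J w) i                 ≡⟨ sym (·-cong I dh̃-u i) ⟩
        (I · (d *V h̃ -V u)) i       ≡⟨ ·-- I (d *V h̃) u i ⟩
        (I · (d *V h̃)) i - (I · u) i ≡⟨ cong₂ _-_ (·-* I d h̃ i) (Ru i) ⟩
        d * (I · h̃) i - + 0         ≡⟨ ℤP.+-identityʳ _ ⟩
        d * (I · h̃) i ∎
      -- As I u = 0, w (σ k) - w k is divisible by d, so w is constant modulo d on every cycle.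
      along : ∀ r k → ∃[ c ] (w (pow σ k r) ≡ w r + d * c)
      along r zero    = + 0 , sym (trans (cong (_+_ (w r)) (ℤP.*-zeroʳ d)) (ℤP.+-identityʳ (w r)))
      along r (suc k) with along r k
      ... | c , eq = c + (I · h̃) (σ x) , (begin
          w (σ x)                              ≡⟨ lemma (w (σ x)) (w x) ⟩
          w x + (w (σ x) - w x)                ≡⟨ cong₂ _+_ eq (trans (sym (IJ-σ w x)) (IJw (σ x))) ⟩
          (w r + d * c) + d * (I · h̃) (σ x)    ≡⟨ lemma' (w r) d c ((I · h̃) (σ x)) ⟩
          w r + d * (c + (I · h̃) (σ x))        ∎)
        where
        x = pow σ k r
        lemma : ∀ p q → p ≡ q + (p - q)
        lemma = solve-∀
        lemma' : ∀ p d c e → (p + d * c) + d * e ≡ p + d * (c + e)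
        lemma' = solve-∀
      -- J sends the part `w₀`, constant on cycles, into the radical; the part d · `w₁` corrects h̃
      -- to an element of R.
      w₀ w₁ : Vecℤ M
      w₀ v = w (rep (κ v))
      w₁ v = proj₁ (along (rep (κ v)) (proj₁ (path v)))
      w≈ : w ≈V (w₀ +V d *V w₁)
      w≈ v = trans (cong w (sym (proj₂ (path v)))) (proj₂ (along (rep (κ v)) (proj₁ (path v))))
      R-Jw₀ : R (J w₀)
      R-Jw₀ = invariant⇒R w₀ λ k → cong (w ∘ rep) (κ-σ k)
      h = h̃ -V J w₁
      u≈ : u ≈V (d *V h -V J w₀)
      u≈ i = begin
        u i
          ≡⟨ lemma (u i) (d * h̃ i) ⟩
        d * h̃ i - (d *V h̃ -V u) i
          ≡⟨ cong (λ z → d * h̃ i - z) (trans (dh̃-u i) (trans (J-cong w≈ i) (trans (J-+ w₀ (d *V w₁) i)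
               (cong (_+_ (J w₀ i)) (J-* d w₁ i))))) ⟩
        d * h̃ i - (J w₀ i + d * J w₁ i)
          ≡⟨ lemma' d (h̃ i) (J w₀ i) (J w₁ i) ⟩
        d * (h̃ i - J w₁ i) - J w₀ i ∎
        where
        lemma : ∀ p q → p ≡ q - (q - p)
        lemma = solve-∀
        lemma' : ∀ d p q r → d * p - (q + d * r) ≡ d * (p - r) - q
        lemma' = solve-∀
      Rh : R h
      Rh i = *-nonzero-cancelˡ d ((I · h) i) d≢0 (begin
        d * (I · h) i
          ≡⟨ sym (·-* I d h i) ⟩
        (I · (d *V h)) i
          ≡⟨ lemma ((I · (d *V h)) i) ((I · J w₀) i) ⟩
        ((I · (d *V h)) i - (I · J w₀) i) + (I · J w₀) i
          ≡⟨ cong₂ _+_ (trans (sym (·-- I (d *V h) (J w₀) i)) (trans (sym (·-cong I u≈ i)) (Ru i))) (R-Jw₀ i) ⟩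
        + 0 ∎)
        where
        lemma : ∀ p q → p ≡ (p - q) + q
        lemma = solve-∀
      b-uv : ∀ v → R v → b u v ≡ d * b h v
      b-uv v Rv = begin
        b u v
          ≡⟨ trans (b-congˡ v u≈) (b--ˡ (d *V h) (J w₀) v) ⟩
        b (d *V h) v - b (J w₀) v
          ≡⟨ cong₂ _-_ (b-*ˡ d h v) (trans (b-antisymˡ v R-Jw₀) (cong -_ (trans (b-Jʳ v w₀) (dot-0ˡ w₀ Rv)))) ⟩
        d * b h v - + 0
          ≡⟨ ℤP.+-identityʳ _ ⟩
        d * b h v ∎

open Lattices

-- A symplectic basis of R modulo its radical.

module Symplectic where

  open import Data.Integer using (_+_; _*_; _-_)
  import Data.Integer.DivMod as ℤD

  module SymplecticTheory {n M ℓ : ℕ} {σ : Fin M → Fin M} (L : Lat n M σ) (cs : Cycles M ℓ σ) (o : Fin M) where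

    open Lat L
    open Cycles cs
    open LatticeTheory L cs o public

    R-lc : ∀ {k} (a : Fin k → ℤ) (v : Fin k → Vecℤ n) → (∀ j → R (v j)) → R (lc a v)
    R-lc a v Rv i = trans (·-lc I a v i) (∑-zero λ j → trans (cong (a j *_) (Rv j i)) (ℤP.*-zeroʳ (a j)))

    record Symp (k : ℕ) : Set where
      field
        u v   : Fin k → Vecℤ n
        Ru    : ∀ i → R (u i)
        Rv    : ∀ i → R (v i)
        uv    : ∀ i j → b (u i) (v j) ≡ δ i j
        uu    : ∀ i j → b (u i) (u j) ≡ + 0
        vv    : ∀ i j → b (v i) (v j) ≡ + 0

    module Projection {k : ℕ} (S : Symp k) where

      open Symp S

      vu : ∀ i j → b (v i) (u j) ≡ - δ i j
      vu i j = trans (b-antisymˡ (u j) (Rv i)) (cong -_ (trans (uv j i) (δ-sym j i)))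

      α β : Vecℤ n → Fin k → ℤ
      α y i = b y (u i)
      β y i = b y (v i)

      -- Projection away from the hyperbolic pairs, also applied to vectors outside R: as u and v
      -- lie in R, it leaves I y unchanged, and left and right orthogonality to them agree.
      proj : Vecℤ n → Vecℤ n
      proj y = y +V lc (α y) v -V lc (β y) u

      I-proj : ∀ y → (I · proj y) ≈V (I · y)
      I-proj y i = trans (·-- I (y +V lc (α y) v) (lc (β y) u) i)
        (trans (cong₂ _-_ (trans (·-+ I y (lc (α y) v) i) (cong (_+_ ((I · y) i)) (R-lc (α y) v Rv i)))
                          (R-lc (β y) u Ru i))
          (trans (ℤP.+-identityʳ _) (ℤP.+-identityʳ _)))

      R-proj : ∀ {y} → R y → R (proj y)
      R-proj {y} Ry i = trans (I-proj y i) (Ry i)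

      b-proj-expand : ∀ y z → b (proj y) z ≡ b y z + ∑ (λ i → α y i * b (v i) z) - ∑ (λ i → β y i * b (u i) z)
      b-proj-expand y z = trans (b--ˡ (y +V lc (α y) v) (lc (β y) u) z)
        (cong₂ _-_ (trans (b-+ˡ y (lc (α y) v) z) (cong (_+_ (b y z)) (b-lcˡ (α y) v z))) (b-lcˡ (β y) u z))

      Perp : Vecℤ n → Set
      Perp z = (∀ i → b z (u i) ≡ + 0) × (∀ i → b z (v i) ≡ + 0)

      ∑-*0 : ∀ {m} (c : Fin m → ℤ) {g : Fin m → ℤ} → (∀ i → g i ≡ + 0) → ∑ (λ i → c i * g i) ≡ + 0
      ∑-*0 c g≡0 = ∑-zero λ i → trans (cong (c i *_) (g≡0 i)) (ℤP.*-zeroʳ (c i))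

      proj-Perp : ∀ y → Perp (proj y)
      proj-Perp y = (λ j → trans (b-proj-expand y (u j)) (trans (cong₂ (λ p q → α y j + p - q)
                      (trans (∑-cong λ i → trans (cong (α y i *_) (vu i j)) (sym (ℤP.neg-distribʳ-* (α y i) (δ i j))))
                         (trans (∑-neg (λ i → α y i * δ i j)) (cong -_ (∑-δʳ j (α y)))))
                      (∑-*0 (β y) λ i → uu i j)) (lemma (α y j)))) ,
                    (λ j → trans (b-proj-expand y (v j)) (trans (cong₂ (λ p q → β y j + p - q)
                      (∑-*0 (α y) λ i → vv i j)
                      (trans (∑-cong λ i → cong (β y i *_) (uv i j)) (∑-δʳ j (β y)))) (lemma' (β y j))))
        where
        lemma : ∀ p → p + - p - + 0 ≡ + 0
        lemma = solve-∀
        lemma' : ∀ p → p + + 0 - p ≡ + 0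
        lemma' = solve-∀

      Perp-flipᵘ : ∀ z → Perp z → ∀ i → b (u i) z ≡ + 0
      Perp-flipᵘ z (pu , pv) i = trans (b-antisymˡ z (Ru i)) (cong -_ (pu i))

      Perp-flipᵛ : ∀ z → Perp z → ∀ i → b (v i) z ≡ + 0
      Perp-flipᵛ z (pu , pv) i = trans (b-antisymˡ z (Rv i)) (cong -_ (pv i))

      b-projˡ : ∀ y z → Perp z → b (proj y) z ≡ b y z
      b-projˡ y z pz = trans (b-proj-expand y z) (trans (cong₂ (λ p q → b y z + p - q)
        (∑-*0 (α y) (Perp-flipᵛ z pz)) (∑-*0 (β y) (Perp-flipᵘ z pz))) (lemma (b y z)))
        where
        lemma : ∀ p → p + + 0 - + 0 ≡ p
        lemma = solve-∀

      b-projʳ : ∀ y z → Perp y → R z → b y (proj z) ≡ b y z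
      b-projʳ y z py Rz = trans (b-antisymʳ y (R-proj Rz))
        (trans (cong -_ (b-projˡ z y py)) (sym (b-antisymʳ y Rz)))

      g : Fin n → Vecℤ n
      g a = proj (ρ (𝐞 a))

      Rg : ∀ a → R (g a)
      Rg a = R-proj (Rρ (𝐞 a))

      -- After projection all of R lies in the radical of b on R: the pairs exhaust R modulo its
      -- radical.
      Full : Set
      Full = ∀ y z → R y → R z → b z (proj y) ≡ + 0

      all-zero⇒Full : (∀ a c → b (ρ (𝐞 a)) (g c) ≡ + 0) → Full
      all-zero⇒Full zeros y z Ry Rz = begin
          b z (proj y)
            ≡⟨ b-antisymʳ z (R-proj Ry) ⟩
          - b (proj y) z
            ≡⟨ cong -_ (trans (sym (b-projʳ (proj y) z (proj-Perp y) Rz)) (b-projˡ y (proj z) (proj-Perp z))) ⟩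
          - b y (proj z)
            ≡⟨ cong -_ (b-generators y Ry (proj z)) ⟩
          - ∑ (λ a → y a * b (ρ (𝐞 a)) (proj z))
            ≡⟨ cong -_ (∑-*0 y λ a → trans (sym (b-projˡ (ρ (𝐞 a)) (proj z) (proj-Perp z)))
                 (trans (b-projʳ (g a) z (proj-Perp (ρ (𝐞 a))) Rz)
                 (trans (b-antisymʳ (g a) Rz) (cong -_ (trans (b-generators z Rz (g a)) (∑-*0 z λ c → zeros c a)))))) ⟩
          + 0 ∎
        where open ≡-Reasoning

      -- The u i are independent, being dual to the v i. This bounds the search for further pairs.
      dimension : k ℕ.≤ n
      dimension = injective⇒≤ (λ i j → u j i) λ x Fx≈0 j → begin
          x j
            ≡⟨ sym (∑-δʳ j x) ⟩
          ∑ (λ i → x i * δ i j)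
            ≡⟨ ∑-cong (λ i → cong (x i *_) (sym (uv i j))) ⟩
          ∑ (λ i → x i * b (u i) (v j))
            ≡⟨ sym (b-lcˡ x u (v j)) ⟩
          b (lc x u) (v j)
            ≡⟨ b-0ˡ (v j) (λ i → trans (∑-cong λ l → ℤP.*-comm (x l) (u l i)) (Fx≈0 i)) ⟩
          + 0 ∎
        where open ≡-Reasoning

    module _ (u* : Vecℤ n) where

      Divisor : Set
      Divisor = ∃[ z ] (R z × b z u* ≢ + 0 × Σ (Vecℤ n) λ q → ∀ a → b (ρ (𝐞 a)) u* ≡ b z u* * q a)

      -- Euclidean algorithm on the values of b(·, u*): a nonzero remainder of b(ρ e_a, u*) modulo
      -- b(z, u*) is again a value on R, smaller in absolute value.
      descend : ∀ N z → R z → b z u* ≢ + 0 → ∣ b z u* ∣ ℕ.≤ N → Divisor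
      descend zero    z Rz d≢0 d≤0 = contradiction (ℤP.∣i∣≡0⇒i≡0 (ℕP.n≤0⇒n≡0 d≤0)) d≢0
      descend (suc N) z Rz d≢0 d≤N with FinP.all? (λ a → ℤ._%_ (b (ρ (𝐞 a)) u*) (b z u*) {{ℤ.≢-nonZero d≢0}} ℕ.≟ 0)
      ... | yes all0 = z , Rz , d≢0 , (λ a → ℤ._/_ (b (ρ (𝐞 a)) u*) d {{nz}}) , λ a →
          trans (ℤD.a≡a%n+[a/n]*n (b (ρ (𝐞 a)) u*) d {{nz}})
            (trans (cong (λ r → + r + ℤ._/_ (b (ρ (𝐞 a)) u*) d {{nz}} * d) (all0 a))
              (trans (ℤP.+-identityˡ _) (ℤP.*-comm (ℤ._/_ (b (ρ (𝐞 a)) u*) d {{nz}}) d)))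
        where
        d = b z u*
        nz = ℤ.≢-nonZero d≢0
      ... | no some with FinP.¬∀⟶∃¬ n _ (λ a → ℤ._%_ (b (ρ (𝐞 a)) u*) (b z u*) {{ℤ.≢-nonZero d≢0}} ℕ.≟ 0) some
      ...   | a , r≢0 = descend N z' Rz' (λ eq → r≢0 (ℤP.+-injective (trans (sym b-z') eq)))
            (subst (ℕ._≤ N) (sym (cong ∣_∣ b-z')) (ℕP.≤-pred (ℕP.≤-trans (ℤD.n%d<d x d {{nz}}) d≤N)))
        where
        d = b z u*
        nz = ℤ.≢-nonZero d≢0
        x = b (ρ (𝐞 a)) u*
        c = ℤ._/_ x d {{nz}}
        z' = ρ (𝐞 a) -V c *V z
        Rz' : R z'
        Rz' i = trans (·-- I (ρ (𝐞 a)) (c *V z) i) (cong₂ _-_ (Rρ (𝐞 a) i)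
          (trans (·-* I c z i) (trans (cong (c *_) (Rz i)) (ℤP.*-zeroʳ c))))
        lemma : ∀ r q → (r + q) - q ≡ r
        lemma = solve-∀
        b-z' : b z' u* ≡ + (ℤ._%_ x d {{nz}})
        b-z' = trans (b--ˡ (ρ (𝐞 a)) (c *V z) u*) (trans (cong₂ _-_ (ℤD.a≡a%n+[a/n]*n x d {{nz}}) (b-*ˡ c z u*))
          (lemma (+ (ℤ._%_ x d {{nz}})) (c * d)))

    -- Let d = b(z, g c) divide all values b(·, g c) on R. Then `divide` yields h with b(g c, ·) = d
    -- · b(h, ·) on R, and for u* = proj z one gets d · b(h, u*) = b(g c, u*) = - d. So u* and v* =
    -- proj h form a new hyperbolic pair, orthogonal to the old ones.
    enlarge : ∀ {k} (S : Symp k) a c → b (ρ (𝐞 a)) (Projection.g S c) ≢ + 0 → Symp (suc k)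
    enlarge {k} S a c bac≢0 = record
        { u = λ { zero → u* ; (suc i) → u i } ; v = λ { zero → v* ; (suc i) → v i }
        ; Ru = λ { zero → Ru* ; (suc i) → Ru i } ; Rv = λ { zero → Rv* ; (suc i) → Rv i }
        ; uv = λ { zero zero → u*v* ; zero (suc j) → proj₂ pu* j
                 ; (suc i) zero → Perp-flipᵘ v* pv* i ; (suc i) (suc j) → trans (uv i j) (sym (δ-suc i j)) }
        ; uu = λ { zero zero → self u* Ru* ; zero (suc j) → proj₁ pu* j
                 ; (suc i) zero → Perp-flipᵘ u* pu* i ; (suc i) (suc j) → uu i j }
        ; vv = λ { zero zero → self v* Rv* ; zero (suc j) → proj₂ pv* j
                 ; (suc i) zero → Perp-flipᵛ v* pv* i ; (suc i) (suc j) → vv i j } }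
      where
      open Symp S
      open Projection S
      open ≡-Reasoning
      D = descend (g c) _ (ρ (𝐞 a)) (Rρ (𝐞 a)) bac≢0 ℕP.≤-refl
      z = proj₁ D
      Rz = proj₁ (proj₂ D)
      d = b z (g c)
      d≢0 = proj₁ (proj₂ (proj₂ D))
      H = divide (g c) (Rg c) d d≢0 (proj₁ (proj₂ (proj₂ (proj₂ D)))) (proj₂ (proj₂ (proj₂ (proj₂ D))))
      u* = proj z
      v* = proj (proj₁ H)
      Ru* : R u*
      Ru* = R-proj Rz
      Rv* : R v*
      Rv* = R-proj (proj₁ (proj₂ H))
      pu* = proj-Perp z
      pv* = proj-Perp (proj₁ H)
      self : ∀ x → R x → b x x ≡ + 0
      self x Rx = *-nonzero-cancelˡ (+ 2) (b x x) (λ ()) (trans (double (b x x))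
        (trans (b-sym x x) (dot-0ˡ (I · x) Rx)))
        where
        double : ∀ p → + 2 * p ≡ p + p
        double = solve-∀
      b-h-u* : d * (+ 1 + b (proj₁ H) u*) ≡ + 0
      b-h-u* = begin
        d * (+ 1 + b (proj₁ H) u*)
          ≡⟨ lemma d (b (proj₁ H) u*) ⟩
        d + d * b (proj₁ H) u*
          ≡⟨ cong (_+_ d) (sym (proj₂ (proj₂ H) u* Ru*)) ⟩
        d + b (g c) u*
          ≡⟨ cong (_+_ d) (trans (b-antisymʳ (g c) Ru*) (cong -_ (b-projˡ z (g c) (proj-Perp (ρ (𝐞 c)))))) ⟩
        d - d
          ≡⟨ ℤP.+-inverseʳ d ⟩
        + 0 ∎
        where
        lemma : ∀ d e → d * (+ 1 + e) ≡ d + d * e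
        lemma = solve-∀
      u*v* : b u* v* ≡ + 1
      u*v* = begin
        b u* v*
          ≡⟨ b-antisymˡ v* Ru* ⟩
        - b v* u*
          ≡⟨ cong -_ (b-projˡ (proj₁ H) u* pu*) ⟩
        - b (proj₁ H) u*
          ≡⟨ lemma (b (proj₁ H) u*) ⟩
        + 1 - (+ 1 + b (proj₁ H) u*)
          ≡⟨ cong (λ t → + 1 - t) (*-nonzero-cancelˡ d _ d≢0 b-h-u*) ⟩
        + 1 ∎
        where
        lemma : ∀ e → - e ≡ + 1 - (+ 1 + e)
        lemma = solve-∀

    symplectic-basis : ∃[ k ] Σ (Symp k) Projection.Full
    symplectic-basis = loop (suc n) 0 empty (s≤s (ℕP.m≤m+n n 0))
      where
      empty : Symp 0
      empty = record { u = λ () ; v = λ () ; Ru = λ () ; Rv = λ () ; uv = λ () ; uu = λ () ; vv = λ () }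
      loop : ∀ fuel k (S : Symp k) → n ℕ.< fuel ℕ.+ k → ∃[ k ] Σ (Symp k) Projection.Full
      loop zero k S n<k = contradiction n<k (ℕP.≤⇒≯ (Projection.dimension S))
      loop (suc fuel) k S n<
        with FinP.any? (λ a → FinP.any? (λ c → ¬? (b (ρ (𝐞 a)) (Projection.g S c) ℤ.≟ + 0)))
      ... | yes (a , c , ≢0) = loop fuel (suc k) (enlarge S a c ≢0) (ℕP.≤-trans n< (ℕP.≤-reflexive (sym (ℕP.+-suc fuel k))))
      ... | no none = k , S , Projection.all-zero⇒Full S zeros
        where
        zeros : ∀ a c → b (ρ (𝐞 a)) (Projection.g S c) ≡ + 0
        zeros a c with b (ρ (𝐞 a)) (Projection.g S c) ℤ.≟ + 0
        ... | yes eq = eq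
        ... | no neq = contradiction (a , c , neq) none

open Symplectic

-- Frames: a basis of ℤⁿ adapted to the cycles.

module Frames where

  open import Data.Integer using (_+_; _*_; _-_)

  cat : ∀ {X : Set} {a b} → (Fin a → X) → (Fin b → X) → Fin (a ℕ.+ b) → X
  cat {a = a} f g i = [ f , g ]′ (splitAt a i)

  cat-ˡ : ∀ {X : Set} {a b} (f : Fin a → X) (g : Fin b → X) i → cat f g (i ↑ˡ b) ≡ f i
  cat-ˡ {a = a} {b} f g i = cong [ f , g ]′ (FinP.splitAt-↑ˡ a i b)

  cat-ʳ : ∀ {X : Set} {a b} (f : Fin a → X) (g : Fin b → X) j → cat f g (a ↑ʳ j) ≡ g j
  cat-ʳ {a = a} {b} f g j = cong [ f , g ]′ (FinP.splitAt-↑ʳ a b j)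

  lc-cat : ∀ {n a b} (x : Fin (a ℕ.+ b) → ℤ) (f : Fin a → Vecℤ n) (g : Fin b → Vecℤ n) →
           lc x (cat f g) ≈V (lc (λ i → x (i ↑ˡ b)) f +V lc (λ j → x (a ↑ʳ j)) g)
  lc-cat {a = a} {b} x f g l = trans (∑-++ a (λ i → x i * cat f g i l)) (cong₂ _+_
    (∑-cong λ i → cong (λ y → x (i ↑ˡ b) * y l) (cat-ˡ f g i))
    (∑-cong λ j → cong (λ y → x (a ↑ʳ j) * y l) (cat-ʳ f g j)))

  -- Redundant coordinates: w for J w, p and q for the hyperbolic pairs, γ for the lifts of cycles.
  -- Here γ is indexed by vertices, each standing for its cycle, so that I y itself can serve as the
  -- γ of y.
  record Coord (M k : ℕ) : Set where
    field
      w   : Vecℤ M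
      p q : Fin k → ℤ
      γ   : Fin M → ℤ

  module FrameTheory {n M' ℓ' : ℕ} {σ : Fin (suc M') → Fin (suc M')}
                     (L : Lat n (suc M') σ) (cs : Cycles (suc M') (suc ℓ') σ) where

    open Lat L
    open Cycles cs
    open SymplecticTheory L cs (rep zero) public

    M = suc M'

    -- J applied to the indicator function of cycle j. These vectors span the radical of b on R, yet
    -- pair nontrivially with the lifts of cycles, so they can change b between lifts without
    -- disturbing anything on R.
    r : Fin (suc ℓ') → Vecℤ n
    r j = J (λ v → δ (κ v) j)

    Rr : ∀ j → R (r j)
    Rr j = invariant⇒R (λ v → δ (κ v) j) λ k → cong (λ i → δ i j) (κ-σ k)

    b-R-r : ∀ x → R x → ∀ j → b x (r j) ≡ + 0
    b-R-r x Rx j = trans (b-Jʳ x (λ v → δ (κ v) j)) (dot-0ˡ (λ v → δ (κ v) j) Rx)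

    Above : Vecℤ n → Fin (suc ℓ') → Set
    Above x j = (I · x) ≈V (𝐞 (rep j) -V 𝐞 (rep zero))

    b-Above-J : ∀ {x i} → Above x i → ∀ w → b x (J w) ≡ w (rep i) - w (rep zero)
    b-Above-J {x} {i} Ax w = trans (b-Jʳ x w) (trans (dot-congˡ w Ax)
      (trans (dot--ˡ (𝐞 (rep i)) (𝐞 (rep zero)) w) (cong₂ _-_ (dot-𝐞ˡ (rep i) w) (dot-𝐞ˡ (rep zero) w))))

    b-Above-r : ∀ {x i} → Above x i → ∀ j → b x (r j) ≡ δ i j - δ zero j
    b-Above-r {x} {i} Ax j = trans (b-Above-J Ax (λ v → δ (κ v) j))
      (cong₂ _-_ (cong (λ v → δ v j) (κ-rep i)) (cong (λ v → δ v j) (κ-rep zero)))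

    Re : Vecℤ n → Set
    Re x = R x × (∀ y → R y → b y x ≡ + 0)

    -- An element of `Re` is J w with w constant on cycles, and b(x j, y) is the difference of w
    -- between its cycle and cycle 0. If these vanish, w is constant, and J w = 0 because the
    -- columns of I sum to zero.
    Re-zero : ∀ y → Re y → (x : Fin ℓ' → Vecℤ n) → (∀ j → Above (x j) (suc j)) → (∀ j → b (x j) y ≡ + 0) → y ≈V 0V
    Re-zero y (Ry , orth) x Ax xy i = trans (y≈Jw i) (trans (J-cong w≈ i) (J-const i))
      where
      w = λ v → b (T (rep zero) v) y
      y≈Jw : y ≈V J w
      y≈Jw = orthogonal-R⇒J y orth
      inv : ∀ v → w v ≡ w (rep (κ v))
      inv = invariant-rep w (R⇒invariant w λ i → trans (sym (·-cong I y≈Jw i)) (Ry i))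
      w-rep : ∀ j → w (rep j) ≡ w (rep zero)
      w-rep zero    = refl
      w-rep (suc j) = ℤP.i-j≡0⇒i≡j _ _ (trans (sym (b-Above-J (Ax j) w))
        (trans (b-congʳ (x j) (λ i → sym (y≈Jw i))) (xy j)))
      w≈ : w ≈V (λ _ → w (rep zero))
      w≈ v = trans (inv v) (w-rep (κ v))
      J-const : J (λ _ → w (rep zero)) ≈V 0V
      J-const = ·-0 V λ a → trans (∑-*ʳ (w (rep zero)) (λ i → I i a)) (cong (_* w (rep zero)) (colsum a))

    record Frame (k : ℕ) : Set where
      field
        S     : Symp k
        x     : Fin (suc ℓ') → Vecℤ n
        Ax    : ∀ j → Above (x j) j
        perp  : ∀ j → Projection.Perp S (x j)
        xx    : ∀ i j → i Fin.< j → b (x i) (x j) ≡ + 0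
        full  : Projection.Full S

    module MakeFrame {k : ℕ} (S : Symp k) where

      open Symp S
      open Projection S

      x⁰ : Fin (suc ℓ') → Vecℤ n
      x⁰ zero    = 0V
      x⁰ (suc j) = T (rep zero) (rep (suc j))

      Ax⁰ : ∀ j → Above (x⁰ j) j
      Ax⁰ zero    i = trans (·-0 I (λ _ → refl) i) (sym (ℤP.+-inverseʳ (𝐞 (rep zero) i)))
      Ax⁰ (suc j) = IT (rep zero) (rep (suc j))

      x¹ : Fin (suc ℓ') → Vecℤ n
      x¹ j = proj (x⁰ j)

      Ax¹ : ∀ j → Above (x¹ j) j
      Ax¹ j i = trans (I-proj (x⁰ j) i) (Ax⁰ j i)

      -- Adding a i j · r j to x¹ i lowers b(x i, x j) by a i j. Strict triangularity of a keeps the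
      -- correction of x j from interfering when i < j, and a i 0 = 0 removes the contribution of
      -- cycle 0.
      a : Fin (suc ℓ') → Fin (suc ℓ') → ℤ
      a i j with i Fin.<? j
      ... | yes _ = b (x¹ i) (x¹ j)
      ... | no _  = + 0

      a-< : ∀ {i j} → i Fin.< j → a i j ≡ b (x¹ i) (x¹ j)
      a-< {i} {j} i<j with i Fin.<? j
      ... | yes _  = refl
      ... | no i≮j = contradiction i<j i≮j

      a-≮ : ∀ {i j} → ¬ (i Fin.< j) → a i j ≡ + 0
      a-≮ {i} {j} i≮j with i Fin.<? j
      ... | yes i<j = contradiction i<j i≮j
      ... | no _    = refl

      x : Fin (suc ℓ') → Vecℤ n
      x j = x¹ j +V lc (a j) r

      Ax : ∀ j → Above (x j) j
      Ax j i = trans (·-+ I (x¹ j) (lc (a j) r) i)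
        (trans (cong (_+_ ((I · x¹ j) i)) (R-lc (a j) r Rr i)) (trans (ℤP.+-identityʳ _) (Ax¹ j i)))

      b-r-R : ∀ {y} → R y → ∀ j → b (r j) y ≡ + 0
      b-r-R {y} Ry j = trans (b-antisymˡ y (Rr j)) (cong -_ (b-R-r y Ry j))

      perp : ∀ j → Perp (x j)
      perp j = (λ i → step (u i) (proj₁ (proj-Perp (x⁰ j)) i) (Ru i)) , (λ i → step (v i) (proj₂ (proj-Perp (x⁰ j)) i) (Rv i))
        where
        step : ∀ z → b (x¹ j) z ≡ + 0 → R z → b (x j) z ≡ + 0
        step z eq Rz = trans (b-+ˡ (x¹ j) (lc (a j) r) z) (cong₂ _+_ eq
          (trans (b-lcˡ (a j) r z) (∑-*0 (a j) λ l → b-r-R Rz l)))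

      pair-r : ∀ (c : Fin (suc ℓ') → ℤ) i → c zero ≡ + 0 → ∑ (λ l → c l * (δ i l - δ zero l)) ≡ c i
      pair-r c i c0 = trans (∑-cong λ l → *-distribˡ-- (c l) (δ i l) (δ zero l))
        (trans (∑-- (λ l → c l * δ i l) (λ l → c l * δ zero l))
          (trans (cong₂ _-_ (∑-δʳ′ i c) (trans (∑-δʳ′ zero c) c0)) (ℤP.+-identityʳ _)))

      xx : ∀ i j → i Fin.< j → b (x i) (x j) ≡ + 0
      xx i j i<j = begin
          b (x i) (x j)
            ≡⟨ b-+ʳ (x i) (x¹ j) (lc (a j) r) ⟩
          b (x i) (x¹ j) + b (x i) (lc (a j) r)
            ≡⟨ cong₂ _+_ (b-+ˡ (x¹ i) (lc (a i) r) (x¹ j))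
                 (trans (b-lcʳ (x i) (a j) r) (trans (∑-cong λ l → cong (a j l *_) (b-Above-r (Ax i) l))
                   (trans (pair-r (a j) i (a-≮ {j} {zero} λ ())) (a-≮ {j} {i} (ℕP.<⇒≯ i<j))))) ⟩
          (b (x¹ i) (x¹ j) + b (lc (a i) r) (x¹ j)) + + 0
            ≡⟨ cong (λ z → (b (x¹ i) (x¹ j) + z) + + 0) (trans (b-lcˡ (a i) r (x¹ j)) (trans
                 (∑-cong λ l → trans (cong (a i l *_) (trans (b-antisymˡ (x¹ j) (Rr l)) (cong -_ (b-Above-r (Ax¹ j) l))))
                                     (sym (ℤP.neg-distribʳ-* (a i l) (δ j l - δ zero l))))
                 (trans (∑-neg (λ l → a i l * (δ j l - δ zero l)))
                   (cong -_ (trans (pair-r (a i) j (a-≮ {i} {zero} λ ())) (a-< i<j)))))) ⟩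
          (b (x¹ i) (x¹ j) - b (x¹ i) (x¹ j)) + + 0
            ≡⟨ trans (ℤP.+-identityʳ _) (ℤP.+-inverseʳ (b (x¹ i) (x¹ j))) ⟩
          + 0 ∎
        where open ≡-Reasoning

    frame-exists : ∃[ k ] Frame k
    frame-exists with symplectic-basis
    ... | k , S , full = k , record { S = S ; x = x ; Ax = Ax ; perp = perp ; xx = xx ; full = full }
      where open MakeFrame S

    -- I J (- e_v) = e_(σ v) - e_v telescopes along the path from the representative.
    IJ-path : ∀ v → ∃[ w ] ((I · J w) ≈V (𝐞 v -V 𝐞 (rep (κ v))))
    IJ-path v = subst (λ v' → ∃[ w ] ((I · J w) ≈V (𝐞 v' -V 𝐞 (rep (κ v))))) (proj₂ (path v)) (along (proj₁ (path v)))
      where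
      along : ∀ k → ∃[ w ] ((I · J w) ≈V (𝐞 (pow σ k (rep (κ v))) -V 𝐞 (rep (κ v))))
      along zero = 0V , λ i → trans (·-0 I (·-0 V (·-0 (I ᵀ) λ _ → refl)) i) (sym (ℤP.+-inverseʳ (𝐞 (rep (κ v)) i)))
      along (suc k) with along k
      ... | w , eq = w -V 𝐞 v' , λ i → trans (·-cong I (J-- w (𝐞 v')) i) (trans (·-- I (J w) (J (𝐞 v')) i)
              (trans (cong₂ _-_ (eq i) (IJ-𝐞 v' i)) (lemma (𝐞 v' i) (𝐞 (rep (κ v)) i) (𝐞 (σ v') i))))
        where
        v' = pow σ k (rep (κ v))
        lemma : ∀ p q r → (p - q) - (p - r) ≡ r - q
        lemma = solve-∀

    module FrameUse {k : ℕ} (F : Frame k) where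

      open Frame F
      open Symp S
      open Projection S

      X : Fin M → Vecℤ n
      X v = x (κ v)

      elt : Coord M k → Vecℤ n
      elt c = (J w +V lc γ X) +V (lc p u +V lc q v)
        where open Coord c

      -- J w₁ moves every vertex in I y to the representative of its cycle, and the lifts X account
      -- for the representatives; the rest y₁ lies in R. Without its hyperbolic components y₁ is in
      -- the radical by fullness, hence of the form J w₂.
      span : ∀ y → ∃[ c ] (y ≈V elt c)
      span y = record { w = w₁ +V w₂ ; p = β y₁ ; q = λ i → - α y₁ i ; γ = z } , λ i → begin
          y i
            ≡⟨ lemma (y i) (J w₁ i) (lc z X i) (lc (α y₁) v i) (lc (β y₁) u i) ⟩
          ((J w₁ i + proj y₁ i) + lc z X i) + (lc (β y₁) u i - lc (α y₁) v i)
            ≡⟨ cong₂ (λ s t → ((J w₁ i + s) + lc z X i) + (lc (β y₁) u i + t))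
                 (orthogonal-R⇒J (proj y₁) (λ z' Rz' → full y₁ z' Ry₁ Rz') i)
                 (trans (sym (∑-neg (λ l → α y₁ l * v l i))) (∑-cong λ l → ℤP.neg-distribˡ-* (α y₁ l) (v l i))) ⟩
          ((J w₁ i + J w₂ i) + lc z X i) + (lc (β y₁) u i + lc (λ l → - α y₁ l) v i)
            ≡⟨ cong (λ s → (s + lc z X i) + (lc (β y₁) u i + lc (λ l → - α y₁ l) v i)) (sym (J-+ w₁ w₂ i)) ⟩
          (J (w₁ +V w₂) i + lc z X i) + (lc (β y₁) u i + lc (λ l → - α y₁ l) v i) ∎
        where
        open ≡-Reasoning
        z = I · y
        P : Fin M → Vecℤ M
        P v = proj₁ (IJ-path v)
        w₁ = lc z P
        y₁ = y -V J w₁ -V lc z X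
        w₂ = λ v → b (T (rep zero) v) (proj y₁)
        lemma : ∀ y j g a b → y ≡ ((j + ((y - j - g) + a - b)) + g) + (b - a)
        lemma = solve-∀
        IJw₁ : ∀ i → (I · J w₁) i ≡ lc z (λ v → 𝐞 v -V 𝐞 (rep (κ v))) i
        IJw₁ i = trans (·-cong I (J-lin z P) i) (trans (·-lc I z (λ v → J (P v)) i)
          (∑-cong λ v → cong (z v *_) (proj₂ (IJ-path v) i)))
        IX : ∀ i → (I · lc z X) i ≡ lc z (λ v → 𝐞 (rep (κ v))) i
        IX i = trans (·-lc I z X i) (trans (∑-cong λ v → cong (z v *_) (Ax (κ v) i))
          (sum-zero-lc z (I-sum y) (𝐞 (rep zero)) (λ v → 𝐞 (rep (κ v))) i))
        Ry₁ : R y₁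
        Ry₁ i = begin
          (I · y₁) i
            ≡⟨ trans (·-- I (y -V J w₁) (lc z X) i) (cong (_- (I · lc z X) i) (·-- I y (J w₁) i)) ⟩
          z i - (I · J w₁) i - (I · lc z X) i
            ≡⟨ cong₂ (λ s t → z i - s - t) (IJw₁ i) (IX i) ⟩
          z i - lc z (λ v → 𝐞 v -V 𝐞 (rep (κ v))) i - lc z (λ v → 𝐞 (rep (κ v))) i
            ≡⟨ cong (λ s → z i - s - lc z (λ v → 𝐞 (rep (κ v))) i)
                 (trans (∑-cong λ v → *-distribˡ-- (z v) (𝐞 v i) (𝐞 (rep (κ v)) i))
                   (trans (∑-- (λ v → z v * 𝐞 v i) (λ v → z v * 𝐞 (rep (κ v)) i))
                          (cong (_- lc z (λ v → 𝐞 (rep (κ v))) i) (lc-𝐞 z i)))) ⟩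
          z i - (z i - lc z (λ v → 𝐞 (rep (κ v))) i) - lc z (λ v → 𝐞 (rep (κ v))) i
            ≡⟨ lemma' (z i) (lc z (λ v → 𝐞 (rep (κ v))) i) ⟩
          + 0 ∎
          where
          lemma' : ∀ p q → p - (p - q) - q ≡ + 0
          lemma' = solve-∀

      -- J (𝐞 (suc i)), u, v and the xⱼ with j ≠ 0 form a basis of ℤⁿ.
      family : Fin ((M' ℕ.+ ℓ') ℕ.+ (k ℕ.+ k)) → Vecℤ n
      family = cat (cat (λ i → J (𝐞 (suc i))) (x ∘ suc)) (cat u v)

      J0⇒const : ∀ w → J w ≈V 0V → ∀ i → w i ≡ w (rep zero)
      J0⇒const w Jw≈0 i = ℤP.i-j≡0⇒i≡j (w i) (w (rep zero)) (begin
          w i - w (rep zero)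
            ≡⟨ sym (cong₂ _-_ (dot-𝐞ˡ i w) (dot-𝐞ˡ (rep zero) w)) ⟩
          dot (𝐞 i) w - dot (𝐞 (rep zero)) w
            ≡⟨ sym (dot--ˡ (𝐞 i) (𝐞 (rep zero)) w) ⟩
          dot (𝐞 i -V 𝐞 (rep zero)) w
            ≡⟨ dot-congˡ w (λ j → sym (IT (rep zero) i j)) ⟩
          dot (I · T (rep zero) i) w
            ≡⟨ sym (b-Jʳ (T (rep zero) i) w) ⟩
          b (T (rep zero) i) (J w)
            ≡⟨ dot-0ʳ (T (rep zero) i) (·-0 U Jw≈0) ⟩
          + 0 ∎)
        where open ≡-Reasoning

      b-J-R : ∀ w {y} → R y → b (J w) y ≡ + 0
      b-J-R w {y} Ry = trans (b-antisymʳ (J w) Ry) (cong -_ (trans (b-Jʳ y w) (dot-0ˡ w Ry)))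

      -- Pairing with v i, u i and r j isolates the coefficients of u, v and x. What remains is J W
      -- = 0, so W is constant, and it has no component at vertex 0.
      family-independent : LinIndep family
      family-independent a a≈0 = ↑-cases (M' ℕ.+ ℓ') (λ i → a i ≡ + 0)
          (↑-cases M' (λ i → a (i ↑ˡ (k ℕ.+ k)) ≡ + 0) w≡0 γ≡0)
          (↑-cases k (λ i → a ((M' ℕ.+ ℓ') ↑ʳ i) ≡ + 0) p≡0 q≡0)
        where
        open ≡-Reasoning
        aw : Fin M' → ℤ
        aw i = a ((i ↑ˡ ℓ') ↑ˡ (k ℕ.+ k))
        aγ : Fin ℓ' → ℤ
        aγ j = a ((M' ↑ʳ j) ↑ˡ (k ℕ.+ k))
        ap aq : Fin k → ℤ
        ap i = a ((M' ℕ.+ ℓ') ↑ʳ (i ↑ˡ k))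
        aq i = a ((M' ℕ.+ ℓ') ↑ʳ (k ↑ʳ i))
        W : Vecℤ M
        W = lc aw (𝐞 ∘ suc)
        total = (J W +V lc aγ (x ∘ suc)) +V (lc ap u +V lc aq v)
        total≈0 : total ≈V 0V
        total≈0 i = trans (sym (trans (lc-cat a (cat (λ i → J (𝐞 (suc i))) (x ∘ suc)) (cat u v) i) (cong₂ _+_
            (trans (lc-cat (λ j → a (j ↑ˡ (k ℕ.+ k))) (λ i → J (𝐞 (suc i))) (x ∘ suc) i)
                   (cong (λ s → s + lc aγ (x ∘ suc) i) (sym (J-lin aw (𝐞 ∘ suc) i))))
            (lc-cat (λ j → a ((M' ℕ.+ ℓ') ↑ʳ j)) u v i))))
          (a≈0 i)
        b-total : ∀ z → b total z ≡ (b (J W) z + ∑ (λ j → aγ j * b (x (suc j)) z))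
                                    + (∑ (λ i → ap i * b (u i) z) + ∑ (λ i → aq i * b (v i) z))
        b-total z = trans (b-+ˡ (J W +V lc aγ (x ∘ suc)) (lc ap u +V lc aq v) z) (cong₂ _+_
          (trans (b-+ˡ (J W) (lc aγ (x ∘ suc)) z) (cong (_+_ (b (J W) z)) (b-lcˡ aγ (x ∘ suc) z)))
          (trans (b-+ˡ (lc ap u) (lc aq v) z) (cong₂ _+_ (b-lcˡ ap u z) (b-lcˡ aq v z))))
        four : ∀ {s t p q s' t' p' q' : ℤ} → s ≡ s' → t ≡ t' → p ≡ p' → q ≡ q' → (s + t) + (p + q) ≡ (s' + t') + (p' + q')
        four refl refl refl refl = refl
        p≡0 : ∀ i → ap i ≡ + 0
        p≡0 i = trans (sym (trans (b-total (v i)) (trans (four {s' = + 0} {+ 0} {ap i} {+ 0}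
            (b-J-R W (Rv i)) (∑-*0 aγ λ j → proj₂ (perp (suc j)) i)
            (trans (∑-cong λ l → cong (ap l *_) (uv l i)) (∑-δʳ i ap)) (∑-*0 aq λ l → vv l i))
            (trans (ℤP.+-identityˡ _) (ℤP.+-identityʳ (ap i))))))
          (b-0ˡ (v i) total≈0)
        q≡0 : ∀ i → aq i ≡ + 0
        q≡0 i = trans (sym (ℤP.neg-involutive (aq i))) (cong -_ (trans
          (sym (trans (b-total (u i)) (trans (four {s' = + 0} {+ 0} {+ 0} { - aq i}
            (b-J-R W (Ru i)) (∑-*0 aγ λ j → proj₁ (perp (suc j)) i) (∑-*0 ap λ l → uu l i)
            (trans (∑-cong λ l → trans (cong (aq l *_) (vu l i)) (sym (ℤP.neg-distribʳ-* (aq l) (δ l i))))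
              (trans (∑-neg (λ l → aq l * δ l i)) (cong -_ (∑-δʳ i aq)))))
            (trans (ℤP.+-identityˡ _) (ℤP.+-identityˡ (- aq i))))))
          (b-0ˡ (u i) total≈0)))
        γ≡0 : ∀ j → aγ j ≡ + 0
        γ≡0 j = trans (sym (trans (b-total (r (suc j))) (trans (four {s' = + 0} {aγ j} {+ 0} {+ 0}
            (b-J-R W (Rr (suc j)))
            (trans (∑-cong λ l → cong (aγ l *_) (trans (b-Above-r (Ax (suc l)) (suc j))
                     (trans (ℤP.+-identityʳ _) (δ-suc l j)))) (∑-δʳ j aγ))
            (∑-*0 ap λ l → b-R-r (u l) (Ru l) (suc j)) (∑-*0 aq λ l → b-R-r (v l) (Rv l) (suc j)))
            (trans (ℤP.+-identityʳ _) (ℤP.+-identityˡ (aγ j))))))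
          (b-0ˡ (r (suc j)) total≈0)
        lc-zero : ∀ {m k} (c : Fin k → ℤ) (f : Fin k → Vecℤ m) → (∀ j → c j ≡ + 0) → lc c f ≈V 0V
        lc-zero c f c≡0 i = ∑-zero λ j → cong (_* f j i) (c≡0 j)
        JW≈0 : J W ≈V 0V
        JW≈0 i = trans (lemma (J W i)) (trans (sym (four {J W i} refl (lc-zero aγ (x ∘ suc) γ≡0 i)
          (lc-zero ap u p≡0 i) (lc-zero aq v q≡0 i))) (total≈0 i))
          where
          lemma : ∀ p → p ≡ (p + + 0) + (+ 0 + + 0)
          lemma = solve-∀
        W-zero : W zero ≡ + 0
        W-zero = ∑-zero λ l → ℤP.*-zeroʳ (aw l)
        w≡0 : ∀ i → aw i ≡ + 0
        w≡0 i = begin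
          aw i
            ≡⟨ sym (trans (∑-cong λ l → cong (aw l *_) (δ-suc i l)) (∑-δʳ′ i aw)) ⟩
          W (suc i)
            ≡⟨ trans (J0⇒const W JW≈0 (suc i)) (sym (J0⇒const W JW≈0 zero)) ⟩
          W zero
            ≡⟨ W-zero ⟩
          + 0 ∎

      -- These functionals are as many as the vectors of `family`. The missing coordinate of I y
      -- vanishes because ∑ (I y) = 0, orthogonality to the pairs then puts y into the radical, and
      -- `Re-zero` finishes.
      family-complete : ∀ y → (∀ i → (I · y) (suc i) ≡ + 0) → (∀ j → b (x (suc j)) y ≡ + 0) →
                        (∀ i → b (u i) y ≡ + 0) → (∀ i → b (v i) y ≡ + 0) → y ≈V 0V
      family-complete y Iy≡0 xy uy vy = Re-zero y (Ry , orth) (x ∘ suc) (Ax ∘ suc) xy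
        where
        Ry : R y
        Ry zero    = trans (sym (trans (cong (_+_ ((I · y) zero)) (∑-zero Iy≡0)) (ℤP.+-identityʳ _))) (I-sum y)
        Ry (suc i) = Iy≡0 i
        py : Perp y
        py = (λ i → trans (b-antisymʳ y (Ru i)) (cong -_ (uy i))) , (λ i → trans (b-antisymʳ y (Rv i)) (cong -_ (vy i)))
        orth : ∀ z → R z → b z y ≡ + 0
        orth z Rz = trans (sym (b-projˡ z y py)) (trans (b-antisymʳ (proj z) Ry) (cong -_ (full z y Rz Ry)))

      -- Independent vectors give one inequality, jointly injective functionals the other. With n =
      -- c + (m - 1) it reads c = (ℓ - 1) + 2 k: this is the parity condition, and it forces the
      -- same k for any two forms of equal cycle type.
      dimension-formula : (M' ℕ.+ ℓ') ℕ.+ (k ℕ.+ k) ≡ n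
      dimension-formula = ℕP.≤-antisym
        (injective⇒≤ (λ i j → family j i) λ z Fz≈0 → family-independent z
          λ i → trans (∑-cong λ j → ℤP.*-comm (z j) (family j i)) (Fz≈0 i))
        (injective⇒≤ rows λ y Fy≈0 → family-complete y
          (λ i → trans (cong (λ c → dot c y) (sym (trans (cat-ˡ rows₁ rows₂ (i ↑ˡ ℓ')) (cat-ˡ (I ∘ suc) (λ j → (U ᵀ) · x (suc j)) i))))
                   (Fy≈0 ((i ↑ˡ ℓ') ↑ˡ (k ℕ.+ k))))
          (λ j → trans (dot-· U (x (suc j)) y) (trans (cong (λ c → dot c y) (sym
                   (trans (cat-ˡ rows₁ rows₂ (M' ↑ʳ j)) (cat-ʳ (I ∘ suc) (λ j → (U ᵀ) · x (suc j)) j))))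
                   (Fy≈0 ((M' ↑ʳ j) ↑ˡ (k ℕ.+ k)))))
          (λ i → trans (dot-· U (u i) y) (trans (cong (λ c → dot c y) (sym
                   (trans (cat-ʳ rows₁ rows₂ (i ↑ˡ k)) (cat-ˡ (λ i → (U ᵀ) · u i) (λ i → (U ᵀ) · v i) i))))
                   (Fy≈0 ((M' ℕ.+ ℓ') ↑ʳ (i ↑ˡ k)))))
          (λ i → trans (dot-· U (v i) y) (trans (cong (λ c → dot c y) (sym
                   (trans (cat-ʳ rows₁ rows₂ (k ↑ʳ i)) (cat-ʳ (λ i → (U ᵀ) · u i) (λ i → (U ᵀ) · v i) i))))
                   (Fy≈0 ((M' ℕ.+ ℓ') ↑ʳ (k ↑ʳ i))))))
        where
        rows₁ = cat (I ∘ suc) (λ j → (U ᵀ) · x (suc j))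
        rows₂ = cat (λ i → (U ᵀ) · u i) (λ i → (U ᵀ) · v i)
        rows : Fin ((M' ℕ.+ ℓ') ℕ.+ (k ℕ.+ k)) → Vecℤ n
        rows = cat rows₁ rows₂

open Frames

-- The Gram matrix of a frame, and the rank of the reduced radical.

module GramMatrices where

  open import Data.Integer using (_+_; _*_; _-_)

  module GramBase {M' ℓ' : ℕ} {σ : Fin (suc M') → Fin (suc M')} (cs : Cycles (suc M') (suc ℓ') σ) where

    open Cycles cs

    IJf IXf : Vecℤ (suc M') → Vecℤ (suc M')
    IJf w i = w i - ∑ (λ j → δ i (σ j) * w j)
    IXf γ   = lc γ (λ v → 𝐞 (rep (κ v)) -V 𝐞 (rep zero))

    -- The summands are the values of b(elt c, J w'), b(J w, lc γ' X) and the symplectic pairing,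
    -- written without the lattice: only σ, κ and rep enter.
    base : ∀ {k} → Coord (suc M') k → Coord (suc M') k → ℤ
    base c c' = dot (IJf (w c) +V IXf (γ c)) (w c') + (dot (IJf (w c)) (IXf (γ c')) - dot (IXf (γ c')) (w c))
              + (∑ (λ i → q c' i * p c i) - ∑ (λ i → p c' i * q c i))
      where open Coord

  module GramFormula {n M' ℓ' : ℕ} {σ : Fin (suc M') → Fin (suc M')}
                     (L : Lat n (suc M') σ) (cs : Cycles (suc M') (suc ℓ') σ) where

    open Lat L
    open Cycles cs
    open FrameTheory L cs
    open GramBase cs

    module _ {k : ℕ} (F : Frame k) where

      open Frame F
      open Symp S
      open Projection S
      open FrameUse F

      IX≈ : ∀ γ → (I · lc γ X) ≈V IXf γ
      IX≈ γ i = trans (·-lc I γ X i) (∑-cong λ v → cong (γ v *_) (Ax (κ v) i))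

      module _ (c c' : Coord M k) where

        open Coord c
        open Coord c' renaming (w to w'; p to p'; q to q'; γ to γ')
        open ≡-Reasoning

        private
          Y = lc γ X
          Y' = lc γ' X
          H = lc p u +V lc q v
          H' = lc p' u +V lc q' v

        R-H : ∀ (p q : Fin k → ℤ) → R (lc p u +V lc q v)
        R-H p q i = trans (·-+ I (lc p u) (lc q v) i) (cong₂ _+_ (R-lc p u Ru i) (R-lc q v Rv i))

        I-elt : (I · elt c) ≈V (IJf w +V IXf γ)
        I-elt i = trans (·-+ I (J w +V Y) H i) (trans (cong₂ _+_
          (trans (·-+ I (J w) Y i) (cong₂ _+_ (IJ w i) (IX≈ γ i))) (R-H p q i)) (ℤP.+-identityʳ _))

        b-YH : ∀ γ p' q' → b (lc γ X) (lc p' u +V lc q' v) ≡ + 0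
        b-YH γ p' q' = trans (b-lcˡ γ X (lc p' u +V lc q' v)) (∑-*0 γ λ a →
          trans (b-+ʳ (X a) (lc p' u) (lc q' v)) (cong₂ _+_
            (trans (b-lcʳ (X a) p' u) (∑-*0 p' (proj₁ (perp (κ a)))))
            (trans (b-lcʳ (X a) q' v) (∑-*0 q' (proj₂ (perp (κ a)))))))

        b-u-H : ∀ i → b (u i) H' ≡ q' i
        b-u-H i = trans (b-+ʳ (u i) (lc p' u) (lc q' v)) (trans (cong₂ _+_
          (trans (b-lcʳ (u i) p' u) (∑-*0 p' (uu i)))
          (trans (b-lcʳ (u i) q' v) (trans (∑-cong λ j → cong (q' j *_) (uv i j)) (∑-δʳ′ i q')))) (ℤP.+-identityˡ _))

        b-v-H : ∀ i → b (v i) H' ≡ - p' i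
        b-v-H i = trans (b-+ʳ (v i) (lc p' u) (lc q' v)) (trans (cong₂ _+_
          (trans (b-lcʳ (v i) p' u) (trans (∑-cong λ j → trans (cong (p' j *_) (vu i j)) (sym (ℤP.neg-distribʳ-* (p' j) (δ i j))))
             (trans (∑-neg (λ j → p' j * δ i j)) (cong -_ (∑-δʳ′ i p')))))
          (trans (b-lcʳ (v i) q' v) (∑-*0 q' (vv i)))) (ℤP.+-identityʳ _))

        b-HH : b H H' ≡ ∑ (λ i → q' i * p i) - ∑ (λ i → p' i * q i)
        b-HH = trans (b-+ˡ (lc p u) (lc q v) H') (cong₂ _+_
          (trans (b-lcˡ p u H') (∑-cong λ i → trans (cong (p i *_) (b-u-H i)) (ℤP.*-comm (p i) (q' i))))
          (trans (b-lcˡ q v H') (trans (∑-cong λ i → trans (cong (q i *_) (b-v-H i)) (lemma (q i) (p' i)))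
            (∑-neg (λ i → p' i * q i)))))
          where
          lemma : ∀ a b → a * - b ≡ - (b * a)
          lemma = solve-∀

        gram : b (elt c) (elt c') ≡ base c c' + ∑ (λ a → γ a * ∑ (λ d → γ' d * b (X a) (X d)))
        gram = begin
          b (elt c) (elt c')
            ≡⟨ trans (b-+ʳ (elt c) (J w' +V Y') H') (cong (λ s → s + b (elt c) H') (b-+ʳ (elt c) (J w') Y')) ⟩
          (b (elt c) (J w') + b (elt c) Y') + b (elt c) H'
            ≡⟨ cong₂ _+_ (cong₂ _+_ (trans (b-Jʳ (elt c) w') (dot-congˡ w' I-elt)) bY) bH ⟩
          (dot (IJf w +V IXf γ) w' + ((dot (IJf w) (IXf γ') - dot (IXf γ') w) + ZZ)) + (∑ (λ i → q' i * p i) - ∑ (λ i → p' i * q i))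
            ≡⟨ lemma (dot (IJf w +V IXf γ) w') (dot (IJf w) (IXf γ') - dot (IXf γ') w) ZZ _ ⟩
          base c c' + ZZ ∎
          where
          ZZ = ∑ (λ a → γ a * ∑ (λ d → γ' d * b (X a) (X d)))
          lemma : ∀ a b c d → (a + (b + c)) + d ≡ ((a + b) + d) + c
          lemma = solve-∀
          bY : b (elt c) Y' ≡ (dot (IJf w) (IXf γ') - dot (IXf γ') w) + ZZ
          bY = begin
            b (elt c) Y'
              ≡⟨ trans (b-+ˡ (J w +V Y) H Y') (cong₂ _+_ (b-+ˡ (J w) Y Y')
                   (trans (b-antisymˡ Y' (R-H p q)) (cong -_ (b-YH γ' p q)))) ⟩
            (b (J w) Y' + b Y Y') + + 0
              ≡⟨ ℤP.+-identityʳ _ ⟩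
            b (J w) Y' + b Y Y'
              ≡⟨ cong₂ _+_ (trans (b-flip (J w) Y') (cong₂ _-_ (dot-cong (IJ w) (IX≈ γ'))
                      (trans (b-Jʳ Y' w) (dot-congˡ w (IX≈ γ')))))
                   (trans (b-lcˡ γ X Y') (∑-cong λ a → cong (γ a *_) (b-lcʳ (X a) γ' X))) ⟩
            (dot (IJf w) (IXf γ') - dot (IXf γ') w) + ZZ ∎
          bH : b (elt c) H' ≡ ∑ (λ i → q' i * p i) - ∑ (λ i → p' i * q i)
          bH = trans (b-+ˡ (J w +V Y) H H') (trans (cong₂ _+_ (trans (b-+ˡ (J w) Y H')
            (cong₂ _+_ (b-J-R w (R-H p' q')) (b-YH γ p' q'))) b-HH) (ℤP.+-identityˡ _))

      -- The symmetrisation of b is determined by I, and the value in the opposite order is zero in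
      -- a frame.
      xx-lower : ∀ i j → j Fin.< i → b (x i) (x j) ≡ dot (𝐞 (rep i) -V 𝐞 (rep zero)) (𝐞 (rep j) -V 𝐞 (rep zero))
      xx-lower i j j<i = trans (b-flip (x i) (x j)) (trans (cong₂ _-_ (dot-cong (Ax i) (Ax j)) (xx j i j<i)) (ℤP.+-identityʳ _))

      xx-diag : ∀ i → b (x i) (x i) + b (x i) (x i) ≡ dot (𝐞 (rep i) -V 𝐞 (rep zero)) (𝐞 (rep i) -V 𝐞 (rep zero))
      xx-diag i = trans (b-sym (x i) (x i)) (dot-cong (Ax i) (Ax i))

    t₀ : Fin ℓ' → Vecℤ n
    t₀ j = T (rep zero) (rep (suc j))

    Re-lc : ∀ {k} (a : Fin k → ℤ) (v : Fin k → Vecℤ n) → (∀ j → Re (v j)) → Re (lc a v)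
    Re-lc a v Rev = R-lc a v (proj₁ ∘ Rev) , λ y Ry → trans (b-lcʳ y a v)
      (∑-zero λ j → trans (cong (a j *_) (proj₂ (Rev j) y Ry)) (ℤP.*-zeroʳ (a j)))

    -- The r j with j ≠ 0 are dual to the paths from `rep zero` to `rep j`, and by `Re-zero` pairing
    -- with these paths is injective on `Re`.
    Re-rank : HasRank Re ℓ'
    Re-rank = ((r ∘ suc) , (λ j → Rr (suc j) , λ y Ry → b-R-r y Ry (suc j)) , indep) , dep
      where
      indep : LinIndep (r ∘ suc)
      indep a a≈0 i = trans (sym (trans (b-lcʳ (t₀ i) a (r ∘ suc)) (trans (∑-cong λ j → cong (a j *_)
          (trans (b-Above-r {t₀ i} {suc i} (IT (rep zero) (rep (suc i))) (suc j)) (trans (ℤP.+-identityʳ _) (δ-suc i j))))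
          (∑-δʳ′ i a))))
        (dot-0ʳ (t₀ i) (·-0 U a≈0))
      dep : ∀ (w : Fin (suc ℓ') → Vecℤ n) → (∀ k → Re (w k)) → LinDep w
      dep w Rew with nontrivial-relation (λ j → (U ᵀ) · t₀ j) w
      ... | a , nz , rel = a , nz , Re-zero (lc a w) (Re-lc a w Rew) t₀ (λ j → IT (rep zero) (rep (suc j))) λ j → trans (dot-· U (t₀ j) (lc a w)) (rel j)

open GramMatrices

-- Congruence of lattices with the same permutation.

module Congruence where

  open import Data.Integer using (_+_; _*_; _-_)

  -- U = Cᵀ U' C makes V Cᵀ U' a left inverse of C, and C is square. So reproducing the Gram matrix
  -- already makes the vectors `c j` a basis.
  gram-congruence : ∀ {n} (U V U' : Mat n n) → (V ⊗ U) ≈M Id → (c : Fin n → Vecℤ n) →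
    (∀ i j → U i j ≡ dot (c i) (U' · c j)) → ∃[ B ] (Invertible B × U ≈M ((B ᵀ) ⊗ (U' ⊗ B)))
  gram-congruence {n} U V U' VU c U≈ = C , (D , leftInverse⇒rightInverse D C DC , DC) , U≈
    where
    open ≡-Reasoning
    C : Mat n n
    C i j = c j i
    D = V ⊗ ((C ᵀ) ⊗ U')
    DC : (D ⊗ C) ≈M Id
    DC i j = begin
      ((V ⊗ ((C ᵀ) ⊗ U')) ⊗ C) i j
        ≡⟨ ⊗-assoc V ((C ᵀ) ⊗ U') C i j ⟩
      (V ⊗ (((C ᵀ) ⊗ U') ⊗ C)) i j
        ≡⟨ ⊗-congˡ V (λ a e → trans (⊗-assoc (C ᵀ) U' C a e) (sym (U≈ a e))) i j ⟩
      (V ⊗ U) i j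
        ≡⟨ VU i j ⟩
      Id i j ∎

  module _ {n M' ℓ' : ℕ} {σ : Fin (suc M') → Fin (suc M')} (cs : Cycles (suc M') (suc ℓ') σ) where

    open Cycles cs

    module _ (L L' : Lat n (suc M') σ) where

      private
        module A = FrameTheory L cs
        module B = FrameTheory L' cs

      xx-equal : ∀ {k} (F : A.Frame k) (F' : B.Frame k) → ∀ i j →
                 A.b (A.Frame.x F i) (A.Frame.x F j) ≡ B.b (B.Frame.x F' i) (B.Frame.x F' j)
      xx-equal F F' i j with ℕP.<-cmp (toℕ i) (toℕ j)
      ... | tri< i<j _ _ = trans (A.Frame.xx F i j i<j) (sym (B.Frame.xx F' i j i<j))
      ... | tri> _ _ j<i = trans (GramFormula.xx-lower L cs F i j j<i) (sym (GramFormula.xx-lower L' cs F' i j j<i))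
      ... | tri≈ _ i≡j _ with FinP.toℕ-injective i≡j
      ...   | refl = ℤP.i-j≡0⇒i≡j _ _ (*-nonzero-cancelˡ (+ 2) _ (λ ()) (trans (double p q)
                       (trans (cong₂ _-_ (GramFormula.xx-diag L cs F i) (GramFormula.xx-diag L' cs F' i))
                         (ℤP.+-inverseʳ (dot (𝐞 (rep i) -V 𝐞 (rep zero)) (𝐞 (rep i) -V 𝐞 (rep zero)))))))
        where
        p = A.b (A.Frame.x F i) (A.Frame.x F i)
        q = B.b (B.Frame.x F' i) (B.Frame.x F' i)
        double : ∀ p q → + 2 * (p - q) ≡ (p + p) - (q + q)
        double = solve-∀

      gram-equal : ∀ {k} (F : A.Frame k) (F' : B.Frame k) (c c' : Coord (suc M') k) →
        A.b (A.FrameUse.elt F c) (A.FrameUse.elt F c') ≡ B.b (B.FrameUse.elt F' c) (B.FrameUse.elt F' c')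
      gram-equal F F' c c' = trans (GramFormula.gram L cs F c c')
        (trans (cong (_+_ (GramBase.base cs c c')) (∑-cong λ a → cong (Coord.γ c a *_)
                 (∑-cong λ d → cong (Coord.γ c' d *_) (xx-equal F F' (κ a) (κ d)))))
          (sym (GramFormula.gram L' cs F' c c')))

      congruent-frames : ∀ {k} → A.Frame k → B.Frame k →
        ∃[ B ] (Invertible B × Lat.U L ≈M ((B ᵀ) ⊗ (Lat.U L' ⊗ B)))
      congruent-frames F F' = gram-congruence (Lat.U L) (Lat.V L) (Lat.U L') (Lat.VU L)
        (λ j → B.FrameUse.elt F' (coord j)) λ i j → begin
          Lat.U L i j
            ≡⟨ sym (trans (A.b-𝐞ˡ i (𝐞 j)) (·-𝐞 (Lat.U L) j i)) ⟩
          A.b (𝐞 i) (𝐞 j)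
            ≡⟨ A.b-cong (proj₂ (A.FrameUse.span F (𝐞 i))) (proj₂ (A.FrameUse.span F (𝐞 j))) ⟩
          A.b (A.FrameUse.elt F (coord i)) (A.FrameUse.elt F (coord j))
            ≡⟨ gram-equal F F' (coord i) (coord j) ⟩
          B.b (B.FrameUse.elt F' (coord i)) (B.FrameUse.elt F' (coord j))
            ∎
        where
        open ≡-Reasoning
        coord = λ j → proj₁ (A.FrameUse.span F (𝐞 j))

      lattices-congruent : ∃[ B ] (Invertible B × Lat.U L ≈M ((B ᵀ) ⊗ (Lat.U L' ⊗ B)))
      lattices-congruent = same-rank A.frame-exists B.frame-exists
        where
        double-injective : ∀ a c → a ℕ.+ a ≡ c ℕ.+ c → a ≡ c
        double-injective a c eq = ℕP.*-cancelˡ-≡ a c 2 (trans (cong (ℕ._+_ a) (ℕP.+-identityʳ a))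
          (trans eq (cong (ℕ._+_ c) (sym (ℕP.+-identityʳ c)))))
        same-rank : ∃ A.Frame → ∃ B.Frame → ∃[ B ] (Invertible B × Lat.U L ≈M ((B ᵀ) ⊗ (Lat.U L' ⊗ B)))
        -- Equal numbers of arrows, vertices and cycles leave only one value for the symplectic
        -- rank.
        same-rank (k , F) (k' , F') = congruent-frames F (subst B.Frame
          (double-injective k' k (ℕP.+-cancelˡ-≡ (M' ℕ.+ ℓ') (k' ℕ.+ k') (k ℕ.+ k)
            (trans (B.FrameUse.dimension-formula F') (sym (A.FrameUse.dimension-formula F))))) F')

open Congruence

-- The characteristic polynomial of the standard permutation.

module CyclePolynomials where

  open import Data.Integer using (_+_; _*_; _-_)
  open import Data.List using (foldr; replicate)
  open import Data.Fin.Relation.Unary.Top using (view; ‵fromℕ; ‵inject₁)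

  -- From size 2 on, expand along the first row, whose only nonzero candidates are x and, in the
  -- last column, -1. The first minor is lower triangular with diagonal x, the last one upper
  -- triangular with diagonal -1, whose sign combines with that of the position.
  det-cycle : ∀ x p (C : Mat (suc p) (suc p)) →
    (∀ i → C i (Fin.fromℕ p) ≡ δ i zero) → (∀ i b → C i (inject₁ b) ≡ δ i (suc b)) →
    det (λ i j → x * δ i j - C i j) ≡ x ℤ.^ suc p - + 1
  det-cycle x zero C last step = trans (cong (λ z → + 1 * ((x * + 1 - z) * + 1) + + 0) (last zero)) (lemma x)
    where
    lemma : ∀ x → + 1 * ((x * + 1 - + 1) * + 1) + + 0 ≡ x * + 1 - + 1
    lemma = solve-∀
  det-cycle x (suc p) C last step = begin
      det M
        ≡⟨ cong (_+_ (term zero)) (∑-last p (term ∘ suc)) ⟩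
      term zero + (∑ (λ j → term (suc (inject₁ j))) + term (Fin.fromℕ (suc p)))
        ≡⟨ cong₂ (λ a c → term zero + (a + c)) (∑-zero middle) lastTerm ⟩
      term zero + (+ 0 + - (+ 1))
        ≡⟨ cong (λ z → z + (+ 0 + - (+ 1))) firstTerm ⟩
      x ℤ.^ suc (suc p) - + 1 ∎
    where
    open ≡-Reasoning
    M : Mat (suc (suc p)) (suc (suc p))
    M i j = x * δ i j - C i j
    term : Fin (suc (suc p)) → ℤ
    term j = sgn (toℕ j) * (M zero j * det (minor j (M ∘ suc)))
    M-step : ∀ i b → M i (inject₁ b) ≡ x * δ i (inject₁ b) - δ i (suc b)
    M-step i b = cong (λ z → x * δ i (inject₁ b) - z) (step i b)
    M-last : ∀ i → M i (Fin.fromℕ (suc p)) ≡ x * δ i (Fin.fromℕ (suc p)) - δ i zero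
    M-last i = cong (λ z → x * δ i (Fin.fromℕ (suc p)) - z) (last i)
    M0-zero : M zero zero ≡ x
    M0-zero = trans (M-step zero zero) (lemma x)
      where
      lemma : ∀ x → x * + 1 - + 0 ≡ x
      lemma = solve-∀
    x0-0 : ∀ x → x * + 0 - + 0 ≡ + 0
    x0-0 = solve-∀
    middle : ∀ j → term (suc (inject₁ j)) ≡ + 0
    middle j = trans (cong (λ z → sgn (suc (toℕ (inject₁ j))) * (z * det (minor (suc (inject₁ j)) (M ∘ suc))))
        (trans (M-step zero (suc j)) (x0-0 x)))
      (ℤP.*-zeroʳ (sgn (suc (toℕ (inject₁ j)))))
    M-suc : ∀ (i j : Fin (suc p)) → toℕ i ℕ.≤ toℕ j → M (suc i) (suc j) ≡ x * δ i j
    M-suc i j i≤j with view j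
    ... | ‵fromℕ = trans (M-last (suc i)) (trans (ℤP.+-identityʳ _) (cong (x *_) (δ-suc i _)))
    ... | ‵inject₁ b = trans (M-step (suc i) (suc b)) (trans
          (cong₂ _-_ (cong (x *_) (δ-suc i (inject₁ b))) (trans (δ-suc i (suc b)) (δ-≢ λ { refl →
             ℕP.<-irrefl refl (ℕP.≤-trans i≤j (ℕP.≤-reflexive (FinP.toℕ-inject₁ b))) }))) (ℤP.+-identityʳ _))
    firstTerm : term zero ≡ x ℤ.^ suc (suc p)
    firstTerm = trans (ℤP.*-identityˡ _) (cong₂ _*_ M0-zero (trans
      (det-lower (minor zero (M ∘ suc)) λ i j i<j → trans (M-suc i j (ℕP.<⇒≤ i<j))
         (trans (cong (x *_) (δ-≢ λ { refl → ℕP.<-irrefl refl i<j })) (ℤP.*-zeroʳ x)))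
      (trans (∏-cong λ i → trans (M-suc i i ℕP.≤-refl) (trans (cong (x *_) (δ-refl i)) (ℤP.*-identityʳ x)))
        (∏-const (suc p) x))))
    punchIn-last : ∀ {k} (b : Fin k) → punchIn (Fin.fromℕ k) b ≡ inject₁ b
    punchIn-last zero    = refl
    punchIn-last (suc b) = cong suc (punchIn-last b)
    corner : ∀ i b → minor (Fin.fromℕ (suc p)) (M ∘ suc) i b ≡ x * δ (suc i) (inject₁ b) - δ i b
    corner i b = trans (cong (M (suc i)) (punchIn-last b)) (trans (M-step (suc i) b)
      (cong (λ z → x * δ (suc i) (inject₁ b) - z) (δ-suc i b)))
    off : ∀ (i b : Fin (suc p)) → toℕ b ℕ.≤ toℕ i → δ (suc i) (inject₁ b) ≡ + 0
    off i b b≤i = δ-≢ λ eq → ℕP.<-irrefl (trans (sym (FinP.toℕ-inject₁ b)) (cong toℕ (sym eq))) (s≤s b≤i)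
    sgn² : ∀ k → sgn k * sgn k ≡ + 1
    sgn² zero    = refl
    sgn² (suc k) = trans (lemma (sgn k)) (sgn² k)
      where
      lemma : ∀ z → - z * - z ≡ z * z
      lemma = solve-∀
    ∏-neg : ∀ k → ∏ {k} (λ _ → - (+ 1)) ≡ sgn k
    ∏-neg zero    = refl
    ∏-neg (suc k) = trans (ℤP.-1*i≡-i (∏ {k} (λ _ → - (+ 1)))) (cong -_ (∏-neg k))
    lastTerm : term (Fin.fromℕ (suc p)) ≡ - (+ 1)
    lastTerm = begin
      sgn (toℕ (Fin.fromℕ (suc p))) * (M zero (Fin.fromℕ (suc p)) * det (minor (Fin.fromℕ (suc p)) (M ∘ suc)))
        ≡⟨ cong₂ (λ a c → sgn a * (c * det (minor (Fin.fromℕ (suc p)) (M ∘ suc)))) (FinP.toℕ-fromℕ (suc p))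
             (trans (M-last zero) (cong (_- + 1) (ℤP.*-zeroʳ x))) ⟩
      sgn (suc p) * (- (+ 1) * det (minor (Fin.fromℕ (suc p)) (M ∘ suc)))
        ≡⟨ cong (λ z → sgn (suc p) * (- (+ 1) * z)) (trans
             (det-upper (minor (Fin.fromℕ (suc p)) (M ∘ suc)) λ i b b<i → trans (corner i b)
               (trans (cong₂ (λ a c → x * a - c) (off i b (ℕP.<⇒≤ b<i)) (δ-≢ λ { refl → ℕP.<-irrefl refl b<i })) (x0-0 x)))
             (trans (∏-cong λ i → trans (corner i i) (trans
                (cong₂ (λ a c → x * a - c) (off i i ℕP.≤-refl) (δ-refl i)) (cong (_- + 1) (ℤP.*-zeroʳ x))))
               (∏-neg (suc p)))) ⟩
      sgn (suc p) * (- (+ 1) * sgn (suc p))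
        ≡⟨ lemma (sgn (suc p)) ⟩
      - (sgn (suc p) * sgn (suc p))
        ≡⟨ cong -_ (sgn² (suc p)) ⟩
      - (+ 1) ∎
      where
      lemma : ∀ z → z * (- (+ 1) * z) ≡ - (z * z)
      lemma = solve-∀

  -- The value at x of the product of the λ^πₜ - 1, not of a cyclotomic polynomial in the narrow
  -- sense.
  cyclotomic : ℤ → List ℕ → ℤ
  cyclotomic x = foldr (λ p z → (x ℤ.^ p - + 1) * z) (+ 1)

  det-std : ∀ x π → All (0 ℕ.<_) π → det (λ i j → x * δ i j - δ i (std π j)) ≡ cyclotomic x π
  det-std x []          []          = refl
  det-std x (suc p ∷ π) (_ ∷ pos) = trans
    (det-block (suc p) (λ i j → x * δ i j - δ i (std (suc p ∷ π) j)) λ i j →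
      trans (cong₂ (λ a b → x * a - b) (δ-↑ˡ↑ʳ i j)
        (trans (cong (δ (i ↑ˡ sum π)) (cycleF-rest (std π) p j)) (δ-↑ˡ↑ʳ i (std π j)))) (lemma x))
    (cong₂ _*_
      (trans (det-cong λ i j → cong (λ z → x * z - δ (i ↑ˡ sum π) (cycleF p (std π) (j ↑ˡ sum π)))
                (δ-inj (_↑ˡ sum π) (FinP.↑ˡ-injective (sum π) _ _) i j))
        (det-cycle x p (λ i j → δ (i ↑ˡ sum π) (cycleF p (std π) (j ↑ˡ sum π)))
          (λ i → trans (cong (δ (i ↑ˡ sum π)) (cycleF-last (std π) p)) (δ-inj (_↑ˡ sum π) (FinP.↑ˡ-injective (sum π) _ _) i zero))
          (λ i b → trans (cong (δ (i ↑ˡ sum π)) (cycleF-step (std π) p b)) (δ-inj (_↑ˡ sum π) (FinP.↑ˡ-injective (sum π) _ _) i (suc b)))))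
      (trans (det-cong λ i j → cong₂ (λ a b → x * a - b)
                (δ-inj (suc p ↑ʳ_) (FinP.↑ʳ-injective (suc p) _ _) i j)
                (trans (cong (δ (suc p ↑ʳ i)) (cycleF-rest (std π) p j)) (δ-inj (suc p ↑ʳ_) (FinP.↑ʳ-injective (suc p) _ _) i (std π j))))
        (det-std x π pos)))
    where
    lemma : ∀ x → x * + 0 - + 0 ≡ + 0
    lemma = solve-∀

  evalP-cyclotomic : ∀ x π → evalP (prodP (map XkMinus1 π)) x ≡ cyclotomic x π
  evalP-cyclotomic x []      = evalP-constP x (+ 1)
  evalP-cyclotomic x (p ∷ π) = trans (evalP-*P x (XkMinus1 p) (prodP (map XkMinus1 π)))
    (cong₂ _*_ (evalP-XkMinus1 x p) (evalP-cyclotomic x π))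

  geomP : ℕ → Poly
  geomP p = replicate p (+ 1)

  evalP-geomP : ∀ x p → (x - + 1) * evalP (geomP p) x ≡ x ℤ.^ p - + 1
  evalP-geomP x zero    = ℤP.*-zeroʳ (x - + 1)
  evalP-geomP x (suc p) = trans (lemma x (evalP (geomP p) x)) (trans
      (cong (λ z → (x - + 1) + x * z) (evalP-geomP x p)) (lemma' x (x ℤ.^ p)))
    where
    lemma : ∀ x e → (x - + 1) * (+ 1 + x * e) ≡ (x - + 1) + x * ((x - + 1) * e)
    lemma = solve-∀
    lemma' : ∀ x e → (x - + 1) + x * (e - + 1) ≡ x * e - + 1
    lemma' = solve-∀

  evalP-geomP-1 : ∀ p → evalP (geomP p) (+ 1) ≡ + p
  evalP-geomP-1 zero    = refl
  evalP-geomP-1 (suc p) = cong (_+_ (+ 1)) (trans (ℤP.*-identityˡ _) (evalP-geomP-1 p))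

  -- The product of the 1 + λ + ... + λ^(πₜ - 1): what is left after removing one factor λ - 1 per
  -- part. Its value at 1 is the product of the parts, hence nonzero.
  cofactor : List ℕ → Poly
  cofactor π = prodP (map geomP π)

  evalP-cofactor : ∀ x π → (x - + 1) ℤ.^ length π * evalP (cofactor π) x ≡ cyclotomic x π
  evalP-cofactor x []      = trans (ℤP.*-identityˡ _) (evalP-constP x (+ 1))
  evalP-cofactor x (p ∷ π) = trans (cong ((x - + 1) ℤ.^ suc (length π) *_) (evalP-*P x (geomP p) (cofactor π)))
    (trans (lemma (x - + 1) ((x - + 1) ℤ.^ length π) (evalP (geomP p) x) (evalP (cofactor π) x))
      (cong₂ _*_ (evalP-geomP x p) (evalP-cofactor x π)))
    where
    lemma : ∀ a b c d → (a * b) * (c * d) ≡ (a * c) * (b * d)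
    lemma = solve-∀

  cofactor-1 : ∀ π → All (0 ℕ.<_) π → evalP (cofactor π) (+ 1) ≢ + 0
  cofactor-1 []          []        eq = contradiction eq λ ()
  cofactor-1 (suc p ∷ π) (_ ∷ pos) eq = cofactor-1 π pos (*-nonzero-cancelˡ (evalP (geomP (suc p)) (+ 1)) _
    (λ e → contradiction (trans (sym (evalP-geomP-1 (suc p))) e) λ ())
    (trans (sym (evalP-*P (+ 1) (geomP (suc p)) (cofactor π))) eq))

open CyclePolynomials

-- Powers of the Coxeter matrix in terms of the permutation.

module Spectral where

  open import Data.Integer using (_+_; _*_; _-_)

  ⊗-negʳ : ∀ {m k n} (A : Mat m k) (B : Mat k n) → (A ⊗ negM B) ≈M negM (A ⊗ B)
  ⊗-negʳ A B i j = trans (∑-cong λ l → sym (ℤP.neg-distribʳ-* (A i l) (B l j))) (∑-neg (λ l → A i l * B l j))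

  tr : ∀ {n} → Mat n n → ℤ
  tr A = ∑ (λ i → A i i)

  tr-cong : ∀ {n} {A B : Mat n n} → A ≈M B → tr A ≡ tr B
  tr-cong A≈B = ∑-cong λ i → A≈B i i

  tr-⊗ : ∀ {m n} (A : Mat m n) (B : Mat n m) → tr (A ⊗ B) ≡ tr (B ⊗ A)
  tr-⊗ A B = trans (∑-swap (λ i l → A i l * B l i)) (∑-cong λ l → ∑-cong λ i → ℤP.*-comm (A i l) (B l i))

  tr-Id : ∀ n → tr (Id {n}) ≡ + n
  tr-Id n = trans (∑-cong {n} δ-refl) (trans (∑-const {n} (+ 1)) (ℤP.*-identityʳ (+ n)))

  pow-comm : ∀ {A : Set} (g : A → A) k v → pow g k (g v) ≡ g (pow g k v)
  pow-comm g zero    v = refl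
  pow-comm g (suc k) v = cong g (pow-comm g k v)

  pow-pow : ∀ {A : Set} (g : A → A) a k v → pow (pow g a) k v ≡ pow g (k ℕ.* a) v
  pow-pow g a zero    v = refl
  pow-pow g a (suc k) v = trans (cong (pow g a) (pow-pow g a k v)) (sym (pow-+ g a (k ℕ.* a) v))

  pow-multiple : ∀ {A : Set} (g : A → A) {p v} → pow g p v ≡ v → ∀ k → pow g (k ℕ.* p) v ≡ v
  pow-multiple g         eq zero    = refl
  pow-multiple g {p} {v} eq (suc k) = trans (pow-+ g p (k ℕ.* p) v) (trans (cong (pow g p) (pow-multiple g eq k)) eq)

  module SpectralTheory {n M' : ℕ} {σ : Fin (suc M') → Fin (suc M')} (L : Lat n (suc M') σ)
                        (σ-inj : Inj σ) (returns : ∀ v → ∃[ p ] (0 ℕ.< p × pow σ p v ≡ v)) where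

    open Lat L
    open ≡-Reasoning

    M = suc M'

    -- The Coxeter matrix; for the lattice of a form q it unfolds to `Φ q`.
    Ψ : Mat n n
    Ψ = negM ((U ᵀ) ⊗ V)

    X : Mat n M
    X = I ᵀ

    Y : Mat M n
    Y = I ⊗ V

    Ψ≈ : Ψ ≈M (Id ⊖ (X ⊗ Y))
    Ψ≈ i j = begin
        - ((U ᵀ) ⊗ V) i j
          ≡⟨ cong -_ (⊗-congʳ V (λ a c → trans (lemma (U a c) (U c a)) (cong (_- U a c) (U+Uᵀ a c))) i j) ⟩
        - ((((I ᵀ) ⊗ I) ⊖ U) ⊗ V) i j
          ≡⟨ cong -_ (⊗-distribʳ-⊖ ((I ᵀ) ⊗ I) U V i j) ⟩
        - ((((I ᵀ) ⊗ I) ⊗ V) i j - (U ⊗ V) i j)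
          ≡⟨ cong₂ (λ a c → - (a - c)) (⊗-assoc (I ᵀ) I V i j) (UV i j) ⟩
        - ((X ⊗ Y) i j - Id i j)
          ≡⟨ lemma' ((X ⊗ Y) i j) (Id i j) ⟩
        Id i j - (X ⊗ Y) i j ∎
      where
      lemma : ∀ a c → c ≡ (a + c) - a
      lemma = solve-∀
      lemma' : ∀ a c → - (a - c) ≡ c - a
      lemma' = solve-∀

    YX : ∀ i j → (Y ⊗ X) i j ≡ δ i j - δ i (σ j)
    YX i j = trans (⊗-assoc I V (I ᵀ) i j) (laplace i j)

    YU : (Y ⊗ U) ≈M I
    YU i j = trans (⊗-assoc I V U i j) (trans (⊗-congˡ I VU i j) (⊗-identityʳ I i j))

    -- The partial sum Id + Λ + ... + Λ^(s-1), given entrywise.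
    S : ℕ → Mat M M
    S s i j = ∑ {s} (λ k → δ i (pow σ (toℕ k) j))

    S-last : ∀ s i j → S (suc s) i j ≡ S s i j + δ i (pow σ s j)
    S-last s i j = trans (∑-last s (λ k → δ i (pow σ (toℕ k) j))) (cong₂ _+_
      (∑-cong {s} λ k → cong (λ t → δ i (pow σ t j)) (FinP.toℕ-inject₁ k))
      (cong (λ t → δ i (pow σ t j)) (FinP.toℕ-fromℕ s)))

    P-S : ∀ s i j → ∑ (λ l → δ i (σ l) * S s l j) ≡ S (suc s) i j - δ i j
    P-S s i j = begin
        ∑ (λ l → δ i (σ l) * S s l j)
          ≡⟨ ∑-cong (λ l → sym (∑-*ˡ {s} (δ i (σ l)) (λ k → δ l (pow σ (toℕ k) j)))) ⟩
        ∑ (λ l → ∑ {s} (λ k → δ i (σ l) * δ l (pow σ (toℕ k) j)))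
          ≡⟨ ∑-swap {M} {s} (λ l k → δ i (σ l) * δ l (pow σ (toℕ k) j)) ⟩
        ∑ {s} (λ k → ∑ (λ l → δ i (σ l) * δ l (pow σ (toℕ k) j)))
          ≡⟨ ∑-cong {s} (λ k → ∑-δʳ (pow σ (toℕ k) j) (λ l → δ i (σ l))) ⟩
        ∑ {s} (λ k → δ i (σ (pow σ (toℕ k) j)))
          ≡⟨ lemma (δ i j) _ ⟩
        (δ i j + ∑ {s} (λ k → δ i (σ (pow σ (toℕ k) j)))) - δ i j ∎
      where
      lemma : ∀ a c → c ≡ (a + c) - a
      lemma = solve-∀

    YX-⊗ : ∀ {r} (B : Mat M r) i j → ((Y ⊗ X) ⊗ B) i j ≡ B i j - ∑ (λ l → δ i (σ l) * B l j)
    YX-⊗ B i j = trans (∑-cong λ l → cong (_* B l j) (YX i l))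
      (trans (dot--ˡ (δ i) (λ l → δ i (σ l)) (λ l → B l j)) (cong (_- ∑ (λ l → δ i (σ l) * B l j)) (∑-δˡ i (λ l → B l j))))

    YXS : ∀ s i j → ((Y ⊗ X) ⊗ S s) i j ≡ S s i j - (S (suc s) i j - δ i j)
    YXS s i j = trans (YX-⊗ (S s) i j) (cong (λ z → S s i j - z) (P-S s i j))

    YXS' : ∀ s i j → ((Y ⊗ X) ⊗ S s) i j ≡ δ i j - δ i (pow σ s j)
    YXS' s i j = trans (YXS s i j) (trans (cong (λ z → S s i j - (z - δ i j)) (S-last s i j))
        (lemma (S s i j) (δ i (pow σ s j)) (δ i j)))
      where
      lemma : ∀ a b c → a - ((a + b) - c) ≡ c - b
      lemma = solve-∀

    YXSY : ∀ s → (Y ⊗ (X ⊗ (S s ⊗ Y))) ≈M (((Y ⊗ X) ⊗ S s) ⊗ Y)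
    YXSY s i j = trans (sym (⊗-assoc Y X (S s ⊗ Y) i j)) (sym (⊗-assoc (Y ⊗ X) (S s) Y i j))

    Ψ-power : ∀ s → (Ψ ^M s) ≈M (Id ⊖ (X ⊗ (S s ⊗ Y)))
    Ψ-power zero i j = sym (trans (cong (λ z → Id i j - z)
      (trans (⊗-congˡ X (⊗-zeroˡ Y) i j) (⊗-zeroʳ X i j))) (ℤP.+-identityʳ (Id i j)))
    Ψ-power (suc s) i j = begin
        (Ψ ⊗ (Ψ ^M s)) i j
          ≡⟨ ⊗-cong Ψ≈ (Ψ-power s) i j ⟩
        ((Id ⊖ A) ⊗ (Id ⊖ B)) i j
          ≡⟨ ⊗-distribʳ-⊖ Id A (Id ⊖ B) i j ⟩
        (Id ⊗ (Id ⊖ B)) i j - (A ⊗ (Id ⊖ B)) i j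
          ≡⟨ cong₂ _-_ (⊗-identityˡ (Id ⊖ B) i j) (trans (⊗-distribˡ-⊖ A Id B i j) (cong₂ _-_ (⊗-identityʳ A i j) AB)) ⟩
        (Id i j - B i j) - (A i j - (B i j - (C i j - A i j)))
          ≡⟨ lemma (Id i j) (B i j) (A i j) (C i j) ⟩
        Id i j - C i j ∎
      where
      A = X ⊗ Y
      B = X ⊗ (S s ⊗ Y)
      C = X ⊗ (S (suc s) ⊗ Y)
      lemma : ∀ d b a c → (d - b) - (a - (b - (c - a))) ≡ d - c
      lemma = solve-∀
      AB : (A ⊗ B) i j ≡ B i j - (C i j - A i j)
      AB = begin
        (A ⊗ B) i j
          ≡⟨ ⊗-assoc X Y B i j ⟩
        (X ⊗ (Y ⊗ B)) i j
          ≡⟨ ⊗-congˡ X (λ a c → trans (YXSY s a c) (⊗-congʳ Y (YXS s) a c)) i j ⟩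
        (X ⊗ ((S s ⊖ (S (suc s) ⊖ Id)) ⊗ Y)) i j
          ≡⟨ ⊗-congˡ X (λ a c → trans (⊗-distribʳ-⊖ (S s) (S (suc s) ⊖ Id) Y a c) (cong (λ z → (S s ⊗ Y) a c - z)
               (trans (⊗-distribʳ-⊖ (S (suc s)) Id Y a c) (cong (λ z → (S (suc s) ⊗ Y) a c - z) (⊗-identityˡ Y a c))))) i j ⟩
        (X ⊗ ((S s ⊗ Y) ⊖ ((S (suc s) ⊗ Y) ⊖ Y))) i j
          ≡⟨ trans (⊗-distribˡ-⊖ X (S s ⊗ Y) ((S (suc s) ⊗ Y) ⊖ Y) i j)
               (cong (λ z → B i j - z) (⊗-distribˡ-⊖ X (S (suc s) ⊗ Y) Y i j)) ⟩
        B i j - (C i j - A i j) ∎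

    S-shift : ∀ s i u → S s i (σ u) ≡ S s i u - δ i u + δ i (pow σ s u)
    S-shift s i u = +-cancelˡ (δ i u) (begin
        δ i u + S s i (σ u)
          ≡⟨ cong (_+_ (δ i u)) (∑-cong {s} λ k → cong (δ i) (pow-comm σ (toℕ k) u)) ⟩
        S (suc s) i u
          ≡⟨ S-last s i u ⟩
        S s i u + δ i (pow σ s u)
          ≡⟨ lemma (S s i u) (δ i u) (δ i (pow σ s u)) ⟩
        δ i u + (S s i u - δ i u + δ i (pow σ s u)) ∎)
      where
      lemma : ∀ a b c → a + c ≡ b + (a - b + c)
      lemma = solve-∀

    S-sum : ∀ s u → ∑ (λ i → S s i u) ≡ + s
    S-sum s u = trans (∑-swap {M} {s} (λ i k → δ i (pow σ (toℕ k) u)))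
      (trans (∑-cong {s} λ k → ∑-δ (pow σ (toℕ k) u)) (trans (∑-const {s} (+ 1)) (ℤP.*-identityʳ (+ s))))

    -- Connectedness: every e_v - e_u lies in the image of I.
    columns-equal : ∀ {r} (B : Mat r M) → (B ⊗ I) ≈M 0M → ∀ i u v → B i u ≡ B i v
    columns-equal B BI≈0 i u v = sym (ℤP.i-j≡0⇒i≡j (B i v) (B i u) (begin
        B i v - B i u
          ≡⟨ sym (trans (dot--ʳ (B i) (𝐞 v) (𝐞 u)) (cong₂ _-_ (dot-𝐞ʳ (B i) v) (dot-𝐞ʳ (B i) u))) ⟩
        dot (B i) (𝐞 v -V 𝐞 u)
          ≡⟨ dot-congʳ (B i) (λ j → sym (IT u v j)) ⟩
        (B · (I · T u v)) i
          ≡⟨ sym (·-⊗ B I (T u v) i) ⟩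
        ((B ⊗ I) · T u v) i
          ≡⟨ trans (·-congˡ (T u v) BI≈0 i) (∑-zero {n} λ _ → refl) ⟩
        + 0 ∎))

    -- Ψˢ = 1 means X S Y = 0, so X S I = 0 by Y U = I, and the columns of X S agree. The difference
    -- D of two columns of S is then killed by Iᵀ, hence constant; as both columns sum to s, D = 0.
    power-Id⇒ : ∀ s → (Ψ ^M s) ≈M Id → ∀ i u v → S s i u ≡ S s i v
    power-Id⇒ s Ψˢ≈1 i u v = ℤP.i-j≡0⇒i≡j _ _ (*-nonzero-cancelˡ (+ M) (D i) (λ ()) (begin
        + M * D i
          ≡⟨ sym (∑-const {M} (D i)) ⟩
        ∑ {M} (λ _ → D i)
          ≡⟨ ∑-cong (λ j → const i j) ⟩
        ∑ (λ j → D j)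
          ≡⟨ ∑-- (λ j → S s j u) (λ j → S s j v) ⟩
        ∑ (λ j → S s j u) - ∑ (λ j → S s j v)
          ≡⟨ trans (cong₂ _-_ (S-sum s u) (S-sum s v)) (ℤP.+-inverseʳ (+ s)) ⟩
        + 0 ∎))
      where
      D : Vecℤ M
      D j = S s j u - S s j v
      XSY≈0 : (X ⊗ (S s ⊗ Y)) ≈M 0M
      XSY≈0 a c = trans (lemma (Id a c) _) (trans (cong (λ z → Id a c - z)
          (trans (sym (Ψ-power s a c)) (Ψˢ≈1 a c))) (ℤP.+-inverseʳ (Id a c)))
        where
        lemma : ∀ d z → z ≡ d - (d - z)
        lemma = solve-∀
      XSI≈0 : ((X ⊗ S s) ⊗ I) ≈M 0M
      XSI≈0 a c = begin
        ((X ⊗ S s) ⊗ I) a c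
          ≡⟨ ⊗-congˡ (X ⊗ S s) (≈M-sym YU) a c ⟩
        ((X ⊗ S s) ⊗ (Y ⊗ U)) a c
          ≡⟨ sym (⊗-assoc (X ⊗ S s) Y U a c) ⟩
        (((X ⊗ S s) ⊗ Y) ⊗ U) a c
          ≡⟨ ⊗-congʳ U (λ a' c' → trans (⊗-assoc X (S s) Y a' c') (XSY≈0 a' c')) a c ⟩
        (0M ⊗ U) a c
          ≡⟨ ⊗-zeroˡ U a c ⟩
        + 0 ∎
      XS-equal : ∀ a → (X ⊗ S s) a u ≡ (X ⊗ S s) a v
      XS-equal a = columns-equal (X ⊗ S s) XSI≈0 a u v
      const : ∀ j j' → D j ≡ D j'
      const j j' = columns-equal {1} (λ _ → D) (λ _ a → begin
          dot D (λ l → I l a)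
            ≡⟨ dot--ˡ (λ l → S s l u) (λ l → S s l v) (λ l → I l a) ⟩
          dot (λ l → S s l u) (λ l → I l a) - dot (λ l → S s l v) (λ l → I l a)
            ≡⟨ cong₂ _-_ (dot-comm (λ l → S s l u) (λ l → I l a)) (dot-comm (λ l → S s l v) (λ l → I l a)) ⟩
          (X ⊗ S s) a u - (X ⊗ S s) a v
            ≡⟨ trans (cong (_- (X ⊗ S s) a v) (XS-equal a)) (ℤP.+-inverseʳ ((X ⊗ S s) a v)) ⟩
          + 0 ∎) zero j j'

    power-Id⇐ : ∀ s → (∀ i u v → S s i u ≡ S s i v) → (Ψ ^M s) ≈M Id
    power-Id⇐ s equal a c = trans (Ψ-power s a c) (trans (cong (λ z → Id a c - z) (begin
        (X ⊗ (S s ⊗ (I ⊗ V))) a c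
          ≡⟨ ⊗-congˡ X (λ i j → sym (⊗-assoc (S s) I V i j)) a c ⟩
        (X ⊗ ((S s ⊗ I) ⊗ V)) a c
          ≡⟨ ⊗-congˡ X (λ i j → trans (⊗-congʳ V SI≈0 i j) (⊗-zeroˡ V i j)) a c ⟩
        (X ⊗ 0M) a c
          ≡⟨ ⊗-zeroʳ X a c ⟩
        + 0 ∎)) (ℤP.+-identityʳ (Id a c)))
      where
      SI≈0 : (S s ⊗ I) ≈M 0M
      SI≈0 i b = trans (∑-cong λ j → cong (_* I j b) (equal i j zero))
        (trans (∑-*ˡ (S s i zero) (λ j → I j b)) (trans (cong (S s i zero *_) (colsum b)) (ℤP.*-zeroʳ (S s i zero))))

    -- Columns u and σ u of S differ by e_u - e_(σˢ u), and they are equal.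
    power-Id⇒fixed : ∀ s → (Ψ ^M s) ≈M Id → ∀ u → pow σ s u ≡ u
    power-Id⇒fixed s Ψˢ≈1 u = sym (δ-≢0 λ eq → contradiction (trans (sym (δ-refl u)) (trans δ≡ eq)) λ ())
      where
      δ≡ : δ u u ≡ δ u (pow σ s u)
      δ≡ = +-cancelˡ (S s u u) (begin
        S s u u + δ u u
          ≡⟨ cong (λ z → z + δ u u) (trans (power-Id⇒ s Ψˢ≈1 u u (σ u)) (S-shift s u u)) ⟩
        (S s u u - δ u u + δ u (pow σ s u)) + δ u u
          ≡⟨ lemma (S s u u) (δ u u) (δ u (pow σ s u)) ⟩
        S s u u + δ u (pow σ s u) ∎)
        where
        lemma : ∀ a b c → (a - b + c) + b ≡ a + c
        lemma = solve-∀

    E : ℕ → Mat M M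
    E s i j = δ i (pow σ s j) - δ i j

    N : ℕ → Mat n n
    N s = (Ψ ^M s) ⊖ Id

    N≈ : ∀ s → N s ≈M negM (X ⊗ (S s ⊗ Y))
    N≈ s i j = trans (cong (_- Id i j) (Ψ-power s i j)) (lemma (Id i j) _)
      where
      lemma : ∀ d z → (d - z) - d ≡ - z
      lemma = solve-∀

    YN : ∀ s → (Y ⊗ N s) ≈M (E s ⊗ Y)
    YN s i j = begin
        (Y ⊗ N s) i j
          ≡⟨ trans (⊗-congˡ Y (N≈ s) i j) (⊗-negʳ Y (X ⊗ (S s ⊗ Y)) i j) ⟩
        - (Y ⊗ (X ⊗ (S s ⊗ Y))) i j
          ≡⟨ cong -_ (YXSY s i j) ⟩
        - (((Y ⊗ X) ⊗ S s) ⊗ Y) i j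
          ≡⟨ sym (⊗-negˡ ((Y ⊗ X) ⊗ S s) Y i j) ⟩
        (negM ((Y ⊗ X) ⊗ S s) ⊗ Y) i j
          ≡⟨ ⊗-congʳ Y (λ a c → trans (cong -_ (YXS' s a c)) (lemma (δ a c) (δ a (pow σ s c)))) i j ⟩
        (E s ⊗ Y) i j ∎
      where
      lemma : ∀ a b → - (a - b) ≡ b - a
      lemma = solve-∀

    -- Here Y N = (Λˢ - 1) Y = 0, while N = - X S Y ends in Y; so N² = 0.
    fixed⇒nilpotent : ∀ s → (∀ v → pow σ s v ≡ v) → Nilpotent (N s)
    fixed⇒nilpotent s fix = 2 , λ i j → begin
        (N s ⊗ (N s ⊗ Id)) i j
          ≡⟨ ⊗-cong (N≈ s) (⊗-identityʳ (N s)) i j ⟩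
        (negM (X ⊗ (S s ⊗ Y)) ⊗ N s) i j
          ≡⟨ ⊗-negˡ (X ⊗ (S s ⊗ Y)) (N s) i j ⟩
        - ((X ⊗ (S s ⊗ Y)) ⊗ N s) i j
          ≡⟨ cong -_ (trans (⊗-assoc X (S s ⊗ Y) (N s) i j) (⊗-congˡ X (λ a c →
               trans (⊗-assoc (S s) Y (N s) a c) (trans (⊗-congˡ (S s) YN≈0 a c) (⊗-zeroʳ (S s) a c))) i j)) ⟩
        - (X ⊗ 0M) i j
          ≡⟨ cong -_ (⊗-zeroʳ X i j) ⟩
        + 0 ∎
      where
      YN≈0 : (Y ⊗ N s) ≈M 0M
      YN≈0 a c = trans (YN s a c) (trans (⊗-congʳ Y (λ i j → trans (cong (λ z → δ i z - δ i j) (fix j))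
        (ℤP.+-inverseʳ (δ i j))) a c) (⊗-zeroˡ Y a c))

    module _ (s : ℕ) where

      private
        τ = pow σ s
        τ-inj = pow-injective σ σ-inj s

      E-τ : ∀ {r} (B : Mat M r) i c → (E s ⊗ B) (τ i) c ≡ B i c - B (τ i) c
      E-τ B i c = trans (dot--ˡ (λ l → δ (τ i) (τ l)) (δ (τ i)) (λ l → B l c))
        (cong₂ _-_ (trans (∑-cong λ l → cong (_* B l c) (δ-inj τ τ-inj i l)) (∑-δˡ i (λ l → B l c)))
                   (∑-δˡ (τ i) (λ l → B l c)))

      -- B (τᵏ i) = B i - k (E B) i along a τ-orbit, which is finite.
      E-kernel : ∀ {r} (B : Mat M r) → (E s ⊗ (E s ⊗ B)) ≈M 0M → (E s ⊗ B) ≈M 0M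
      E-kernel B EEB≈0 i c = *-nonzero-cancelˡ (+ p) (Z i) (λ { eq → ℕP.<⇒≢ 0<p (sym (ℤP.+-injective eq)) })
          (trans (lemma (B i c) (+ p * Z i)) (trans (cong (λ z → B i c - z) (trans (sym (along p)) (cong (λ v → B v c) τᵖi≡i)))
            (ℤP.+-inverseʳ (B i c))))
        where
        Z : Fin M → ℤ
        Z l = (E s ⊗ B) l c
        p = proj₁ (returns i)
        0<p = proj₁ (proj₂ (returns i))
        τᵖi≡i : pow τ p i ≡ i
        τᵖi≡i = trans (pow-pow σ s p i) (trans (cong (λ k → pow σ k i) (ℕP.*-comm p s))
          (pow-multiple σ (proj₂ (proj₂ (returns i))) s))
        lemma : ∀ a b → b ≡ a - (a - b)
        lemma = solve-∀
        Z-inv : ∀ l → Z l ≡ Z (τ l)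
        Z-inv l = ℤP.i-j≡0⇒i≡j _ _ (trans (sym (E-τ (E s ⊗ B) l c)) (EEB≈0 (τ l) c))
        Z-pow : ∀ k → Z (pow τ k i) ≡ Z i
        Z-pow zero    = refl
        Z-pow (suc k) = trans (sym (Z-inv (pow τ k i))) (Z-pow k)
        along : ∀ k → B (pow τ k i) c ≡ B i c - + k * Z i
        along zero    = sym (ℤP.+-identityʳ (B i c))
        along (suc k) = begin
          B (τ l) c
            ≡⟨ lemma (B l c) (B (τ l) c) ⟩
          B l c - (B l c - B (τ l) c)
            ≡⟨ cong₂ _-_ (along k) (trans (sym (E-τ B l c)) (trans (sym (Z-inv l)) (Z-pow k))) ⟩
          (B i c - + k * Z i) - Z i
            ≡⟨ lemma' (B i c) (+ k) (Z i) ⟩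
          B i c - (+ 1 + + k) * Z i ∎
          where
          l = pow τ k i
          lemma' : ∀ b k z → (b - k * z) - z ≡ b - (+ 1 + k) * z
          lemma' = solve-∀

      E-nilpotent : ∀ k → (E s ^M suc k) ≈M 0M → E s ≈M 0M
      E-nilpotent zero    E≈0 i j = trans (sym (⊗-identityʳ (E s) i j)) (E≈0 i j)
      E-nilpotent (suc k) E≈0 = E-nilpotent k (E-kernel (E s ^M k) E≈0)

      YNᵏ : ∀ k → (Y ⊗ (N s ^M k)) ≈M ((E s ^M k) ⊗ Y)
      YNᵏ zero    i j = trans (⊗-identityʳ Y i j) (sym (⊗-identityˡ Y i j))
      YNᵏ (suc k) i j = begin
        (Y ⊗ (N s ⊗ (N s ^M k))) i j
          ≡⟨ sym (⊗-assoc Y (N s) (N s ^M k) i j) ⟩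
        ((Y ⊗ N s) ⊗ (N s ^M k)) i j
          ≡⟨ ⊗-congʳ (N s ^M k) (YN s) i j ⟩
        ((E s ⊗ Y) ⊗ (N s ^M k)) i j
          ≡⟨ ⊗-assoc (E s) Y (N s ^M k) i j ⟩
        (E s ⊗ (Y ⊗ (N s ^M k))) i j
          ≡⟨ ⊗-congˡ (E s) (YNᵏ k) i j ⟩
        (E s ⊗ ((E s ^M k) ⊗ Y)) i j
          ≡⟨ sym (⊗-assoc (E s) (E s ^M k) Y i j) ⟩
        ((E s ⊗ (E s ^M k)) ⊗ Y) i j ∎

      -- With E = Λˢ - 1, Nᵏ = 0 gives Eᵏ I = 0, so Eᵏ has equal columns and Eᵏ (Λˢ - 1) = 0. By
      -- `E-kernel` a nilpotent E is zero: a permutation matrix is semisimple at the eigenvalue 1.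
      nilpotent⇒fixed : Nilpotent (N s) → ∀ v → pow σ s v ≡ v
      nilpotent⇒fixed (k , Nᵏ≈0) v = δ-≢0 λ eq → contradiction
          (trans (cong₂ _-_ (sym (δ-refl (τ v))) (sym eq)) (E≈0 (τ v) v)) λ ()
        where
        EI≈0 : ((E s ^M k) ⊗ I) ≈M 0M
        EI≈0 i j = begin
          ((E s ^M k) ⊗ I) i j
            ≡⟨ ⊗-congˡ (E s ^M k) (≈M-sym YU) i j ⟩
          ((E s ^M k) ⊗ (Y ⊗ U)) i j
            ≡⟨ sym (⊗-assoc (E s ^M k) Y U i j) ⟩
          (((E s ^M k) ⊗ Y) ⊗ U) i j
            ≡⟨ ⊗-congʳ U (λ a c → trans (sym (YNᵏ k a c)) (trans (⊗-congˡ Y Nᵏ≈0 a c) (⊗-zeroʳ Y a c))) i j ⟩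
          (0M ⊗ U) i j
            ≡⟨ ⊗-zeroˡ U i j ⟩
          + 0 ∎
        E≈0 : E s ≈M 0M
        E≈0 = E-nilpotent k λ i j → trans (^M-sucʳ (E s) k i j) (trans
          (dot--ʳ ((E s ^M k) i) (𝐞 (τ j)) (𝐞 j))
          (trans (cong₂ _-_ (trans (dot-𝐞ʳ ((E s ^M k) i) (τ j)) (columns-equal (E s ^M k) EI≈0 i (τ j) j)) (dot-𝐞ʳ ((E s ^M k) i) j))
            (ℤP.+-inverseʳ ((E s ^M k) i j))))

    Ψ-trace : ∀ s → tr (Ψ ^M s) ≡ + n - (+ M - ∑ (λ i → δ i (pow σ s i)))
    Ψ-trace s = begin
        tr (Ψ ^M s)
          ≡⟨ trans (tr-cong (Ψ-power s)) (∑-- (λ i → Id i i) (λ i → (X ⊗ (S s ⊗ Y)) i i)) ⟩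
        tr (Id {n}) - tr (X ⊗ (S s ⊗ Y))
          ≡⟨ cong₂ _-_ (tr-Id n) (trans (tr-cong (λ i j → sym (⊗-assoc X (S s) Y i j))) (tr-⊗ (X ⊗ S s) Y)) ⟩
        + n - tr (Y ⊗ (X ⊗ S s))
          ≡⟨ cong (λ z → + n - z) (tr-cong (λ i j → trans (sym (⊗-assoc Y X (S s) i j)) (YXS' s i j))) ⟩
        + n - ∑ (λ i → δ i i - δ i (pow σ s i))
          ≡⟨ cong (λ z → + n - z) (trans (∑-- (λ i → δ i i) (λ i → δ i (pow σ s i)))
               (cong (_- ∑ (λ i → δ i (pow σ s i))) (tr-Id M))) ⟩
        + n - (+ M - ∑ (λ i → δ i (pow σ s i))) ∎

    -- Sylvester's identity at z = x - 1, because x - Ψ = z + X Y and x - Λ = z + Y X.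
    charPoly-Ψ : ∀ x → (x - + 1) ℤ.^ M * evalP (charPoly Ψ) x
                       ≡ (x - + 1) ℤ.^ n * det (λ i j → x * δ i j - δ i (σ j))
    charPoly-Ψ x = begin
        z ℤ.^ M * evalP (charPoly Ψ) x
          ≡⟨ cong (z ℤ.^ M *_) (trans (evalP-charPoly x Ψ) (det-cong λ i j →
               trans (cong (λ t → x * δ i j - t) (Ψ≈ i j)) (lemma x (δ i j) ((X ⊗ Y) i j)))) ⟩
        z ℤ.^ M * det (scal z ⊕ (X ⊗ Y))
          ≡⟨ det-sylvester X Y z ⟩
        z ℤ.^ n * det (scal z ⊕ (Y ⊗ X))
          ≡⟨ cong (z ℤ.^ n *_) (det-cong λ i j → trans (cong (_+_ (scal z i j)) (YX i j)) (lemma' x (δ i j) (δ i (σ j)))) ⟩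
        z ℤ.^ n * det (λ i j → x * δ i j - δ i (σ j)) ∎
      where
      z = x - + 1
      lemma : ∀ x d t → x * d - (d - t) ≡ (x - + 1) * d + t
      lemma = solve-∀
      lemma' : ∀ x d t → (x - + 1) * d + (d - t) ≡ x * d - t
      lemma' = solve-∀

open Spectral

-- Coxeter numbers, Coxeter polynomial and algebraic multiplicity.

module CoxeterInvariants where

  open import Data.Integer using (_+_; _*_; _-_)
  open import Data.Nat.Divisibility using (_∣_; _∣?_; divides; ∣-trans; ∣⇒≤; m%n≡0⇒n∣m)
  open import Data.Nat.DivMod using (m≡m%n+[m/n]*n; m%n<n)
  open import Data.Nat.GCD using (gcd)
  open import Data.Nat.LCM using (lcm; m∣lcm[m,n]; n∣lcm[m,n]; lcm-least; gcd*lcm)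

  period-divides : ∀ {A : Set} {g : A → A} {v p} → Period g v p → ∀ s → pow g s v ≡ v → p ∣ s
  period-divides {g = g} {v} {suc p} (_ , gp , least) s gs = m%n≡0⇒n∣m s (suc p) (zero? (s ℕ.% suc p) (m%n<n s (suc p)) back)
    where
    back : pow g (s ℕ.% suc p) v ≡ v
    back = trans (sym (cong (pow g (s ℕ.% suc p)) (pow-multiple g gp (s ℕ./ suc p))))
      (trans (sym (pow-+ g (s ℕ.% suc p) (s ℕ./ suc p ℕ.* suc p) v))
        (trans (cong (λ k → pow g k v) (sym (m≡m%n+[m/n]*n s (suc p)))) gs))
    zero? : ∀ r → r ℕ.< suc p → pow g r v ≡ v → r ≡ 0
    zero? zero    _   _  = refl
    zero? (suc r) r<p gr = contradiction gr (least (suc r) (s≤s z≤n) r<p)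

  pow-divides : ∀ {A : Set} {g : A → A} {v p} → pow g p v ≡ v → ∀ {s} → p ∣ s → pow g s v ≡ v
  pow-divides {g = g} gp (divides k refl) = pow-multiple g gp k

  part∣lcm : ∀ π v → part π v ∣ lcmList π
  part∣lcm (p ∷ π) = ↑-cases p (λ v → part (p ∷ π) v ∣ lcmList (p ∷ π))
    (λ i → subst (_∣ lcmList (p ∷ π)) (sym (cong [ (λ _ → p) , part π ]′ (FinP.splitAt-↑ˡ p i (sum π)))) (m∣lcm[m,n] p (lcmList π)))
    (λ j → subst (_∣ lcmList (p ∷ π)) (sym (cong [ (λ _ → p) , part π ]′ (FinP.splitAt-↑ʳ p (sum π) j)))
             (∣-trans (part∣lcm π j) (n∣lcm[m,n] p (lcmList π))))

  lcm∣ : ∀ π → All (0 ℕ.<_) π → ∀ {s} → (∀ v → part π v ∣ s) → lcmList π ∣ s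
  lcm∣ []          []        {s} _  = divides s (sym (ℕP.*-identityʳ s))
  lcm∣ (suc p ∷ π) (_ ∷ pos) {s} ∣s = lcm-least (∣s zero) (lcm∣ π pos λ v →
    subst (_∣ s) (cong [ (λ _ → suc p) , part π ]′ (FinP.splitAt-↑ʳ (suc p) (sum π) v)) (∣s (suc p ↑ʳ v)))

  lcmList>0 : ∀ π → All (0 ℕ.<_) π → 0 ℕ.< lcmList π
  lcmList>0 []      []          = s≤s z≤n
  lcmList>0 (p ∷ π) (0<p ∷ pos) = ℕP.n≢0⇒n>0 λ eq → contradiction
    (trans (sym (gcd*lcm p (lcmList π))) (trans (cong (gcd p (lcmList π) ℕ.*_) eq) (ℕP.*-zeroʳ (gcd p (lcmList π)))))
    (ℕP.<⇒≢ (ℕP.*-mono-< 0<p (lcmList>0 π pos)) ∘ sym)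

  module Invariants {n : ℕ} (p : ℕ) (ρ : List ℕ) (pos : All (0 ℕ.<_) ρ)
                    (L : Lat n (sum (suc p ∷ ρ)) (std (suc p ∷ ρ))) where

    π = suc p ∷ ρ
    σ = std π

    pos-π : All (0 ℕ.<_) π
    pos-π = s≤s z≤n ∷ pos

    cs : Cycles (sum π) (length π) σ
    cs = std-cycles π pos-π

    returns : ∀ v → ∃[ k ] (0 ℕ.< k × pow σ k v ≡ v)
    returns v = part π v , proj₁ (std-period π v) , proj₁ (proj₂ (std-period π v))

    open SpectralTheory L (std-injective π) returns public
    open Cycles cs

    reduced-coxeter-number : ReducedCoxeterNumber Ψ (lcmList π)
    reduced-coxeter-number =
      (lcmList>0 π pos-π , fixed⇒nilpotent (lcmList π) (λ v → pow-divides (proj₂ (proj₂ (returns v))) (part∣lcm π v))) ,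
      λ s (0<s , nil) → ∣⇒≤ {{ℕ.>-nonZero 0<s}} (lcm∣ π pos-π λ v → period-divides (std-period π v) s (nilpotent⇒fixed s nil v))

    fixed-points : ∀ s → ∑ (λ i → δ i (pow σ s i)) ≡ divSum s π
    fixed-points s = trans (∑-cong λ i → ind-cong (i Fin.≟ pow σ s i) (part π i ∣? s)
        (λ eq → period-divides (std-period π i) s (sym eq)) (λ p∣s → sym (pow-divides (proj₂ (proj₂ (returns i))) p∣s)))
      (∑-part π (λ p → ind (p ∣? s)))

    power-Id⇒≤ : ∀ s → 0 ℕ.< s → (Ψ ^M s) ≈M Id → suc p ℕ.≤ s
    power-Id⇒≤ s 0<s Ψˢ≈1 = ℕP.≮⇒≥ λ s<p → proj₂ (proj₂ (cycleF-period (std ρ) p)) s 0<s s<p (power-Id⇒fixed s Ψˢ≈1 zero)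

    -- Column u of S counts s iterates of u, and all of them lie in the cycle of u.
    cycle-sum : ∀ s u → ∑ (λ i → δ (κ i) zero * S s i u) ≡ + s * δ (κ u) zero
    cycle-sum s u = begin
        ∑ (λ i → δ (κ i) zero * S s i u)
          ≡⟨ ∑-cong (λ i → sym (∑-*ˡ {s} (δ (κ i) zero) (λ k → δ i (pow σ (toℕ k) u)))) ⟩
        ∑ (λ i → ∑ {s} (λ k → δ (κ i) zero * δ i (pow σ (toℕ k) u)))
          ≡⟨ ∑-swap {M} {s} (λ i k → δ (κ i) zero * δ i (pow σ (toℕ k) u)) ⟩
        ∑ {s} (λ k → ∑ (λ i → δ (κ i) zero * δ i (pow σ (toℕ k) u)))
          ≡⟨ ∑-cong {s} (λ k → trans (∑-δʳ (pow σ (toℕ k) u) (λ i → δ (κ i) zero)) (cong (λ j → δ j zero) (κ-pow (toℕ k)))) ⟩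
        ∑ {s} (λ k → δ (κ u) zero)
          ≡⟨ ∑-const {s} (δ (κ u) zero) ⟩
        + s * δ (κ u) zero ∎
      where
      open ≡-Reasoning
      κ-pow : ∀ k → κ (pow σ k u) ≡ κ u
      κ-pow zero    = refl
      κ-pow (suc k) = trans (κ-σ (pow σ k u)) (κ-pow k)

    -- If Ψˢ = 1, all columns of S agree; but their sums over cycle 0 are s for a vertex of that
    -- cycle and 0 for a vertex of another.
    two-cycles : ∀ (j : Fin (length ρ)) s → 0 ℕ.< s → ¬ ((Ψ ^M s) ≈M Id)
    two-cycles j s 0<s Ψˢ≈1 = ℕP.<⇒≢ 0<s (sym (ℤP.+-injective (begin
        + s
          ≡⟨ sym (ℤP.*-identityʳ (+ s)) ⟩
        + s * + 1
          ≡⟨ sym (cycle-sum s zero) ⟩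
        ∑ (λ i → δ (κ i) zero * S s i zero)
          ≡⟨ ∑-cong (λ i → cong (δ (κ i) zero *_) (power-Id⇒ s Ψˢ≈1 i zero (rep (suc j)))) ⟩
        ∑ (λ i → δ (κ i) zero * S s i (rep (suc j)))
          ≡⟨ trans (cycle-sum s (rep (suc j))) (cong (λ k → + s * δ k zero) (κ-rep (suc j))) ⟩
        + s * + 0
          ≡⟨ ℤP.*-zeroʳ (+ s) ⟩
        + 0 ∎)))
      where open ≡-Reasoning

    -- With m = n - c + 1 and z = x - 1, Sylvester's identity reads zᵐ φ(x) = zⁿ ∏ (x^πₜ - 1).
    charPoly-value : ∀ c → suc n ≡ sum π ℕ.+ c → ∀ k → let x = + (2 ℕ.+ k) in
      evalP (charPoly Ψ) x * (x - + 1) ≡ (x - + 1) ℤ.^ c * cyclotomic x π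
    charPoly-value c n+1≡ k = ℤP.i-j≡0⇒i≡j _ _ (*-nonzero-cancelˡ (z ℤ.^ sum π) _ z^≢0 (begin
        z ℤ.^ sum π * (φx * z - z ℤ.^ c * cyclotomic x π)
          ≡⟨ lemma (z ℤ.^ sum π) φx z (z ℤ.^ c) (cyclotomic x π) ⟩
        z * (z ℤ.^ sum π * φx) - (z ℤ.^ sum π * z ℤ.^ c) * cyclotomic x π
          ≡⟨ cong₂ _-_ (cong (z *_) (trans (charPoly-Ψ x) (cong (z ℤ.^ n *_) (det-std x π pos-π))))
               (cong (_* cyclotomic x π) (trans (sym (ℤP.^-distribˡ-+-* z (sum π) c)) (cong (z ℤ.^_) (sym n+1≡)))) ⟩
        z * (z ℤ.^ n * cyclotomic x π) - z ℤ.^ suc n * cyclotomic x π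
          ≡⟨ lemma' z (z ℤ.^ n) (cyclotomic x π) ⟩
        + 0 ∎))
      where
      open ≡-Reasoning
      x = + (2 ℕ.+ k)
      z = x - + 1
      φx = evalP (charPoly Ψ) x
      z^≢0 : z ℤ.^ sum π ≢ + 0
      z^≢0 eq = contradiction (ℤP.i^n≡0⇒i≡0 z (sum π) eq) λ ()
      lemma : ∀ a b z c d → a * (b * z - c * d) ≡ z * (a * b) - (a * c) * d
      lemma = solve-∀
      lemma' : ∀ z a d → z * (a * d) - (z * a) * d ≡ + 0
      lemma' = solve-∀

    evalP-X-1 : ∀ x → evalP (XkMinus1 1) x ≡ x - + 1
    evalP-X-1 x = trans (evalP-XkMinus1 x 1) (cong (_- + 1) (ℤP.*-identityʳ x))

    evalP-X-1^ : ∀ x c → evalP (XkMinus1 1 ^P c) x ≡ (x - + 1) ℤ.^ c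
    evalP-X-1^ x c = trans (evalP-^P x (XkMinus1 1) c) (cong (ℤ._^ c) (evalP-X-1 x))

    -- One factor λ - 1 stands on the left so that the exponent c - 1 does not become negative for c
    -- = 0.
    charPoly-formula : ∀ c → suc n ≡ sum π ℕ.+ c →
      (charPoly Ψ *P XkMinus1 1) ≈P ((XkMinus1 1 ^P c) *P prodP (map XkMinus1 π))
    charPoly-formula c n+1≡ = evalP-injective (charPoly Ψ *P XkMinus1 1) ((XkMinus1 1 ^P c) *P prodP (map XkMinus1 π)) λ k → begin
        evalP (charPoly Ψ *P XkMinus1 1) (+ (2 ℕ.+ k))
          ≡⟨ evalP-*P (+ (2 ℕ.+ k)) (charPoly Ψ) (XkMinus1 1) ⟩
        evalP (charPoly Ψ) (+ (2 ℕ.+ k)) * evalP (XkMinus1 1) (+ (2 ℕ.+ k))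
          ≡⟨ cong (evalP (charPoly Ψ) (+ (2 ℕ.+ k)) *_) (evalP-X-1 (+ (2 ℕ.+ k))) ⟩
        evalP (charPoly Ψ) (+ (2 ℕ.+ k)) * (+ (2 ℕ.+ k) - + 1)
          ≡⟨ charPoly-value c n+1≡ k ⟩
        (+ (2 ℕ.+ k) - + 1) ℤ.^ c * cyclotomic (+ (2 ℕ.+ k)) π
          ≡⟨ sym (cong₂ _*_ (evalP-X-1^ (+ (2 ℕ.+ k)) c) (evalP-cyclotomic (+ (2 ℕ.+ k)) π)) ⟩
        evalP (XkMinus1 1 ^P c) (+ (2 ℕ.+ k)) * evalP (prodP (map XkMinus1 π)) (+ (2 ℕ.+ k))
          ≡⟨ sym (evalP-*P (+ (2 ℕ.+ k)) (XkMinus1 1 ^P c) (prodP (map XkMinus1 π))) ⟩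
        evalP ((XkMinus1 1 ^P c) *P prodP (map XkMinus1 π)) (+ (2 ℕ.+ k)) ∎
      where open ≡-Reasoning

    -- Each of the ℓ parts adds one factor λ - 1 to the exponent c - 1, giving c + (ℓ - 1) in total;
    -- the remaining `cofactor` does not vanish at 1.
    algebraic-multiplicity : ∀ c → suc n ≡ sum π ℕ.+ c → AlgMult1 Ψ (c ℕ.+ length ρ)
    algebraic-multiplicity c n+1≡ = cofactor π ,
      evalP-injective (charPoly Ψ) ((XkMinus1 1 ^P (c ℕ.+ length ρ)) *P cofactor π) (λ k →
        let x = + (2 ℕ.+ k); z = x - + 1 in
        trans (ℤP.i-j≡0⇒i≡j _ _ (*-nonzero-cancelˡ z _ (λ ()) (begin
          z * (evalP (charPoly Ψ) x - z ℤ.^ (c ℕ.+ length ρ) * evalP (cofactor π) x)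
            ≡⟨ cong (λ t → z * (evalP (charPoly Ψ) x - t * evalP (cofactor π) x)) (ℤP.^-distribˡ-+-* z c (length ρ)) ⟩
          z * (evalP (charPoly Ψ) x - (z ℤ.^ c * z ℤ.^ length ρ) * evalP (cofactor π) x)
            ≡⟨ lemma z (evalP (charPoly Ψ) x) (z ℤ.^ c) (z ℤ.^ length ρ) (evalP (cofactor π) x) ⟩
          evalP (charPoly Ψ) x * z - z ℤ.^ c * (z ℤ.^ length π * evalP (cofactor π) x)
            ≡⟨ cong₂ _-_ (charPoly-value c n+1≡ k) (cong (z ℤ.^ c *_) (evalP-cofactor x π)) ⟩
          z ℤ.^ c * cyclotomic x π - z ℤ.^ c * cyclotomic x π
            ≡⟨ ℤP.+-inverseʳ (z ℤ.^ c * cyclotomic x π) ⟩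
          + 0 ∎)))
        (sym (trans (evalP-*P x (XkMinus1 1 ^P (c ℕ.+ length ρ)) (cofactor π))
          (cong (_* evalP (cofactor π) x) (evalP-X-1^ x (c ℕ.+ length ρ)))))) ,
      cofactor-1 π pos-π
      where
      open ≡-Reasoning
      lemma : ∀ z f a b g → z * (f - (a * b) * g) ≡ f * z - a * ((z * b) * g)
      lemma = solve-∀

  -- For a single cycle, σ^(p+1) = 1 makes the columns of S equal along the cycle, hence all equal,
  -- which is the criterion for Ψ^(p+1) = 1; a smaller exponent moves vertex 0.
  coxeter-number : ∀ {n} p ρ (pos : All (0 ℕ.<_) ρ) (L : Lat n (sum (suc p ∷ ρ)) (std (suc p ∷ ρ))) →
                   CoxeterNumber (negM ((Lat.U L ᵀ) ⊗ Lat.V L)) (coxNumberOf (suc p ∷ ρ))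
  coxeter-number p []      pos L = (s≤s z≤n , power-Id⇐ (suc p) λ i u v → trans (to-rep i u) (sym (to-rep i v))) ,
      λ s (0<s , Ψˢ≈1) → power-Id⇒≤ s 0<s Ψˢ≈1
    where
    open Invariants p [] pos L
    open Cycles cs
    fixed : ∀ u → pow σ (suc p) u ≡ u
    fixed = ↑-cases (suc p) (λ u → pow σ (suc p) u ≡ u)
      (λ i → proj₁ (proj₂ (cycleF-periodˡ (std []) (std-injective []) p i))) (λ ())
    S-σ : ∀ i u → S (suc p) i (σ u) ≡ S (suc p) i u
    S-σ i u = trans (S-shift (suc p) i u) (trans (cong (λ w → S (suc p) i u - δ i u + δ i w) (fixed u)) (lemma (S (suc p) i u) (δ i u)))
      where
      lemma : ∀ a b → a - b + b ≡ a
      lemma = solve-∀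
    S-pow : ∀ i k u → S (suc p) i (pow σ k u) ≡ S (suc p) i u
    S-pow i zero    u = refl
    S-pow i (suc k) u = trans (S-σ i (pow σ k u)) (S-pow i k u)
    single : ∀ (j : Fin 1) → rep j ≡ rep zero
    single zero = refl
    to-rep : ∀ i u → S (suc p) i u ≡ S (suc p) i (rep zero)
    to-rep i u = trans (cong (S (suc p) i) (sym (proj₂ (path u))))
      (trans (S-pow i (proj₁ (path u)) (rep (κ u))) (cong (S (suc p) i) (single (κ u))))
  coxeter-number p (q ∷ ρ) pos L = Invariants.two-cycles p (q ∷ ρ) pos L zero

open CoxeterInvariants

-- Unit forms of Dynkin type A as quiver forms, and conversely.

module Realisations where

  open import Data.Integer using (_+_; _*_; _-_)

  δ-toℕ : ∀ {n} {i j : Fin n} → toℕ i ≡ toℕ j → δ i j ≡ + 1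
  δ-toℕ {i = i} eq = trans (cong (δ i) (sym (FinP.toℕ-injective eq))) (δ-refl i)

  δ-toℕ-≢ : ∀ {n} {i j : Fin n} → toℕ i ≢ toℕ j → δ i j ≡ + 0
  δ-toℕ-≢ neq = δ-≢ (neq ∘ cong toℕ)

  -- 𝔻 eⱼ = eⱼ - eⱼ₊₁ embeds the root lattice of type A_k into ℤ^{k+1}; 𝔼 is a left inverse.
  𝔻 : ∀ k → Mat (suc k) k
  𝔻 k u j = δ u (inject₁ j) - δ u (suc j)

  𝔼 : ∀ k → Mat k (suc k)
  𝔼 k       i       zero    = + 0
  𝔼 (suc k) zero    (suc v) = - (+ 1)
  𝔼 (suc k) (suc i) (suc v) = 𝔼 k i v

  𝔻𝔼 : ∀ k u v → (𝔻 k ⊗ 𝔼 k) u v ≡ δ u v - δ u zero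
  𝔻𝔼 k u zero = trans (∑-zero λ j → ℤP.*-zeroʳ (𝔻 k u j)) (sym (ℤP.+-inverseʳ (δ u zero)))
  𝔻𝔼 (suc k) zero (suc v) = cong (_+_ (- (+ 1))) (∑-zero {k} λ j → refl)
  𝔻𝔼 (suc k) (suc u) (suc v) = begin
      (+ 0 - δ (suc u) (suc zero)) * - (+ 1)
        + ∑ (λ j → (δ (suc u) (suc (inject₁ j)) - δ (suc u) (suc (suc j))) * 𝔼 k j v)
        ≡⟨ cong₂ _+_ (trans (lemma (δ (suc u) (suc zero))) (δ-suc u zero))
             (∑-cong λ j → cong (_* 𝔼 k j v) (cong₂ _-_ (δ-suc u (inject₁ j)) (δ-suc u (suc j)))) ⟩
      δ u zero + (𝔻 k ⊗ 𝔼 k) u v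
        ≡⟨ cong (_+_ (δ u zero)) (𝔻𝔼 k u v) ⟩
      δ u zero + (δ u v - δ u zero)
        ≡⟨ lemma' (δ u zero) (δ u v) ⟩
      δ u v
        ≡⟨ sym (trans (ℤP.+-identityʳ _) (δ-suc u v)) ⟩
      δ (suc u) (suc v) - + 0 ∎
    where
    open ≡-Reasoning
    lemma : ∀ a → (+ 0 - a) * - (+ 1) ≡ a
    lemma = solve-∀
    lemma' : ∀ a b → a + (b - a) ≡ b
    lemma' = solve-∀

  𝔻-dot : ∀ k j (w : Vecℤ (suc k)) → dot (λ u → 𝔻 k u j) w ≡ w (inject₁ j) - w (suc j)
  𝔻-dot k j w = trans (dot--ˡ (𝐞 (inject₁ j)) (𝐞 (suc j)) w) (cong₂ _-_ (dot-𝐞ˡ (inject₁ j) w) (dot-𝐞ˡ (suc j) w))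

  𝔼𝔻 : ∀ k → (𝔼 k ⊗ 𝔻 k) ≈M Id
  𝔼𝔻 k i j = trans (dot-comm (𝔼 k i) (λ u → 𝔻 k u j)) (trans (𝔻-dot k j (𝔼 k i)) (step k i j))
    where
    step : ∀ k i j → 𝔼 k i (inject₁ j) - 𝔼 k i (suc j) ≡ δ i j
    step (suc k) zero    zero    = refl
    step (suc k) zero    (suc j) = refl
    step (suc k) (suc i) zero    = refl
    step (suc k) (suc i) (suc j) = trans (step k i j) (sym (δ-suc i j))

  𝔻-colsum : ∀ k j → ∑ (λ u → 𝔻 k u j) ≡ + 0
  𝔻-colsum k j = trans (∑-- (λ u → δ u (inject₁ j)) (λ u → δ u (suc j))) (cong₂ _-_ (∑-δ (inject₁ j)) (∑-δ (suc j)))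

  GA≈ : ∀ k → GA k ≈M ((𝔻 k ᵀ) ⊗ 𝔻 k)
  GA≈ k i j = trans (entry i j) (sym (𝔻-dot k i (λ u → 𝔻 k u j)))
    where
    value : ∀ {a b c d a' b' c' d' : ℤ} → a ≡ a' → b ≡ b' → c ≡ c' → d ≡ d' → (a - b) - (c - d) ≡ (a' - b') - (c' - d')
    value refl refl refl refl = refl
    inj-inj : ∀ {i j : Fin k} → δ (inject₁ i) (inject₁ j) ≡ δ i j
    inj-inj {i} {j} = δ-inj inject₁ FinP.inject₁-injective i j
    entry : ∀ i j → GA k i j ≡ (δ (inject₁ i) (inject₁ j) - δ (inject₁ i) (suc j)) - (δ (suc i) (inject₁ j) - δ (suc i) (suc j))
    entry i j with toℕ i ℕ.≟ toℕ j | suc (toℕ i) ℕ.≟ toℕ j | suc (toℕ j) ℕ.≟ toℕ i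
    ... | yes i≡j | _ | _ = sym (value (trans inj-inj (δ-toℕ i≡j))
        (δ-toℕ-≢ λ eq → ℕP.<-irrefl (trans (sym i≡j) (trans (sym (FinP.toℕ-inject₁ i)) eq)) ℕP.≤-refl)
        (δ-toℕ-≢ λ eq → ℕP.<-irrefl (trans i≡j (trans (sym (FinP.toℕ-inject₁ j)) (sym eq))) ℕP.≤-refl)
        (δ-toℕ (cong suc i≡j)))
    ... | no i≢j | yes i+1≡j | _ = sym (value (trans inj-inj (δ-toℕ-≢ i≢j))
        (δ-toℕ-≢ λ eq → ℕP.<-irrefl (trans (sym (FinP.toℕ-inject₁ i)) eq) (ℕP.m≤n⇒m≤1+n (ℕP.≤-reflexive i+1≡j)))
        (δ-toℕ (trans i+1≡j (sym (FinP.toℕ-inject₁ j))))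
        (δ-toℕ-≢ (i≢j ∘ ℕP.suc-injective)))
    ... | no i≢j | no i+1≢j | yes j+1≡i = sym (value (trans inj-inj (δ-toℕ-≢ i≢j))
        (δ-toℕ (trans (FinP.toℕ-inject₁ i) (sym j+1≡i)))
        (δ-toℕ-≢ λ eq → i+1≢j (trans eq (FinP.toℕ-inject₁ j)))
        (δ-toℕ-≢ (i≢j ∘ ℕP.suc-injective)))
    ... | no i≢j | no i+1≢j | no j+1≢i = sym (value (trans inj-inj (δ-toℕ-≢ i≢j))
        (δ-toℕ-≢ λ eq → j+1≢i (trans (sym eq) (FinP.toℕ-inject₁ i)))
        (δ-toℕ-≢ λ eq → i+1≢j (trans eq (FinP.toℕ-inject₁ j)))
        (δ-toℕ-≢ (i≢j ∘ ℕP.suc-injective)))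

  -- Otherwise all entries are ≤ 0 with sum zero, hence all zero.
  positive-entry : ∀ {m} (a : Vecℤ m) → ∑ a ≡ + 0 → dot a a ≢ + 0 → ∃[ i ] (+ 0 ℤ.< a i)
  positive-entry a a≡0 aa≢0 with FinP.any? (λ i → + 0 ℤ.<? a i)
  ... | yes found = found
  ... | no none = contradiction (dot-0ʳ a λ i → trans (sym (ℤP.neg-involutive (a i))) (cong -_ (zeros i))) aa≢0
    where
    zeros : ∀ i → - a i ≡ + 0
    zeros = ∑-≥0-≡0 (λ i → ℤP.neg-mono-≤ (ℤP.≮⇒≥ (λ 0<ai → none (i , 0<ai)))) (trans (∑-neg a) (cong -_ a≡0))

  -- For a positive entry aₛ and a negative entry aₜ, the norm of a - eₛ + eₜ is 4 - 2 (aₛ - aₜ) ≤ 0.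
  root : ∀ {m} (a : Vecℤ m) → ∑ a ≡ + 0 → dot a a ≡ + 2 → ∃[ i ] ∃[ j ] (i ≢ j × a ≈V (𝐞 i -V 𝐞 j))
  root {m} a a≡0 aa≡2 = i , j , i≢j , λ l → ℤP.i-j≡0⇒i≡j (a l) (f l) (dot-self-≡0 (a -V f) (ℤP.≤-antisym norm≤0 (∑-≥0 λ l → square-≥0 ((a -V f) l))) l)
    where
    open ≡-Reasoning
    aa≢0 : dot a a ≢ + 0
    aa≢0 eq = contradiction (trans (sym aa≡2) eq) λ ()
    pos = positive-entry a a≡0 aa≢0
    neg = positive-entry (λ l → - a l) (trans (∑-neg a) (cong -_ a≡0))
            (λ eq → aa≢0 (trans (∑-cong λ l → sym (neg-square (a l))) eq))
      where
      neg-square : ∀ x → - x * - x ≡ x * x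
      neg-square = solve-∀
    i = proj₁ pos
    j = proj₁ neg
    i≢j : i ≢ j
    i≢j i≡j = ℤP.<-asym (proj₂ pos) (ℤP.neg-cancel-< (subst (λ l → + 0 ℤ.< - a l) (sym i≡j) (proj₂ neg)))
    f = 𝐞 i -V 𝐞 j
    dot-af : dot a f ≡ a i - a j
    dot-af = trans (dot--ʳ a (𝐞 i) (𝐞 j)) (cong₂ _-_ (dot-𝐞ʳ a i) (dot-𝐞ʳ a j))
    dot-ff : dot f f ≡ + 2
    dot-ff = trans (dot--ˡ (𝐞 i) (𝐞 j) f) (trans (cong₂ _-_ (dot-𝐞ˡ i f) (dot-𝐞ˡ j f))
      (cong₂ _-_ (cong₂ _-_ (δ-refl i) (δ-≢ i≢j)) (cong₂ _-_ (δ-≢ (i≢j ∘ sym)) (δ-refl j))))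
    norm : dot (a -V f) (a -V f) ≡ (+ 1 - a i) + (+ 1 - a i) + ((+ 1 + a j) + (+ 1 + a j))
    norm = begin
      dot (a -V f) (a -V f)
        ≡⟨ trans (dot--ˡ a f (a -V f)) (cong₂ _-_ (dot--ʳ a a f) (dot--ʳ f a f)) ⟩
      (dot a a - dot a f) - (dot f a - dot f f)
        ≡⟨ cong₂ (λ p q → (p - dot a f) - (dot f a - q)) aa≡2 dot-ff ⟩
      (+ 2 - dot a f) - (dot f a - + 2)
        ≡⟨ cong₂ (λ p q → (+ 2 - p) - (q - + 2)) dot-af (trans (dot-comm f a) dot-af) ⟩
      (+ 2 - (a i - a j)) - ((a i - a j) - + 2)
        ≡⟨ lemma (a i) (a j) ⟩
      (+ 1 - a i) + (+ 1 - a i) + ((+ 1 + a j) + (+ 1 + a j)) ∎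
      where
      lemma : ∀ p q → (+ 2 - (p - q)) - ((p - q) - + 2) ≡ (+ 1 - p) + (+ 1 - p) + ((+ 1 + q) + (+ 1 + q))
      lemma = solve-∀
    nonpos : ∀ x → + 0 ℤ.< x → + 1 - x ℤ.≤ + 0
    nonpos x 0<x = ℤP.i≤j⇒i-j≤0 (ℤP.i<j⇒suc[i]≤j 0<x)
    1-ai = nonpos (a i) (proj₂ pos)
    1+aj : + 1 + a j ℤ.≤ + 0
    1+aj = subst (λ z → + 1 + z ℤ.≤ + 0) (ℤP.neg-involutive (a j)) (nonpos (- a j) (proj₂ neg))
    norm≤0 : dot (a -V f) (a -V f) ℤ.≤ + 0
    norm≤0 = subst (ℤ._≤ + 0) (sym norm) (ℤP.+-mono-≤ (ℤP.+-mono-≤ 1-ai 1-ai) (ℤP.+-mono-≤ 1+aj 1+aj))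

  Reach-trans : ∀ {V : Set} {E : V → V → Set} {u v w} → Reach E u v → Reach E v w → Reach E u w
  Reach-trans here        q = q
  Reach-trans (there e p) q = there e (Reach-trans p q)

  Reach-sym : ∀ {V : Set} {E : V → V → Set} → (∀ {a b} → E a b → E b a) → ∀ {u v} → Reach E u v → Reach E v u
  Reach-sym flip here        = here
  Reach-sym flip (there e p) = Reach-trans (Reach-sym flip p) (there (flip e) here)

  Reach-map : ∀ {V W : Set} {E : V → V → Set} {F : W → W → Set} (f : V → W) → (∀ {a b} → E a b → Reach F (f a) (f b)) →
              ∀ {u v} → Reach E u v → Reach F (f u) (f v)
  Reach-map f g here        = here
  Reach-map f g (there e p) = Reach-trans (g e) (Reach-map f g p)

  Edge-sym : ∀ {m n} (Q : Quiver m n) {a b} → Edge Q a b → Edge Q b a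
  Edge-sym Q (i , inj₁ e) = i , inj₂ e
  Edge-sym Q (i , inj₂ e) = i , inj₁ e

  tail-reach : ∀ {m n} (Q : Quiver m (suc n)) {u v} → Reach (Edge (tailQ Q)) u v → Reach (Edge Q) u v
  tail-reach Q = Reach-map id λ (i , e) → there (suc i , e) here

  -- Labels are merged along one arrow at a time. They supply the indicator functions by which a
  -- disconnected quiver is detected.
  components : ∀ {m n} (Q : Quiver m n) → Σ (Fin m → Fin m) λ lab →
    (∀ i → lab (s Q i) ≡ lab (t Q i)) × (∀ u v → lab u ≡ lab v → Reach (Edge Q) u v)
  components {n = zero}  Q = id , (λ ()) , λ { u .u refl → here }
  components {m} {suc n} Q = lab , constant , reach
    where
    IH = components (tailQ Q)
    lab' = proj₁ IH
    a = s Q zero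
    b = t Q zero
    merge : Fin m → Fin m
    merge x with x Fin.≟ lab' a
    ... | yes _ = lab' b
    ... | no _  = x
    lab = merge ∘ lab'
    reach' : ∀ u v → lab' u ≡ lab' v → Reach (Edge Q) u v
    reach' u v eq = tail-reach Q (proj₂ (proj₂ IH) u v eq)
    ab : Reach (Edge Q) a b
    ab = there (zero , inj₁ (refl , refl)) here
    constant : ∀ i → lab (s Q i) ≡ lab (t Q i)
    constant (suc i) = cong merge (proj₁ (proj₂ IH) i)
    constant zero with lab' a Fin.≟ lab' a | lab' b Fin.≟ lab' a
    ... | yes _ | yes _ = refl
    ... | yes _ | no _  = refl
    ... | no ne | _     = contradiction refl ne
    reach : ∀ u v → lab u ≡ lab v → Reach (Edge Q) u v
    reach u v eq with lab' u Fin.≟ lab' a | lab' v Fin.≟ lab' a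
    ... | yes p | yes q = reach' u v (trans p (sym q))
    ... | yes p | no _  = Reach-trans (reach' u a p) (Reach-trans ab (reach' b v eq))
    ... | no _  | yes q = Reach-sym (Edge-sym Q) (Reach-trans (reach' v a q) (Reach-trans ab (reach' b u (sym eq))))
    ... | no _  | no _  = reach' u v eq

  Ǧ≈ǦQ : ∀ {m n} (q : UnitForm n) (Q : Quiver m n) → LoopLess Q → G q ≈M ((Inc Q ᵀ) ⊗ Inc Q) → Ǧ q ≈M ǦQ Q
  Ǧ≈ǦQ q Q ll G≈ i j with ℕP.<-cmp (toℕ i) (toℕ j)
  ... | tri< i<j _ _ = trans (sym (trans (cong (_+_ (Ǧ q i j)) (lower q j i i<j)) (ℤP.+-identityʳ _)))
                             (trans (G≈ i j) (sym (ǦQ-upper Q i j i<j)))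
  ... | tri> _ _ j<i = trans (lower q i j j<i) (sym (ǦQ-lower Q i j j<i))
  ... | tri≈ _ i≡j _ with FinP.toℕ-injective i≡j
  ...   | refl = trans (diag q i) (sym (ǦQ-diag Q ll i i refl))

  module _ {n k : ℕ} (q : UnitForm n) (dyn : DynkinTypeA q k) where

    private
      P = proj₁ dyn
      onto = proj₁ (proj₂ dyn)
      open ≡-Reasoning

      I : Mat (suc k) n
      I = 𝔻 k ⊗ P

      G≈ : G q ≈M ((I ᵀ) ⊗ I)
      G≈ i j = begin
        G q i j
          ≡⟨ proj₂ (proj₂ (proj₂ (proj₂ dyn))) i j ⟩
        ((P ᵀ) ⊗ (GA k ⊗ P)) i j
          ≡⟨ ⊗-congˡ (P ᵀ) (λ a c → trans (⊗-congʳ P (GA≈ k) a c) (⊗-assoc (𝔻 k ᵀ) (𝔻 k) P a c)) i j ⟩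
        ((P ᵀ) ⊗ ((𝔻 k ᵀ) ⊗ I)) i j
          ≡⟨ sym (⊗-assoc (P ᵀ) (𝔻 k ᵀ) I i j) ⟩
        (((P ᵀ) ⊗ (𝔻 k ᵀ)) ⊗ I) i j
          ≡⟨ ⊗-congʳ I (≈M-sym (ᵀ-⊗ (𝔻 k) P)) i j ⟩
        ((I ᵀ) ⊗ I) i j ∎

      -- A column of 𝔻 P has sum zero, and its norm is the diagonal entry 2 of the Gram matrix.
      roots : ∀ i → ∃[ a ] ∃[ b ] (a ≢ b × (λ u → I u i) ≈V (𝐞 a -V 𝐞 b))
      roots i = root (λ u → I u i)
        (trans (∑-swap (λ u l → 𝔻 k u l * P l i)) (∑-zero λ l → trans (∑-*ʳ (P l i) (λ u → 𝔻 k u l)) (cong (_* P l i) (𝔻-colsum k l))))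
        (trans (sym (G≈ i i)) (cong₂ _+_ (diag q i) (diag q i)))

    quiverOf : Quiver (suc k) n
    s quiverOf i = proj₁ (roots i)
    t quiverOf i = proj₁ (proj₂ (roots i))

    quiverOf-loopless : LoopLess quiverOf
    quiverOf-loopless i = proj₁ (proj₂ (proj₂ (roots i)))

    private
      Inc≈ : Inc quiverOf ≈M I
      Inc≈ u i = sym (proj₂ (proj₂ (proj₂ (roots i))) u)

    quiverOf-Ǧ : Ǧ q ≈M ǦQ quiverOf
    quiverOf-Ǧ = Ǧ≈ǦQ q quiverOf quiverOf-loopless λ i j → trans (G≈ i j)
      (∑-cong λ u → sym (cong₂ _*_ (Inc≈ u i) (Inc≈ u j)))

    -- As P is onto, e_u - e_v lies in the image of I. The indicator χ of the component of u is
    -- constant along arrows, so it pairs to zero with that image; but if v lay outside the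
    -- component, its value on e_u - e_v would be 1.
    quiverOf-connected : QConnected quiverOf
    quiverOf-connected u v = proj₂ (proj₂ comp) u v (sym (δ-≢0 λ eq → contradiction (trans (sym (value eq)) zero-value) λ ()))
      where
      comp = components quiverOf
      lab = proj₁ comp
      χ : Vecℤ (suc k)
      χ w = δ (lab w) (lab u)
      d = 𝐞 u -V 𝐞 v
      y = 𝔼 k · d
      x = proj₁ (onto y)
      d-sum : ∑ d ≡ + 0
      d-sum = trans (∑-- (𝐞 u) (𝐞 v)) (cong₂ _-_ (∑-δ u) (∑-δ v))
      Ix : (I · x) ≈V d
      Ix w = begin
        (I · x) w
          ≡⟨ trans (·-⊗ (𝔻 k) P x w) (·-cong (𝔻 k) (proj₂ (onto y)) w) ⟩
        (𝔻 k · (𝔼 k · d)) w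
          ≡⟨ trans (sym (·-⊗ (𝔻 k) (𝔼 k) d w)) (dot-congˡ d (𝔻𝔼 k w)) ⟩
        dot (λ l → δ w l - δ w zero) d
          ≡⟨ dot--ˡ (δ w) (λ _ → δ w zero) d ⟩
        dot (δ w) d - ∑ (λ l → δ w zero * d l)
          ≡⟨ cong₂ _-_ (∑-δˡ w d) (trans (∑-*ˡ (δ w zero) d) (trans (cong (δ w zero *_) d-sum) (ℤP.*-zeroʳ (δ w zero)))) ⟩
        d w - + 0
          ≡⟨ ℤP.+-identityʳ (d w) ⟩
        d w ∎
      zero-value : dot χ d ≡ + 0
      zero-value = begin
        dot χ d
          ≡⟨ dot-congʳ χ (λ w → sym (Ix w)) ⟩
        dot χ (I · x)
          ≡⟨ dot-· I χ x ⟩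
        dot ((I ᵀ) · χ) x
          ≡⟨ dot-0ˡ x (λ i → trans (dot-congˡ χ (λ w → sym (Inc≈ w i))) (trans (inc-dot quiverOf i χ)
               (trans (cong (λ l → δ l (lab u) - χ (t quiverOf i)) (proj₁ (proj₂ comp) i)) (ℤP.+-inverseʳ (χ (t quiverOf i)))))) ⟩
        + 0 ∎
      value : δ (lab v) (lab u) ≡ + 0 → dot χ d ≡ + 1
      value eq = trans (dot--ʳ χ (𝐞 u) (𝐞 v)) (cong₂ _-_ (trans (dot-𝐞ʳ χ u) (δ-refl (lab u))) (trans (dot-𝐞ʳ χ v) eq))

  quiverForm : ∀ {m n} (Q : Quiver m n) → LoopLess Q → UnitForm n
  quiverForm Q ll = record { Ǧ = ǦQ Q ; diag = λ i → ǦQ-diag Q ll i i refl ; lower = ǦQ-lower Q }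

  module _ {m n : ℕ} (q : UnitForm n) (Q : Quiver m n) (ll : LoopLess Q) (Ǧ≈ : Ǧ q ≈M ǦQ Q) where

    private
      I = Inc Q

    G≈IᵀI : G q ≈M ((I ᵀ) ⊗ I)
    G≈IᵀI i j = trans (cong₂ _+_ (Ǧ≈ i j) (Ǧ≈ j i)) (ǦQ-sym Q ll i j)

    rad⇐ : ∀ x → (I · x) ≈V 0V → rad q x
    rad⇐ = gram-kernel⇐ (G q) I G≈IᵀI

    rad⇒ : ∀ x → rad q x → (I · x) ≈V 0V
    rad⇒ = gram-kernel⇒ (G q) I G≈IᵀI

    nonNegative : NonNegative q
    nonNegative x = ℤP.≮⇒≥ λ q<0 → contradiction
        (ℤP.≤-<-trans (∑-≥0 λ v → square-≥0 ((I · x) v)) (subst (ℤ._< + 0) double (ℤP.+-mono-< q<0 q<0))) (ℤP.<-irrefl refl)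
      where
      open ≡-Reasoning
      double : qval q x + qval q x ≡ dot (I · x) (I · x)
      double = begin
        dot x (Ǧ q · x) + dot x (Ǧ q · x)
          ≡⟨ cong (_+_ (dot x (Ǧ q · x))) (trans (dot-· (Ǧ q) x x) (dot-comm ((Ǧ q ᵀ) · x) x)) ⟩
        dot x (Ǧ q · x) + dot x ((Ǧ q ᵀ) · x)
          ≡⟨ sym (dot-+ʳ x (Ǧ q · x) ((Ǧ q ᵀ) · x)) ⟩
        dot x ((Ǧ q · x) +V ((Ǧ q ᵀ) · x))
          ≡⟨ dot-congʳ x (λ i → trans (sym (dot-+ˡ (Ǧ q i) ((Ǧ q ᵀ) i) x)) (dot-congˡ x (G≈IᵀI i))) ⟩
        dot x (((I ᵀ) ⊗ I) · x)
          ≡⟨ trans (dot-congʳ x (·-⊗ (I ᵀ) I x)) (dot-· (I ᵀ) x (I · x)) ⟩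
        dot (I · x) (I · x) ∎

    Touches : Fin n → Fin m → Set
    Touches i v = s Q i ≡ v ⊎ t Q i ≡ v

    -- Up to the signs of the two arrows both start at v. Without loops the entry is then 1, or 2 if
    -- they share the other end as well.
    touching : ∀ i j v → Touches i v → Touches j v → G q i j ≢ + 0
    touching i j v ti tj G≡0 = nonzero ti tj (trans (sym (trans (G≈IᵀI i j) (inc-dot Q i (λ w → I w j)))) G≡0)
      where
      one : ∀ {a b c d : Fin m} → a ≡ c → a ≢ d → b ≢ c → (δ a c - δ a d) - (δ b c - δ b d) ≢ + 0
      one {a} {b} {d = d} refl a≢d b≢c eq with b Fin.≟ d
      ... | yes refl = contradiction (trans (sym (cong₂ (λ p q → (p - q) - (δ b a - + 1)) (δ-refl a) (δ-≢ a≢d))) eq)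
                         (subst (λ z → ¬ ((+ 1 - + 0) - (z - + 1) ≡ + 0)) (sym (δ-≢ b≢c)) λ ())
      ... | no b≢d   = contradiction (trans (sym (cong₂ (λ p q → (p - q) - (δ b a - + 0)) (δ-refl a) (δ-≢ a≢d))) eq)
                         (subst (λ z → ¬ ((+ 1 - + 0) - (z - + 0) ≡ + 0)) (sym (δ-≢ b≢c)) λ ())
      si = s Q i
      ti' = t Q i
      sj = s Q j
      tj' = t Q j
      flip₁ : ∀ a b c d → (a - b) - (c - d) ≡ - ((c - d) - (a - b))
      flip₁ = solve-∀
      flip₂ : ∀ a b c d → (a - b) - (c - d) ≡ - ((b - a) - (d - c))
      flip₂ = solve-∀
      neg0 : ∀ {x y : ℤ} → x ≡ - y → x ≡ + 0 → y ≡ + 0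
      neg0 {x} {y} x≡-y x≡0 = trans (sym (ℤP.neg-involutive y)) (cong -_ (trans (sym x≡-y) x≡0))
      nonzero : Touches i v → Touches j v → (δ si sj - δ si tj') - (δ ti' sj - δ ti' tj') ≢ + 0
      nonzero (inj₁ a) (inj₁ c) = one (trans a (sym c)) (λ e → ll j (trans c (trans (sym a) e))) (λ e → ll i (trans a (trans (sym c) (sym e))))
      nonzero (inj₁ a) (inj₂ c) eq = one {si} {ti'} {tj'} {sj} (trans a (sym c)) (λ e → ll j (trans (sym e) (trans a (sym c)))) (λ e → ll i (trans a (trans (sym c) (sym e))))
        (neg0 (flip₂ (δ si sj) (δ si tj') (δ ti' sj) (δ ti' tj')) eq)
      nonzero (inj₂ a) (inj₁ c) eq = one {ti'} {si} {sj} {tj'} (trans a (sym c)) (λ e → ll j (trans c (trans (sym a) e))) (λ e → ll i (trans e (trans c (sym a))))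
        (neg0 (flip₁ (δ si sj) (δ si tj') (δ ti' sj) (δ ti' tj')) eq)
      nonzero (inj₂ a) (inj₂ c) eq = one {ti'} {si} {tj'} {sj} (trans a (sym c)) (λ e → ll j (trans (sym e) (trans a (sym c)))) (λ e → ll i (trans e (trans c (sym a))))
        (neg0 (flip₂ (δ ti' sj) (δ ti' tj') (δ si sj) (δ si tj')) (neg0 (flip₁ (δ si sj) (δ si tj') (δ ti' sj) (δ ti' tj')) eq))

    Adjacent : Fin n → Fin n → Set
    Adjacent a b = a ≢ b × G q a b ≢ + 0

    share : ∀ i j v → Touches i v → Touches j v → Reach Adjacent i j
    share i j v ti tj with i Fin.≟ j
    ... | yes refl = here
    ... | no i≢j   = there (i≢j , touching i j v ti tj) here

    -- Consecutive arrows of a walk share a vertex, so they are equal or adjacent in the graph of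
    -- the form.
    along : ∀ {u v} → Reach (Edge Q) u v → ∀ i j → Touches i u → Touches j v → Reach Adjacent i j
    along {u} here i j ti tj = share i j u ti tj
    along {u} (there (l , inj₁ (sl , tl)) r) i j ti tj = Reach-trans (share i l u ti (inj₁ sl)) (along r l j (inj₂ tl) tj)
    along {u} (there (l , inj₂ (sl , tl)) r) i j ti tj = Reach-trans (share i l u ti (inj₂ tl)) (along r l j (inj₁ sl) tj)

    connected : QConnected Q → Connected q
    connected con i j = along (con (s Q i) (s Q j)) i j (inj₁ refl) (inj₁ refl)

  -- The rows of I sum to zero, so k of them cut out the kernel, and elimination leaves c
  -- independent vectors. Conversely, c + 1 radical vectors and k paths T j are n + 1 vectors in ℤⁿ;
  -- in a relation among them I kills the former and isolates the coefficients of the latter, so the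
  -- relation is among the radical vectors.
  corank : ∀ {k n} c (q : UnitForm n) (Q : Quiver (suc k) n) → LoopLess Q → QConnected Q → Ǧ q ≈M ǦQ Q →
           n ≡ c ℕ.+ k → Corank q c
  corank {k} {n} c q Q ll con Ǧ≈ refl = (proj₁ KV , (λ j → rad⇐ q Q ll Ǧ≈ _ (in-kernel j)) , proj₂ (proj₂ KV)) , dep
    where
    I = Inc Q
    KV = kernel-vectors k {n} {c} (ℕP.+-comm c k) (I ∘ suc)
    I-sum : ∀ y → ∑ (I · y) ≡ + 0
    I-sum y = trans (∑-swap (λ i a → I i a * y a)) (∑-zero λ a →
      trans (∑-*ʳ (y a) (λ i → I i a)) (cong (_* y a) (inc-colsum Q a)))
    in-kernel : ∀ j → (I · proj₁ KV j) ≈V 0V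
    in-kernel j zero    = trans (sym (trans (cong (_+_ ((I · proj₁ KV j) zero)) (∑-zero (proj₁ (proj₂ KV) j))) (ℤP.+-identityʳ _)))
                                (I-sum (proj₁ KV j))
    in-kernel j (suc i) = proj₁ (proj₂ KV) j i
    T : Fin k → Vecℤ n
    T j = proj₁ (reach-vector Q (con zero (suc j)))
    dep : ∀ (w : Fin (suc c) → Vecℤ n) → (∀ l → rad q (w l)) → LinDep w
    dep w rw = dependent (nontrivial-relation {n} {n} Id (cat w T))
      where
      dependent : (∃[ a ] ((∃[ l ] (a l ≢ + 0)) × (Id · lc a (cat w T)) ≈V 0V)) → LinDep w
      dependent (a , (l , al≢0) , rel) = α , ↑-cases (suc c) (λ l → a l ≢ + 0 → ∃[ i ] (α i ≢ + 0))
          (λ i ne → i , ne) (λ j ne → contradiction (β≡0 j) ne) l al≢0 , λ i → trans (sym (trans (cong (_+_ (lc α w i))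
            (∑-zero λ j → cong (_* T j i) (β≡0 j))) (ℤP.+-identityʳ _))) (total i)
        where
        α : Fin (suc c) → ℤ
        α i = a (i ↑ˡ k)
        β : Fin k → ℤ
        β j = a (suc c ↑ʳ j)
        total : (lc α w +V lc β T) ≈V 0V
        total i = trans (sym (lc-cat a w T i)) (trans (sym (Id-· _ i)) (rel i))
        open ≡-Reasoning
        β≡0 : ∀ j → β j ≡ + 0
        β≡0 j = begin
          β j
            ≡⟨ sym (∑-δʳ′ j β) ⟩
          ∑ (λ l → β l * δ j l)
            ≡⟨ ∑-cong (λ l → cong (β l *_) (sym (trans (proj₂ (reach-vector Q (con zero (suc l))) (suc j))
                 (trans (ℤP.+-identityʳ _) (δ-suc j l))))) ⟩
          ∑ (λ l → β l * (I · T l) (suc j))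
            ≡⟨ sym (ℤP.+-identityˡ _) ⟩
          + 0 + ∑ (λ l → β l * (I · T l) (suc j))
            ≡⟨ cong₂ _+_ (sym (∑-zero λ l → trans (cong (α l *_) (rad⇒ q Q ll Ǧ≈ (w l) (rw l) (suc j))) (ℤP.*-zeroʳ (α l))))
                         (sym (·-lc I β T (suc j))) ⟩
          ∑ (λ l → α l * (I · w l) (suc j)) + (I · lc β T) (suc j)
            ≡⟨ cong (λ z → z + (I · lc β T) (suc j)) (sym (·-lc I α w (suc j))) ⟩
          (I · lc α w) (suc j) + (I · lc β T) (suc j)
            ≡⟨ sym (·-+ I (lc α w) (lc β T) (suc j)) ⟩
          (I · (lc α w +V lc β T)) (suc j)
            ≡⟨ ·-0 I total (suc j) ⟩
          + 0 ∎

  -- P writes the columns of I in simple roots; by connectedness they generate the root lattice, so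
  -- P is onto.
  dynkinType : ∀ {k n} (q : UnitForm n) (Q : Quiver (suc k) n) → LoopLess Q → QConnected Q → Ǧ q ≈M ǦQ Q → DynkinTypeA q k
  dynkinType {k} {n} q Q ll con Ǧ≈ = P , onto , kernel⇒ , kernel⇐ , G≈
    where
    open ≡-Reasoning
    I = Inc Q
    P = 𝔼 k ⊗ I
    𝔻P : (𝔻 k ⊗ P) ≈M I
    𝔻P u i = begin
      (𝔻 k ⊗ (𝔼 k ⊗ I)) u i
        ≡⟨ trans (sym (⊗-assoc (𝔻 k) (𝔼 k) I u i)) (dot-congˡ (λ v → I v i) (𝔻𝔼 k u)) ⟩
      dot (λ v → δ u v - δ u zero) (λ v → I v i)
        ≡⟨ dot--ˡ (δ u) (λ _ → δ u zero) (λ v → I v i) ⟩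
      dot (δ u) (λ v → I v i) - ∑ (λ v → δ u zero * I v i)
        ≡⟨ cong₂ _-_ (∑-δˡ u (λ v → I v i)) (trans (∑-*ˡ (δ u zero) (λ v → I v i))
             (trans (cong (δ u zero *_) (inc-colsum Q i)) (ℤP.*-zeroʳ (δ u zero)))) ⟩
      I u i - + 0
        ≡⟨ ℤP.+-identityʳ (I u i) ⟩
      I u i ∎
    T : Fin (suc k) → Vecℤ n
    T v = proj₁ (reach-vector Q (con zero v))
    onto : ∀ y → ∃[ x ] ((P · x) ≈V y)
    onto y = x , λ i → begin
        (P · x) i
          ≡⟨ trans (·-⊗ (𝔼 k) I x i) (·-cong (𝔼 k) Ix i) ⟩
        (𝔼 k · (𝔻 k · y)) i
          ≡⟨ trans (sym (·-⊗ (𝔼 k) (𝔻 k) y i)) (trans (·-congˡ y (𝔼𝔻 k) i) (Id-· y i)) ⟩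
        y i ∎
      where
      d = 𝔻 k · y
      x = lc d T
      d-sum : ∑ d ≡ + 0
      d-sum = trans (∑-swap (λ u j → 𝔻 k u j * y j)) (∑-zero λ j →
        trans (∑-*ʳ (y j) (λ u → 𝔻 k u j)) (cong (_* y j) (𝔻-colsum k j)))
      Ix : (I · x) ≈V d
      Ix u = begin
        (I · x) u
          ≡⟨ trans (·-lc I d T u) (∑-cong λ v → cong (d v *_) (proj₂ (reach-vector Q (con zero v)) u)) ⟩
        ∑ (λ v → d v * (δ u v - δ u zero))
          ≡⟨ trans (∑-cong λ v → *-distribˡ-- (d v) (δ u v) (δ u zero)) (∑-- (λ v → d v * δ u v) (λ v → d v * δ u zero)) ⟩
        ∑ (λ v → d v * δ u v) - ∑ (λ v → d v * δ u zero)
          ≡⟨ cong₂ _-_ (∑-δʳ′ u d) (trans (∑-*ʳ (δ u zero) d) (cong (_* δ u zero) d-sum)) ⟩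
        d u - + 0
          ≡⟨ ℤP.+-identityʳ (d u) ⟩
        d u ∎
    kernel⇒ : ∀ x → (P · x) ≈V 0V → rad q x
    kernel⇒ x Px≈0 = rad⇐ q Q ll Ǧ≈ x λ u → trans (·-congˡ x (≈M-sym 𝔻P) u) (trans (·-⊗ (𝔻 k) P x u) (·-0 (𝔻 k) Px≈0 u))
    kernel⇐ : ∀ x → rad q x → (P · x) ≈V 0V
    kernel⇐ x rx i = trans (·-⊗ (𝔼 k) I x i) (·-0 (𝔼 k) (rad⇒ q Q ll Ǧ≈ x rx) i)
    G≈ : G q ≈M ((P ᵀ) ⊗ (GA k ⊗ P))
    G≈ i j = begin
      G q i j
        ≡⟨ G≈IᵀI q Q ll Ǧ≈ i j ⟩
      ((I ᵀ) ⊗ I) i j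
        ≡⟨ ⊗-cong (λ a c → sym (𝔻P c a)) (≈M-sym 𝔻P) i j ⟩
      (((𝔻 k ⊗ P) ᵀ) ⊗ (𝔻 k ⊗ P)) i j
        ≡⟨ ⊗-congʳ (𝔻 k ⊗ P) (ᵀ-⊗ (𝔻 k) P) i j ⟩
      (((P ᵀ) ⊗ (𝔻 k ᵀ)) ⊗ (𝔻 k ⊗ P)) i j
        ≡⟨ ⊗-assoc (P ᵀ) (𝔻 k ᵀ) (𝔻 k ⊗ P) i j ⟩
      ((P ᵀ) ⊗ ((𝔻 k ᵀ) ⊗ (𝔻 k ⊗ P))) i j
        ≡⟨ ⊗-congˡ (P ᵀ) (λ a c → trans (sym (⊗-assoc (𝔻 k ᵀ) (𝔻 k) P a c)) (⊗-congʳ P (≈M-sym (GA≈ k)) a c)) i j ⟩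
      ((P ᵀ) ⊗ (GA k ⊗ P)) i j ∎

open Realisations

-- Quivers realising every admissible partition.

module StandardQuivers where

  import Data.Fin.Permutation.Components as PC

  liftQ : ∀ {m n} → Quiver m n → Quiver (suc m) n
  s (liftQ Q) i = suc (s Q i)
  t (liftQ Q) i = suc (t Q i)

  consQ : ∀ {m n} → Fin m → Fin m → Quiver m n → Quiver m (suc n)
  s (consQ a b Q) zero    = a
  s (consQ a b Q) (suc i) = s Q i
  t (consQ a b Q) zero    = b
  t (consQ a b Q) (suc i) = t Q i

  ξQ-liftQ : ∀ {m n} (Q : Quiver m n) → (∀ v → ξQ (liftQ Q) ⟨$⟩ʳ suc v ≡ suc (ξQ Q ⟨$⟩ʳ v)) × ξQ (liftQ Q) ⟨$⟩ʳ zero ≡ zero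
  ξQ-liftQ {n = zero}  Q = (λ v → refl) , refl
  ξQ-liftQ {n = suc n} Q =
    (λ v → trans (cong (PC.transpose (suc (s Q zero)) (suc (t Q zero))) (proj₁ (ξQ-liftQ (tailQ Q)) v))
                 (Perm.lift₀-transpose (s Q zero) (t Q zero) (suc (ξQ (tailQ Q) ⟨$⟩ʳ v)))) ,
    cong (PC.transpose (suc (s Q zero)) (suc (t Q zero))) (proj₂ (ξQ-liftQ (tailQ Q)))

  liftQ-reach : ∀ {m n} (Q : Quiver m n) {u v} → Reach (Edge Q) u v → Reach (Edge (liftQ Q)) (suc u) (suc v)
  liftQ-reach Q = Reach-map suc λ { (i , inj₁ (e , e')) → there (i , inj₁ (cong suc e , cong suc e')) here
                                  ; (i , inj₂ (e , e')) → there (i , inj₂ (cong suc e , cong suc e')) here }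

  consQ-connected : ∀ {m n} a b (Q : Quiver m n) → QConnected Q → QConnected (consQ a b Q)
  consQ-connected a b Q con u v = tail-reach (consQ a b Q) (con u v)

  consQ-loopless : ∀ {m n} {a b} (Q : Quiver m n) → a ≢ b → LoopLess Q → LoopLess (consQ a b Q)
  consQ-loopless Q a≢b ll zero    = a≢b
  consQ-loopless Q a≢b ll (suc i) = ll i

  liftQ-loopless : ∀ {m n} (Q : Quiver m n) → LoopLess Q → LoopLess (liftQ Q)
  liftQ-loopless Q ll i eq = ll i (FinP.suc-injective eq)

  attach-connected : ∀ {m n} (a : Fin m) (Q : Quiver m n) → QConnected Q → QConnected (consQ zero (suc a) (liftQ Q))
  attach-connected a Q con = λ { zero zero → here ; zero (suc v) → from-new v
                               ; (suc u) zero → Reach-sym (Edge-sym Q⁺) (from-new u) ; (suc u) (suc v) → old u v }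
    where
    Q⁺ = consQ zero (suc a) (liftQ Q)
    old : ∀ u v → Reach (Edge Q⁺) (suc u) (suc v)
    old u v = tail-reach Q⁺ (liftQ-reach Q (con u v))
    from-new : ∀ v → Reach (Edge Q⁺) zero (suc v)
    from-new v = there (zero , inj₁ (refl , refl)) (old a v)

  record Realises (π : List ℕ) (n : ℕ) : Set where
    field
      Q    : Quiver (sum π) n
      ll   : LoopLess Q
      con  : QConnected Q
      ξ≗   : ∀ v → ξQ Q ⟨$⟩ʳ v ≡ std π v

  -- The two transpositions cancel, so the corank grows by 2 at unchanged cycle type.
  double-arrow : ∀ {π n} (a b : Fin (sum π)) → a ≢ b → Realises π n → Realises π (suc (suc n))
  double-arrow a b a≢b r = record
      { Q = consQ a b (consQ b a Q) ; ll = consQ-loopless (consQ b a Q) a≢b (consQ-loopless Q (a≢b ∘ sym) ll)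
      ; con = consQ-connected a b (consQ b a Q) (consQ-connected b a Q con)
      ; ξ≗ = λ v → trans (PC.transpose-inverse a b) (ξ≗ v) }
    where open Realises r

  -- The new vertex 0 is a fixed point until the arrow multiplies by (0 1), which inserts it into
  -- the first cycle.
  enlarge-cycle : ∀ {p ρ n} → Realises (suc p ∷ ρ) n → Realises (suc (suc p) ∷ ρ) (suc n)
  enlarge-cycle {p} {ρ} r = record
      { Q = consQ zero (suc zero) (liftQ Q) ; ll = consQ-loopless (liftQ Q) (λ ()) (liftQ-loopless Q ll)
      ; con = attach-connected zero Q con
      ; ξ≗ = λ { zero → cong (PC.transpose zero (suc zero)) (proj₂ (ξQ-liftQ Q))
               ; (suc v) → trans (cong (PC.transpose zero (suc zero)) (trans (proj₁ (ξQ-liftQ Q) v) (cong suc (ξ≗ v))))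
                                 (skip (std (suc p ∷ ρ) v)) } }
    where
    open Realises r
    skip : ∀ {k} (w : Fin (suc k)) → PC.transpose zero (suc zero) (suc w) ≡ punchIn (suc zero) w
    skip zero    = refl
    skip (suc w) = refl

  -- Two antiparallel arrows connect the new vertex to the quiver while their transpositions cancel,
  -- so it stays a fixed point.
  new-cycle : ∀ {p ρ n} → Realises (suc p ∷ ρ) n → Realises (1 ∷ suc p ∷ ρ) (suc (suc n))
  new-cycle {p} {ρ} r = record
      { Q = consQ (suc zero) zero (consQ zero (suc zero) (liftQ Q))
      ; ll = consQ-loopless (consQ zero (suc zero) (liftQ Q)) (λ ()) (consQ-loopless (liftQ Q) (λ ()) (liftQ-loopless Q ll))
      ; con = consQ-connected (suc zero) zero (consQ zero (suc zero) (liftQ Q)) (attach-connected zero Q con)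
      ; ξ≗ = λ { zero → trans (PC.transpose-inverse (suc zero) zero) (proj₂ (ξQ-liftQ Q))
               ; (suc v) → trans (PC.transpose-inverse (suc zero) zero) (trans (proj₁ (ξQ-liftQ Q) v) (cong suc (ξ≗ v))) } }
    where open Realises r

  -- The number of arrows is (m - 1) + (ℓ - 1), which belongs to the least corank c = ℓ - 1 allowed
  -- for ℓ parts; larger coranks come from `double-arrow`.
  realise : ∀ p ρ → All (0 ℕ.<_) ρ → Realises (suc p ∷ ρ) (p ℕ.+ (sum ρ ℕ.+ length ρ))
  realise (suc p) ρ           pos       = enlarge-cycle (realise p ρ pos)
  realise zero    []          pos       = record
    { Q = record { s = λ () ; t = λ () } ; ll = λ () ; con = λ { zero zero → here } ; ξ≗ = λ { zero → refl } }
  realise zero    (suc p ∷ ρ) (_ ∷ pos) = subst (Realises (1 ∷ suc p ∷ ρ)) count-arrows (new-cycle (realise p ρ pos))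
    where
    count-arrows : suc (suc (p ℕ.+ (sum ρ ℕ.+ length ρ))) ≡ suc p ℕ.+ sum ρ ℕ.+ suc (length ρ)
    count-arrows = cong suc (trans (cong suc (sym (ℕP.+-assoc p (sum ρ) (length ρ)))) (sym (ℕP.+-suc (p ℕ.+ sum ρ) (length ρ))))

  realise-extra : ∀ p ρ → All (0 ℕ.<_) ρ → 2 ℕ.≤ sum (suc p ∷ ρ) → ∀ k →
                  Realises (suc p ∷ ρ) (k ℕ.+ k ℕ.+ (p ℕ.+ (sum ρ ℕ.+ length ρ)))
  realise-extra p ρ pos 2≤ zero    = realise p ρ pos
  realise-extra p ρ pos 2≤ (suc k) = subst (Realises (suc p ∷ ρ))
    (cong (λ l → suc (l ℕ.+ (p ℕ.+ (sum ρ ℕ.+ length ρ)))) (sym (ℕP.+-suc k k)))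
    (double-arrow zero (Fin.fromℕ< 2≤) (λ eq → contradiction (trans (cong toℕ eq) (FinP.toℕ-fromℕ< 2≤)) λ ())
      (realise-extra p ρ pos 2≤ k))

open StandardQuivers

-- Invariance, injectivity and surjectivity of the cycle type, and the invariants.

module Classification where

  open import Data.Integer using (_+_; _*_; _-_)

  HasRank-≐ : ∀ {n r} {A B : Vecℤ n → Set} → (∀ x → A x → B x) → (∀ x → B x → A x) → HasRank A r → HasRank B r
  HasRank-≐ A⇒B B⇒A ((v , Av , ind) , dep) = (v , (λ k → A⇒B (v k) (Av k)) , ind) , λ w Bw → dep w (λ k → B⇒A (w k) (Bw k))

  ≈V-injective⇒LinIndep : ∀ {n r} (F : Mat n n) {v : Fin r → Vecℤ n} → (∀ x → (F · x) ≈V 0V → x ≈V 0V) →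
                           LinIndep v → LinIndep (λ k → F · v k)
  ≈V-injective⇒LinIndep F {v} F-inj ind a a≈0 = ind a (F-inj (lc a v) λ i → trans (·-lc F a v i) (a≈0 i))

  module _ {n : ℕ} (q : UnitForm n) where

    private
      U = Ǧ q
      V = invUni U
      tri : UpperUnitriangular U
      tri = diag q , lower q
      UV = invUni-inverseʳ U tri
      VU = invUni-inverseˡ U tri

      UVx : ∀ x → (U · (V · x)) ≈V x
      UVx x i = trans (sym (·-⊗ U V x i)) (trans (·-congˡ x UV i) (Id-· x i))
      VUx : ∀ x → (V · (U · x)) ≈V x
      VUx x i = trans (sym (·-⊗ V U x i)) (trans (·-congˡ x VU i) (Id-· x i))

      Φ-1 : ∀ x → ((Φ q ⊖ Id) · x) ≈V (λ i → - (G q · (V · x)) i)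
      Φ-1 x i = begin
          ((Φ q ⊖ Id) · x) i
            ≡⟨ dot-congˡ x (λ j → trans (cong (λ z → - ((U ᵀ) ⊗ V) i j - z) (sym (UV i j)))
                 (trans (lemma (((U ᵀ) ⊗ V) i j) ((U ⊗ V) i j)) (cong -_ (sym (⊗-distribʳ-⊕ U (U ᵀ) V i j))))) ⟩
          dot (λ j → - (G q ⊗ V) i j) x
            ≡⟨ trans (∑-cong λ j → sym (ℤP.neg-distribˡ-* ((G q ⊗ V) i j) (x j))) (∑-neg (λ j → (G q ⊗ V) i j * x j)) ⟩
          - ((G q ⊗ V) · x) i
            ≡⟨ cong -_ (·-⊗ (G q) V x i) ⟩
          - (G q · (V · x)) i ∎
        where
        open ≡-Reasoning
        lemma : ∀ a b → - a - b ≡ - (b + a)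
        lemma = solve-∀

    -- Φ - 1 = - G Ǧ⁻¹, so Ǧ carries the radical isomorphically onto the eigenspace of 1.
    geometric-multiplicity : ∀ {c} → Corank q c → GeomMult1 (Φ q) c
    geometric-multiplicity ((v , rv , ind) , dep) =
      ((λ k → U · v k) , (λ k → eigen (U · v k) λ i → trans (·-cong (G q) (VUx (v k)) i) (rv k i)) ,
       ≈V-injective⇒LinIndep U (λ x Ux≈0 i → trans (sym (VUx x i)) (·-0 V Ux≈0 i)) ind) , dep'
      where
      eigen : ∀ x → rad q (V · x) → ((Φ q ⊖ Id) · x) ≈V 0V
      eigen x rx i = trans (Φ-1 x i) (cong -_ (rx i))
      eigen⁻¹ : ∀ x → ((Φ q ⊖ Id) · x) ≈V 0V → rad q (V · x)
      eigen⁻¹ x ex i = trans (sym (ℤP.neg-involutive _)) (cong -_ (trans (sym (Φ-1 x i)) (ex i)))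
      dep' : ∀ (w : Fin _ → Vecℤ n) → (∀ k → ((Φ q ⊖ Id) · w k) ≈V 0V) → LinDep w
      dep' w ew = back (dep (λ k → V · w k) λ k → eigen⁻¹ (w k) (ew k))
        where
        back : LinDep (λ k → V · w k) → LinDep w
        back (a , nz , rel) = a , nz , λ i → trans (sym (UVx (lc a w) i)) (·-0 U (λ j → trans (·-lc V a w j) (rel j)) i)

  -- From Ǧ' = Bᵀ Ǧ B follows B Ǧ'⁻¹ Bᵀ = Ǧ⁻¹ and then Φ' Bᵀ = Bᵀ Φ: the Coxeter matrices are
  -- conjugate.
  gram-trace : ∀ {n} (q q' : UnitForm n) → q ≈Gram q' → ∀ k → tr (Φ q ^M k) ≡ tr (Φ q' ^M k)
  gram-trace {n} q q' (B , (B⁻¹ , BB⁻¹ , B⁻¹B) , U'≈) k = sym (begin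
      tr (Φ q' ^M k)
        ≡⟨ tr-cong (λ i j → sym (trans (⊗-congˡ (Φ q' ^M k) (λ a c → trans (sym (ᵀ-⊗ B⁻¹ B a c)) (trans (B⁻¹B c a) (δ-sym c a))) i j)
             (⊗-identityʳ (Φ q' ^M k) i j))) ⟩
      tr ((Φ q' ^M k) ⊗ ((B ᵀ) ⊗ (B⁻¹ ᵀ)))
        ≡⟨ tr-cong (λ i j → trans (sym (⊗-assoc (Φ q' ^M k) (B ᵀ) (B⁻¹ ᵀ) i j)) (⊗-congʳ (B⁻¹ ᵀ) (intertwine k) i j)) ⟩
      tr (((B ᵀ) ⊗ (Φ q ^M k)) ⊗ (B⁻¹ ᵀ))
        ≡⟨ tr-⊗ ((B ᵀ) ⊗ (Φ q ^M k)) (B⁻¹ ᵀ) ⟩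
      tr ((B⁻¹ ᵀ) ⊗ ((B ᵀ) ⊗ (Φ q ^M k)))
        ≡⟨ tr-cong (λ i j → trans (sym (⊗-assoc (B⁻¹ ᵀ) (B ᵀ) (Φ q ^M k) i j)) (trans (⊗-congʳ (Φ q ^M k)
             B⁻ᵀBᵀ i j) (⊗-identityˡ (Φ q ^M k) i j))) ⟩
      tr (Φ q ^M k) ∎)
    where
    open ≡-Reasoning
    U = Ǧ q
    U' = Ǧ q'
    V = invUni U
    V' = invUni U'
    UV' = invUni-inverseʳ U' (diag q' , lower q')
    VU = invUni-inverseˡ U (diag q , lower q)
    B⁻ᵀBᵀ : ((B⁻¹ ᵀ) ⊗ (B ᵀ)) ≈M Id
    B⁻ᵀBᵀ a c = trans (sym (ᵀ-⊗ B B⁻¹ a c)) (trans (BB⁻¹ c a) (δ-sym c a))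
    BV'Bᵀ : (B ⊗ (V' ⊗ (B ᵀ))) ≈M V
    BV'Bᵀ i j = begin
      (B ⊗ (V' ⊗ (B ᵀ))) i j
        ≡⟨ sym (trans (⊗-congʳ W VU i j) (⊗-identityˡ W i j)) ⟩
      ((V ⊗ U) ⊗ W) i j
        ≡⟨ ⊗-assoc V U W i j ⟩
      (V ⊗ (U ⊗ W)) i j
        ≡⟨ ⊗-congˡ V UW i j ⟩
      (V ⊗ Id) i j
        ≡⟨ ⊗-identityʳ V i j ⟩
      V i j ∎
      where
      W = B ⊗ (V' ⊗ (B ᵀ))
      BᵀUW : ((B ᵀ) ⊗ (U ⊗ W)) ≈M (B ᵀ)
      BᵀUW a c = begin
        ((B ᵀ) ⊗ (U ⊗ (B ⊗ (V' ⊗ (B ᵀ))))) a c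
          ≡⟨ ⊗-congˡ (B ᵀ) (λ x y → sym (⊗-assoc U B (V' ⊗ (B ᵀ)) x y)) a c ⟩
        ((B ᵀ) ⊗ ((U ⊗ B) ⊗ (V' ⊗ (B ᵀ)))) a c
          ≡⟨ sym (⊗-assoc (B ᵀ) (U ⊗ B) (V' ⊗ (B ᵀ)) a c) ⟩
        (((B ᵀ) ⊗ (U ⊗ B)) ⊗ (V' ⊗ (B ᵀ))) a c
          ≡⟨ ⊗-congʳ (V' ⊗ (B ᵀ)) (≈M-sym U'≈) a c ⟩
        (U' ⊗ (V' ⊗ (B ᵀ))) a c
          ≡⟨ sym (⊗-assoc U' V' (B ᵀ) a c) ⟩
        ((U' ⊗ V') ⊗ (B ᵀ)) a c
          ≡⟨ trans (⊗-congʳ (B ᵀ) UV' a c) (⊗-identityˡ (B ᵀ) a c) ⟩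
        (B ᵀ) a c ∎
      UW : (U ⊗ W) ≈M Id
      UW a c = begin
        (U ⊗ W) a c
          ≡⟨ sym (trans (⊗-congʳ (U ⊗ W) B⁻ᵀBᵀ a c) (⊗-identityˡ (U ⊗ W) a c)) ⟩
        (((B⁻¹ ᵀ) ⊗ (B ᵀ)) ⊗ (U ⊗ W)) a c
          ≡⟨ ⊗-assoc (B⁻¹ ᵀ) (B ᵀ) (U ⊗ W) a c ⟩
        ((B⁻¹ ᵀ) ⊗ ((B ᵀ) ⊗ (U ⊗ W))) a c
          ≡⟨ trans (⊗-congˡ (B⁻¹ ᵀ) BᵀUW a c) (B⁻ᵀBᵀ a c) ⟩
        Id a c ∎
    ΦBᵀ : (Φ q' ⊗ (B ᵀ)) ≈M ((B ᵀ) ⊗ Φ q)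
    ΦBᵀ i j = begin
      (negM ((U' ᵀ) ⊗ V') ⊗ (B ᵀ)) i j
        ≡⟨ trans (⊗-negˡ ((U' ᵀ) ⊗ V') (B ᵀ) i j) (cong -_ (⊗-assoc (U' ᵀ) V' (B ᵀ) i j)) ⟩
      - ((U' ᵀ) ⊗ (V' ⊗ (B ᵀ))) i j
        ≡⟨ cong -_ (⊗-congʳ (V' ⊗ (B ᵀ)) U'ᵀ i j) ⟩
      - (((B ᵀ) ⊗ ((U ᵀ) ⊗ B)) ⊗ (V' ⊗ (B ᵀ))) i j
        ≡⟨ cong -_ (trans (⊗-assoc (B ᵀ) ((U ᵀ) ⊗ B) (V' ⊗ (B ᵀ)) i j)
             (⊗-congˡ (B ᵀ) (λ a c → trans (⊗-assoc (U ᵀ) B (V' ⊗ (B ᵀ)) a c) (⊗-congˡ (U ᵀ) BV'Bᵀ a c)) i j)) ⟩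
      - ((B ᵀ) ⊗ ((U ᵀ) ⊗ V)) i j
        ≡⟨ sym (⊗-negʳ (B ᵀ) ((U ᵀ) ⊗ V) i j) ⟩
      ((B ᵀ) ⊗ Φ q) i j ∎
      where
      U'ᵀ : (U' ᵀ) ≈M ((B ᵀ) ⊗ ((U ᵀ) ⊗ B))
      U'ᵀ a c = trans (U'≈ c a) (trans (ᵀ-⊗ (B ᵀ) (U ⊗ B) a c)
        (trans (⊗-congʳ B (ᵀ-⊗ U B) a c) (⊗-assoc (B ᵀ) (U ᵀ) B a c)))
    intertwine : ∀ k → ((Φ q' ^M k) ⊗ (B ᵀ)) ≈M ((B ᵀ) ⊗ (Φ q ^M k))
    intertwine zero    i j = trans (⊗-identityˡ (B ᵀ) i j) (sym (⊗-identityʳ (B ᵀ) i j))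
    intertwine (suc k) i j = begin
      ((Φ q' ⊗ (Φ q' ^M k)) ⊗ (B ᵀ)) i j
        ≡⟨ trans (⊗-assoc (Φ q') (Φ q' ^M k) (B ᵀ) i j) (⊗-congˡ (Φ q') (intertwine k) i j) ⟩
      (Φ q' ⊗ ((B ᵀ) ⊗ (Φ q ^M k))) i j
        ≡⟨ trans (sym (⊗-assoc (Φ q') (B ᵀ) (Φ q ^M k) i j)) (⊗-congʳ (Φ q ^M k) ΦBᵀ i j) ⟩
      (((B ᵀ) ⊗ Φ q) ⊗ (Φ q ^M k)) i j
        ≡⟨ ⊗-assoc (B ᵀ) (Φ q) (Φ q ^M k) i j ⟩
      ((B ᵀ) ⊗ (Φ q ⊗ (Φ q ^M k))) i j ∎

  ctLattice : ∀ {n m π} (q : UnitForm n) → CT m q π → Lat n (sum π) (std π)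
  ctLattice q (Q , ll , con , Ǧ≈ , ξ , Λ≈ , ct) = lattice Q ll con ξ Λ≈ (cycleType⇒conj ξ ct) (Ǧ q) Ǧ≈

  ctPartition : ∀ {n m π} (q : UnitForm n) → CT m q π → IsPartition m π
  ctPartition q (Q , ll , con , Ǧ≈ , ξ , Λ≈ , ct) = proj₁ ct

  ct-exists : ∀ {n k} (q : UnitForm n) → DynkinTypeA q k → ∃[ π ] CT (suc k) q π
  ct-exists q dyn = proj₁ CE , Q , quiverOf-loopless q dyn , quiverOf-connected q dyn , quiverOf-Ǧ q dyn ,
      ξQ Q , ΛQ-permutation Q (quiverOf-loopless q dyn) , conj⇒cycleType (ξQ Q) (proj₁ CE) (proj₁ (proj₂ CE)) (proj₂ (proj₂ CE))
    where
    Q = quiverOf q dyn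
    CE = conj-exists (ξQ Q)

  module _ {n k : ℕ} (q : UnitForm n) where

    ct-trace : ∀ π → CT (suc k) q π → ∀ l → divSum l π ≡ tr (Φ q ^M l) - (+ n - + suc k)
    ct-trace []          ct l = contradiction (proj₂ (proj₂ (ctPartition q ct))) λ ()
    ct-trace (zero ∷ ρ)  ct l = contradiction (All.head (proj₁ (proj₂ (ctPartition q ct)))) λ ()
    ct-trace (suc p ∷ ρ) ct l = trans (sym (fixed-points l)) (trans (lemma (+ n) (+ M) (∑ (λ i → δ i (pow σ l i))))
        (cong₂ (λ a c → a - (+ n - + c)) (sym (Ψ-trace l)) (proj₂ (proj₂ (ctPartition q ct)))))
      where
      open Invariants p ρ (All.tail (proj₁ (proj₂ (ctPartition q ct)))) (ctLattice q ct)
      lemma : ∀ n m f → f ≡ (n - (m - f)) - (n - m)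
      lemma = solve-∀

  ct-invariant : ∀ {n k} (q q' : UnitForm n) π π' → q ≈Gram q' → CT (suc k) q π → CT (suc k) q' π' → π ≡ π'
  ct-invariant q q' π π' q≈q' ct ct' = sorted-unique π π' (proj₁ IsP) (proj₁ IsP') (proj₁ (proj₂ IsP)) (proj₁ (proj₂ IsP'))
      (divSum-injective π π' λ l _ → trans (ct-trace q π ct l) (trans (cong (_- _) (gram-trace q q' q≈q' l)) (sym (ct-trace q' π' ct' l))))
    where
    IsP = ctPartition q ct
    IsP' = ctPartition q' ct'

  ct-parity : ∀ {n k c} (q : UnitForm n) π → n ≡ c ℕ.+ k → CT (suc k) q π → InPartc1 c (suc k) π
  ct-parity q []          n≡ ct = contradiction (proj₂ (proj₂ (ctPartition q ct))) λ ()
  ct-parity q (zero ∷ ρ)  n≡ ct = contradiction (All.head (proj₁ (proj₂ (ctPartition q ct)))) λ ()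
  ct-parity {n} {k} {c} q (suc p ∷ ρ) n≡ ct = ctPartition q ct , proj₁ frame , equation
    where
    pos = proj₁ (proj₂ (ctPartition q ct))
    open FrameTheory (ctLattice q ct) (std-cycles (suc p ∷ ρ) pos) using (frame-exists; module FrameUse)
    frame = frame-exists
    κ = proj₁ frame
    ℓ = length ρ
    dim : (p ℕ.+ sum ρ ℕ.+ ℓ) ℕ.+ (κ ℕ.+ κ) ≡ c ℕ.+ k
    dim = trans (FrameUse.dimension-formula (proj₂ frame)) n≡
    equation : c ℕ.+ 1 ≡ suc ℓ ℕ.+ 2 ℕ.* κ
    equation = trans (ℕP.+-comm c 1) (cong suc (ℕP.+-cancelʳ-≡ k c (ℓ ℕ.+ 2 ℕ.* κ) (trans (sym dim)
      (trans (cong (λ s → (s ℕ.+ ℓ) ℕ.+ (κ ℕ.+ κ)) (ℕP.suc-injective (proj₂ (proj₂ (ctPartition q ct)))))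
        (trans (ℕP.+-assoc k ℓ (κ ℕ.+ κ)) (trans (ℕP.+-comm k (ℓ ℕ.+ (κ ℕ.+ κ)))
          (cong (λ z → (ℓ ℕ.+ (κ ℕ.+ z)) ℕ.+ k) (sym (ℕP.+-identityʳ κ)))))))))

  ct-injective : ∀ {n k} (q q' : UnitForm n) π → CT (suc k) q π → CT (suc k) q' π → q ≈Gram q'
  ct-injective q q' []          ct ct' = contradiction (proj₂ (proj₂ (ctPartition q ct))) λ ()
  ct-injective q q' (zero ∷ ρ)  ct ct' = contradiction (All.head (proj₁ (proj₂ (ctPartition q ct)))) λ ()
  ct-injective q q' (suc p ∷ ρ) ct ct' =
    -- `q ≈Gram q'` expresses the matrix of q' through that of q, hence the order of the two
    -- lattices.
    lattices-congruent (std-cycles (suc p ∷ ρ) (proj₁ (proj₂ (ctPartition q ct)))) (ctLattice q' ct') (ctLattice q ct)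

  quiver-InQuadA : ∀ {n c} (Q : Quiver (suc (n ℕ.∸ c)) n) (ll : LoopLess Q) → QConnected Q → n ≡ c ℕ.+ (n ℕ.∸ c) →
                   InQuadA n c (quiverForm Q ll)
  quiver-InQuadA {n} {c} Q ll con n≡ = connected q Q ll Ǧ≈ con , nonNegative q Q ll Ǧ≈ ,
      corank c q Q ll con Ǧ≈ n≡ , dynkinType q Q ll con Ǧ≈
    where
    q = quiverForm Q ll
    Ǧ≈ : Ǧ q ≈M ǦQ Q
    Ǧ≈ i j = refl

  ct-surjective : ∀ n c → n ≡ c ℕ.+ (n ℕ.∸ c) → 1 ℕ.≤ n ℕ.∸ c → ∀ π → InPartc1 c (suc (n ℕ.∸ c)) π →
                  ∃[ q ] (InQuadA n c q × CT (suc (n ℕ.∸ c)) q π)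
  ct-surjective n c n≡ 1≤k []          ((_ , _ , ()) , _)
  ct-surjective n c n≡ 1≤k (zero ∷ ρ)  ((_ , (() ∷ _) , _) , _)
  ct-surjective n c n≡ 1≤k π@(suc p ∷ ρ) ((sorted , pos , sum≡) , κ , parity) =
      build (suc (n ℕ.∸ c)) sum≡ refl (subst (Realises π) arrows (realise-extra p ρ (All.tail pos) (subst (2 ℕ.≤_) (sym sum≡) (s≤s 1≤k)) κ))
    where
    ℓ = length ρ
    arrows : κ ℕ.+ κ ℕ.+ (p ℕ.+ (sum ρ ℕ.+ ℓ)) ≡ n
    arrows = trans (cong (ℕ._+_ (κ ℕ.+ κ)) (trans (sym (ℕP.+-assoc p (sum ρ) ℓ)) (cong (ℕ._+ ℓ) (ℕP.suc-injective sum≡))))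
      (trans (sym (ℕP.+-assoc (κ ℕ.+ κ) (n ℕ.∸ c) ℓ)) (trans (ℕP.+-comm (κ ℕ.+ κ ℕ.+ (n ℕ.∸ c)) ℓ)
        (trans (sym (ℕP.+-assoc ℓ (κ ℕ.+ κ) (n ℕ.∸ c))) (trans (cong (ℕ._+ (n ℕ.∸ c)) (sym c≡)) (sym n≡)))))
      where
      c≡ : c ≡ ℓ ℕ.+ (κ ℕ.+ κ)
      c≡ = ℕP.suc-injective (trans (ℕP.+-comm 1 c) (trans parity (cong (λ z → suc (ℓ ℕ.+ (κ ℕ.+ z))) (ℕP.+-identityʳ κ))))
    -- Generalised over m so that `sum π ≡ m` can be matched; the conjugation with `std π` is then
    -- the identity map.
    build : ∀ m → sum π ≡ m → m ≡ suc (n ℕ.∸ c) → Realises π n → ∃[ q ] (InQuadA n c q × CT m q π)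
    build _ refl sum≡ r = quiverForm Q ll , relabel Q ll con ,
        Q , ll , con , (λ i j → refl) , ξQ Q , ΛQ-permutation Q ll ,
        conj⇒cycleType (ξQ Q) π (record { f = id ; f⁻¹ = id ; ff⁻¹ = λ v → refl ; f-inj = id ; comm = λ v → sym (ξ≗ v) })
          (sorted , pos , refl)
      where
      open Realises r
      relabel : (Q : Quiver (sum π) n) (ll : LoopLess Q) → QConnected Q → InQuadA n c (quiverForm Q ll)
      relabel = subst (λ m → (Q : Quiver m n) (ll : LoopLess Q) → QConnected Q → InQuadA n c (quiverForm Q ll)) (sym sum≡)
        (λ Q ll con → quiver-InQuadA Q ll con n≡)

  reduced-corank : ∀ {n k} (q : UnitForm n) p ρ → CT (suc k) q (suc p ∷ ρ) → ReducedCorank q (length ρ)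
  reduced-corank q p ρ ct = HasRank-≐ to from Re-rank
    where
    L = ctLattice q ct
    pos = proj₁ (proj₂ (ctPartition q ct))
    open Lat L
    open FrameTheory L (std-cycles (suc p ∷ ρ) pos) using (R; Re)
    open GramFormula L (std-cycles (suc p ∷ ρ) pos) using (Re-rank)
    R⇒rad : ∀ x → R x → rad q x
    R⇒rad = gram-kernel⇐ (G q) I U+Uᵀ
    rad⇒R : ∀ x → rad q x → R x
    rad⇒R = gram-kernel⇒ (G q) I U+Uᵀ
    to : ∀ x → Re x → radRe q x
    to x (Rx , orth) = R⇒rad x Rx , λ y ry → orth y (rad⇒R y ry)
    from : ∀ x → radRe q x → Re x
    from x (rx , orth) = rad⇒R x rx , λ y Ry → orth y (R⇒rad y Ry)

  ct-invariants : ∀ {n k c} (q : UnitForm n) π → n ≡ c ℕ.+ k → Corank q c → CT (suc k) q π →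
    ((φ q *P XkMinus1 1) ≈P ((XkMinus1 1 ^P c) *P prodP (map XkMinus1 π)))
    × CoxeterNumber (Φ q) (coxNumberOf π)
    × ReducedCoxeterNumber (Φ q) (lcmList π)
    × GeomMult1 (Φ q) c
    × ReducedCorank q (length π ℕ.∸ 1)
    × AlgMult1 (Φ q) (c ℕ.+ (length π ℕ.∸ 1))
  ct-invariants q []          n≡ cor ct = contradiction (proj₂ (proj₂ (ctPartition q ct))) λ ()
  ct-invariants q (zero ∷ ρ)  n≡ cor ct = contradiction (All.head (proj₁ (proj₂ (ctPartition q ct)))) λ ()
  ct-invariants {n} {k} {c} q (suc p ∷ ρ) n≡ cor ct =
      charPoly-formula c n+1≡ , coxeter-number p ρ pos (ctLattice q ct) , reduced-coxeter-number ,
      geometric-multiplicity q cor , reduced-corank q p ρ ct , algebraic-multiplicity c n+1≡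
    where
    pos = All.tail (proj₁ (proj₂ (ctPartition q ct)))
    open Invariants p ρ pos (ctLattice q ct)
    n+1≡ : suc n ≡ sum (suc p ∷ ρ) ℕ.+ c
    n+1≡ = trans (cong suc (trans n≡ (ℕP.+-comm c k))) (cong (ℕ._+ c) (sym (proj₂ (proj₂ (ctPartition q ct)))))

open Classification

open import Data.Nat using (_≤_; _∸_; _+_)

theoremC : ∀ (n c : ℕ) → 1 ≤ n → 2 ≤ n ∸ c + 1 →
    (∀ (q : UnitForm n) → InQuadA n c q → ∃[ π ] CT (n ∸ c + 1) q π)
    × (∀ (q q' : UnitForm n) (π π' : List ℕ) → InQuadA n c q → InQuadA n c q' →
    q ≈Gram q' → CT (n ∸ c + 1) q π → CT (n ∸ c + 1) q' π' → π ≡ π')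
    × (∀ (q : UnitForm n) (π : List ℕ) → InQuadA n c q → CT (n ∸ c + 1) q π →
    InPartc1 c (n ∸ c + 1) π)
    × (∀ (q q' : UnitForm n) (π : List ℕ) → InQuadA n c q → InQuadA n c q' →
    CT (n ∸ c + 1) q π → CT (n ∸ c + 1) q' π → q ≈Gram q')
    × (∀ (π : List ℕ) → InPartc1 c (n ∸ c + 1) π →
    ∃[ q ] (InQuadA n c q × CT (n ∸ c + 1) q π))
    × (∀ (q : UnitForm n) (π : List ℕ) → InQuadA n c q → CT (n ∸ c + 1) q π →
    ((φ q *P XkMinus1 1) ≈P ((XkMinus1 1 ^P c) *P prodP (map XkMinus1 π)))
    × CoxeterNumber (Φ q) (coxNumberOf π)
    × ReducedCoxeterNumber (Φ q) (lcmList π)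
    × GeomMult1 (Φ q) c
    × ReducedCorank q (length π ∸ 1)
    × AlgMult1 (Φ q) (c + (length π ∸ 1)))
theoremC n c _ 2≤m =
    (λ q (_ , _ , _ , dyn) → subst (λ m → ∃[ π ] CT m q π) (sym m≡) (ct-exists q dyn)) ,
    (λ q q' π π' _ _ q≈q' ct ct' → ct-invariant q q' π π' q≈q' (to q ct) (to q' ct')) ,
    (λ q π _ ct → subst (λ m → InPartc1 c m π) (sym m≡) (ct-parity q π n≡ (to q ct))) ,
    (λ q q' π _ _ ct ct' → ct-injective q q' π (to q ct) (to q' ct')) ,
    (λ π π∈ → subst (λ m → ∃[ q ] (InQuadA n c q × CT m q π)) (sym m≡)
                (ct-surjective n c n≡ 1≤k π (subst (λ m → InPartc1 c m π) m≡ π∈))) ,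
    (λ q π (_ , _ , cor , _) ct → ct-invariants q π n≡ cor (to q ct))
  where
  m≡ : n ∸ c + 1 ≡ suc (n ∸ c)
  m≡ = ℕP.+-comm (n ∸ c) 1
  1≤k : 1 ≤ n ∸ c
  1≤k = ℕP.≤-pred (subst (2 ≤_) m≡ 2≤m)
  -- As m ≥ 2 makes `n ∸ c` positive, the subtraction is not truncated.
  n≡ : n ≡ c + (n ∸ c)
  n≡ = sym (ℕP.m+[n∸m]≡n {c} {n} (ℕP.<⇒≤ (ℕP.m∸n≢0⇒n<m {n} {c} (ℕP.<⇒≢ 1≤k ∘ sym))))
  to : ∀ q {π} → CT (n ∸ c + 1) q π → CT (suc (n ∸ c)) q π
  to q {π} = subst (λ m → CT m q π) m≡
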